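{- There is an absolute constant $C>0$ such that for every non-exceptional primitive coherent configuration $\mathfrak{X}$ on $n\ge 2$ vertices there exists a set of at most $C n^{1/3}(\log n)^{4/3}$ vertices that completely splits $\mathfrak{X}$ under naive vertex refinement.
   Context: A configuration of rank $r$ on a finite vertex set $V$ with $|V|=n$ is a map $c: V\times V \to \{0,\ldots,r-1\}$ such that (i) $c(u,u)\ne c(v,w)$ whenever $v\ne w$, and (ii) for every color $i$ there is $i^*$ with $c(u,v)=i$ iff $c(v,u)=i^*$. It is coherent if (iii) for all colors $i,j,k$ there is $p^i_{jk}$ such that whenever $c(u,v)=i$, exactly $p^i_{jk}$ vertices $w$ satisfy $c(u,w)=j$, $c(w,v)=k$. It is homogeneous if all diagonal pairs have the same color; a homogeneous coherent configuration is primitive (a PCC) if each off-diagonal color class, viewed as a digraph on $V$, is strongly connected. For a graph $X=(V,E)$, $\mathfrak{X}(X)$ is the configuration with one color on the diagonal, one on ordered pairs $(u,v)$ with $\{u,v\}\in E$, and one on the remaining pairs of distinct vertices. $T(m)$ is the line graph of $K_m$, $L_2(m)$ the line graph of $K_{m,m}$. A PCC is exceptional if it is isomorphic to $\mathfrak{X}(X)$ with $X$ isomorphic to $K_n$, $T(m)$, $L_2(m)$ or the complement of one of these. Naive vertex refinement: the diagonal colors $c(u,u)$ are "vertex colors" and off-diagonal colors are "edge colors"; in one refinement round, edge colors are unchanged and the new vertex color of $u$ encodes its current vertex color together with, for every pair $(a,b)$ with $a$ a vertex color and $b$ an edge color, the number of vertices $v$ of vertex color $a$ with $c(u,v)=b$.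 A set $S\subseteq V$ completely splits $\mathfrak{X}$ if, after giving each vertex of $S$ its own new unique vertex color and repeating naive refinement until the coloring is stable, all vertices have distinct colors. -}

module Defs where

open import Data.Nat using (ℕ; zero; suc; _+_; _*_; _≡ᵇ_)
open import Data.Bool using (Bool; true; false; _∧_; _∨_; not; if_then_else_)
open import Data.Fin using (Fin; _<_)
open import Data.Fin.Properties using (_≟_)
open import Data.Fin.Subset using (Subset)
open import Data.Vec using (lookup)
open import Data.List using (List; allFin; map)
open import Data.Nat.ListAction using (sum)
open import Data.Bool.ListAction using (all; any)
open import Data.Product using (Σ; ∃; _×_; _,_; proj₁; proj₂)
open import Data.Sum using (_⊎_)
open import Data.Empty using (⊥)
open import Relation.Nullary using (¬_; does)
open import Relation.Binary.PropositionalEquality using (_≡_; _≢_)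
open import Function.Bundles using (_⇔_; _↔_; Inverse)

_==_ : {n : ℕ} → Fin n → Fin n → Bool
x == y = does (x ≟ y)

count : {n : ℕ} → (Fin n → Bool) → ℕ
count {n} p = sum (map (λ w → if p w then 1 else 0) (allFin n))

allF : {n : ℕ} → (Fin n → Bool) → Bool
allF {n} p = all p (allFin n)

anyF : {n : ℕ} → (Fin n → Bool) → Bool
anyF {n} p = any p (allFin n)

Coloring : ℕ → ℕ → Set
Coloring n r = Fin n → Fin n → Fin r

record IsConfig {n r : ℕ} (c : Coloring n r) : Set where
  field
    rank-surj : ∀ (i : Fin r) → ∃ λ u → ∃ λ v → c u v ≡ i
    diag-sep  : ∀ (u v w : Fin n) → v ≢ w → c u u ≢ c v w
    converse  : ∀ (i : Fin r) → ∃ λ (i* : Fin r) →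
                  ∀ (u v : Fin n) → (c u v ≡ i) ⇔ (c v u ≡ i*)

IsCoherent : {n r : ℕ} → Coloring n r → Set
IsCoherent {n} {r} c =
  ∀ (i j k : Fin r) → ∃ λ (p : ℕ) → ∀ (u v : Fin n) → c u v ≡ i →
    count (λ w → (c u w == j) ∧ (c w v == k)) ≡ p

IsHomogeneous : {n r : ℕ} → Coloring n r → Set
IsHomogeneous c = ∀ u v → c u u ≡ c v v

data Reach {n : ℕ} (E : Fin n → Fin n → Set) : Fin n → Fin n → Set where
  here  : ∀ {x} → Reach E x x
  there : ∀ {x y z} → E x y → Reach E y z → Reach E x z

StronglyConnected : {n : ℕ} → (Fin n → Fin n → Set) → Set
StronglyConnected E = ∀ x y → Reach E x y

IsEdgeColour : {n r : ℕ} → Coloring n r → Fin r → Set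
IsEdgeColour c i = ∃ λ u → ∃ λ v → u ≢ v × c u v ≡ i

record IsPCC {n r : ℕ} (c : Coloring n r) : Set where
  field
    config      : IsConfig c
    coherent    : IsCoherent c
    homogeneous : IsHomogeneous c
    primitiv    : ∀ (i : Fin r) → IsEdgeColour c i →
                    StronglyConnected (λ u v → c u v ≡ i)

data Base : Set where
  Kb Tb Lb : Base

BaseV : Base → ℕ → Set
BaseV Kb m = Fin m
BaseV Tb m = Σ (Fin m × Fin m) (λ p → proj₁ p < proj₂ p)   -- 2-subsets of [m]
BaseV Lb m = Fin m × Fin m

BaseE : (b : Base) (m : ℕ) → BaseV b m → BaseV b m → Set
BaseE Kb m u v = u ≢ v
BaseE Tb m ((a , b) , _) ((a' , b') , _) =
  ((a , b) ≢ (a' , b')) × ((a ≡ a' ⊎ a ≡ b') ⊎ (b ≡ a' ⊎ b ≡ b'))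
BaseE Lb m (a , b) (a' , b') = (a ≡ a' × b ≢ b') ⊎ (a ≢ a' × b ≡ b')

ModelE : (b : Base) (m : ℕ) (compl : Bool) → BaseV b m → BaseV b m → Set
ModelE b m false u v = BaseE b m u v
ModelE b m true  u v = u ≢ v × ¬ BaseE b m u v

-- (u,v) and (u',v') lie in the same colour class of 𝔛(X), X = (V,E)
SameX : {V : Set} → (V → V → Set) → V → V → V → V → Set
SameX E u v u' v' =
  (u ≡ v × u' ≡ v')
  ⊎ ((u ≢ v × E u v) × (u' ≢ v' × E u' v'))
  ⊎ ((u ≢ v × ¬ E u v) × (u' ≢ v' × ¬ E u' v'))

-- c is isomorphic to 𝔛(X) with X ≅ K_m, T(m), L_2(m) or a complement
Exceptional : {n r : ℕ} → Coloring n r → Set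
Exceptional {n} c =
  ∃ λ (b : Base) → ∃ λ (m : ℕ) → ∃ λ (compl : Bool) →
  ∃ λ (f : Fin n ↔ BaseV b m) →
    ∀ (u v u' v' : Fin n) →
      (c u v ≡ c u' v') ⇔
      SameX (ModelE b m compl) (Inverse.to f u) (Inverse.to f v)
                               (Inverse.to f u') (Inverse.to f v')

-- Sameᵣ c S k u v = true iff u and v have the same vertex colour after
-- k rounds of naive refinement.
Sameᵣ : {n r : ℕ} → Coloring n r → Subset n → ℕ → Fin n → Fin n → Bool
Sameᵣ c S zero u v =
  (u == v) ∨ (not (lookup S u) ∧ not (lookup S v) ∧ (c u u == c v v))
Sameᵣ {n} {r} c S (suc k) u v =
  Sameᵣ c S k u v ∧
  allF (λ a → allF (λ (b : Fin r) →
    not (anyF (λ x → anyF (λ y → not (x == y) ∧ (c x y == b)))) ∨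
    (count (λ w → Sameᵣ c S k w a ∧ (c u w == b))
      ≡ᵇ count (λ w → Sameᵣ c S k w a ∧ (c v w == b)))))

-- the stable colouring is discrete (the partitions decrease, so this holds
-- iff some round already is discrete)
CompletelySplits : {n r : ℕ} → Coloring n r → Subset n → Set
CompletelySplits c S = ∃ λ (k : ℕ) → ∀ u v → Sameᵣ c S k u v ≡ true → u ≡ v

{-# OPTIONS --safe #-}

-- Let D u v be the number of vertices w with c u w ≠ c v w. If every D u v with u ≠ v is at
-- least n^(2/3)/1200, a greedy hitting set of O(n^(1/3) log n) vertices separates all pairs in
-- one round. Otherwise fix a pair with small D. The triangle inequality for D along the edges of
-- its colour, together with the disjointness of the differences of concentric balls, shows that
-- one colour d contains more than 2/3 of the pairs. Call its pairs far and the other pairs of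
-- distinct vertices neighbours; the graph of neighbours has valency ρ with ρ³ < n²/10⁶, and any
-- two far vertices have the same number μ of common neighbours.
--
-- If for each edge yu the set N(y) contains at least ρ²/20000 ordered pairs of far vertices that
-- are far from u as well, O(n^(1/3) log n) vertices split the configuration in two rounds:
-- u and v are separated by some y in N(u) whose colours to two chosen vertices occur at no vertex
-- w with c v w = c u y. Otherwise, by coherence, every N(y) is the union of two almost cliques.
-- These are exact cliques, so the graph is the line graph of a root graph in which any two
-- disjoint edges are joined by exactly μ edges, and 1 ≤ μ ≤ 4. Then μ = 2 or μ = 4, the root graph
-- is complete bipartite or complete, and counting coloured paths of length two shows that all
-- edges have the same colour, so the configuration is exceptional.
module Submission where

open import Defs
open import Data.Nat using (ℕ; _*_; _^_; _≤_)
open import Data.Nat.Logarithm using (⌊log₂_⌋)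
open import Data.Fin using (Fin)
open import Data.Fin.Subset using (Subset; ∣_∣)
open import Data.Product using (Σ; _×_)
open import Relation.Nullary using (¬_)
open import Data.Bool using (Bool; true; false; _∧_; _∨_; not; if_then_else_; _xor_)
import Data.Bool.ListAction as LB
open import Data.Empty using (⊥; ⊥-elim)
open import Data.Fin using (zero; suc; _↑ˡ_; _↑ʳ_; splitAt; combine; remQuot)
import Data.Fin.Properties as Fin
import Data.Fin.Subset as Sub
open import Data.Fin.Subset.Properties using (∣⊥∣≡0)
open import Data.List using (List; []; _∷_; _++_; length; map; tabulate)
open import Data.List.Properties using (length-++)
open import Data.Nat
import Data.Nat.ListAction as LA
open import Data.Nat.DivMod using (_/_; _%_; m≡m%n+[m/n]*n; m%n<n)
open import Data.Nat.Logarithm using (⌊log₂⌋-mono-≤; ⌊log₂[2^n]⌋≡n)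
open import Data.Nat.Properties
open import Data.Product using (∃; _,_; proj₁; proj₂)
open import Data.Sum using (_⊎_; inj₁; inj₂; [_,_]′)
open import Data.Unit using (⊤; tt)
open import Data.Vec using (Vec; []; _∷_; lookup; _[_]≔_)
open import Data.Vec.Properties using (lookup∘updateAt; lookup∘updateAt′)
open import Function using (_∘_; id)
open import Function.Bundles using (_↔_; Inverse; mk⇔; mk↔ₛ′)
open import Relation.Binary.Definitions using (Tri; tri<; tri≈; tri>)
open import Relation.Binary.PropositionalEquality hiding (J)
open import Relation.Nullary using (Dec; yes; no)
open import Relation.Nullary.Decidable using (_×-dec_; ¬?; dec-true; dec-false)

-- Coherence fixes how many triangles of given colours stand on an edge, but the proof has to count
-- far pairs s, s′ inside N(y) against a further vertex u, and such counts on four vertices are not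
-- determined by the colour of yu. The way out is that two far vertices have only μ common
-- neighbours: each of these counts equals a combination of coherent numbers up to an error of at
-- most ρμ, and `h * μ ≤ ρ` makes this negligible beside ρ². So smallness at one edge passes to all
-- edges of its colour, and with them to every vertex. Two consequences of small ρ carry the rest:
-- every colour of neighbours has valency at least hμ, and two neighbours share hardly more than
-- 2ρ/3 neighbours, because three steps in any neighbour colour reach a far vertex. Roots are
-- avoided by comparing squares and cubes of natural numbers. The slack sits in two parameters: ρ²/q
-- far pairs are available at an edge, at most 3ρ²/h of them are lost, and `6 * q ≤ h` keeps half.

-- Linear arithmetic by certificates

-- Polynomials in k variables, as lists of coefficients in the powers of the first variable.
Poly : ℕ → Set
Poly zero    = ℕ
Poly (suc k) = List (Poly k)

0ᵖ : ∀ k → Poly k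
0ᵖ zero    = 0
0ᵖ (suc k) = []

constᵖ : ∀ k → ℕ → Poly k
constᵖ zero    c = c
constᵖ (suc k) c = constᵖ k c ∷ []

varᵖ : ∀ {k} → Fin k → Poly k
varᵖ {suc k} zero    = 0ᵖ k ∷ constᵖ k 1 ∷ []
varᵖ {suc k} (suc i) = varᵖ i ∷ []

_⊞_ : ∀ {k} → Poly k → Poly k → Poly k
_⊞_ {zero}  a       b       = a + b
_⊞_ {suc k} []      q       = q
_⊞_ {suc k} (a ∷ p) []      = a ∷ p
_⊞_ {suc k} (a ∷ p) (b ∷ q) = (a ⊞ b) ∷ (p ⊞ q)

mutual
  _⊠_ : ∀ {k} → Poly k → Poly k → Poly k
  _⊠_ {zero}  a       b = a * b
  _⊠_ {suc k} []      q = []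
  _⊠_ {suc k} (a ∷ p) q = scale a q ⊞ (0ᵖ k ∷ (p ⊠ q))

  scale : ∀ {k} → Poly k → List (Poly k) → List (Poly k)
  scale a []      = []
  scale a (b ∷ q) = (a ⊠ b) ∷ scale a q

eval : ∀ {k} → Poly k → Vec ℕ k → ℕ
eval {zero}  a       _        = a
eval {suc k} []      _        = 0
eval {suc k} (a ∷ p) (x ∷ xs) = eval a xs + x * eval p (x ∷ xs)

-- Coefficientwise order, a missing coefficient counting as zero. It only has to be sound: the
-- variables are natural numbers, so larger coefficients give larger values.
_≤ᵖ_ : ∀ {k} → Poly k → Poly k → Bool
_≤ᵖ_ {zero}  a       b       = a ≤ᵇ b
_≤ᵖ_ {suc k} []      q       = true
_≤ᵖ_ {suc k} (a ∷ p) []      = (a ≤ᵖ 0ᵖ k) ∧ (p ≤ᵖ [])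
_≤ᵖ_ {suc k} (a ∷ p) (b ∷ q) = (a ≤ᵖ b) ∧ (p ≤ᵖ q)

eval-0 : ∀ {k} (xs : Vec ℕ k) → eval (0ᵖ k) xs ≡ 0
eval-0 []       = refl
eval-0 (x ∷ xs) = refl

eval-const : ∀ {k} c (xs : Vec ℕ k) → eval (constᵖ k c) xs ≡ c
eval-const c []       = refl
eval-const c (x ∷ xs) =
  trans (cong₂ _+_ (eval-const c xs) (*-zeroʳ x)) (+-identityʳ c)

eval-var : ∀ {k} (i : Fin k) (xs : Vec ℕ k) → eval (varᵖ i) xs ≡ lookup xs i
eval-var zero (x ∷ xs) = trans
  (cong₂ _+_ (eval-0 xs) (cong (x *_) (trans (cong₂ _+_ (eval-const 1 xs) (*-zeroʳ x)) refl)))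
  (*-identityʳ x)
eval-var (suc i) (x ∷ xs) = trans (cong₂ _+_ (eval-var i xs) (*-zeroʳ x)) (+-identityʳ _)

eval-⊞ : ∀ {k} (p q : Poly k) (xs : Vec ℕ k) → eval (p ⊞ q) xs ≡ eval p xs + eval q xs
eval-⊞ {zero}  a       b       xs       = refl
eval-⊞ {suc k} []      q       xs       = refl
eval-⊞ {suc k} (a ∷ p) []      (x ∷ xs) = sym (+-identityʳ _)
eval-⊞ {suc k} (a ∷ p) (b ∷ q) (x ∷ xs) = begin
  eval (a ⊞ b) xs + x * eval (p ⊞ q) (x ∷ xs)
    ≡⟨ cong₂ _+_ (eval-⊞ a b xs) (cong (x *_) (eval-⊞ p q (x ∷ xs))) ⟩
  (A + B) + x * (P + Q)
    ≡⟨ cong ((A + B) +_) (*-distribˡ-+ x P Q) ⟩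
  (A + B) + (x * P + x * Q)
    ≡⟨ +-assoc A B _ ⟩
  A + (B + (x * P + x * Q))
    ≡⟨ cong (A +_) (trans (sym (+-assoc B (x * P) (x * Q))) (trans (cong (_+ x * Q) (+-comm B (x * P))) (+-assoc (x * P) B (x * Q)))) ⟩
  A + (x * P + (B + x * Q))
    ≡⟨ sym (+-assoc A _ _) ⟩
  (A + x * P) + (B + x * Q) ∎
  where
  open ≡-Reasoning
  A = eval a xs
  B = eval b xs
  P = eval p (x ∷ xs)
  Q = eval q (x ∷ xs)

mutual
  eval-⊠ : ∀ {k} (p q : Poly k) (xs : Vec ℕ k) → eval (p ⊠ q) xs ≡ eval p xs * eval q xs
  eval-⊠ {zero}  a       b xs       = refl
  eval-⊠ {suc k} []      q xs       = refl
  eval-⊠ {suc k} (a ∷ p) q (x ∷ xs) = begin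
    eval (scale a q ⊞ (0ᵖ k ∷ (p ⊠ q))) (x ∷ xs)
      ≡⟨ eval-⊞ (scale a q) (0ᵖ k ∷ (p ⊠ q)) (x ∷ xs) ⟩
    eval (scale a q) (x ∷ xs) + (eval (0ᵖ k) xs + x * eval (p ⊠ q) (x ∷ xs))
      ≡⟨ cong₂ _+_ (eval-scale a q x xs)
           (cong₂ _+_ (eval-0 xs) (cong (x *_) (eval-⊠ p q (x ∷ xs)))) ⟩
    A * Q + x * (P * Q)
      ≡⟨ cong (A * Q +_) (sym (*-assoc x P Q)) ⟩
    A * Q + x * P * Q
      ≡⟨ sym (*-distribʳ-+ Q A (x * P)) ⟩
    (A + x * P) * Q ∎
    where
    open ≡-Reasoning
    A = eval a xs
    P = eval p (x ∷ xs)
    Q = eval q (x ∷ xs)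

  eval-scale : ∀ {k} (a : Poly k) (q : List (Poly k)) (x : ℕ) (xs : Vec ℕ k) →
               eval (scale a q) (x ∷ xs) ≡ eval a xs * eval {suc k} q (x ∷ xs)
  eval-scale a []      x xs = sym (*-zeroʳ (eval a xs))
  eval-scale a (b ∷ q) x xs = begin
    eval (a ⊠ b) xs + x * eval (scale a q) (x ∷ xs)
      ≡⟨ cong₂ _+_ (eval-⊠ a b xs) (cong (x *_) (eval-scale a q x xs)) ⟩
    A * B + x * (A * Q)
      ≡⟨ cong (A * B +_) (trans (sym (*-assoc x A Q)) (trans (cong (_* Q) (*-comm x A)) (*-assoc A x Q))) ⟩
    A * B + A * (x * Q)
      ≡⟨ sym (*-distribˡ-+ A B (x * Q)) ⟩
    A * (B + x * Q) ∎
    where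
    open ≡-Reasoning
    A = eval a xs
    B = eval b xs
    Q = eval q (x ∷ xs)

∧-true : ∀ {a b} → a ∧ b ≡ true → a ≡ true × b ≡ true
∧-true {true} {true} _ = refl , refl

≤ᵖ-sound : ∀ {k} (p q : Poly k) (xs : Vec ℕ k) → (p ≤ᵖ q) ≡ true → eval p xs ≤ eval q xs
≤ᵖ-sound {zero}  a       b       xs       e = ≤ᵇ⇒≤ a b (subst Data.Bool.T (sym e) tt)
≤ᵖ-sound {suc k} []      q       xs       e = z≤n
≤ᵖ-sound {suc k} (a ∷ p) []      (x ∷ xs) e = ≤-trans
  (+-mono-≤ (≤-trans (≤ᵖ-sound a (0ᵖ k) xs (proj₁ (∧-true e))) (≤-reflexive (eval-0 xs)))
            (*-monoʳ-≤ x (≤ᵖ-sound p [] (x ∷ xs) (proj₂ (∧-true e)))))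
  (≤-reflexive (*-zeroʳ x))
≤ᵖ-sound {suc k} (a ∷ p) (b ∷ q) (x ∷ xs) e =
  +-mono-≤ (≤ᵖ-sound a b xs (proj₁ (∧-true e)))
           (*-monoʳ-≤ x (≤ᵖ-sound p q (x ∷ xs) (proj₂ (∧-true {a ≤ᵖ b} e))))

infixl 6 _⊕_
infixl 7 _⊗_
data Expr (k : ℕ) : Set where
  var     : Fin k → Expr k
  κ       : ℕ → Expr k
  _⊕_ _⊗_ : Expr k → Expr k → Expr k

⟦_⟧ : ∀ {k} → Expr k → Vec ℕ k → ℕ
⟦ var i ⟧ xs = lookup xs i
⟦ κ c ⟧   xs = c
⟦ a ⊕ b ⟧ xs = ⟦ a ⟧ xs + ⟦ b ⟧ xs
⟦ a ⊗ b ⟧ xs = ⟦ a ⟧ xs * ⟦ b ⟧ xs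

norm : ∀ {k} → Expr k → Poly k
norm (var i)     = varᵖ i
norm {k} (κ c)   = constᵖ k c
norm (a ⊕ b)     = norm a ⊞ norm b
norm (a ⊗ b)     = norm a ⊠ norm b

norm-sound : ∀ {k} (e : Expr k) (xs : Vec ℕ k) → eval (norm e) xs ≡ ⟦ e ⟧ xs
norm-sound (var i) xs = eval-var i xs
norm-sound (κ c)   xs = eval-const c xs
norm-sound (a ⊕ b) xs =
  trans (eval-⊞ (norm a) (norm b) xs) (cong₂ _+_ (norm-sound a xs) (norm-sound b xs))
norm-sound (a ⊗ b) xs =
  trans (eval-⊠ (norm a) (norm b) xs) (cong₂ _*_ (norm-sound a xs) (norm-sound b xs))

infix 5 _≼_
record Ineq (k : ℕ) : Set where
  constructor _≼_
  field lhs rhs : Expr k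
open Ineq

⟪_⟫ : ∀ {k} → Ineq k → Vec ℕ k → Set
⟪ i ⟫ xs = ⟦ lhs i ⟧ xs ≤ ⟦ rhs i ⟧ xs

-- An entry pairs a hypothesis with its multiplier. Multipliers are expressions, so a hypothesis may
-- be multiplied by variables; thus squaring `x ≤ y` (multiplier x + y) becomes a check of
-- coefficients.
Hyps : ∀ {k} → List (Expr k × Ineq k) → Vec ℕ k → Set
Hyps []             xs = ⊤
Hyps ((_ , i) ∷ is) xs = ⟪ i ⟫ xs × Hyps is xs

Σˡ Σʳ : ∀ {k} → List (Expr k × Ineq k) → Expr k
Σˡ []             = κ 0
Σˡ ((m , i) ∷ is) = m ⊗ lhs i ⊕ Σˡ is
Σʳ []             = κ 0
Σʳ ((m , i) ∷ is) = m ⊗ rhs i ⊕ Σʳ is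

Σ-mono : ∀ {k} (is : List (Expr k × Ineq k)) (xs : Vec ℕ k) → Hyps is xs →
         ⟦ Σˡ is ⟧ xs ≤ ⟦ Σʳ is ⟧ xs
Σ-mono []             xs _        = z≤n
Σ-mono ((m , i) ∷ is) xs (h , hs) = +-mono-≤ (*-monoʳ-≤ (⟦ m ⟧ xs) h) (Σ-mono is xs hs)

abstract
  -- A polynomial inequality follows from others when a combination of them with
  -- nonnegative multipliers (and a positive multiple of the goal) holds coefficientwise.
  lin : ∀ {k} (xs : Vec ℕ k) (s : ℕ) (g : Ineq k) (is : List (Expr k × Ineq k)) →
        (norm (κ (suc s) ⊗ lhs g ⊕ Σʳ is) ≤ᵖ norm (κ (suc s) ⊗ rhs g ⊕ Σˡ is)) ≡ true →
        Hyps is xs → ⟪ g ⟫ xs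
  lin xs s g is ok hs = *-cancelˡ-≤ (suc s) (+-cancelʳ-≤ (⟦ Σˡ is ⟧ xs) _ _ (begin
    ⟦ κ (suc s) ⊗ lhs g ⊕ Σˡ is ⟧ xs ≤⟨ +-monoʳ-≤ _ (Σ-mono is xs hs) ⟩
    ⟦ κ (suc s) ⊗ lhs g ⊕ Σʳ is ⟧ xs ≡⟨ sym (norm-sound (κ (suc s) ⊗ lhs g ⊕ Σʳ is) xs) ⟩
    eval (norm (κ (suc s) ⊗ lhs g ⊕ Σʳ is)) xs ≤⟨ ≤ᵖ-sound _ _ xs ok ⟩
    eval (norm (κ (suc s) ⊗ rhs g ⊕ Σˡ is)) xs ≡⟨ norm-sound (κ (suc s) ⊗ rhs g ⊕ Σˡ is) xs ⟩
    ⟦ κ (suc s) ⊗ rhs g ⊕ Σˡ is ⟧ xs ∎))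
    where open ≤-Reasoning

  identity : ∀ {k} (xs : Vec ℕ k) (a b : Expr k) → (norm a ≤ᵖ norm b) ∧ (norm b ≤ᵖ norm a) ≡ true → ⟦ a ⟧ xs ≡ ⟦ b ⟧ xs
  identity xs a b ok = trans (sym (norm-sound a xs)) (trans (≤-antisym (≤ᵖ-sound (norm a) (norm b) xs (proj₁ (∧-true ok)))
    (≤ᵖ-sound (norm b) (norm a) xs (proj₂ (∧-true {norm a ≤ᵖ norm b} ok)))) (norm-sound b xs))

x₀ : ∀ {k} → Expr (1 + k)
x₀ = var zero
x₁ : ∀ {k} → Expr (2 + k)
x₁ = var (1 ↑ʳ zero)
x₂ : ∀ {k} → Expr (3 + k)
x₂ = var (2 ↑ʳ zero)
x₃ : ∀ {k} → Expr (4 + k)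
x₃ = var (3 ↑ʳ zero)
x₄ : ∀ {k} → Expr (5 + k)
x₄ = var (4 ↑ʳ zero)
x₅ : ∀ {k} → Expr (6 + k)
x₅ = var (5 ↑ʳ zero)
x₆ : ∀ {k} → Expr (7 + k)
x₆ = var (6 ↑ʳ zero)
x₇ : ∀ {k} → Expr (8 + k)
x₇ = var (7 ↑ʳ zero)
x₈ : ∀ {k} → Expr (9 + k)
x₈ = var (8 ↑ʳ zero)
x₉ : ∀ {k} → Expr (10 + k)
x₉ = var (9 ↑ʳ zero)
x₁₀ : ∀ {k} → Expr (11 + k)
x₁₀ = var (10 ↑ʳ zero)

-- Finite sums

private variable
  n n′ : ℕ

-- Structural recursion, unlike the list sum behind `count`; `count≡#` translates between the two.
sum : (Fin n → ℕ) → ℕ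
sum {zero}  f = 0
sum {suc n} f = f zero + sum (f ∘ suc)

χ : Bool → ℕ
χ b = if b then 1 else 0

χ≤1 : ∀ b → χ b ≤ 1
χ≤1 false = z≤n
χ≤1 true  = ≤-refl

χ-∧ : ∀ a b → χ (a ∧ b) ≡ χ a * χ b
χ-∧ false b     = refl
χ-∧ true  b = sym (+-identityʳ _)

# : (Fin n → Bool) → ℕ
# p = sum (λ x → χ (p x))

sum-mono : {f g : Fin n → ℕ} → (∀ x → f x ≤ g x) → sum f ≤ sum g
sum-mono {zero}  p = z≤n
sum-mono {suc n} p = +-mono-≤ (p zero) (sum-mono (p ∘ suc))

sum-cong-≗ : {f g : Fin n → ℕ} → (∀ x → f x ≡ g x) → sum f ≡ sum g
sum-cong-≗ {zero}  p = refl
sum-cong-≗ {suc n} p = cong₂ _+_ (p zero) (sum-cong-≗ (p ∘ suc))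

sum-+ : (f g : Fin n → ℕ) → sum (λ x → f x + g x) ≡ sum f + sum g
sum-+ {zero}  f g = refl
sum-+ {suc n} f g = trans (cong (f zero + g zero +_) (sum-+ (f ∘ suc) (g ∘ suc)))
  (identity (f zero ∷ g zero ∷ sum (f ∘ suc) ∷ sum (g ∘ suc) ∷ []) (x₀ ⊕ x₁ ⊕ (x₂ ⊕ x₃)) (x₀ ⊕ x₂ ⊕ (x₁ ⊕ x₃)) refl)

sum-*ˡ : ∀ c (f : Fin n → ℕ) → sum (λ x → c * f x) ≡ c * sum f
sum-*ˡ {zero}  c f = sym (*-zeroʳ c)
sum-*ˡ {suc n} c f = trans (cong (c * f zero +_) (sum-*ˡ c (f ∘ suc))) (sym (*-distribˡ-+ c (f zero) _))

sum-*ʳ : ∀ c (f : Fin n → ℕ) → sum (λ x → f x * c) ≡ sum f * c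
sum-*ʳ c f = trans (sum-cong-≗ (λ x → *-comm (f x) c)) (trans (sum-*ˡ c f) (*-comm c _))

sum-const : ∀ n c → sum {n} (λ _ → c) ≡ n * c
sum-const zero    c = refl
sum-const (suc n) c = cong (c +_) (sum-const n c)

sum-0 : {f : Fin n → ℕ} → (∀ x → f x ≡ 0) → sum f ≡ 0
sum-0 {n} p = trans (sum-cong-≗ p) (trans (sum-const n 0) (*-zeroʳ n))

sum-≤ : {f : Fin n → ℕ} → ∀ c → (∀ x → f x ≤ c) → sum f ≤ n * c
sum-≤ {n} c p = ≤-trans (sum-mono p) (≤-reflexive (sum-const n c))

sum-swap : (f : Fin n′ → Fin n → ℕ) → (sum λ x → sum λ y → f x y) ≡ (sum λ y → sum λ x → f x y)
sum-swap {zero} {n} f = sym (sum-0 {n} (λ _ → refl))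
sum-swap {suc n′} f = trans (cong (sum (f zero) +_) (sum-swap (f ∘ suc)))
  (sym (sum-+ (f zero) (λ y → sum λ x → f (suc x) y)))

term≤sum : (f : Fin n → ℕ) → ∀ x → f x ≤ sum f
term≤sum f zero    = m≤m+n _ _
term≤sum f (suc x) = ≤-trans (term≤sum (f ∘ suc) x) (m≤n+m _ _)

sum>0⇒∃ : (f : Fin n → ℕ) → 0 < sum f → ∃ λ x → 0 < f x
sum>0⇒∃ {suc n} f p with f zero in eq
... | suc k = zero , subst (0 <_) (sym eq) z<s
... | zero  with sum>0⇒∃ (f ∘ suc) p
...   | x , q = suc x , q

sum<⇒∃< : (f g : Fin n → ℕ) → sum f < sum g → ∃ λ x → f x < g x
sum<⇒∃< {suc n} f g p with f zero <? g zero
... | yes q = zero , q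
... | no ¬q with sum<⇒∃< (f ∘ suc) (g ∘ suc)
                  (+-cancelˡ-< (f zero) _ _ (<-≤-trans p (+-monoˡ-≤ _ (≮⇒≥ ¬q))))
...   | x , q = suc x , q

χ>0 : ∀ {b} → 0 < χ b → b ≡ true
χ>0 {true} _ = refl

true⇒χ : ∀ {b} → b ≡ true → 1 ≤ χ b
true⇒χ refl = ≤-refl

#>0⇒∃ : (p : Fin n → Bool) → 0 < # p → ∃ λ x → p x ≡ true
#>0⇒∃ p q with sum>0⇒∃ (χ ∘ p) q
... | x , r = x , χ>0 r

∃⇒#>0 : (p : Fin n → Bool) → ∀ x → p x ≡ true → 0 < # p
∃⇒#>0 p x e = ≤-trans (true⇒χ e) (term≤sum (χ ∘ p) x)

#≤n : (p : Fin n → Bool) → # p ≤ n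
#≤n {n} p = ≤-trans (sum-≤ 1 (λ x → χ≤1 (p x))) (≤-reflexive (*-identityʳ n))

χ-mono : ∀ {a b} → (a ≡ true → b ≡ true) → χ a ≤ χ b
χ-mono {false}         f = z≤n
χ-mono {true}  {true}  f = ≤-refl
χ-mono {true}  {false} f with () ← f refl

#-mono : {p q : Fin n → Bool} → (∀ x → p x ≡ true → q x ≡ true) → # p ≤ # q
#-mono f = sum-mono (λ x → χ-mono (f x))

#≡0⇒ : (p : Fin n → Bool) → # p ≡ 0 → ∀ x → p x ≡ false
#≡0⇒ p e x with p x in eq
... | false = refl
... | true  = ⊥-elim (<-irrefl (sym e) (∃⇒#>0 p x eq))

#≤1 : (p : Fin n → Bool) → (∀ x y → p x ≡ true → p y ≡ true → x ≡ y) → # p ≤ 1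
#≤1 {zero}  p u = z≤n
#≤1 {suc n} p u with p zero in eq
... | false = #≤1 (p ∘ suc) (λ x y a b → Fin.suc-injective (u (suc x) (suc y) a b))
... | true  = s≤s (≤-reflexive (sum-0 (λ x → helper x)))
  where
  helper : ∀ x → χ (p (suc x)) ≡ 0
  helper x with p (suc x) in e
  ... | false = refl
  ... | true with () ← u zero (suc x) eq e

==-refl : (x : Fin n) → (x == x) ≡ true
==-refl x = dec-true (x Fin.≟ x) refl

==⇒≡ : {x y : Fin n} → (x == y) ≡ true → x ≡ y
==⇒≡ {x = x} {y} e with x Fin.≟ y
... | yes p = p
... | no _ with () ← e

≢⇒== : {x y : Fin n} → x ≢ y → (x == y) ≡ false
≢⇒== {x = x} {y} ne = dec-false (x Fin.≟ y) ne

==⇒≢ : {x y : Fin n} → (x == y) ≡ false → x ≢ y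
==⇒≢ {x = x} e refl with () ← trans (sym e) (==-refl x)

==-sym : (x y : Fin n) → (x == y) ≡ (y == x)
==-sym x y with x Fin.≟ y
... | yes refl = sym (==-refl x)
... | no ne = sym (≢⇒== (ne ∘ sym))

sum-δ : (f : Fin n → ℕ) (x : Fin n) → sum (λ y → χ (x == y) * f y) ≡ f x
sum-δ {suc n} f zero = trans (cong₂ _+_ (+-identityʳ (f zero)) (sum-0 {n} (λ _ → refl))) (+-identityʳ _)
sum-δ {suc n} f (suc x) = sum-δ (f ∘ suc) x

-- Two-step walks summed over their endpoint: the first step contributes `F`, the second its row
-- sum. Bounds such as `μN≤ρρ` count walks in this way.
sum-paths : (F : Fin n′ → ℕ) (G : Fin n′ → Fin n → ℕ) →
            (sum λ y → sum λ w → F w * G w y) ≡ (sum λ w → F w * sum (G w))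
sum-paths F G = trans (sum-swap (λ y w → F w * G w y))
                      (sum-cong-≗ (λ w → sum-*ˡ (F w) (G w)))

sum-paths-≤ : (F : Fin n′ → ℕ) (G : Fin n′ → Fin n → ℕ) → ∀ g → (∀ w → sum (G w) ≤ g) →
              (sum λ y → sum λ w → F w * G w y) ≤ sum F * g
sum-paths-≤ F G g h = ≤-trans (≤-reflexive (sum-paths F G))
  (≤-trans (sum-mono (λ w → *-monoʳ-≤ (F w) (h w))) (≤-reflexive (sum-*ʳ g F)))

count≡# : (p : Fin n → Bool) → count p ≡ # p
count≡# {n} p = go n p id
  where
  go : ∀ k {n} (p : Fin n → Bool) (f : Fin k → Fin n) →
       LA.sum (map (λ w → if p w then 1 else 0) (tabulate f)) ≡ sum (λ x → χ (p (f x)))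
  go zero    p f = refl
  go (suc k) p f = cong (χ (p (f zero)) +_) (go k p (f ∘ suc))

allF⇒ : (p : Fin n → Bool) → allF p ≡ true → ∀ x → p x ≡ true
allF⇒ {n} p = go n p id
  where
  go : ∀ k {n} (p : Fin n → Bool) (f : Fin k → Fin n) → LB.all p (tabulate f) ≡ true → ∀ x → p (f x) ≡ true
  go (suc k) p f e zero    = proj₁ (∧-true e)
  go (suc k) p f e (suc x) = go k p (f ∘ suc) (proj₂ (∧-true {p (f zero)} e)) x

⇒allF : (p : Fin n → Bool) → (∀ x → p x ≡ true) → allF p ≡ true
⇒allF {n} p h = go n id
  where
  go : ∀ k (f : Fin k → Fin n) → LB.all p (tabulate f) ≡ true
  go zero    f = refl
  go (suc k) f rewrite h (f zero) = go k (f ∘ suc)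

⇒anyF : (p : Fin n → Bool) → ∀ x → p x ≡ true → anyF p ≡ true
⇒anyF {n} p x h = go n id x h
  where
  go : ∀ k (f : Fin k → Fin n) (x : Fin k) → p (f x) ≡ true → LB.any p (tabulate f) ≡ true
  go (suc k) f zero    e rewrite e = refl
  go (suc k) f (suc x) e with p (f zero)
  ... | true  = refl
  ... | false = go k (f ∘ suc) x e

any? : (p : Fin n → Bool) → (∃ λ x → p x ≡ true) ⊎ (∀ x → p x ≡ false)
any? p with # p in eq
... | zero  = inj₂ (#≡0⇒ p eq)
... | suc _ = inj₁ (#>0⇒∃ p (subst (0 <_) (sym eq) z<s))

≡⇒≡ᵇ-true : ∀ {a b} → a ≡ b → (a ≡ᵇ b) ≡ true
≡⇒≡ᵇ-true {zero}  refl = refl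
≡⇒≡ᵇ-true {suc a} refl = ≡⇒≡ᵇ-true {a} refl

≡ᵇ-true⇒≡ : ∀ a b → (a ≡ᵇ b) ≡ true → a ≡ b
≡ᵇ-true⇒≡ zero    zero    _ = refl
≡ᵇ-true⇒≡ (suc a) (suc b) e = cong suc (≡ᵇ-true⇒≡ a b e)

not-true : ∀ {b} → not b ≡ true → b ≡ false
not-true {false} _ = refl

true≢false : ∀ {b} → b ≡ true → b ≡ false → ⊥
true≢false refl ()

∨-true : ∀ {a b} → a ∨ b ≡ true → a ≡ true ⊎ b ≡ true
∨-true {true}  _ = inj₁ refl
∨-true {false} e = inj₂ e

∧-intro : ∀ {a b} → a ≡ true → b ≡ true → a ∧ b ≡ true
∧-intro refl refl = refl

-- Hitting sets

-- Averaging. Adding 1 to every `g x` raises the total by n ≥ 1, so the strict version applies.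
sum≤⇒∃≤ : (f g : Fin n → ℕ) → 1 ≤ n → sum f ≤ sum g → ∃ λ x → f x ≤ g x
sum≤⇒∃≤ {n} f g n≥1 p with sum<⇒∃< f (λ x → 1 + g x) (≤-trans (s≤s p) (≤-trans (+-monoˡ-≤ (sum g) n≥1)
    (≤-reflexive (trans (cong (_+ sum g) (sym (trans (sum-const n 1) (*-identityʳ n)))) (sym (sum-+ (λ _ → 1) g))))))
... | x , s≤s q = x , q

hit : (Fin n → Bool) → List (Fin n) → Bool
hit p []      = false
hit p (x ∷ T) = p x ∨ hit p T

module _ (A : Fin n′ → Fin n → Bool) (K : ℕ) (n≥1 : 1 ≤ n) (K≥1 : 1 ≤ K) (big : ∀ j → n ≤ K * # (A j)) where

  unhit : List (Fin n) → ℕ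
  unhit T = # (λ j → not (hit (A j) T))

  hits : List (Fin n) → Fin n → ℕ
  hits T x = sum (λ j → χ (not (hit (A j) T)) * χ (A j x))

  unhit-∷ : ∀ T x → unhit (x ∷ T) + hits T x ≡ unhit T
  unhit-∷ T x = trans (sym (sum-+ (λ j → χ (not (hit (A j) (x ∷ T)))) (λ j → χ (not (hit (A j) T)) * χ (A j x))))
                      (sum-cong-≗ (λ j → case (A j x) (hit (A j) T)))
    where
    case : ∀ a b → χ (not (a ∨ b)) + χ (not b) * χ a ≡ χ (not b)
    case true  true  = refl
    case true  false = refl
    case false true  = refl
    case false false = refl

  sum-hits : ∀ T → sum (λ (x : Fin n) → unhit T) ≤ sum (λ x → K * hits T x)
  sum-hits T = begin
    sum (λ (x : Fin n) → unhit T)                   ≡⟨ sum-const n (unhit T) ⟩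
    n * unhit T                                     ≡⟨ sum-*ˡ n (λ j → χ (not (hit (A j) T))) ⟨
    sum (λ j → n * χ (not (hit (A j) T)))           ≤⟨ sum-mono (λ j → *-monoˡ-≤ (χ (not (hit (A j) T))) (big j)) ⟩
    sum (λ j → K * # (A j) * χ (not (hit (A j) T))) ≡⟨ sum-cong-≗ (λ j → rearrange j) ⟩
    sum (λ j → K * (χ (not (hit (A j) T)) * # (A j))) ≡⟨ sum-*ˡ K (λ j → χ (not (hit (A j) T)) * # (A j)) ⟩
    K * sum (λ j → χ (not (hit (A j) T)) * # (A j))
      ≡⟨ cong (K *_) (sum-paths (λ j → χ (not (hit (A j) T))) (λ j x → χ (A j x))) ⟨
    K * sum (hits T)                                ≡⟨ sum-*ˡ K (hits T) ⟨
    sum (λ x → K * hits T x)                        ∎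
    where
    open ≤-Reasoning
    rearrange : ∀ j → K * # (A j) * χ (not (hit (A j) T)) ≡ K * (χ (not (hit (A j) T)) * # (A j))
    rearrange j = trans (*-assoc K (# (A j)) _) (cong (K *_) (*-comm (# (A j)) _))

  -- Every unhit set contains at least n/K points, so an average point lies in a proportion 1/K of
  -- the unhit sets.
  hit-many : ∀ T → ∃ λ x → unhit T + K * unhit (x ∷ T) ≤ K * unhit T
  hit-many T with sum≤⇒∃≤ (λ _ → unhit T) (λ x → K * hits T x) n≥1 (sum-hits T)
  ... | x , px = x , (lin (unhit T ∷ unhit (x ∷ T) ∷ hits T x ∷ K ∷ []) 0 (x₀ ⊕ x₃ ⊗ x₁ ≼ x₃ ⊗ x₀) ((x₃ , x₁ ⊕ x₂ ≼ x₀) ∷ (κ 1 , x₀ ≼ x₃ ⊗ x₂) ∷ []) refl (≤-reflexive (unhit-∷ T x) , px , tt))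

  -- A set hit by none of the chosen points meets at least a proportion 1/K of the points,
  -- so as long as more than half of the sets are unhit, each point hits R/2K of them.
  phase : ∀ T j → ∃ λ T′ → length T′ ≤ j + length T ×
          (2 * unhit T′ ≤ unhit T ⊎ j * unhit T + 2 * K * unhit T′ ≤ 2 * K * unhit T)
  phase T zero = T , ≤-refl , inj₂ ≤-refl
  phase T (suc j) with phase T j
  ... | T′ , l , inj₁ p = T′ , m≤n⇒m≤1+n l , inj₁ p
  ... | T′ , l , inj₂ p = step (2 * unhit T′ ≤? unhit T) (hit-many T′)
    where
    step : Dec (2 * unhit T′ ≤ unhit T) → (∃ λ x → unhit T′ + K * unhit (x ∷ T′) ≤ K * unhit T′) →
           ∃ λ T″ → length T″ ≤ suc j + length T ×
           (2 * unhit T″ ≤ unhit T ⊎ suc j * unhit T + 2 * K * unhit T″ ≤ 2 * K * unhit T)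
    step (yes q) _ = T′ , m≤n⇒m≤1+n l , inj₁ q
    step (no ¬q) (x , r) = x ∷ T′ , s≤s l , inj₂
      (lin (unhit T ∷ unhit T′ ∷ unhit (x ∷ T′) ∷ K ∷ j ∷ []) 0 ((κ 1 ⊕ x₄) ⊗ x₀ ⊕ κ 2 ⊗ x₃ ⊗ x₂ ≼ κ 2 ⊗ x₃ ⊗ x₀) ((κ 1 , κ 1 ⊕ x₀ ≼ κ 2 ⊗ x₁) ∷ (κ 2 , x₁ ⊕ x₃ ⊗ x₂ ≼ x₃ ⊗ x₁) ∷ (κ 1 , x₄ ⊗ x₀ ⊕ κ 2 ⊗ x₃ ⊗ x₁ ≼ κ 2 ⊗ x₃ ⊗ x₀) ∷ []) refl (≰⇒> ¬q , r , p , tt))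

  -- K steps suffice: after them the second alternative of `phase` reads Ku + 2Ku′ ≤ 2Ku, which is
  -- 2u′ ≤ u.
  halve : ∀ T → ∃ λ T′ → length T′ ≤ K + length T × 2 * unhit T′ ≤ unhit T
  halve T with phase T K
  ... | T′ , l , inj₁ p = T′ , l , p
  ... | T′ , l , inj₂ p = T′ , l ,
    *-cancelˡ-≤ K ⦃ >-nonZero K≥1 ⦄ (lin (unhit T ∷ unhit T′ ∷ K ∷ []) 0 (x₂ ⊗ (κ 2 ⊗ x₁) ≼ x₂ ⊗ x₀) ((κ 1 , x₂ ⊗ x₀ ⊕ κ 2 ⊗ x₂ ⊗ x₁ ≼ κ 2 ⊗ x₂ ⊗ x₀) ∷ []) refl (p , tt))

  -- After L halvings fewer than one set is left, since there were fewer than `2 ^ L`.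
  halvings : ∀ L → unhit [] < 2 ^ L → ∃ λ T → length T ≤ K * L × unhit T ≡ 0
  halvings L lt with go L
    where
    go : ∀ j → ∃ λ T → length T ≤ K * j × 2 ^ j * unhit T ≤ unhit []
    go zero = [] , z≤n , ≤-reflexive (+-identityʳ _)
    go (suc j) with go j
    ... | T , l , p with halve T
    ...   | T′ , l′ , q = T′ , ≤-trans l′ (≤-trans (+-monoʳ-≤ K l) (≤-reflexive (sym (*-suc K j)))) ,
      (lin (2 ^ j ∷ unhit T ∷ unhit T′ ∷ unhit [] ∷ []) 0 (κ 2 ⊗ x₀ ⊗ x₂ ≼ x₃) ((x₀ , κ 2 ⊗ x₂ ≼ x₁) ∷ (κ 1 , x₀ ⊗ x₁ ≼ x₃) ∷ []) refl (q , p , tt))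
  ... | T , l , p with unhit T in e
  ...   | zero  = T , l , e
  ...   | suc k = ⊥-elim (<-irrefl refl (<-≤-trans lt (≤-trans (m≤m*n (2 ^ L) (suc k)) p)))

  hitting-set : ∀ L → n′ < 2 ^ L → ∃ λ T → length T ≤ K * L × (∀ j → hit (A j) T ≡ true)
  hitting-set L lt with halvings L (≤-<-trans (#≤n _) lt)
  ... | T , l , z = T , l , λ j → not-false (#≡0⇒ _ z j)
    where
    not-false : ∀ {b} → not b ≡ false → b ≡ true
    not-false {true} _ = refl

-- The n² ordered pairs index the sets; a diagonal pair gets the full set, so that every set is
-- large. As n² < 2^(2(L+1)), the greedy choice takes 2(L+1) halvings, at most 4L because L ≥ 1.
pair-hitting-set : 2 ≤ n → ∀ L → 1 ≤ L → n < 2 ^ suc L → (A : Fin n → Fin n → Fin n → Bool) (K : ℕ) → (∀ u v → u ≢ v → n ≤ K * # (A u v)) →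
                   ∃ λ T → length T ≤ K * (4 * L) × (∀ u v → u ≢ v → hit (A u v) T ≡ true)
pair-hitting-set {n} n≥2 L L≥1 n<2^ A K big =
  let T , l , h = hitting-set A′ K (<⇒≤ n≥2) K≥1 big′ (2 * suc L) small in
  T , ≤-trans l (*-monoʳ-≤ K (lin (L ∷ []) 0 (κ 2 ⊗ (κ 1 ⊕ x₀) ≼ κ 4 ⊗ x₀) ((κ 2 , κ 1 ≼ x₀) ∷ []) refl (L≥1 , tt))) ,
  λ u v u≢v → trans (sym (hit-cong (λ x → trans (cong (λ p → (proj₁ p == proj₂ p) ∨ A (proj₁ p) (proj₂ p) x) (Fin.remQuot-combine {n} {n} u v))
                                              (cong (_∨ A u v x) (≢⇒== u≢v))) T)) (h (combine {n} {n} u v))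
  where
  A′ : Fin (n * n) → Fin n → Bool
  A′ j x = (proj₁ (remQuot {n} n j) == proj₂ (remQuot {n} n j)) ∨ A (proj₁ (remQuot {n} n j)) (proj₂ (remQuot {n} n j)) x
  hit-cong : ∀ {p q : Fin n → Bool} → (∀ x → p x ≡ q x) → ∀ T → hit p T ≡ hit q T
  hit-cong e []      = refl
  hit-cong e (x ∷ T) = cong₂ _∨_ (e x) (hit-cong e T)
  K≥1 : 1 ≤ K
  K≥1 = positive n≥2 K A big
    where
    positive : ∀ {n} → 2 ≤ n → ∀ K (A : Fin n → Fin n → Fin n → Bool) → (∀ u v → u ≢ v → n ≤ K * # (A u v)) → 1 ≤ K
    positive _ (suc _) _ _ = s≤s z≤n
    positive (s≤s (s≤s _)) zero A b with () ← b zero (suc zero) (λ ())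
  big′ : ∀ j → n ≤ K * # (A′ j)
  big′ j = go (proj₁ (remQuot {n} n j)) (proj₂ (remQuot {n} n j)) (_ Fin.≟ _)
    where
    go : ∀ u v → Dec (u ≡ v) → n ≤ K * # (λ x → (u == v) ∨ A u v x)
    go u v (no ne)    = subst (λ b → n ≤ K * # (λ x → b ∨ A u v x)) (sym (≢⇒== ne)) (big u v ne)
    go u .u (yes refl) = subst (λ b → n ≤ K * # (λ x → b ∨ A u u x)) (sym (==-refl u))
      (≤-trans (≤-reflexive (sym (trans (sum-const n 1) (*-identityʳ n)))) (m≤n*m _ K ⦃ >-nonZero K≥1 ⦄))
  small : n * n < 2 ^ (2 * suc L)
  small = <-≤-trans (*-mono-< n<2^ n<2^)
    (≤-reflexive (trans (sym (^-distribˡ-+-* 2 (suc L) (suc L))) (cong (λ k → 2 ^ (suc L + k)) (sym (+-identityʳ _)))))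

toSubset : List (Fin n) → Subset n
toSubset []      = Sub.⊥
toSubset (x ∷ T) = toSubset T [ x ]≔ true

∣toSubset∣≤ : (T : List (Fin n)) → ∣ toSubset T ∣ ≤ length T
∣toSubset∣≤ {n} []  = ≤-reflexive (∣⊥∣≡0 n)
∣toSubset∣≤ (x ∷ T) = ≤-trans (∣∣-update (toSubset T) x) (s≤s (∣toSubset∣≤ T))
  where
  ∣∣-update : ∀ {n} (S : Subset n) x → ∣ S [ x ]≔ true ∣ ≤ 1 + ∣ S ∣
  ∣∣-update (true ∷ S)  zero    = n≤1+n _
  ∣∣-update (false ∷ S) zero    = ≤-refl
  ∣∣-update (true ∷ S)  (suc x) = s≤s (∣∣-update S x)
  ∣∣-update (false ∷ S) (suc x) = ∣∣-update S x

hit⇒∃ : (p : Fin n → Bool) (T : List (Fin n)) → hit p T ≡ true → ∃ λ x → p x ≡ true × lookup (toSubset T) x ≡ true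
hit⇒∃ p (x ∷ T) e with ∨-true {p x} e
... | inj₁ q = x , q , lookup∘updateAt x (toSubset T)
... | inj₂ q with hit⇒∃ p T q
...   | y , py , y∈ with y Fin.≟ x
...     | yes refl = y , py , lookup∘updateAt x (toSubset T)
...     | no ne = y , py , trans (lookup∘updateAt′ y x ne (toSubset T)) y∈

hit-++ˡ : (p : Fin n → Bool) (T T′ : List (Fin n)) → hit p T ≡ true → hit p (T Data.List.++ T′) ≡ true
hit-++ˡ p (x ∷ T) T′ e with p x
... | true  = refl
... | false = hit-++ˡ p T T′ e

hit-++ʳ : (p : Fin n → Bool) (T T′ : List (Fin n)) → hit p T′ ≡ true → hit p (T Data.List.++ T′) ≡ true
hit-++ʳ p []      T′ e = e
hit-++ʳ p (x ∷ T) T′ e with p x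
... | true  = refl
... | false = hit-++ʳ p T T′ e

n<2^[1+log₂n] : ∀ n → n < 2 ^ suc ⌊log₂ n ⌋
n<2^[1+log₂n] n = ≰⇒> λ p → 1+n≰n (≤-trans (≤-reflexive (sym (⌊log₂[2^n]⌋≡n (suc ⌊log₂ n ⌋)))) (⌊log₂⌋-mono-≤ p))

log₂≥1 : ∀ {n} → 2 ≤ n → 1 ≤ ⌊log₂ n ⌋
log₂≥1 {n} p = ≤-trans (≤-reflexive (sym (⌊log₂[2^n]⌋≡n 1))) (⌊log₂⌋-mono-≤ p)

-- Refinement

module _ {n r : ℕ} (c : Coloring n r) (S : Subset n) where

  same-refl : ∀ k u → Sameᵣ c S k u u ≡ true
  same-refl zero u rewrite ==-refl u = refl
  same-refl (suc k) u = ∧-intro (same-refl k u) (⇒allF _ λ a → ⇒allF _ λ b →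
    or-right (≡⇒≡ᵇ-true {count (λ w → Sameᵣ c S k w a ∧ (c u w == b))} refl))
    where
    or-right : ∀ {a b} → b ≡ true → a ∨ b ≡ true
    or-right {true}  _ = refl
    or-right {false} e = e

  same-pred : ∀ k {u v} → Sameᵣ c S (suc k) u v ≡ true → Sameᵣ c S k u v ≡ true
  same-pred k e = proj₁ (∧-true e)

  -- The refinement test for a colour is guarded by its being an edge colour; `x ≢ y` witnesses this
  -- for `c x y`, which leaves the equality of the counts.
  same-count : ∀ k {u v} → Sameᵣ c S (suc k) u v ≡ true → ∀ a {x y} → x ≢ y →
               # (λ w → Sameᵣ c S k w a ∧ (c u w == c x y)) ≡ # (λ w → Sameᵣ c S k w a ∧ (c v w == c x y))
  same-count k {u} {v} e a {x} {y} x≢y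
    with ∨-true (allF⇒ _ (allF⇒ _ (proj₂ (∧-true {Sameᵣ c S k u v} e)) a) (c x y))
  ... | inj₁ p = ⊥-elim (true≢false (⇒anyF _ x (⇒anyF _ y (∧-intro (cong not (≢⇒== x≢y)) (==-refl (c x y))))) (not-true p))
  ... | inj₂ p = trans (sym (count≡# (λ w → Sameᵣ c S k w a ∧ (c u w == c x y))))
                   (trans (≡ᵇ-true⇒≡ _ _ p) (count≡# (λ w → Sameᵣ c S k w a ∧ (c v w == c x y))))

  -- From u the vertex y itself is seen in its class along `c u y`, hence from v some member of that
  -- class is seen along the same colour.
  same⇒∃ : ∀ k {u v} → Sameᵣ c S (suc k) u v ≡ true → ∀ y → u ≢ y →
           ∃ λ w → Sameᵣ c S k w y ≡ true × c v w ≡ c u y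
  same⇒∃ k {u} {v} e y u≢y with #>0⇒∃ _ (subst (0 <_) (same-count k e y u≢y)
      (∃⇒#>0 _ y (∧-intro (same-refl k y) (==-refl (c u y)))))
  ... | w , p = w , proj₁ (∧-true p) , ==⇒≡ (proj₂ (∧-true {Sameᵣ c S k w y} p))

  same₀-∈ : ∀ {w s} → lookup S s ≡ true → Sameᵣ c S 0 w s ≡ true → w ≡ s
  same₀-∈ {w} {s} s∈ e with ∨-true {w == s} e
  ... | inj₁ p = ==⇒≡ p
  ... | inj₂ p = ⊥-elim (true≢false (proj₁ (∧-true (proj₂ (∧-true {not (lookup S w)} p)))) (cong not s∈))

  -- A vertex s of S is alone in its class from the start, so one round compares the colours to s.
  -- If u is s itself, the initial colouring already decides.
  same₁-∈ : ∀ {u v s} → lookup S s ≡ true → Sameᵣ c S 1 u v ≡ true → u ≡ v ⊎ c u s ≡ c v s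
  same₁-∈ {u} {v} {s} s∈ e = go (u Fin.≟ s)
    where
    go : Dec (u ≡ s) → u ≡ v ⊎ c u s ≡ c v s
    go (no u≢s) with same⇒∃ 0 {u} {v} e s u≢s
    ... | w , p , q with refl ← same₀-∈ {w} {s} s∈ p = inj₂ (sym q)
    go (yes refl) with ∨-true {u == v} (same-pred 0 {u} {v} e)
    ... | inj₁ p = inj₁ (==⇒≡ p)
    ... | inj₂ p = ⊥-elim (true≢false (proj₁ (∧-true p)) (cong not s∈))

  splits₁ : (∀ u v → u ≢ v → ∃ λ s → lookup S s ≡ true × c u s ≢ c v s) → CompletelySplits c S
  splits₁ h = 1 , λ u v e → go u v e (u Fin.≟ v)
    where
    go : ∀ u v → Sameᵣ c S 1 u v ≡ true → Dec (u ≡ v) → u ≡ v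
    go u v e (yes p) = p
    go u v e (no ne) with h u v ne
    ... | s , s∈ , d with same₁-∈ {u} {v} s∈ e
    ...   | inj₁ p = p
    ...   | inj₂ p = ⊥-elim (d p)

  -- If u and v survived two rounds, v would have a w with `c v w ≡ c u y` that one round does not
  -- tell from y. Such a w is y, against `c v y ≢ c u y`, or a chosen vertex equal to y, or it
  -- shares the colours of y to s and s′.
  splits₂ : (∀ u v → u ≢ v → ∃ λ y → u ≢ y × c v y ≢ c u y ×
              ∃ λ s → lookup S s ≡ true × ∃ λ s′ → lookup S s′ ≡ true ×
              (∀ w → c v w ≡ c u y → c w s ≡ c y s → c w s′ ≡ c y s′ → ⊥)) → CompletelySplits c S
  splits₂ h = 2 , λ u v e → go u v e (u Fin.≟ v)
    where
    go : ∀ u v → Sameᵣ c S 2 u v ≡ true → Dec (u ≡ v) → u ≡ v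
    go u v e (yes p) = p
    go u v e (no ne) with h u v ne
    ... | y , u≢y , d , s , s∈ , s′ , s′∈ , no-w with same⇒∃ 1 {u} {v} e y u≢y
    ...   | w , p , q with same₁-∈ {w} {y} s∈ p | same₁-∈ {w} {y} s′∈ p
    ...     | inj₁ refl | _ = ⊥-elim (d q)
    ...     | inj₂ _ | inj₁ refl = ⊥-elim (d q)
    ...     | inj₂ a | inj₂ b = ⊥-elim (no-w w q a b)

-- Coherence

χ-injective : ∀ a b → χ a ≡ χ b → a ≡ b
χ-injective false false _ = refl
χ-injective true  true  _ = refl

module Coherent {n r : ℕ} (c : Coloring n r) (pcc : IsPCC c) where
  open IsPCC pcc
  open IsConfig config

  -- Functions of the colour, that is, the adjacency algebra of the configuration: closed under
  -- transposition (`coh-flip`), entrywise operations (`coh-op`) and matrix product (`coh-∘`).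
  Coh : (Fin n → Fin n → ℕ) → Set
  Coh F = ∀ {u v u′ v′} → c u v ≡ c u′ v′ → F u v ≡ F u′ v′

  c-flip : ∀ {u v u′ v′} → c u v ≡ c u′ v′ → c v u ≡ c v′ u′
  c-flip {u} {v} {u′} {v′} e with converse (c u v)
  ... | i* , h = trans (Equivalence.to (h u v) refl) (sym (Equivalence.to (h u′ v′) (sym e)))
    where open import Function.Bundles using (Equivalence)

  c-diag : ∀ {u v w} → c v w ≡ c u u → v ≡ w
  c-diag {u} {v} {w} e with v Fin.≟ w
  ... | yes p = p
  ... | no ne = ⊥-elim (diag-sep u v w ne (sym e))

  ==-coh : ∀ {u v u′ v′} → c u v ≡ c u′ v′ → (u == v) ≡ (u′ == v′)
  ==-coh {u} {v} {u′} {v′} e with u Fin.≟ v | u′ Fin.≟ v′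
  ... | yes _ | yes _ = refl
  ... | no _  | no _  = refl
  ... | yes refl | no ne = ⊥-elim (ne (c-diag (sym e)))
  ... | no ne | yes refl = ⊥-elim (ne (c-diag e))

  coh-col : ∀ (φ : Fin r → ℕ) → Coh (λ u v → φ (c u v))
  coh-col φ e = cong φ e

  coh-const : ∀ k → Coh (λ _ _ → k)
  coh-const k _ = refl

  coh-flip : ∀ {F} → Coh F → Coh (λ u v → F v u)
  coh-flip h e = h (c-flip e)

  coh-op : ∀ (_∙_ : ℕ → ℕ → ℕ) {F G} → Coh F → Coh G → Coh (λ u v → F u v ∙ G u v)
  coh-op _∙_ f g e = cong₂ _∙_ (f e) (g e)

  -- Grouping the middle vertices by the colours j and k of the two steps leaves intersection
  -- numbers with coefficients `φ j k`. The weight may depend on both colours jointly, as it does in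
  -- `coh-D`.
  coh-path : ∀ (φ : Fin r → Fin r → ℕ) → Coh (λ u v → sum (λ w → φ (c u w) (c w v)))
  coh-path φ {u} {v} {u′} {v′} e = trans (expand u v) (trans
      (sum-cong-≗ (λ j → sum-cong-≗ (λ k → cong (φ j k *_) (same j k)))) (sym (expand u′ v′)))
    where
    δ : Fin r → Fin r → Fin n → Fin n → Fin n → ℕ
    δ j k u v w = χ ((c u w == j) ∧ (c w v == k))
    same : ∀ j k → sum (δ j k u v) ≡ sum (δ j k u′ v′)
    same j k with coherent (c u v) j k
    ... | p , h = trans (trans (sym (count≡# (λ w → (c u w == j) ∧ (c w v == k)))) (h u v refl))
                    (sym (trans (sym (count≡# (λ w → (c u′ w == j) ∧ (c w v′ == k)))) (h u′ v′ (sym e))))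
    term : ∀ u v w → φ (c u w) (c w v) ≡ (sum λ j → sum λ k → φ j k * δ j k u v w)
    term u v w = sym (trans (sum-cong-≗ (λ j → trans (sum-cong-≗ (λ k → shape j k))
        (trans (sum-*ˡ (χ (c u w == j)) (λ k → χ (c w v == k) * φ j k))
               (cong (χ (c u w == j) *_) (sum-δ (φ j) (c w v))))))
        (sum-δ (λ j → φ j (c w v)) (c u w)))
      where
      shape : ∀ j k → φ j k * δ j k u v w ≡ χ (c u w == j) * (χ (c w v == k) * φ j k)
      shape j k = trans (cong (φ j k *_) (χ-∧ (c u w == j) _)) (trans (*-comm (φ j k) _) (*-assoc (χ (c u w == j)) _ _))
    expand : ∀ u v → sum (λ w → φ (c u w) (c w v)) ≡ (sum λ j → sum λ k → φ j k * sum (δ j k u v))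
    expand u v = trans (sum-cong-≗ (term u v)) (trans (sum-swap (λ w j → sum λ k → φ j k * δ j k u v w))
      (sum-cong-≗ (λ j → trans (sum-swap (λ w k → φ j k * δ j k u v w)) (sum-cong-≗ (λ k → sum-*ˡ (φ j k) (δ j k u v))))))

  value : ∀ (F : Fin n → Fin n → ℕ) → Fin r → ℕ
  value F i = F (proj₁ (rank-surj i)) (proj₁ (proj₂ (rank-surj i)))

  value-c : ∀ {F} → Coh F → ∀ u v → F u v ≡ value F (c u v)
  value-c h u v = h (sym (proj₂ (proj₂ (rank-surj (c u v)))))

  coh-∘ : ∀ {F G} → Coh F → Coh G → Coh (λ u v → sum (λ w → F u w * G w v))
  coh-∘ {F} {G} f g {u} {v} {u′} {v′} e = trans (via u v) (trans (coh-path (λ j k → value F j * value G k) e) (sym (via u′ v′)))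
    where
    via : ∀ u v → sum (λ w → F u w * G w v) ≡ sum (λ w → value F (c u w) * value G (c w v))
    via u v = sum-cong-≗ (λ w → cong₂ _*_ (value-c f u w) (value-c g w v))

  coh-row : ∀ {F} → Coh F → ∀ u v → sum (F u) ≡ sum (F v)
  coh-row {F} f u v = trans (mul u) (trans (coh-∘ f (coh-const 1) (homogeneous u v)) (sym (mul v)))
    where
    mul : ∀ u → sum (F u) ≡ sum (λ w → F u w * 1)
    mul u = sum-cong-≗ {n} (λ w → sym (*-identityʳ _))

  -- Homogeneity makes row sums and column sums constant, and the total over all pairs is n times
  -- either of them.
  coh-col≡row : ∀ {F} → Coh F → ∀ u v → sum (λ w → F w v) ≡ sum (F u)
  coh-col≡row {F} f u v = *-cancelˡ-≡ _ _ n ⦃ inhabited v ⦄ (begin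
    n * sum (λ w → F w v)                  ≡⟨ sum-const n _ ⟨
    sum {n} (λ _ → sum (λ w → F w v))          ≡⟨ sum-cong-≗ (λ x → coh-row {λ a b → F b a} (coh-flip f) v x) ⟩
    (sum λ x → sum λ w → F w x)            ≡⟨ sum-swap (λ x w → F w x) ⟩
    (sum λ w → sum λ x → F w x)            ≡⟨ sum-cong-≗ (λ w → coh-row f w u) ⟩
    sum {n} (λ _ → sum (F u))                  ≡⟨ sum-const n _ ⟩
    n * sum (F u)                          ∎)
    where
    open ≡-Reasoning
    inhabited : ∀ {k} → Fin k → NonZero k
    inhabited {suc k} _ = _

  -- Primitivity as a cut condition: a path in colour i from inside P to a vertex outside has an
  -- edge that leaves P.
  exit : ∀ {i} → IsEdgeColour c i → (P : Fin n → Bool) → ∀ {u v} → P u ≡ true → P v ≡ false →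
         ∃ λ x → ∃ λ y → P x ≡ true × P y ≡ false × c x y ≡ i
  exit {i} ei P {u} {v} Pu Pv = go (primitiv i ei u v) Pu
    where
    go : ∀ {u} → Reach (λ u v → c u v ≡ i) u v → P u ≡ true → ∃ λ x → ∃ λ y → P x ≡ true × P y ≡ false × c x y ≡ i
    go here Pu = ⊥-elim (true≢false Pu Pv)
    go {u} (there {y = y} e rest) Pu = next (P y) refl
      where
      next : ∀ b → P y ≡ b → ∃ λ x → ∃ λ y → P x ≡ true × P y ≡ false × c x y ≡ i
      next true  eq = go rest eq
      next false eq = u , y , Pu , eq , e

1≰0 : ∀ {a} {A : Set a} → 1 ≤ 0 → A
1≰0 ()

both⇒χ*χ : ∀ {a b} → a ≡ true → b ≡ true → χ a * χ b ≡ 1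
both⇒χ*χ refl refl = refl

χ*χ>0 : ∀ a b → 0 < χ a * χ b → a ≡ true × b ≡ true
χ*χ>0 true true _ = refl , refl

pointwise-max : ∀ {n} (f : Fin n → Bool) (a b : Fin n → ℕ) → (∀ x → f x ≡ true → a x ≤ b x) →
                sum (λ x → χ (f x) * a x) ≤ sum (λ x → χ (f x) * b x)
pointwise-max f a b h = sum-mono (λ x → go (f x) x refl)
  where
  go : ∀ t x → f x ≡ t → χ t * a x ≤ χ t * b x
  go true  x e = *-monoʳ-≤ 1 (h x e)
  go false x e = z≤n

-- A colour on more than two thirds of the pairs

module Dominant {n r : ℕ} (c : Coloring n r) (pcc : IsPCC c) (n≥2 : 2 ≤ n) (u₀ : Fin n) (d : Fin r)
                (dominant : 2 * n < 3 * # (λ w → c u₀ w == d)) where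
  open Coherent c pcc

  far nb : Fin n → Fin n → Bool
  far u v = c u v == d
  nb u v  = not (u == v) ∧ not (far u v)

  N ρ : ℕ
  N = # (far u₀)
  ρ = # (nb u₀)

  coh-far : Coh (λ u v → χ (far u v))
  coh-far = coh-col (λ j → χ (j == d))

  nb-coh : ∀ {u v u′ v′} → c u v ≡ c u′ v′ → nb u v ≡ nb u′ v′
  nb-coh e = cong₂ (λ a b → not a ∧ not (b == d)) (==-coh e) e

  coh-nb : Coh (λ u v → χ (nb u v))
  coh-nb e = cong χ (nb-coh e)

  #far : ∀ u → # (far u) ≡ N
  #far u = coh-row coh-far u u₀

  #nb : ∀ u → # (nb u) ≡ ρ
  #nb u = coh-row coh-nb u u₀

  -- A diagonal colour occurs once in each row, while 3N > 2n ≥ 4.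
  far-irrefl : ∀ u → far u u ≡ false
  far-irrefl u = go (far u u) refl
    where
    go : ∀ b → far u u ≡ b → b ≡ false
    go false _ = refl
    go true  e = 1≰0 (lin (n ∷ N ∷ []) 1 (κ 1 ≼ κ 0) ((κ 1 , κ 1 ⊕ κ 2 ⊗ x₀ ≼ κ 3 ⊗ x₁) ∷ (κ 2 , κ 2 ≼ x₀) ∷ (κ 3 , x₁ ≼ κ 1) ∷ []) refl (dominant , n≥2 , N≤1 , tt))
      where
      only : ∀ {x} → far u x ≡ true → u ≡ x
      only p = c-diag (trans (==⇒≡ p) (sym (==⇒≡ e)))
      N≤1 : N ≤ 1
      N≤1 = subst (_≤ 1) (#far u) (#≤1 (far u) (λ x y p q → trans (sym (only p)) (only q)))

  far⇒≢ : ∀ {u v} → far u v ≡ true → u ≢ v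
  far⇒≢ {u} e refl = true≢false e (far-irrefl u)

  -- The colour d and its converse each fill more than half of a row, so they meet there and
  -- coincide.
  far-sym : ∀ u v → far u v ≡ far v u
  far-sym u v = go (far u v) (far v u) refl refl
    where
    total : sum (λ w → χ (far u₀ w) + χ (far w u₀)) ≡ N + N
    total = trans (sum-+ (λ w → χ (far u₀ w)) (λ w → χ (far w u₀)))
                  (cong (N +_) (coh-col≡row {λ u v → χ (far u v)} coh-far u₀ u₀))
    large : sum {n} (λ _ → 1) < sum (λ w → χ (far u₀ w) + χ (far w u₀))
    large = subst₂ _<_ (sym (trans (sum-const n 1) (*-identityʳ n))) (sym total)
      (lin (n ∷ N ∷ []) 4 (κ 1 ⊕ x₀ ≼ x₁ ⊕ x₁) ((κ 3 , κ 1 ⊕ κ 2 ⊗ x₀ ≼ κ 3 ⊗ x₁) ∷ (κ 1 , κ 2 ≼ x₀) ∷ []) refl (dominant , n≥2 , tt))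
    both : ∃ λ w → far u₀ w ≡ true × far w u₀ ≡ true
    both with sum<⇒∃< {n} (λ _ → 1) (λ w → χ (far u₀ w) + χ (far w u₀)) large
    ... | w , lt = w , split (far u₀ w) (far w u₀) lt
      where
      split : ∀ a b → 1 < χ a + χ b → a ≡ true × b ≡ true
      split true true _ = refl , refl
      split true false (s≤s ())
      split false true (s≤s ())
    flip : ∀ {u v} → far u v ≡ true → far v u ≡ true
    flip {u} {v} e with both
    ... | w , p , q = trans (cong (_== d) (c-flip (trans (==⇒≡ e) (sym (==⇒≡ p))))) q
    go : ∀ a b → far u v ≡ a → far v u ≡ b → a ≡ b
    go true  true  _ _ = refl
    go false false _ _ = refl
    go true  false p q = ⊥-elim (true≢false (flip p) q)
    go false true  p q = ⊥-elim (true≢false (flip q) p)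

  nb-sym : ∀ u v → nb u v ≡ nb v u
  nb-sym u v = cong₂ (λ a b → not a ∧ not b) (==-sym u v) (far-sym u v)

  nb-irrefl : ∀ u → nb u u ≡ false
  nb-irrefl u = cong (λ b → not b ∧ not (far u u)) (==-refl u)

  nb⇒¬far : ∀ {u v} → nb u v ≡ true → far u v ≡ false
  nb⇒¬far {u} {v} e = not-true (proj₂ (∧-true {not (u == v)} e))

  nb⇒≢ : ∀ {u v} → nb u v ≡ true → u ≢ v
  nb⇒≢ {u} {v} e = ==⇒≢ (not-true (proj₁ (∧-true e)))

  ≢∧¬far⇒nb : ∀ {u v} → u ≢ v → far u v ≡ false → nb u v ≡ true
  ≢∧¬far⇒nb ne e = cong₂ (λ a b → not a ∧ not b) (≢⇒== ne) e

  trichotomy : ∀ u v → χ (u == v) + χ (far u v) + χ (nb u v) ≡ 1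
  trichotomy u v = go (u == v) (far u v) refl refl
    where
    go : ∀ a b → (u == v) ≡ a → far u v ≡ b → χ a + χ b + χ (not a ∧ not b) ≡ 1
    go true  false _ _ = refl
    go false true  _ _ = refl
    go false false _ _ = refl
    go true  true  p q = ⊥-elim (far⇒≢ q (==⇒≡ p))

  1+N+ρ≡n : 1 + N + ρ ≡ n
  1+N+ρ≡n = begin
    1 + N + ρ                                                   ≡⟨ cong (λ k → k + N + ρ) (sym one) ⟩
    sum (λ v → χ (u₀ == v)) + N + ρ                             ≡⟨ cong (_+ ρ) (sum-+ (λ v → χ (u₀ == v)) (χ ∘ far u₀)) ⟨
    sum (λ v → χ (u₀ == v) + χ (far u₀ v)) + ρ                  ≡⟨ sum-+ (λ v → χ (u₀ == v) + χ (far u₀ v)) (χ ∘ nb u₀) ⟨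
    sum (λ v → χ (u₀ == v) + χ (far u₀ v) + χ (nb u₀ v))        ≡⟨ sum-cong-≗ (trichotomy u₀) ⟩
    sum {n} (λ _ → 1)                                           ≡⟨ trans (sum-const n 1) (*-identityʳ n) ⟩
    n                                                           ∎
    where
    open ≡-Reasoning
    one : sum (λ v → χ (u₀ == v)) ≡ 1
    one = trans (sum-cong-≗ (λ v → sym (*-identityʳ (χ (u₀ == v))))) (sum-δ (λ _ → 1) u₀)

  3+2ρ≤N : 3 + 2 * ρ ≤ N
  3+2ρ≤N = lin (n ∷ N ∷ ρ ∷ []) 0 (κ 3 ⊕ κ 2 ⊗ x₂ ≼ x₁) ((κ 2 , κ 1 ⊕ x₁ ⊕ x₂ ≼ x₀) ∷ (κ 1 , κ 1 ⊕ κ 2 ⊗ x₀ ≼ κ 3 ⊗ x₁) ∷ []) refl (≤-reflexive 1+N+ρ≡n , dominant , tt)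

  far-exists : ∀ u → ∃ λ v → far u v ≡ true
  far-exists u = #>0⇒∃ (far u) (subst (0 <_) (sym (#far u)) (≤-trans (s≤s z≤n) 3+2ρ≤N))

  far-pair : ∃ λ v → far u₀ v ≡ true
  far-pair = far-exists u₀

  cn : Fin n → Fin n → ℕ
  cn u v = sum (λ w → χ (nb u w) * χ (nb w v))

  coh-cn : Coh cn
  coh-cn = coh-∘ coh-nb coh-nb

  μ : ℕ
  μ = cn u₀ (proj₁ far-pair)

  far-coh : ∀ {F} → Coh F → ∀ {u v u′ v′} → far u v ≡ true → far u′ v′ ≡ true → F u v ≡ F u′ v′
  far-coh h e e′ = h (trans (==⇒≡ e) (sym (==⇒≡ e′)))

  cn-far : ∀ {u v} → far u v ≡ true → cn u v ≡ μ
  cn-far e = far-coh coh-cn e (proj₂ far-pair)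

  far-const : ∀ {F} → Coh F → ∀ u {x y} → far x y ≡ true → sum (λ v → χ (far u v) * F u v) ≡ N * F x y
  far-const {F} h u {x} {y} e = trans (sum-cong-≗ (λ v → go (far u v) v refl)) (trans (sum-*ʳ (F x y) (χ ∘ far u)) (cong (_* F x y) (#far u)))
    where
    go : ∀ b v → far u v ≡ b → χ b * F u v ≡ χ b * F x y
    go true  v p = cong (1 *_) (far-coh h p e)
    go false v p = refl

  sum-far-≤ : ∀ u (F : Fin n → ℕ) → sum (λ v → χ (far u v) * F v) ≤ sum F
  sum-far-≤ u F = sum-mono (λ v → ≤-trans (*-monoˡ-≤ (F v) (χ≤1 (far u v))) (≤-reflexive (*-identityˡ (F v))))

  μN≤ρρ : μ * N ≤ ρ * ρ
  μN≤ρρ = begin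
    μ * N                                       ≡⟨ *-comm μ N ⟩
    N * μ                                       ≡⟨ far-const coh-cn u₀ (proj₂ far-pair) ⟨
    sum (λ v → χ (far u₀ v) * cn u₀ v)          ≤⟨ sum-far-≤ u₀ (cn u₀) ⟩
    sum (cn u₀)                                 ≤⟨ sum-paths-≤ (χ ∘ nb u₀) (λ w v → χ (nb w v)) ρ (λ w → ≤-reflexive (#nb w)) ⟩
    ρ * ρ                                       ∎
    where open ≤-Reasoning

  -- From μN ≤ ρ² and N ≥ 2ρ, the latter because d holds more than two thirds of a row.
  2μ≤ρ : 2 * μ ≤ ρ
  2μ≤ρ = *-cancelʳ-≤ (2 * μ) ρ N ⦃ >-nonZero (≤-trans (s≤s z≤n) 3+2ρ≤N) ⦄
    (lin (μ ∷ ρ ∷ N ∷ []) 0 (κ 2 ⊗ x₀ ⊗ x₂ ≼ x₁ ⊗ x₂) ((κ 2 , x₀ ⊗ x₂ ≼ x₁ ⊗ x₁) ∷ (x₁ , κ 3 ⊕ κ 2 ⊗ x₁ ≼ x₂) ∷ []) refl (μN≤ρρ , 3+2ρ≤N , tt))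

  -- One-sided difference of neighbourhoods. As all neighbourhoods have size ρ, it is ρ minus the
  -- number of common neighbours; unlike `cn`, it obeys a triangle inequality.
  N-diff : Fin n → Fin n → ℕ
  N-diff u v = # (λ w → nb u w ∧ not (nb v w))

  N-diff-cn : ∀ u v → N-diff u v + cn u v ≡ ρ
  N-diff-cn u v = trans (sym (sum-+ (λ w → χ (nb u w ∧ not (nb v w))) (λ w → χ (nb u w) * χ (nb w v))))
                     (trans (sum-cong-≗ (λ w → trans (cong (λ b → χ (nb u w ∧ not (nb v w)) + χ (nb u w) * χ b) (nb-sym w v))
                                                     (go (nb u w) (nb v w)))) (#nb u))
    where
    go : ∀ a b → χ (a ∧ not b) + χ a * χ b ≡ χ a
    go true  true  = refl
    go true  false = refl
    go false b     = refl

  N-diff-tri : ∀ u x v → N-diff u v ≤ N-diff u x + N-diff x v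
  N-diff-tri u x v = ≤-trans (sum-mono (λ w → go (nb u w) (nb x w) (nb v w)))
                        (≤-reflexive (sum-+ (λ w → χ (nb u w ∧ not (nb x w))) (λ w → χ (nb x w ∧ not (nb v w)))))
    where
    go : ∀ a b e → χ (a ∧ not e) ≤ χ (a ∧ not b) + χ (b ∧ not e)
    go false b     e     = z≤n
    go true  false e     = ≤-trans (χ≤1 (not e)) (s≤s z≤n)
    go true  true  e     = ≤-refl

  N-diff-far : ∀ {u v} → far u v ≡ true → N-diff u v + μ ≡ ρ
  N-diff-far {u} {v} e = trans (cong (N-diff u v +_) (sym (cn-far e))) (N-diff-cn u v)

-- Distinguishing vertices and distances

least : (P : ℕ → Bool) → ∀ a → P a ≡ true → ∃ λ m → P m ≡ true × (∀ j → j < m → P j ≡ false)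
least P a e = go a 0 (trans (cong P (+-identityʳ a)) e) (λ j ())
  where
  go : ∀ k b → P (k + b) ≡ true → (∀ j → j < b → P j ≡ false) → ∃ λ m → P m ≡ true × (∀ j → j < m → P j ≡ false)
  decide : ∀ k b → P (suc k + b) ≡ true → (∀ j → j < b → P j ≡ false) → ∀ t → P b ≡ t →
           ∃ λ m → P m ≡ true × (∀ j → j < m → P j ≡ false)
  go zero    b e h = b , e , h
  go (suc k) b e h = decide k b e h (P b) refl
  decide k b e h true  q = b , q , h
  decide k b e h false q = go k (suc b) (trans (cong P (+-suc k b)) e) below
    where
    below : ∀ j → j < suc b → P j ≡ false
    below j (s≤s j≤b) with m≤n⇒m<n∨m≡n j≤b
    ... | inj₁ j<b  = h j j<b
    ... | inj₂ refl = q

pos : ℕ → Bool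
pos zero    = false
pos (suc _) = true

pos⇒ : ∀ {k} → pos k ≡ true → 0 < k
pos⇒ {suc k} _ = s≤s z≤n

⇒pos : ∀ {k} → 0 < k → pos k ≡ true
⇒pos (s≤s _) = refl

∨-introˡ : ∀ {a b} → a ≡ true → a ∨ b ≡ true
∨-introˡ refl = refl

∨-introʳ : ∀ {a b} → b ≡ true → a ∨ b ≡ true
∨-introʳ {true}  _ = refl
∨-introʳ {false} e = e

¬true⇒false : ∀ {b} → (b ≡ true → ⊥) → b ≡ false
¬true⇒false {true}  h = ⊥-elim (h refl)
¬true⇒false {false} h = refl

module Differ {n r : ℕ} (c : Coloring n r) (pcc : IsPCC c) where
  open Coherent c pcc

  D : Fin n → Fin n → ℕ
  D u v = # (λ w → not (c u w == c v w))

  -- Reading `c v w` as the converse of `c w v` turns D into a sum over two-step paths from u to v.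
  coh-D : Coh D
  coh-D {u} {v} {u′} {v′} e = trans (via u v) (trans (coh-path (λ j k → χ (not (j == star k))) e) (sym (via u′ v′)))
    where
    star : Fin r → Fin r
    star k = c (proj₁ (proj₂ (rank k))) (proj₁ (rank k))
      where rank = IsConfig.rank-surj (IsPCC.config pcc)
    star-c : ∀ w v → c v w ≡ star (c w v)
    star-c w v = c-flip (sym (proj₂ (proj₂ (IsConfig.rank-surj (IsPCC.config pcc) (c w v)))))
    via : ∀ u v → D u v ≡ sum (λ w → χ (not (c u w == star (c w v))))
    via u v = sum-cong-≗ (λ w → cong (λ k → χ (not (c u w == k))) (star-c w v))

  D-sym : ∀ u v → D u v ≡ D v u
  D-sym u v = sum-cong-≗ (λ w → cong (χ ∘ not) (==-sym (c u w) (c v w)))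

  D-refl : ∀ u → D u u ≡ 0
  D-refl u = sum-0 {n} (λ w → cong (χ ∘ not) (==-refl (c u w)))

  D-tri : ∀ u x v → D u v ≤ D u x + D x v
  D-tri u x v = ≤-trans (sum-mono pointwise) (≤-reflexive (sum-+ (λ w → χ (not (c u w == c x w))) (λ w → χ (not (c x w == c v w)))))
    where
    pointwise : ∀ w → χ (not (c u w == c v w)) ≤ χ (not (c u w == c x w)) + χ (not (c x w == c v w))
    pointwise w with c u w Fin.≟ c x w
    ... | yes e = ≤-reflexive (cong (λ k → χ (not (k == c v w))) e)
    ... | no _ = ≤-trans (χ≤1 _) (m≤m+n 1 _)

∨-comm : ∀ a b → a ∨ b ≡ b ∨ a
∨-comm true  true  = refl
∨-comm true  false = refl
∨-comm false true  = refl
∨-comm false false = refl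

module Metric {n r : ℕ} (c : Coloring n r) (pcc : IsPCC c) (i : Fin r) (edge-i : IsEdgeColour c i) where
  open Coherent c pcc
  open Differ c pcc

  abstract
    -- The colour i without direction, and the same with loops, so that walks of length a reach
    -- everything within distance a.
    J J⁼ : Fin n → Fin n → Bool
    J x y  = (c x y == i) ∨ (c y x == i)
    J⁼ x y = (x == y) ∨ J x y

    J-coh : ∀ {u v u′ v′} → c u v ≡ c u′ v′ → J u v ≡ J u′ v′
    J-coh e = cong₂ (λ a b → (a == i) ∨ (b == i)) e (c-flip e)

    J-sym : ∀ x y → J x y ≡ J y x
    J-sym x y = ∨-comm (c x y == i) (c y x == i)

    i⇒J : ∀ {x y} → c x y ≡ i → J x y ≡ true
    i⇒J {x} {y} e = ∨-introˡ {c x y == i} (trans (cong (_== i) e) (==-refl i))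

    J⇒i : ∀ {x y} → J x y ≡ true → c x y ≡ i ⊎ c y x ≡ i
    J⇒i {x} {y} e with ∨-true {c x y == i} e
    ... | inj₁ p = inj₁ (==⇒≡ p)
    ... | inj₂ p = inj₂ (==⇒≡ p)

    J⁼-coh : ∀ {u v u′ v′} → c u v ≡ c u′ v′ → J⁼ u v ≡ J⁼ u′ v′
    J⁼-coh e = cong₂ _∨_ (==-coh e) (J-coh e)

    J⁼-sym : ∀ x y → J⁼ x y ≡ J⁼ y x
    J⁼-sym x y = cong₂ _∨_ (==-sym x y) (J-sym x y)

    J⁼-refl : ∀ x → J⁼ x x ≡ true
    J⁼-refl x = ∨-introˡ {x == x} (==-refl x)

    J⇒J⁼ : ∀ {x y} → J x y ≡ true → J⁼ x y ≡ true
    J⇒J⁼ {x} {y} e = ∨-introʳ {x == y} e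

    J⁼⇒ : ∀ {x y} → J⁼ x y ≡ true → x ≡ y ⊎ J x y ≡ true
    J⁼⇒ {x} {y} e with ∨-true {x == y} e
    ... | inj₁ p = inj₁ (==⇒≡ p)
    ... | inj₂ p = inj₂ p

    -- R a u v holds when v is within distance a of u in the graph J.
    R : ℕ → Fin n → Fin n → Bool
    R zero    u v = u == v
    R (suc a) u v = pos (sum (λ x → χ (R a u x) * χ (J⁼ x v)))

    R-coh : ∀ a {u v u′ v′} → c u v ≡ c u′ v′ → R a u v ≡ R a u′ v′
    R-coh zero    e = ==-coh e
    R-coh (suc a) e = cong pos (coh-∘ {λ u v → χ (R a u v)} {λ u v → χ (J⁼ u v)} (λ e → cong χ (R-coh a e)) (λ e → cong χ (J⁼-coh e)) e)

    R-refl : ∀ u → R 0 u u ≡ true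
    R-refl u = ==-refl u

    R-zero : ∀ {u v} → R 0 u v ≡ true → u ≡ v
    R-zero {u} {v} e = ==⇒≡ {x = u} {v} e

    R-snoc : ∀ a {u x v} → R a u x ≡ true → J⁼ x v ≡ true → R (suc a) u v ≡ true
    R-snoc a {u} {x} {v} p q = ⇒pos (≤-trans (≤-reflexive (sym (both⇒χ*χ p q))) (term≤sum (λ x → χ (R a u x) * χ (J⁼ x v)) x))

    R-unsnoc : ∀ a {u v} → R (suc a) u v ≡ true → ∃ λ x → R a u x ≡ true × J⁼ x v ≡ true
    R-unsnoc a {u} {v} e with sum>0⇒∃ (λ x → χ (R a u x) * χ (J⁼ x v)) (pos⇒ e)
    ... | x , p = x , χ*χ>0 _ _ p

  coh-R : ∀ a → Coh (λ u v → χ (R a u v))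
  coh-R a e = cong χ (R-coh a e)

  R-suc : ∀ a {u v} → R a u v ≡ true → R (suc a) u v ≡ true
  R-suc a {u} {v} e = R-snoc a e (J⁼-refl v)

  R-mono : ∀ {a b u v} → a ≤ b → R a u v ≡ true → R b u v ≡ true
  R-mono {a} {b} {u} {v} a≤b e = subst (λ k → R k u v ≡ true) (m∸n+n≡m a≤b) (go (b ∸ a))
    where
    go : ∀ k → R (k + a) u v ≡ true
    go zero    = e
    go (suc k) = R-suc (k + a) (go k)

  R-++ : ∀ a b {u x v} → R a u x ≡ true → R b x v ≡ true → R (a + b) u v ≡ true
  R-++ a zero {u} {x} {v} p q with refl ← R-zero q = subst (λ k → R k u _ ≡ true) (sym (+-identityʳ a)) p
  R-++ a (suc b) {u} {x} {v} p q with R-unsnoc b q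
  ... | y , q₁ , q₂ = subst (λ k → R k u v ≡ true) (sym (+-suc a b)) (R-snoc (a + b) (R-++ a b p q₁) q₂)

  R-split : ∀ a b {u v} → R (a + b) u v ≡ true → ∃ λ x → R a u x ≡ true × R b x v ≡ true
  R-split a zero {u} {v} e = v , subst (λ k → R k u v ≡ true) (+-identityʳ a) e , R-refl v
  R-split a (suc b) {u} {v} e with R-unsnoc (a + b) (subst (λ k → R k u v ≡ true) (+-suc a b) e)
  ... | y , p , q with R-split a b p
  ...   | x , p₁ , p₂ = x , p₁ , R-snoc b p₂ q

  J⁼⇒R : ∀ {x y} → J⁼ x y ≡ true → R 1 x y ≡ true
  J⁼⇒R {x} e = R-snoc 0 (R-refl x) e

  R-sym : ∀ a {u v} → R a u v ≡ true → R a v u ≡ true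
  R-sym zero {u} {v} e with refl ← R-zero e = e
  R-sym (suc a) {u} {v} e with R-unsnoc a e
  ... | x , p , q = R-++ 1 a (J⁼⇒R (trans (J⁼-sym v x) q)) (R-sym a p)

  connected : ∀ u v → ∃ λ a → R a u v ≡ true
  connected u v = go (IsPCC.primitiv pcc i edge-i u v)
    where
    go : ∀ {u} → Reach (λ u v → c u v ≡ i) u v → ∃ λ a → R a u v ≡ true
    go here = 0 , R-refl _
    go {u} (there {y = y} e rest) with go rest
    ... | a , p = suc a , R-++ 1 a (J⁼⇒R (J⇒J⁼ (i⇒J e))) p

  deg : Fin n → ℕ
  deg u = # (J u)

  ball : ℕ → Fin n → ℕ
  ball a u = # (R a u)

  ball-const : ∀ a u v → ball a u ≡ ball a v
  ball-const a = coh-row (coh-R a)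

  ball-mono : ∀ {a b} u → a ≤ b → ball a u ≤ ball b u
  ball-mono {a} {b} u a≤b = #-mono {p = R a u} {R b u} (λ x → R-mono a≤b)

  deg-const : ∀ u v → deg u ≡ deg v
  deg-const = coh-row {λ u v → χ (J u v)} (λ e → cong χ (J-coh e))

  module _ {u₁ v₁ : Fin n} (e₁ : c u₁ v₁ ≡ i) where

    δ : ℕ
    δ = D u₁ v₁

    D-J : ∀ {x y} → J x y ≡ true → D x y ≡ δ
    D-J {x} {y} e with J⇒i e
    ... | inj₁ p = coh-D (trans p (sym e₁))
    ... | inj₂ p = trans (D-sym x y) (coh-D (trans p (sym e₁)))

    D-J⁼ : ∀ {x y} → J⁼ x y ≡ true → D x y ≤ δ
    D-J⁼ {x} {y} e with J⁼⇒ e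
    ... | inj₁ p = ≤-trans (≤-reflexive (trans (cong (D x) (sym p)) (D-refl x))) z≤n
    ... | inj₂ p = ≤-reflexive (D-J p)

    -- Any Φ with a triangle inequality grows by at most k per step. This serves for D, for the
    -- layer sums Ψ and for `N-diff`.
    along : (Φ : Fin n → Fin n → ℕ) → (∀ u → Φ u u ≡ 0) → (∀ u x v → Φ u v ≤ Φ u x + Φ x v) →
            ∀ k → (∀ {x y} → J⁼ x y ≡ true → Φ x y ≤ k) → ∀ a {u v} → R a u v ≡ true → Φ u v ≤ a * k
    along Φ Φ0 Φtri k h zero {u} {v} e with refl ← R-zero e = ≤-reflexive (Φ0 u)
    along Φ Φ0 Φtri k h (suc a) {u} {v} e with R-unsnoc a e
    ... | x , p , q = ≤-trans (Φtri u x v) (≤-trans (+-mono-≤ (along Φ Φ0 Φtri k h a p) (h q)) (≤-reflexive (+-comm (a * k) k)))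

    D-along : ∀ a {u v} → R a u v ≡ true → D u v ≤ a * δ
    D-along = along D D-refl D-tri δ D-J⁼

    E : ℕ → Fin n → Fin n → ℕ
    E a u v = # (λ w → R a u w ∧ not (R a v w))

    -- The sum of `E a u v` over the radii o ≤ a < o + m; `ψ` is the share of a single vertex w.
    Ψ : ℕ → ℕ → Fin n → Fin n → ℕ
    Ψ o zero    u v = 0
    Ψ o (suc m) u v = E o u v + Ψ (suc o) m u v

    ψ : ℕ → ℕ → Fin n → Fin n → Fin n → ℕ
    ψ o zero    u v w = 0
    ψ o (suc m) u v w = χ (R o u w ∧ not (R o v w)) + ψ (suc o) m u v w

    Ψ≡sum-ψ : ∀ o m u v → Ψ o m u v ≡ sum (ψ o m u v)
    Ψ≡sum-ψ o zero u v = sym (sum-0 {n} (λ _ → refl))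
    Ψ≡sum-ψ o (suc m) u v = trans (cong (E o u v +_) (Ψ≡sum-ψ (suc o) m u v))
      (sym (sum-+ (λ w → χ (R o u w ∧ not (R o v w))) (ψ (suc o) m u v)))

    Ψ-refl : ∀ o m u → Ψ o m u u ≡ 0
    Ψ-refl o zero u = refl
    Ψ-refl o (suc m) u = cong₂ _+_ (sum-0 {n} (λ w → go (R o u w))) (Ψ-refl (suc o) m u)
      where
      go : ∀ b → χ (b ∧ not b) ≡ 0
      go true  = refl
      go false = refl

    Ψ-tri : ∀ o m u x v → Ψ o m u v ≤ Ψ o m u x + Ψ o m x v
    Ψ-tri o zero u x v = z≤n
    Ψ-tri o (suc m) u x v = lin (E o u v ∷ Ψ (suc o) m u v ∷ E o u x ∷ Ψ (suc o) m u x ∷ E o x v ∷ Ψ (suc o) m x v ∷ []) 0 (x₀ ⊕ x₁ ≼ x₂ ⊕ x₃ ⊕ (x₄ ⊕ x₅)) ((κ 1 , x₀ ≼ x₂ ⊕ x₄) ∷ (κ 1 , x₁ ≼ x₃ ⊕ x₅) ∷ []) refl (E-tri , Ψ-tri (suc o) m u x v , tt)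
      where
      go : ∀ a b e → χ (a ∧ not e) ≤ χ (a ∧ not b) + χ (b ∧ not e)
      go false b     e     = z≤n
      go true  false e     = ≤-trans (χ≤1 (not e)) (s≤s z≤n)
      go true  true  e     = ≤-refl
      E-tri : E o u v ≤ E o u x + E o x v
      E-tri = ≤-trans (sum-mono (λ w → go (R o u w) (R o x w) (R o v w)))
                (≤-reflexive (sum-+ (λ w → χ (R o u w ∧ not (R o x w))) (λ w → χ (R o x w ∧ not (R o v w)))))

    -- A vertex w moves at most one layer along an edge xy, so it lies in at most one
    -- difference of concentric balls around x and y.
    ψ≤1 : ∀ o m {x y} → J⁼ x y ≡ true → ∀ w → ψ o m x y w + χ (R o y w) ≤ 1
    ψ≤1 o zero e w = χ≤1 _
    ψ≤1 o (suc m) {x} {y} e w =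
      (lin (χ (R o x w ∧ not (R o y w)) ∷ ψ (suc o) m x y w ∷ χ (R o y w) ∷ χ (R (suc o) y w) ∷ []) 0 (x₀ ⊕ x₁ ⊕ x₂ ≼ κ 1) ((κ 1 , x₀ ⊕ x₂ ≼ x₃) ∷ (κ 1 , x₁ ⊕ x₃ ≼ κ 1) ∷ []) refl (layer (R o x w) (R o y w) refl refl , ψ≤1 (suc o) m {x} {y} e w , tt))
      where
      layer : ∀ a b → R o x w ≡ a → R o y w ≡ b → χ (a ∧ not b) + χ b ≤ χ (R (suc o) y w)
      layer a     true  p q = ≤-trans (≤-reflexive (zero-left a)) (true⇒χ (R-suc o q))
        where
        zero-left : ∀ a → χ (a ∧ false) + 1 ≡ 1
        zero-left true  = refl
        zero-left false = refl
      layer true  false p q = true⇒χ (R-++ 1 o (J⁼⇒R (trans (J⁼-sym y x) e)) p)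
      layer false false p q = z≤n

    -- A vertex w contributes only if `c x w ≢ c y w`, since balls are unions of colour classes, and
    -- then at most once by `ψ≤1`. So any number of layers together costs no more than one.
    Ψ-edge : ∀ o m {x y} → J⁼ x y ≡ true → Ψ o m x y ≤ δ
    Ψ-edge o m {x} {y} e = ≤-trans (≤-reflexive (Ψ≡sum-ψ o m x y)) (≤-trans (sum-mono (λ w → pointwise w (c x w == c y w) refl)) (D-J⁼ {x} {y} e))
      where
      same : ∀ o m w → c x w ≡ c y w → ψ o m x y w ≡ 0
      same o zero    w p = refl
      same o (suc m) w p = cong₂ _+_ (trans (cong (λ b → χ (b ∧ not (R o y w))) (R-coh o p)) (go (R o y w))) (same (suc o) m w p)
        where
        go : ∀ b → χ (b ∧ not b) ≡ 0
        go true  = refl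
        go false = refl
      pointwise : ∀ w b → (c x w == c y w) ≡ b → ψ o m x y w ≤ χ (not b)
      pointwise w true  p = ≤-reflexive (same o m w (==⇒≡ p))
      pointwise w false p = ≤-trans (m≤m+n _ _) (ψ≤1 o m {x} {y} e w)

    Ψ-along : ∀ o m a {u v} → R a u v ≡ true → Ψ o m u v ≤ a * δ
    Ψ-along o m = along (Ψ o m) (Ψ-refl o m) (Ψ-tri o m) δ (λ {x} {y} → Ψ-edge o m {x} {y})

    Ψ-lower : ∀ k B o m u v → (∀ a → o ≤ a → a < o + m → B ≤ k * E a u v) → m * B ≤ k * Ψ o m u v
    Ψ-lower k B o zero    u v h = z≤n
    Ψ-lower k B o (suc m) u v h = lin (B ∷ m * B ∷ k ∷ E o u v ∷ Ψ (suc o) m u v ∷ []) 0 (x₀ ⊕ x₁ ≼ x₂ ⊗ (x₃ ⊕ x₄)) ((κ 1 , x₀ ≼ x₂ ⊗ x₃) ∷ (κ 1 , x₁ ≼ x₂ ⊗ x₄) ∷ []) refl (h o ≤-refl (≤-trans (≤-reflexive (+-comm 1 o)) (+-monoʳ-≤ o (s≤s z≤n))) , Ψ-lower k B (suc o) m u v (λ a p q → h a (≤-trans (n≤1+n o) p) (≤-trans q (≤-reflexive (sym (+-suc o m))))) , tt)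

    -- Seen from w, every vertex x ≠ w has a J-neighbour in another colour class,
    -- since the class of x is a proper subset of a connected graph.
    deg-bound : n ≤ 1 + deg u₁ * δ
    deg-bound = *-cancelˡ-≤ n ⦃ inhabited u₁ ⦄ (begin
      n * n                                              ≡⟨ sum-const n n ⟨
      sum {n} (λ w → n)                                  ≤⟨ sum-mono crossing ⟩
      sum (λ w → 1 + sum (λ x → L w x))                  ≡⟨ sum-+ (λ _ → 1) (λ w → sum (L w)) ⟩
      sum {n} (λ _ → 1) + (sum λ w → sum λ x → L w x)        ≡⟨ cong₂ _+_ (sum-const n 1) (trans (sum-swap L) (sum-cong-≗ per-x)) ⟩
      n * 1 + sum {n} (λ x → deg u₁ * δ)                     ≡⟨ cong (n * 1 +_) (sum-const n (deg u₁ * δ)) ⟩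
      n * 1 + n * (deg u₁ * δ)                           ≡⟨ *-distribˡ-+ n 1 _ ⟨
      n * (1 + deg u₁ * δ)                               ∎)
      where
      open ≤-Reasoning
      inhabited : ∀ {k} → Fin k → NonZero k
      inhabited {suc k} _ = _
      -- `L w x` counts the neighbours y of x in J whose colour from w differs from that of x. For
      -- fixed adjacent x and y, the number of such w is `D x y`, which is δ.
      L : Fin n → Fin n → ℕ
      L w x = sum (λ y → χ (J x y) * χ (not (c w x == c w y)))
      per-x : ∀ x → sum (λ w → L w x) ≡ deg u₁ * δ
      per-x x = trans (sum-swap (λ w y → χ (J x y) * χ (not (c w x == c w y))))
          (trans (sum-cong-≗ (λ y → trans (sum-*ˡ (χ (J x y)) (λ w → χ (not (c w x == c w y)))) (inner y (J x y) refl)))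
          (trans (sum-*ʳ δ (λ y → χ (J x y))) (cong (_* δ) (deg-const x u₁))))
        where
        flip-D : ∀ y → sum (λ w → χ (not (c w x == c w y))) ≡ D x y
        flip-D y = sum-cong-≗ (λ w → cong (χ ∘ not) (same w))
          where
          same : ∀ w → (c w x == c w y) ≡ (c x w == c y w)
          same w with c w x Fin.≟ c w y | c x w Fin.≟ c y w
          ... | yes _ | yes _ = refl
          ... | no _  | no _  = refl
          ... | yes p | no q  = ⊥-elim (q (c-flip p))
          ... | no q  | yes p = ⊥-elim (q (c-flip p))
        inner : ∀ y b → J x y ≡ b → χ b * sum (λ w → χ (not (c w x == c w y))) ≡ χ b * δ
        inner y true  p = cong (1 *_) (trans (flip-D y) (D-J p))
        inner y false p = refl
      -- `exit` yields a crossing edge at some vertex in the colour class of x; since L depends on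
      -- `c w x` only, x itself has one too.
      L-coh : ∀ {w x x′} → c w x ≡ c w x′ → L w x ≡ L w x′
      L-coh {w} {x} {x′} e = trans (reorder x) (trans (coh-path (λ j k → value (λ u v → χ (J u v)) k * χ (not (c w x == j))) e)
          (sym (trans (reorder x′) (sum-cong-≗ (λ y → cong (λ t → value (λ u v → χ (J u v)) (c y x′) * χ (not (t == c w y))) (sym e))))))
        where
        reorder : ∀ x → L w x ≡ sum (λ y → value (λ u v → χ (J u v)) (c y x) * χ (not (c w x == c w y)))
        reorder x = sum-cong-≗ (λ y → cong (_* χ (not (c w x == c w y)))
          (trans (cong χ (J-sym x y)) (value-c {λ u v → χ (J u v)} (λ e → cong χ (J-coh e)) y x)))
      leaves : ∀ w x → w ≢ x → 1 ≤ L w x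
      leaves w x w≢x with exit edge-i (λ y → c w y == c w x) {x} {w} (==-refl (c w x)) (¬true⇒false (λ p → w≢x (sym-diag (==⇒≡ {x = c w w} {c w x} p))))
        where
        sym-diag : c w w ≡ c w x → w ≡ x
        sym-diag e = c-diag {w} {w} {x} (sym e)
      ... | a , b , p , q , e = subst (1 ≤_) (L-coh {w} {a} {x} (==⇒≡ {x = c w a} {c w x} p)) (≤-trans (≤-reflexive (sym (both⇒χ*χ {J a b}
              (i⇒J e)
              (cong not (trans (cong (_== c w b) (==⇒≡ {x = c w a} {c w x} p)) (trans (==-sym (c w x) (c w b)) q))))))
            (term≤sum (λ y → χ (J a y) * χ (not (c w a == c w y))) b))
      crossing : ∀ w → n ≤ 1 + sum (L w)
      crossing w = ≤-trans (≤-reflexive (sym (trans (sum-const n 1) (*-identityʳ n)))) (≤-trans (sum-mono each)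
          (≤-reflexive (trans (sum-+ (λ x → χ (w == x)) (L w)) (cong (_+ sum (L w))
             (trans (sum-cong-≗ (λ x → sym (*-identityʳ (χ (w == x))))) (sum-δ (λ _ → 1) w))))))
        where
        each : ∀ x → 1 ≤ χ (w == x) + L w x
        each x with w Fin.≟ x
        ... | yes p = s≤s z≤n
        ... | no ne = leaves w x ne

div-rem : ∀ m k → ∃ λ q → ∃ λ t → m ≡ suc k * q + t × t ≤ k
div-rem m k = m / suc k , m % suc k , trans (m≡m%n+[m/n]*n m (suc k)) (trans (+-comm (m % suc k) _) (cong (_+ m % suc k) (*-comm (m / suc k) (suc k)))) , s≤s⁻¹ (m%n<n m (suc k))

-- Lower bounds for the number of distinguishing vertices

module LargeBound {n r : ℕ} (c : Coloring n r) (pcc : IsPCC c) (n≥2 : 2 ≤ n) (u₁ v₁ : Fin n) (u₁≢v₁ : u₁ ≢ v₁) where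
  open Coherent c pcc
  open Differ c pcc
  open Metric c pcc (c u₁ v₁) (u₁ , v₁ , u₁≢v₁ , refl)

  δ₁ : ℕ
  δ₁ = D u₁ v₁

  Δ-bound : ∀ a {u v} → R a u v ≡ true → D u v ≤ a * δ₁
  Δ-bound a = D-along {u₁} {v₁} refl a

  module Flat (flat : ∀ u j → 3 * # (λ w → c u w == j) ≤ 2 * n) where

    -- For every w at least n/3 of the v have `c v w ≢ c u₁ w`, as no colour holds more than two
    -- thirds of a column; averaging over v gives the pair. The added 1 makes the comparison strict.
    far-apart : ∃ λ u → ∃ λ v → n ≤ 3 * D u v
    far-apart with sum<⇒∃< {n} (λ _ → n) (λ v → 1 + 3 * D u₁ v) total
      where
      class : ∀ w → n ≤ 3 * sum (λ v → χ (not (c u₁ w == c v w)))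
      class w = lin (n ∷ # (λ x → c u₁ x == c u₁ w) ∷ sum (λ v → χ (not (c u₁ w == c v w))) ∷ []) 0 (x₀ ≼ κ 3 ⊗ x₂) ((κ 3 , x₀ ≼ x₁ ⊕ x₂) ∷ (κ 1 , κ 3 ⊗ x₁ ≼ κ 2 ⊗ x₀) ∷ []) refl (≤-reflexive (sym split) , flat u₁ (c u₁ w) , tt)
        where
        split : # (λ x → c u₁ x == c u₁ w) + sum (λ v → χ (not (c u₁ w == c v w))) ≡ n
        split = trans (cong (_+ sum (λ v → χ (not (c u₁ w == c v w)))) (sym (coh-col≡row {λ u v → χ (c u v == c u₁ w)} (coh-col (λ k → χ (k == c u₁ w))) u₁ w)))
          (trans (sym (sum-+ (λ v → χ (c v w == c u₁ w)) (λ v → χ (not (c u₁ w == c v w)))))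
          (trans (sum-cong-≗ (λ v → trans (cong (λ b → χ b + χ (not (c u₁ w == c v w))) (==-sym (c v w) (c u₁ w))) (go (c u₁ w == c v w))))
                 (trans (sum-const n 1) (*-identityʳ n))))
          where
          go : ∀ b → χ b + χ (not b) ≡ 1
          go true  = refl
          go false = refl
      total : sum {n} (λ _ → n) < sum (λ v → 1 + 3 * D u₁ v)
      total = begin-strict
        sum {n} (λ _ → n)                                             ≤⟨ sum-mono class ⟩
        sum (λ w → 3 * sum (λ v → χ (not (c u₁ w == c v w))))     ≡⟨ sum-*ˡ 3 (λ w → sum (λ v → χ (not (c u₁ w == c v w)))) ⟩
        3 * sum (λ w → sum (λ v → χ (not (c u₁ w == c v w))))     ≡⟨ cong (3 *_) (sum-swap (λ w v → χ (not (c u₁ w == c v w)))) ⟩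
        3 * sum (λ v → D u₁ v)                                    ≡⟨ sum-*ˡ 3 (D u₁) ⟨
        sum (λ v → 3 * D u₁ v)                                    <⟨ +-monoˡ-≤ (sum (λ v → 3 * D u₁ v)) (<⇒≤ n≥2) ⟩
        n + sum (λ v → 3 * D u₁ v)                                ≡⟨ cong (_+ sum (λ v → 3 * D u₁ v)) (trans (sum-const n 1) (*-identityʳ n)) ⟨
        sum {n} (λ _ → 1) + sum (λ v → 3 * D u₁ v)                    ≡⟨ sum-+ (λ _ → 1) (λ v → 3 * D u₁ v) ⟨
        sum (λ v → 1 + 3 * D u₁ v)                                ∎
        where open ≤-Reasoning
    ... | v , s≤s p = u₁ , v , p

    module _ {u v : Fin n} (uv : n ≤ 3 * D u v) (Δ : ℕ) (at : R Δ u v ≡ true) (before : ∀ j → j < Δ → R j u v ≡ false) where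

      -- A vertex common to the two balls would give a path from u to v of length 2a < Δ.
      disjoint : ∀ a → 2 * a < Δ → E {u₁} {v₁} refl a u v ≡ ball a u
      disjoint a lt = sum-cong-≗ (λ w → go (R a u w) (R a v w) refl refl)
        where
        go : ∀ {w} x y → R a u w ≡ x → R a v w ≡ y → χ (x ∧ not y) ≡ χ x
        go true  true  p q = ⊥-elim (true≢false (R-++ a a p (R-sym a q))
                               (before (a + a) (≤-trans (s≤s (≤-reflexive (cong (a +_) (sym (+-identityʳ a))))) lt)))
        go true  false p q = refl
        go false y     p q = refl

      -- Let x lie at distance 3j+2 from u on a shortest path to v. Its neighbours in J are within
      -- distance 3j+3 of u but not within 3j, so three more steps of radius add a whole degree.
      ball-grows : ∀ j → 3 * j ≤ Δ → j * deg u₁ ≤ ball (3 * j) u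
      ball-grows zero    _  = z≤n
      ball-grows (suc j) le with R-split (2 + 3 * j) (Δ ∸ (2 + 3 * j)) (subst (λ k → R k u v ≡ true) (sym (m+[n∸m]≡n small)) at)
        where
        small : 2 + 3 * j ≤ Δ
        small = lin (j ∷ Δ ∷ []) 0 (κ 2 ⊕ κ 3 ⊗ x₀ ≼ x₁) ((κ 1 , κ 3 ⊗ (κ 1 ⊕ x₀) ≼ x₁) ∷ []) refl (le , tt)
      ... | x , p , q = subst (λ k → suc j * deg u₁ ≤ ball k u) (sym (*-suc 3 j)) (begin
        deg u₁ + j * deg u₁            ≤⟨ +-mono-≤ (≤-reflexive (deg-const u₁ x)) (ball-grows j (lin (j ∷ Δ ∷ []) 0 (κ 3 ⊗ x₀ ≼ x₁) ((κ 1 , κ 3 ⊗ (κ 1 ⊕ x₀) ≼ x₁) ∷ []) refl (le , tt))) ⟩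
        deg x + ball (3 * j) u         ≡⟨ sum-+ (λ y → χ (J x y)) (λ y → χ (R (3 * j) u y)) ⟨
        sum (λ y → χ (J x y) + χ (R (3 * j) u y)) ≤⟨ sum-mono (λ y → go y (J x y) (R (3 * j) u y) refl refl) ⟩
        ball (3 + 3 * j) u             ∎)
        where
        open ≤-Reasoning
        go : ∀ y a b → J x y ≡ a → R (3 * j) u y ≡ b → χ a + χ b ≤ χ (R (3 + 3 * j) u y)
        go y false false _ _ = z≤n
        go y true  false e _ = true⇒χ (R-snoc (2 + 3 * j) p (J⇒J⁼ e))
        go y false true  _ e = true⇒χ (R-mono (m≤n+m (3 * j) 3) e)
        go y true  true  e f = ⊥-elim (true≢false
            (R-++ (1 + 3 * j) (Δ ∸ (2 + 3 * j)) (R-snoc (3 * j) f (J⇒J⁼ (trans (J-sym y x) e))) q)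
            (before (1 + 3 * j + (Δ ∸ (2 + 3 * j)))
              (≤-reflexive (m+[n∸m]≡n (lin (j ∷ Δ ∷ []) 0 (κ 2 ⊕ κ 3 ⊗ x₀ ≼ x₁) ((κ 1 , κ 3 ⊗ (κ 1 ⊕ x₀) ≼ x₁) ∷ []) refl (le , tt))))))

      flat-bound : n * n ≤ 35937 * δ₁ * δ₁ * δ₁
      flat-bound = from (div-rem Δ 11)
       where
       from : (∃ λ q → ∃ λ t → Δ ≡ 12 * q + t × t ≤ 11) → n * n ≤ 35937 * δ₁ * δ₁ * δ₁
       from (q₀ , t , e₀ , t≤11) = go q₀ e₀
        where
        n≤ : n ≤ 3 * (Δ * δ₁)
        n≤ = ≤-trans uv (*-monoʳ-≤ 3 (Δ-bound Δ at))
        n≤1+ : n ≤ 1 + deg u₁ * δ₁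
        n≤1+ = deg-bound {u₁} {v₁} refl
        go : ∀ q → Δ ≡ 12 * q + t → n * n ≤ 35937 * δ₁ * δ₁ * δ₁
        -- Here Δ ≤ 11, so n ≤ 33δ₁ and n² ≤ n³ ≤ 33³δ₁³: the constant 35937 is 33³.
        go zero e = lin (n ∷ Δ ∷ δ₁ ∷ t ∷ []) 0 (x₀ ⊗ x₀ ≼ κ 35937 ⊗ x₂ ⊗ x₂ ⊗ x₂) ((x₀ ⊗ x₀ , κ 1 ≼ x₀) ∷ (x₀ ⊗ x₀ ⊕ κ 33 ⊗ (x₀ ⊗ x₂) ⊕ κ 1089 ⊗ (x₂ ⊗ x₂) , x₀ ≼ κ 33 ⊗ x₂) ∷ []) refl (<⇒≤ n≥2 , n≤33D , tt)
          where
          n≤33D : n ≤ 33 * δ₁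
          n≤33D = lin (n ∷ Δ ∷ δ₁ ∷ t ∷ []) 0 (x₀ ≼ κ 33 ⊗ x₂) ((κ 1 , x₀ ≼ κ 3 ⊗ (x₁ ⊗ x₂)) ∷ (κ 3 ⊗ x₂ , x₁ ≼ κ 12 ⊗ κ 0 ⊕ x₃) ∷ (κ 3 ⊗ x₂ , x₃ ≼ κ 11) ∷ []) refl (n≤ , ≤-reflexive e , t≤11 , tt)
        -- For the 3q radii from 3q to 6q - 1 the balls around u and v are disjoint and have at
        -- least q · deg vertices, while the layers sum to at most Δδ₁ ≤ 23qδ₁; hence 3q · deg ≤
        -- 23δ₁. Multiplying n ≤ 1 + deg · δ₁ by n ≤ 69qδ₁ then removes q and the degree.
        go (suc k) e = lin (n ∷ δ₁ ∷ q ∷ deg u₁ ∷ []) 0 (x₀ ⊗ x₀ ≼ κ 35937 ⊗ x₁ ⊗ x₁ ⊗ x₁) ((κ 2 ⊗ x₀ , x₀ ≼ κ 1 ⊕ x₃ ⊗ x₁) ∷ (κ 2 ⊗ (x₃ ⊗ x₁) , x₀ ≼ κ 69 ⊗ x₂ ⊗ x₁) ∷ (κ 46 ⊗ (x₁ ⊗ x₁) , κ 3 ⊗ x₂ ⊗ x₃ ≼ κ 23 ⊗ x₁) ∷ (x₀ , κ 2 ≼ x₀) ∷ []) refl (n≤1+ , n≤69qD , 3qg≤23D , n≥2 , tt)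
          where
          q : ℕ
          q = suc k
          n≤69qD : n ≤ 69 * q * δ₁
          n≤69qD = lin (n ∷ Δ ∷ δ₁ ∷ t ∷ k ∷ []) 0 (x₀ ≼ κ 69 ⊗ (κ 1 ⊕ x₄) ⊗ x₂) ((κ 1 , x₀ ≼ κ 3 ⊗ (x₁ ⊗ x₂)) ∷ (κ 3 ⊗ x₂ , x₁ ≼ κ 12 ⊗ (κ 1 ⊕ x₄) ⊕ x₃) ∷ (κ 3 ⊗ x₂ , x₃ ≼ κ 11) ∷ []) refl (n≤ , ≤-reflexive e , t≤11 , tt)
          lower : 3 * q * ball (3 * q) u ≤ 1 * Ψ {u₁} {v₁} refl (3 * q) (3 * q) u v
          lower = Ψ-lower {u₁} {v₁} refl 1 (ball (3 * q) u) (3 * q) (3 * q) u v (λ a p r →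
            ≤-trans (ball-mono u p) (≤-reflexive (trans (sym (disjoint a (lin (a ∷ k ∷ Δ ∷ t ∷ []) 0 (κ 1 ⊕ κ 2 ⊗ x₀ ≼ x₂) ((κ 2 , κ 1 ⊕ x₀ ≼ κ 3 ⊗ (κ 1 ⊕ x₁) ⊕ κ 3 ⊗ (κ 1 ⊕ x₁)) ∷ (κ 1 , κ 12 ⊗ (κ 1 ⊕ x₁) ⊕ x₃ ≼ x₂) ∷ []) refl (r , ≤-reflexive (sym e) , tt)))) (sym (*-identityˡ _)))))
          upper : Ψ {u₁} {v₁} refl (3 * q) (3 * q) u v ≤ Δ * δ₁
          upper = Ψ-along {u₁} {v₁} refl (3 * q) (3 * q) Δ at
          3qg≤23D : 3 * q * deg u₁ ≤ 23 * δ₁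
          3qg≤23D = *-cancelˡ-≤ q (lin (k ∷ deg u₁ ∷ δ₁ ∷ ball (3 * q) u ∷ Δ ∷ t ∷ Ψ {u₁} {v₁} refl (3 * q) (3 * q) u v ∷ []) 0 ((κ 1 ⊕ x₀) ⊗ (κ 3 ⊗ (κ 1 ⊕ x₀) ⊗ x₁) ≼ (κ 1 ⊕ x₀) ⊗ (κ 23 ⊗ x₂)) ((κ 3 ⊗ (κ 1 ⊕ x₀) , (κ 1 ⊕ x₀) ⊗ x₁ ≼ x₃) ∷ (κ 1 , κ 3 ⊗ (κ 1 ⊕ x₀) ⊗ x₃ ≼ κ 1 ⊗ x₆) ∷ (κ 1 , x₆ ≼ x₄ ⊗ x₂) ∷ (x₂ , x₄ ≼ κ 12 ⊗ (κ 1 ⊕ x₀) ⊕ x₅) ∷ (x₂ , x₅ ≼ κ 11) ∷ []) refl (ball-grows q (lin (k ∷ Δ ∷ t ∷ []) 3 (κ 3 ⊗ (κ 1 ⊕ x₀) ≼ x₁) ((κ 1 , κ 12 ⊗ (κ 1 ⊕ x₀) ⊕ x₂ ≼ x₁) ∷ []) refl (≤-reflexive (sym e) , tt)) , lower , upper , ≤-reflexive e , t≤11 , tt))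

    flat-large : n * n ≤ 35937 * δ₁ * δ₁ * δ₁
    flat-large = from far-apart
      where
      from : (∃ λ u → ∃ λ v → n ≤ 3 * D u v) → n * n ≤ 35937 * δ₁ * δ₁ * δ₁
      from (u , v , uv) = at-distance (least (λ k → R k u v) (proj₁ (connected u v)) (proj₂ (connected u v)))
        where
        at-distance : (∃ λ Δ → R Δ u v ≡ true × (∀ j → j < Δ → R j u v ≡ false)) → n * n ≤ 35937 * δ₁ * δ₁ * δ₁
        at-distance (Δ , at , before) = flat-bound uv Δ at before

  module Peaked (d : Fin r) (dominant : 2 * n < 3 * # (λ w → c u₁ w == d)) where
    open Dominant c pcc n≥2 u₁ d dominant hiding (far-exists)

    -- `N-diff` is ρ - μ ≥ ρ/2 here, and every vertex it counts distinguishes u from v, since being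
    -- a neighbour depends on the colour only.
    D-far : ∀ {u v} → far u v ≡ true → ρ ≤ 2 * D u v
    D-far {u} {v} e = lin (ρ ∷ μ ∷ D u v ∷ N-diff u v ∷ []) 0 (x₀ ≼ κ 2 ⊗ x₂) ((κ 2 , x₀ ≼ x₃ ⊕ x₁) ∷ (κ 1 , κ 2 ⊗ x₁ ≼ x₀) ∷ (κ 2 , x₃ ≼ x₂) ∷ []) refl (≤-reflexive (sym (N-diff-far e)) , 2μ≤ρ , diff , tt)
      where
      diff : N-diff u v ≤ D u v
      diff = sum-mono (λ w → go (c u w == c v w) refl)
        where
        go : ∀ {w} b → (c u w == c v w) ≡ b → χ (nb u w ∧ not (nb v w)) ≤ χ (not b)
        go {w} true  p = ≤-reflexive (trans (cong (λ b → χ (b ∧ not (nb v w))) (nb-coh (==⇒≡ p))) (never (nb v w)))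
          where
          never : ∀ b → χ (b ∧ not b) ≡ 0
          never true  = refl
          never false = refl
        go {w} false p = χ≤1 (nb u w ∧ not (nb v w))

    module _ {v : Fin n} (uv : far u₁ v ≡ true) (Δ : ℕ) (at : R Δ u₁ v ≡ true) (before : ∀ j → j < Δ → R j u₁ v ≡ false) where

      at′ : ∀ {x y} → far x y ≡ true → R Δ x y ≡ true
      at′ e = trans (R-coh Δ (trans (==⇒≡ e) (sym (==⇒≡ uv)))) at

      before′ : ∀ {x y} → far x y ≡ true → ∀ j → j < Δ → R j x y ≡ false
      before′ e j lt = trans (R-coh j (trans (==⇒≡ e) (sym (==⇒≡ uv)))) (before j lt)

      -- All far pairs have the same distance Δ, so a ball of smaller radius contains no vertex far
      -- from its centre.
      ball-small : ∀ a → a < Δ → ball a u₁ + N ≤ n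
      ball-small a lt = begin
        ball a u₁ + N                            ≡⟨ sum-+ (λ w → χ (R a u₁ w)) (χ ∘ far u₁) ⟨
        sum (λ w → χ (R a u₁ w) + χ (far u₁ w))  ≤⟨ sum-≤ 1 (λ w → go w (R a u₁ w) (far u₁ w) refl refl) ⟩
        n * 1                                    ≡⟨ *-identityʳ n ⟩
        n                                        ∎
        where
        open ≤-Reasoning
        go : ∀ w x y → R a u₁ w ≡ x → far u₁ w ≡ y → χ x + χ y ≤ 1
        go w true  true  p q = ⊥-elim (true≢false p (before′ q a lt))
        go w true  false p q = ≤-refl
        go w false y     p q = χ≤1 y

      common : ℕ → Fin n → Fin n → ℕ
      common a x y = sum (λ w → χ (R a x w) * χ (R a w y))

      -- If any two far vertices have k vertices within distance a of both, then at least Nk walks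
      -- of two such steps lead from u₁ to a far vertex, out of all walks, whose number is the
      -- square of the ball size.
      ball² : ∀ a (F : Fin n → Fin n → ℕ) k → Coh F → F u₁ v ≡ k → (∀ {x y} → far x y ≡ true → F x y ≤ common a x y) → N * k ≤ ball a u₁ * ball a u₁
      ball² a F k coh refl h = begin
        N * F u₁ v                                ≡⟨ far-const coh u₁ uv ⟨
        sum (λ y → χ (far u₁ y) * F u₁ y)         ≤⟨ pointwise-max (far u₁) (F u₁) (common a u₁) (λ y → h) ⟩
        sum (λ y → χ (far u₁ y) * common a u₁ y) ≤⟨ sum-far-≤ u₁ (common a u₁) ⟩
        sum (common a u₁)                        ≤⟨ sum-paths-≤ (λ w → χ (R a u₁ w)) (λ w y → χ (R a w y)) (ball a u₁) (λ w → ≤-reflexive (ball-const a w u₁)) ⟩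
        ball a u₁ * ball a u₁                     ∎
        where open ≤-Reasoning

      -- A ball of radius a < Δ has at most 1 + ρ ≤ N/2 vertices, so by `ball²` the balls around two
      -- far vertices share at most half of either.
      half : ∀ a → a < Δ → ball a u₁ ≤ 2 * E {u₁} {v₁} refl a u₁ v
      half a lt = lin (common a u₁ v ∷ ball a u₁ ∷ E {u₁} {v₁} refl a u₁ v ∷ []) 0 (x₁ ≼ κ 2 ⊗ x₂) ((κ 2 , x₁ ≼ x₂ ⊕ x₀) ∷ (κ 1 , κ 2 ⊗ x₀ ≼ x₁) ∷ []) refl (≤-reflexive (sym split) , 2I≤b , tt)
        where
        I : ℕ
        I = common a u₁ v
        2I≤b : 2 * I ≤ ball a u₁
        2I≤b = *-cancelˡ-≤ N ⦃ >-nonZero (≤-trans (s≤s z≤n) 3+2ρ≤N) ⦄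
          (lin (I ∷ N ∷ ball a u₁ ∷ n ∷ ρ ∷ []) 0 (x₁ ⊗ (κ 2 ⊗ x₀) ≼ x₁ ⊗ x₂) ((κ 2 , x₁ ⊗ x₀ ≼ x₂ ⊗ x₂) ∷ (κ 2 ⊗ x₂ , x₂ ⊕ x₁ ≼ x₃) ∷ (x₂ , κ 3 ⊕ κ 2 ⊗ x₄ ≼ x₁) ∷ (κ 2 ⊗ x₂ , x₃ ≼ κ 1 ⊕ x₁ ⊕ x₄) ∷ []) refl (ball² a (common a) I (coh-∘ (coh-R a) (coh-R a)) refl (λ _ → ≤-refl) , ball-small a lt , 3+2ρ≤N , ≤-reflexive (sym 1+N+ρ≡n) , tt))
        split : E {u₁} {v₁} refl a u₁ v + I ≡ ball a u₁
        split = trans (sym (sum-+ (λ w → χ (R a u₁ w ∧ not (R a v w))) (λ w → χ (R a u₁ w) * χ (R a w v))))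
            (sum-cong-≗ (λ w → go w (R a u₁ w) (R a v w) (R a w v) refl refl))
          where
          go : ∀ w x y z → R a v w ≡ y → R a w v ≡ z → χ (x ∧ not y) + χ x * χ z ≡ χ x
          go w false y     z     p q = refl
          go w true  true  true  p q = refl
          go w true  false false p q = refl
          go w true  true  false p q = ⊥-elim (true≢false (R-sym a p) q)
          go w true  false true  p q = ⊥-elim (true≢false (R-sym a q) p)

      -- The neighbours in J of a vertex halfway between two far vertices lie in both balls of
      -- radius 2 + e.
      middle : ∀ e → Δ ≤ (1 + e) + (1 + e) → N * deg u₁ ≤ ball (2 + e) u₁ * ball (2 + e) u₁
      middle e le = ball² (2 + e) (λ _ _ → deg u₁) (deg u₁) (λ _ → refl) refl through
        where
        through : ∀ {x y} → far x y ≡ true → deg u₁ ≤ common (2 + e) x y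
        through {x} {y} f with R-split (1 + e) (1 + e) (R-mono le (at′ f))
        ... | z , p , q = ≤-trans (≤-reflexive (deg-const u₁ z)) (sum-mono (λ w → go w (J z w) refl))
          where
          go : ∀ w b → J z w ≡ b → χ b ≤ χ (R (2 + e) x w) * χ (R (2 + e) w y)
          go w false _ = z≤n
          go w true  j = ≤-reflexive (sym (both⇒χ*χ (R-snoc (1 + e) p (J⇒J⁼ j)) (R-++ 1 (1 + e) (J⁼⇒R (J⇒J⁼ (trans (J-sym w z) j))) q)))

      far-large : 7 ≤ Δ → n * n ≤ 35937 * δ₁ * δ₁ * δ₁
      far-large Δ≥7 = from (div-rem Δ 1)
       where
       from : (∃ λ e → ∃ λ t → Δ ≡ 2 * e + t × t ≤ 1) → n * n ≤ 35937 * δ₁ * δ₁ * δ₁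
       from (e , t , eq , t≤1) = lin (n ∷ N ∷ deg u₁ ∷ δ₁ ∷ []) 1 (x₀ ⊗ x₀ ≼ κ 35937 ⊗ x₃ ⊗ x₃ ⊗ x₃) ((κ 6 ⊗ x₁ , x₀ ≼ κ 1 ⊕ x₂ ⊗ x₃) ∷ (κ 6 ⊗ x₃ , x₁ ⊗ x₂ ≼ κ 100 ⊗ x₃ ⊗ x₃) ∷ (x₀ , κ 1 ⊕ κ 2 ⊗ x₀ ≼ κ 3 ⊗ x₁) ∷ (κ 3 ⊗ x₁ , κ 2 ≼ x₀) ∷ []) refl (deg-bound {u₁} {v₁} refl , Ng≤ , dominant , n≥2 , tt)
        where
        -- With e half of Δ, the radius 2 + e suffices for `middle`, and the radii from there up to
        -- Δ - 1 still number at least Δ/5 because Δ ≥ 7.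
        o m : ℕ
        o = 2 + e
        m = Δ ∸ o
        o≤Δ : o ≤ Δ
        o≤Δ = lin (e ∷ t ∷ Δ ∷ []) 13 (κ 2 ⊕ x₀ ≼ x₂) ((κ 4 , κ 7 ≼ x₂) ∷ (κ 7 , κ 2 ⊗ x₀ ⊕ x₁ ≼ x₂) ∷ []) refl (Δ≥7 , ≤-reflexive (sym eq) , tt)
        o+m : o + m ≡ Δ
        o+m = m+[n∸m]≡n o≤Δ
        B : ℕ
        B = ball o u₁
        lower : m * B ≤ 2 * Ψ {u₁} {v₁} refl o m u₁ v
        lower = Ψ-lower {u₁} {v₁} refl 2 B o m u₁ v (λ a p q → ≤-trans (ball-mono u₁ p) (half a (≤-trans q (≤-reflexive o+m))))
        upper : Ψ {u₁} {v₁} refl o m u₁ v ≤ Δ * δ₁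
        upper = Ψ-along {u₁} {v₁} refl o m Δ at
        Δ≤5m : Δ ≤ 5 * m
        Δ≤5m = lin (e ∷ t ∷ Δ ∷ m ∷ []) 2 (x₂ ≼ κ 5 ⊗ x₃) ((κ 14 , x₂ ≼ κ 2 ⊕ x₀ ⊕ x₃) ∷ (κ 4 , κ 7 ≼ x₂) ∷ (κ 7 , κ 2 ⊗ x₀ ⊕ x₁ ≼ x₂) ∷ []) refl (≤-reflexive (sym o+m) , Δ≥7 , ≤-reflexive (sym eq) , tt)
        B≤10D : B ≤ 10 * δ₁
        B≤10D = *-cancelˡ-≤ Δ ⦃ >-nonZero (≤-trans (s≤s z≤n) Δ≥7) ⦄
          (lin (Δ ∷ m ∷ B ∷ Ψ {u₁} {v₁} refl o m u₁ v ∷ δ₁ ∷ []) 0 (x₀ ⊗ x₂ ≼ x₀ ⊗ (κ 10 ⊗ x₄)) ((x₂ , x₀ ≼ κ 5 ⊗ x₁) ∷ (κ 5 , x₁ ⊗ x₂ ≼ κ 2 ⊗ x₃) ∷ (κ 10 , x₃ ≼ x₀ ⊗ x₄) ∷ []) refl (Δ≤5m , lower , upper , tt))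
        Ng≤ : N * deg u₁ ≤ 100 * δ₁ * δ₁
        Ng≤ = lin (B ∷ δ₁ ∷ N ∷ deg u₁ ∷ []) 0 (x₂ ⊗ x₃ ≼ κ 100 ⊗ x₁ ⊗ x₁) ((κ 1 , x₂ ⊗ x₃ ≼ x₀ ⊗ x₀) ∷ (x₀ ⊕ κ 10 ⊗ x₁ , x₀ ≼ κ 10 ⊗ x₁) ∷ []) refl (middle e (lin (e ∷ t ∷ Δ ∷ []) 0 (x₂ ≼ κ 1 ⊕ x₀ ⊕ (κ 1 ⊕ x₀)) ((κ 1 , x₂ ≼ κ 2 ⊗ x₀ ⊕ x₁) ∷ (κ 1 , x₁ ≼ κ 1) ∷ []) refl (≤-reflexive eq , t≤1 , tt)) , B≤10D , tt)

    -- For Δ ≥ 7 the layers give the bound of the flat case. For Δ ≤ 6, `D-far` and the triangle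
    -- inequality give ρ ≤ 2 · 6δ₁, whence the 12.
    peaked-large : n * n ≤ 35937 * δ₁ * δ₁ * δ₁ ⊎ ρ ≤ 12 * δ₁
    peaked-large = from far-pair
      where
      from : (∃ λ v → far u₁ v ≡ true) → n * n ≤ 35937 * δ₁ * δ₁ * δ₁ ⊎ ρ ≤ 12 * δ₁
      from (v , uv) = at-distance (least (λ k → R k u₁ v) (proj₁ (connected u₁ v)) (proj₂ (connected u₁ v)))
        where
        at-distance : (∃ λ Δ → R Δ u₁ v ≡ true × (∀ j → j < Δ → R j u₁ v ≡ false)) →
                      n * n ≤ 35937 * δ₁ * δ₁ * δ₁ ⊎ ρ ≤ 12 * δ₁
        at-distance (Δ , at , before) = decide (7 ≤? Δ)
          where
          decide : Dec (7 ≤ Δ) → n * n ≤ 35937 * δ₁ * δ₁ * δ₁ ⊎ ρ ≤ 12 * δ₁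
          decide (yes p) = inj₁ (far-large uv Δ at before p)
          decide (no ¬p) = inj₂ (lin (ρ ∷ D u₁ v ∷ Δ ∷ δ₁ ∷ []) 0 (x₀ ≼ κ 12 ⊗ x₃) ((κ 1 , x₀ ≼ κ 2 ⊗ x₁) ∷ (κ 2 , x₁ ≼ x₂ ⊗ x₃) ∷ (κ 2 ⊗ x₃ , κ 1 ⊕ x₂ ≼ κ 7) ∷ []) refl (D-far uv , Δ-bound Δ at , ≰⇒> ¬p , tt))

-- Sparse neighbourhoods

module Sparse {n r : ℕ} (c : Coloring n r) (pcc : IsPCC c) (n≥2 : 2 ≤ n) (u₀ : Fin n) (d : Fin r)
              (dominant : 2 * n < 3 * # (λ w → c u₀ w == d)) where
  open Coherent c pcc
  open Dominant c pcc n≥2 u₀ d dominant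

  module Params (h : ℕ) (h≥ : 120000 ≤ h) (sparse : h * (ρ * ρ * ρ) ≤ N * N) (ρ≥1 : 1 ≤ ρ) where

    N>0 : 0 < N
    N>0 = ≤-trans (s≤s z≤n) 3+2ρ≤N

    nb-pair : ∃ λ v → nb u₀ v ≡ true
    nb-pair = #>0⇒∃ (nb u₀) ρ≥1

    nb-edge : ∀ {a b} → nb a b ≡ true → IsEdgeColour c (c a b)
    nb-edge {a} {b} e = a , b , nb⇒≢ e , refl

    same-nb : ∀ {a b x y} → nb a b ≡ true → c x y ≡ c a b → nb x y ≡ true
    same-nb e p = trans (nb-coh p) e

    valency : Fin n → Fin n → ℕ
    valency a b = # (λ w → c a w == c a b)

    valency-const : ∀ a b u → # (λ w → c u w == c a b) ≡ valency a b
    valency-const a b u = coh-row (coh-col (λ k → χ (k == c a b))) u a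

    -- Following edges of the colour of (a, b) out of u, one leaves the neighbourhood of u.
    two-step : ∀ {a b} → nb a b ≡ true → ∀ {u v} → far u v ≡ true → ∃ λ x → nb u x ≡ true × c x v ≡ c a b
    two-step {a} {b} e {u} {v} uv with exit (nb-edge e) (λ w → not (far u w)) {u} {v} (cong not (far-irrefl u)) (cong not uv)
    ... | x , y , p , q , xy = transport
      where
      far-uy : far u y ≡ true
      far-uy = not-false q
        where
        not-false : ∀ {b} → not b ≡ false → b ≡ true
        not-false {true} _ = refl
      x≢u : u ≢ x
      x≢u refl = true≢false far-uy (nb⇒¬far (same-nb e xy))
      F : Fin n → Fin n → ℕ
      F u v = sum (λ x → χ (nb u x) * χ (c x v == c a b))
      F-coh : Coh F
      F-coh = coh-∘ coh-nb (coh-col (λ k → χ (k == c a b)))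
      F>0 : 0 < F u v
      F>0 = subst (0 <_) (far-coh F-coh far-uy uv)
        (≤-trans (≤-reflexive (sym (both⇒χ*χ (≢∧¬far⇒nb x≢u (not-true p)) (trans (cong (_== c a b) xy) (==-refl (c a b))))))
                 (term≤sum (λ x → χ (nb u x) * χ (c x y == c a b)) x))
      transport : ∃ λ x → nb u x ≡ true × c x v ≡ c a b
      transport with sum>0⇒∃ (λ x → χ (nb u x) * χ (c x v == c a b)) F>0
      ... | x , pos = x , proj₁ (χ*χ>0 _ _ pos) , ==⇒≡ (proj₂ (χ*χ>0 (nb u x) (c x v == c a b) pos))

    -- By `two-step` every far vertex ends a walk from u₀ to a neighbour and on along the given
    -- colour, and there are ρ · valency such walks.
    N≤ρ*valency : ∀ {a b} → nb a b ≡ true → N ≤ ρ * valency a b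
    N≤ρ*valency {a} {b} e = begin
      N                                                              ≤⟨ sum-mono (λ v → each v (far u₀ v) refl) ⟩
      sum (λ v → sum (λ x → χ (nb u₀ x) * χ (c x v == c a b)))       ≤⟨ sum-paths-≤ (χ ∘ nb u₀) (λ x v → χ (c x v == c a b)) (valency a b) (λ x → ≤-reflexive (valency-const a b x)) ⟩
      ρ * valency a b                                                ∎
      where
      open ≤-Reasoning
      each : ∀ v t → far u₀ v ≡ t → χ t ≤ sum (λ x → χ (nb u₀ x) * χ (c x v == c a b))
      each v false _ = z≤n
      each v true  p = from (two-step e p)
        where
        from : (∃ λ x → nb u₀ x ≡ true × c x v ≡ c a b) → 1 ≤ sum (λ x → χ (nb u₀ x) * χ (c x v == c a b))
        from (x , q , r) = ≤-trans (≤-reflexive (sym (both⇒χ*χ q (trans (cong (_== c a b) r) (==-refl (c a b))))))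
                          (term≤sum (λ x → χ (nb u₀ x) * χ (c x v == c a b)) x)

    cn>0 : ∀ {u w v} → nb u w ≡ true → nb w v ≡ true → 0 < cn u v
    cn>0 {u} {w} {v} p q = ≤-trans (≤-reflexive (sym (both⇒χ*χ p q))) (term≤sum (λ w → χ (nb u w) * χ (nb w v)) w)

    μ≥1 : 1 ≤ μ
    μ≥1 = from (two-step (proj₂ nb-pair) (proj₂ far-pair))
      where
      from : (∃ λ x → nb u₀ x ≡ true × c x (proj₁ far-pair) ≡ c u₀ (proj₁ nb-pair)) → 1 ≤ μ
      from (x , p , q) = subst (1 ≤_) (cn-far (proj₂ far-pair)) (cn>0 p (same-nb (proj₂ nb-pair) q))

    -- hρ(μN) ≤ hρ³ ≤ N² ≤ Nρ · valency; dividing by ρN shows that even the rarest neighbour colour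
    -- dwarfs μ.
    hμ≤valency : ∀ {a b} → nb a b ≡ true → h * μ ≤ valency a b
    hμ≤valency {a} {b} e = *-cancelʳ-≤ (h * μ) (valency a b) (ρ * N) ⦃ >-nonZero (*-mono-< ρ≥1 N>0) ⦄
      (lin (h ∷ μ ∷ N ∷ ρ ∷ valency a b ∷ []) 0 (x₀ ⊗ x₁ ⊗ (x₃ ⊗ x₂) ≼ x₄ ⊗ (x₃ ⊗ x₂)) ((x₀ ⊗ x₃ , x₁ ⊗ x₂ ≼ x₃ ⊗ x₃) ∷ (κ 1 , x₀ ⊗ (x₃ ⊗ x₃ ⊗ x₃) ≼ x₂ ⊗ x₂) ∷ (x₂ , x₂ ≼ x₃ ⊗ x₄) ∷ []) refl (μN≤ρρ , sparse , N≤ρ*valency e , tt))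

    valency≤ρ : ∀ {a b} → nb a b ≡ true → valency a b ≤ ρ
    valency≤ρ {a} {b} e = ≤-trans (#-mono {p = λ w → c a w == c a b} {nb a} (λ w p → same-nb e (==⇒≡ p))) (≤-reflexive (#nb a))

    hμ≤ρ : h * μ ≤ ρ
    hμ≤ρ = ≤-trans (hμ≤valency (proj₂ nb-pair)) (valency≤ρ (proj₂ nb-pair))

    N≤ρρ : N ≤ ρ * ρ
    N≤ρρ = lin (μ ∷ N ∷ ρ ∷ []) 0 (x₁ ≼ x₂ ⊗ x₂) ((x₁ , κ 1 ≼ x₀) ∷ (κ 1 , x₀ ⊗ x₁ ≼ x₂ ⊗ x₂) ∷ []) refl (μ≥1 , μN≤ρρ , tt)

    h≤ρ : h ≤ ρ
    h≤ρ = lin (h ∷ μ ∷ ρ ∷ []) 0 (x₀ ≼ x₂) ((κ 1 , x₀ ⊗ x₁ ≼ x₂) ∷ (x₀ , κ 1 ≼ x₁) ∷ []) refl (hμ≤ρ , μ≥1 , tt)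

    module _ {a b : Fin n} (ab : nb a b ≡ true) where
      open Metric c pcc (c a b) (nb-edge ab)

      valency≤deg : ∀ x → valency a b ≤ deg x
      valency≤deg x = ≤-trans (≤-reflexive (sym (valency-const a b x))) (#-mono {p = λ w → c x w == c a b} {J x} (λ w p → i⇒J (==⇒≡ p)))

      -- All far pairs have one distance Δ, so pairs at smaller distance are not far. If Δ > 3, the
      -- neighbours in J of a vertex two steps from u towards v would be closer than Δ to both ends,
      -- hence common neighbours of u and v, and the valency would be at most μ.
      distance≤3 : ∀ {u v} → far u v ≡ true → R 3 u v ≡ true
      distance≤3 {u} {v} uv = from (least (λ k → R k u v) (proj₁ (connected u v)) (proj₂ (connected u v)))
        where
        from : (∃ λ Δ → R Δ u v ≡ true × (∀ j → j < Δ → R j u v ≡ false)) → R 3 u v ≡ true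
        from (Δ , at , before) = decide (Δ ≤? 3)
          where
          close : ∀ j {x y} → j < Δ → R j x y ≡ true → far x y ≡ false
          close j {x} {y} lt e = ¬true⇒false (λ f → true≢false (trans (R-coh j (trans (==⇒≡ uv) (sym (==⇒≡ f)))) e) (before j lt))
          decide : Dec (Δ ≤ 3) → R 3 u v ≡ true
          decide (yes p) = R-mono p at
          decide (no ¬p) with R-split 2 (Δ ∸ 2) (subst (λ k → R k u v ≡ true) (sym (m+[n∸m]≡n (≤-trans (s≤s (s≤s z≤n)) (≰⇒> ¬p)))) at)
          ... | x , p , q = 1≰0 (lin (h ∷ μ ∷ deg x ∷ valency a b ∷ []) 119998 (κ 1 ≼ κ 0) ((κ 1 , x₀ ⊗ x₁ ≼ x₃) ∷ (κ 1 , x₃ ≼ x₂) ∷ (κ 1 , x₂ ≼ x₁) ∷ (x₁ , κ 120000 ≼ x₀) ∷ (κ 119999 , κ 1 ≼ x₁) ∷ []) refl (hμ≤valency ab , valency≤deg x , deg≤μ , h≥ , μ≥1 , tt))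
            where
            1+k<Δ : suc (Δ ∸ 2) < Δ
            1+k<Δ = ≤-reflexive (m+[n∸m]≡n (≤-trans (s≤s (s≤s z≤n)) (≰⇒> ¬p)))
            between : ∀ y → J x y ≡ true → nb u y ≡ true × nb y v ≡ true
            between y j = ≢∧¬far⇒nb (λ eq → true≢false (subst (λ z → R (suc (Δ ∸ 2)) z v ≡ true) (sym eq) yv) (before _ 1+k<Δ)) (close 3 (≰⇒> ¬p) uy) ,
                          ≢∧¬far⇒nb (λ eq → true≢false (subst (λ z → R 3 u z ≡ true) eq uy) (before 3 (≰⇒> ¬p))) (close (suc (Δ ∸ 2)) 1+k<Δ yv)
              where
              uy : R 3 u y ≡ true
              uy = R-snoc 2 p (J⇒J⁼ j)
              yv : R (suc (Δ ∸ 2)) y v ≡ true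
              yv = R-++ 1 (Δ ∸ 2) (J⁼⇒R (J⇒J⁼ (trans (J-sym y x) j))) q
            deg≤μ : deg x ≤ μ
            deg≤μ = ≤-trans (sum-mono (λ y → each y (J x y) refl)) (≤-reflexive (cn-far uv))
              where
              each : ∀ y t → J x y ≡ t → χ t ≤ χ (nb u y) * χ (nb y v)
              each y false _ = z≤n
              each y true  e = ≤-reflexive (sym (both⇒χ*χ (proj₁ (between y e)) (proj₂ (between y e))))

      -- Between two far vertices `N-diff` is ρ - μ, and at most three edges of the colour of ab,
      -- each of cost ρ - `cn a b`, join them. Later this rules out that N(y) is nearly a single
      -- clique.
      3λ≤2ρ+μ : 3 * cn a b ≤ 2 * ρ + μ
      3λ≤2ρ+μ = lin (N-diff a b ∷ cn a b ∷ μ ∷ ρ ∷ N-diff u₀ v ∷ []) 0 (κ 3 ⊗ x₁ ≼ κ 2 ⊗ x₃ ⊕ x₂) ((κ 3 , x₀ ⊕ x₁ ≼ x₃) ∷ (κ 1 , x₃ ≼ x₄ ⊕ x₂) ∷ (κ 1 , x₄ ≼ κ 3 ⊗ x₀) ∷ []) refl (≤-reflexive (N-diff-cn a b) , ≤-reflexive (sym (N-diff-far uv)) , along {a} {b} refl N-diff N-diff-refl N-diff-tri (N-diff a b) on-edge 3 (distance≤3 uv) , tt)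
        where
        v = proj₁ far-pair
        uv = proj₂ far-pair
        N-diff-refl : ∀ u → N-diff u u ≡ 0
        N-diff-refl u = sum-0 {n} (λ w → go (nb u w))
          where
          go : ∀ b → χ (b ∧ not b) ≡ 0
          go true  = refl
          go false = refl
        cn-sym : ∀ x y → cn x y ≡ cn y x
        cn-sym x y = sum-cong-≗ (λ w → trans (*-comm (χ (nb x w)) _) (cong₂ (λ s t → χ s * χ t) (nb-sym w y) (nb-sym x w)))
        on-edge : ∀ {x y} → J⁼ x y ≡ true → N-diff x y ≤ N-diff a b
        on-edge {x} {y} e with J⁼⇒ e
        ... | inj₁ refl = ≤-trans (≤-reflexive (N-diff-refl x)) z≤n
        ... | inj₂ j = ≤-reflexive (+-cancelʳ-≡ (cn a b) _ _ (trans (cong (N-diff x y +_) (sym cn-same)) (trans (N-diff-cn x y) (sym (N-diff-cn a b)))))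
          where
          cn-same : cn x y ≡ cn a b
          cn-same with J⇒i j
          ... | inj₁ p = coh-cn p
          ... | inj₂ p = trans (cn-sym x y) (coh-cn p)

-- Far pairs inside a neighbourhood

module Windows {n r : ℕ} (c : Coloring n r) (pcc : IsPCC c) (n≥2 : 2 ≤ n) (u₀ : Fin n) (d : Fin r)
               (dominant : 2 * n < 3 * # (λ w → c u₀ w == d)) where
  open Coherent c pcc
  open Dominant c pcc n≥2 u₀ d dominant

  near : Fin n → Fin n → Bool
  near u v = not (far u v)

  coh-near : Coh (λ u v → χ (near u v))
  coh-near = coh-col (λ k → χ (not (k == d)))

  far-near : ∀ {s z} → far s z ≡ true → near s z ≡ true → ⊥
  far-near p q = true≢false p (not-true q)

  near-both : ∀ {s s′ z} → far s s′ ≡ true → near s z ≡ true → near s′ z ≡ true → nb s z ≡ true × nb z s′ ≡ true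
  near-both {s} {s′} {z} f p q =
    ≢∧¬far⇒nb (λ { refl → far-near (trans (far-sym s′ s) f) q }) (not-true p) ,
    trans (nb-sym z s′) (≢∧¬far⇒nb (λ { refl → far-near f p }) (not-true q))

  a : Fin n → Fin n → Fin n → ℕ
  a y z s = χ (nb y s) * χ (near s z)

  α : Fin n → Fin n → ℕ
  α y z = sum (a y z)

  -- Ordered far pairs inside N(y) with both members near z. Four vertices are involved, so the
  -- colour of yz does not determine the number.
  W : Fin n → Fin n → ℕ
  W y z = sum (λ s → a y z s * sum (λ s′ → a y z s′ * χ (far s s′)))

  V₀ X : Fin n → Fin n → ℕ
  V₀ y z = sum (λ s → a y z s * sum (λ s′ → a y z s′ * χ (near s s′)))
  X y z  = sum (λ s → a y z s * sum (λ q → χ (nb y q) * χ (near s q) * χ (far q z)))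

  m : Fin n → Fin n → ℕ
  m y s = sum (λ q → χ (nb y q) * χ (near q s))

  -- Pairs s, q in N(y), near each other, with s near z. Unlike `V₀` this imposes nothing on q and
  -- z, so it is built from two-step counts and is coherent.
  w : Fin n → Fin n → ℕ
  w y z = sum (λ s → χ (nb y s) * m y s * χ (near s z))

  near-sym : ∀ u v → near u v ≡ near v u
  near-sym u v = cong not (far-sym u v)

  coh-α : Coh α
  coh-α = coh-∘ coh-nb coh-near

  coh-m : Coh m
  coh-m = coh-∘ coh-nb coh-near

  coh-w : Coh w
  coh-w = coh-∘ {λ y s → χ (nb y s) * m y s} {λ s z → χ (near s z)} (coh-op _*_ {λ y s → χ (nb y s)} {m} coh-nb coh-m) coh-near

  χ-not : ∀ b → χ b + χ (not b) ≡ 1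
  χ-not true  = refl
  χ-not false = refl

  W+V₀ : ∀ y z → W y z + V₀ y z ≡ α y z * α y z
  W+V₀ y z = trans (sym (sum-+ (λ s → a y z s * sum (λ s′ → a y z s′ * χ (far s s′))) (λ s → a y z s * sum (λ s′ → a y z s′ * χ (near s s′)))))
    (trans (sum-cong-≗ (λ s → trans (sym (*-distribˡ-+ (a y z s) _ _)) (cong (a y z s *_)
       (trans (sym (sum-+ (λ s′ → a y z s′ * χ (far s s′)) (λ s′ → a y z s′ * χ (near s s′))))
              (sum-cong-≗ (λ s′ → trans (sym (*-distribˡ-+ (a y z s′) (χ (far s s′)) (χ (near s s′)))) (trans (cong (a y z s′ *_) (χ-not (far s s′))) (*-identityʳ _))))))))
    (sum-*ʳ (α y z) (a y z)))

  w≡V₀+X : ∀ y z → w y z ≡ V₀ y z + X y z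
  w≡V₀+X y z = trans (sum-cong-≗ per-s) (sum-+ (λ s → a y z s * sum (λ s′ → a y z s′ * χ (near s s′)))
                                               (λ s → a y z s * sum (λ q → χ (nb y q) * χ (near s q) * χ (far q z))))
    where
    per-s : ∀ s → χ (nb y s) * m y s * χ (near s z)
                ≡ a y z s * sum (λ s′ → a y z s′ * χ (near s s′)) + a y z s * sum (λ q → χ (nb y q) * χ (near s q) * χ (far q z))
    per-s s = trans (identity (χ (nb y s) ∷ m y s ∷ χ (near s z) ∷ []) (x₀ ⊗ x₁ ⊗ x₂) (x₀ ⊗ x₂ ⊗ x₁) refl) (trans (cong (a y z s *_) (trans (sum-cong-≗ per-q)
        (sum-+ (λ s′ → a y z s′ * χ (near s s′)) (λ q → χ (nb y q) * χ (near s q) * χ (far q z))))) (*-distribˡ-+ (a y z s) _ _))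
      where
      per-q : ∀ q → χ (nb y q) * χ (near q s) ≡ a y z q * χ (near s q) + χ (nb y q) * χ (near s q) * χ (far q z)
      per-q q = trans (cong (λ t → χ (nb y q) * χ t) (near-sym q s))
        (≤-antisym (lin (χ (nb y q) ∷ χ (near s q) ∷ χ (near q z) ∷ χ (far q z) ∷ []) 0 (x₀ ⊗ x₁ ≼ x₀ ⊗ x₂ ⊗ x₁ ⊕ x₀ ⊗ x₁ ⊗ x₃) ((x₀ ⊗ x₁ , κ 1 ≼ x₃ ⊕ x₂) ∷ []) refl (≤-reflexive (sym (χ-not (far q z))) , tt)) (lin (χ (nb y q) ∷ χ (near s q) ∷ χ (near q z) ∷ χ (far q z) ∷ []) 0 (x₀ ⊗ x₂ ⊗ x₁ ⊕ x₀ ⊗ x₁ ⊗ x₃ ≼ x₀ ⊗ x₁) ((x₀ ⊗ x₁ , x₃ ⊕ x₂ ≼ κ 1) ∷ []) refl (≤-reflexive (χ-not (far q z)) , tt)))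

  -- A choice of q in N(y) leaves for s only common neighbours of the far vertices q and z.
  X≤ρμ : ∀ y z → X y z ≤ ρ * μ
  X≤ρμ y z = begin
    X y z ≡⟨ sum-cong-≗ (λ s → sym (sum-*ˡ (a y z s) (λ q → χ (nb y q) * χ (near s q) * χ (far q z)))) ⟩
    sum (λ s → sum (λ q → a y z s * (χ (nb y q) * χ (near s q) * χ (far q z)))) ≡⟨ sum-swap (λ s q → a y z s * (χ (nb y q) * χ (near s q) * χ (far q z))) ⟩
    sum (λ q → sum (λ s → a y z s * (χ (nb y q) * χ (near s q) * χ (far q z)))) ≤⟨ sum-mono per-q ⟩
    sum (λ q → χ (nb y q) * μ) ≡⟨ sum-*ʳ μ (χ ∘ nb y) ⟩
    # (nb y) * μ ≡⟨ cong (_* μ) (#nb y) ⟩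
    ρ * μ ∎
    where
    open ≤-Reasoning
    per-q : ∀ q → sum (λ s → a y z s * (χ (nb y q) * χ (near s q) * χ (far q z))) ≤ χ (nb y q) * μ
    per-q q = go (nb y q) (far q z) refl refl
      where
      go : ∀ b e → nb y q ≡ b → far q z ≡ e → sum (λ s → a y z s * (χ b * χ (near s q) * χ e)) ≤ χ b * μ
      go false e     _ _ = ≤-reflexive (sum-0 {n} (λ s → *-zeroʳ (a y z s)))
      go true  false _ _ = ≤-trans (≤-reflexive (sum-0 {n} (λ s → trans (cong (a y z s *_) (*-zeroʳ (1 * χ (near s q)))) (*-zeroʳ (a y z s))))) z≤n
      go true  true  _ f = ≤-trans (sum-mono per-s) (≤-reflexive (trans (cn-far f) (sym (*-identityˡ μ))))
        where
        per-s : ∀ s → a y z s * (1 * χ (near s q) * 1) ≤ χ (nb q s) * χ (nb s z)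
        per-s s = case (near s z) (near s q) refl refl
          where
          case : ∀ g k → near s z ≡ g → near s q ≡ k → χ (nb y s) * χ g * (1 * χ k * 1) ≤ χ (nb q s) * χ (nb s z)
          case g false _ _ = ≤-trans (≤-reflexive (*-zeroʳ (χ (nb y s) * χ g))) z≤n
          case false true _ _ = ≤-trans (≤-reflexive (cong (_* 1) (*-zeroʳ (χ (nb y s))))) z≤n
          case true true p q′ with near-both f (trans (near-sym q s) q′) (trans (near-sym z s) p)
          ... | k , l = ≤-trans (*-monoˡ-≤ 1 (≤-trans (≤-reflexive (*-identityʳ (χ (nb y s)))) (χ≤1 (nb y s)))) (≤-reflexive (sym (both⇒χ*χ k l)))

  -- Eliminating `V₀` shows that `W` is the coherent α² - w up to the error `X`.
  W+w : ∀ y z → W y z + w y z ≡ α y z * α y z + X y z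
  W+w y z = (≤-antisym (lin (W y z ∷ w y z ∷ α y z ∷ X y z ∷ V₀ y z ∷ []) 0 (x₀ ⊕ x₁ ≼ x₂ ⊗ x₂ ⊕ x₃) ((κ 1 , x₀ ⊕ x₄ ≼ x₂ ⊗ x₂) ∷ (κ 1 , x₁ ≼ x₄ ⊕ x₃) ∷ []) refl (≤-reflexive (W+V₀ y z) , ≤-reflexive (w≡V₀+X y z) , tt)) (lin (W y z ∷ w y z ∷ α y z ∷ X y z ∷ V₀ y z ∷ []) 0 (x₂ ⊗ x₂ ⊕ x₃ ≼ x₀ ⊕ x₁) ((κ 1 , x₂ ⊗ x₂ ≼ x₀ ⊕ x₄) ∷ (κ 1 , x₄ ⊕ x₃ ≼ x₁) ∷ []) refl (≤-reflexive (sym (W+V₀ y z)) , ≤-reflexive (sym (w≡V₀+X y z)) , tt)))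

  W-window : ∀ {y z y′ z′} → c y z ≡ c y′ z′ → W y z ≤ W y′ z′ + ρ * μ
  W-window {y} {z} {y′} {z′} e = lin (W y z ∷ w y z ∷ α y z ∷ X y z ∷ W y′ z′ ∷ w y′ z′ ∷ α y′ z′ ∷ ρ * μ ∷ []) 0 (x₀ ≼ x₄ ⊕ x₇) ((κ 1 , x₀ ⊕ x₁ ≼ x₂ ⊗ x₂ ⊕ x₃) ∷ (κ 1 , x₃ ≼ x₇) ∷ (κ 1 , x₆ ⊗ x₆ ≼ x₄ ⊕ x₅) ∷ (κ 1 , x₅ ≼ x₁) ∷ (x₂ ⊕ x₆ , x₂ ≼ x₆) ∷ []) refl (≤-reflexive (W+w y z) , X≤ρμ y z , ≤-trans (m≤m+n _ (X y′ z′)) (≤-reflexive (sym (W+w y′ z′))) , ≤-reflexive (sym (coh-w e)) , ≤-reflexive (coh-α e) , tt)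

  -- A vertex z near both members of a far pair is a common neighbour of them, so each of the at
  -- most ρ² far pairs of N(y) is counted at most μ times.
  sum-W : ∀ y → sum (λ z → χ (nb y z) * W y z) ≤ ρ * (ρ * μ)
  sum-W y = begin
    sum (λ z → χ (nb y z) * W y z)                             ≤⟨ sum-mono (λ z → ≤-trans (*-monoˡ-≤ (W y z) (χ≤1 (nb y z))) (≤-reflexive (*-identityˡ (W y z)))) ⟩
    sum (λ z → W y z)                                         ≡⟨ sum-cong-≗ (λ z → sum-cong-≗ (λ s → sym (sum-*ˡ (a y z s) (λ s′ → a y z s′ * χ (far s s′))))) ⟩
    sum (λ z → sum (λ s → sum (λ s′ → a y z s * (a y z s′ * χ (far s s′)))))  ≡⟨ sum-swap (λ z s → sum (λ s′ → a y z s * (a y z s′ * χ (far s s′)))) ⟩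
    sum (λ s → sum (λ z → sum (λ s′ → a y z s * (a y z s′ * χ (far s s′)))))  ≡⟨ sum-cong-≗ (λ s → sum-swap (λ z s′ → a y z s * (a y z s′ * χ (far s s′)))) ⟩
    sum (λ s → sum (λ s′ → sum (λ z → a y z s * (a y z s′ * χ (far s s′)))))  ≤⟨ sum-mono (λ s → sum-mono (λ s′ → per s s′)) ⟩
    sum (λ s → sum (λ s′ → χ (nb y s) * (χ (nb y s′) * μ)))    ≡⟨ sum-cong-≗ (λ s → trans (sum-*ˡ (χ (nb y s)) (λ s′ → χ (nb y s′) * μ)) (cong (χ (nb y s) *_) (trans (sum-*ʳ μ (χ ∘ nb y)) (cong (_* μ) (#nb y))))) ⟩
    sum (λ s → χ (nb y s) * (ρ * μ))                           ≡⟨ trans (sum-*ʳ (ρ * μ) (χ ∘ nb y)) (cong (_* (ρ * μ)) (#nb y)) ⟩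
    ρ * (ρ * μ)                                                ∎
    where
    open ≤-Reasoning
    per : ∀ s s′ → sum (λ z → a y z s * (a y z s′ * χ (far s s′))) ≤ χ (nb y s) * (χ (nb y s′) * μ)
    per s s′ = go (far s s′) refl
      where
      go : ∀ e → far s s′ ≡ e → sum (λ z → a y z s * (a y z s′ * χ e)) ≤ χ (nb y s) * (χ (nb y s′) * μ)
      go false _ = ≤-trans (≤-reflexive (sum-0 {n} (λ z → trans (cong (a y z s *_) (*-zeroʳ (a y z s′))) (*-zeroʳ (a y z s))))) z≤n
      go true  f = begin
        sum (λ z → a y z s * (a y z s′ * 1))                                                ≤⟨ sum-mono per-z ⟩
        sum (λ z → χ (nb y s) * χ (nb y s′) * (χ (nb s z) * χ (nb z s′)))                   ≡⟨ sum-*ˡ (χ (nb y s) * χ (nb y s′)) (λ z → χ (nb s z) * χ (nb z s′)) ⟩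
        χ (nb y s) * χ (nb y s′) * cn s s′                                                  ≡⟨ trans (cong (χ (nb y s) * χ (nb y s′) *_) (cn-far f)) (*-assoc (χ (nb y s)) _ _) ⟩
        χ (nb y s) * (χ (nb y s′) * μ)                                                      ∎
        where
        per-z : ∀ z → a y z s * (a y z s′ * 1) ≤ χ (nb y s) * χ (nb y s′) * (χ (nb s z) * χ (nb z s′))
        per-z z = ≤-trans (≤-reflexive (identity (χ (nb y s) ∷ χ (nb y s′) ∷ χ (near s z) ∷ χ (near s′ z) ∷ []) (x₀ ⊗ x₂ ⊗ (x₁ ⊗ x₃ ⊗ κ 1)) (x₀ ⊗ x₁ ⊗ (x₂ ⊗ x₃)) refl))
            (*-monoʳ-≤ (χ (nb y s) * χ (nb y s′)) (case (near s z) (near s′ z) refl refl))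
          where
          case : ∀ g k → near s z ≡ g → near s′ z ≡ k → χ g * χ k ≤ χ (nb s z) * χ (nb z s′)
          case false k     _ _ = z≤n
          case true  false _ _ = z≤n
          case true  true  p q with near-both f p q
          ... | i , j = ≤-reflexive (sym (both⇒χ*χ i j))

  -- Far pairs of N(y) together with a vertex of N(v) near both members: such a vertex may be
  -- mistaken for y by its colours to the pair.
  bad : Fin n → Fin n → ℕ
  bad y v = sum (λ z → χ (nb v z) * W y z)

  -- The coherent part of `W`, cut off at zero, with V ≤ W ≤ V + ρμ. Being coherent, it can be
  -- averaged over all far v, as in `NU≤`.
  V : Fin n → Fin n → ℕ
  V y z = α y z * α y z ∸ w y z

  coh-V : Coh V
  coh-V = coh-op _∸_ {λ y z → α y z * α y z} {w} (coh-op _*_ {α} {α} coh-α coh-α) coh-w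

  V≤W : ∀ y z → V y z ≤ W y z
  V≤W y z = ≤-trans (∸-monoˡ-≤ (w y z) (≤-trans (m≤m+n _ (X y z)) (≤-reflexive (sym (W+w y z))))) (≤-reflexive (m+n∸n≡m (W y z) (w y z)))

  W≤V+ρμ : ∀ y z → W y z ≤ V y z + ρ * μ
  W≤V+ρμ y z = lin (W y z ∷ w y z ∷ V y z ∷ α y z * α y z ∷ X y z ∷ ρ * μ ∷ []) 0 (x₀ ≼ x₂ ⊕ x₅) ((κ 1 , x₀ ⊕ x₁ ≼ x₃ ⊕ x₄) ∷ (κ 1 , x₄ ≼ x₅) ∷ (κ 1 , x₃ ≼ x₁ ⊕ x₂) ∷ []) refl (≤-reflexive (W+w y z) , X≤ρμ y z , m≤n+m∸n (α y z * α y z) (w y z) , tt)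

  α-far : ∀ {y z} → far y z ≡ true → α y z ≤ μ
  α-far {y} {z} f = ≤-trans (sum-mono (λ s → go s (nb y s) (near s z) refl refl)) (≤-reflexive (cn-far f))
    where
    go : ∀ s b g → nb y s ≡ b → near s z ≡ g → χ b * χ g ≤ χ (nb y s) * χ (nb s z)
    go s false g     _ _ = z≤n
    go s true  false _ _ = z≤n
    go s true  true  p q = ≤-reflexive (sym (both⇒χ*χ p (≢∧¬far⇒nb (λ { refl → true≢false f (nb⇒¬far p) }) (not-true q))))

  W≤αα : ∀ y z → W y z ≤ α y z * α y z
  W≤αα y z = ≤-trans (m≤m+n (W y z) (V₀ y z)) (≤-reflexive (W+V₀ y z))

  module _ {y v : Fin n} (yv : far y v ≡ true) where

    U : ℕ
    U = sum (λ z → χ (nb y z) * V y z * χ (nb z v))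

    NU≤ : N * U ≤ ρ * (ρ * μ) * ρ
    NU≤ = begin
      N * U                                                             ≡⟨ far-const coh-U y yv ⟨
      sum (λ v → χ (far y v) * sum (λ z → χ (nb y z) * V y z * χ (nb z v))) ≤⟨ sum-far-≤ y (λ v → sum (λ z → χ (nb y z) * V y z * χ (nb z v))) ⟩
      sum (λ v → sum (λ z → χ (nb y z) * V y z * χ (nb z v)))               ≤⟨ sum-paths-≤ (λ z → χ (nb y z) * V y z) (λ z v → χ (nb z v)) ρ (λ z → ≤-reflexive (#nb z)) ⟩
      sum (λ z → χ (nb y z) * V y z) * ρ                                ≤⟨ *-monoˡ-≤ ρ (sum-mono (λ z → *-monoʳ-≤ (χ (nb y z)) (V≤W y z))) ⟩
      sum (λ z → χ (nb y z) * W y z) * ρ                                ≤⟨ *-monoˡ-≤ ρ (sum-W y) ⟩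
      ρ * (ρ * μ) * ρ                                                   ∎
      where
      open ≤-Reasoning
      coh-U : Coh (λ y v → sum (λ z → χ (nb y z) * V y z * χ (nb z v)))
      coh-U = coh-∘ {λ y z → χ (nb y z) * V y z} {λ z v → χ (nb z v)} (coh-op _*_ {λ y z → χ (nb y z)} {V} coh-nb coh-V) coh-nb

    -- A vertex z of N(v) that is also a neighbour of y costs at most V + ρμ, and there are μ of
    -- them. Every other z is far from y, so that W ≤ α² ≤ μ².
    bad≤ : bad y v ≤ U + μ * (ρ * μ) + ρ * (μ * μ)
    bad≤ = begin
      bad y v ≤⟨ sum-mono per-z ⟩
      sum (λ z → χ (nb y z) * V y z * χ (nb z v) + χ (nb y z) * χ (nb z v) * (ρ * μ) + χ (nb v z) * (μ * μ))
        ≡⟨ sum-+ (λ z → χ (nb y z) * V y z * χ (nb z v) + χ (nb y z) * χ (nb z v) * (ρ * μ)) (λ z → χ (nb v z) * (μ * μ)) ⟩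
      sum (λ z → χ (nb y z) * V y z * χ (nb z v) + χ (nb y z) * χ (nb z v) * (ρ * μ)) + sum (λ z → χ (nb v z) * (μ * μ))
        ≡⟨ cong₂ _+_ (sum-+ (λ z → χ (nb y z) * V y z * χ (nb z v)) (λ z → χ (nb y z) * χ (nb z v) * (ρ * μ))) (trans (sum-*ʳ (μ * μ) (χ ∘ nb v)) (cong (_* (μ * μ)) (#nb v))) ⟩
      U + sum (λ z → χ (nb y z) * χ (nb z v) * (ρ * μ)) + ρ * (μ * μ)
        ≡⟨ cong (λ k → U + k + ρ * (μ * μ)) (trans (sum-*ʳ (ρ * μ) (λ z → χ (nb y z) * χ (nb z v))) (cong (_* (ρ * μ)) (cn-far yv))) ⟩
      U + μ * (ρ * μ) + ρ * (μ * μ) ∎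
      where
      open ≤-Reasoning
      per-z : ∀ z → χ (nb v z) * W y z ≤ χ (nb y z) * V y z * χ (nb z v) + χ (nb y z) * χ (nb z v) * (ρ * μ) + χ (nb v z) * (μ * μ)
      per-z z = go (nb v z) (nb y z) (nb z v) refl refl (nb-sym z v)
        where
        go : ∀ p q t → nb v z ≡ p → nb y z ≡ q → t ≡ nb v z → χ p * W y z ≤ χ q * V y z * χ t + χ q * χ t * (ρ * μ) + χ p * (μ * μ)
        go false q t _ _ _ = z≤n
        go true true true _ _ _ = lin (W y z ∷ V y z ∷ ρ * μ ∷ μ * μ ∷ []) 0 (κ 1 ⊗ x₀ ≼ κ 1 ⊗ x₁ ⊗ κ 1 ⊕ κ 1 ⊗ κ 1 ⊗ x₂ ⊕ κ 1 ⊗ x₃) ((κ 1 , x₀ ≼ x₁ ⊕ x₂) ∷ []) refl (W≤V+ρμ y z , tt)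
        go true q false e _ t with () ← trans t e
        go true false true e q _ = lin (W y z ∷ V y z ∷ ρ * μ ∷ α y z ∷ μ ∷ []) 0 (κ 1 ⊗ x₀ ≼ κ 0 ⊗ x₁ ⊗ κ 1 ⊕ κ 0 ⊗ κ 1 ⊗ x₂ ⊕ κ 1 ⊗ (x₄ ⊗ x₄)) ((κ 1 , x₀ ≼ x₃ ⊗ x₃) ∷ (x₃ ⊕ x₄ , x₃ ≼ x₄) ∷ []) refl (W≤αα y z , α-far (farness (far y z) refl) , tt)
          where
          farness : ∀ b → far y z ≡ b → far y z ≡ true
          farness true  f = f
          farness false f = distinct (y Fin.≟ z)
            where
            distinct : Dec (y ≡ z) → far y z ≡ true
            distinct (yes refl) = ⊥-elim (true≢false (trans (far-sym v y) yv) (nb⇒¬far e))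
            distinct (no ne)    = ⊥-elim (true≢false (≢∧¬far⇒nb ne f) q)

  NM : Fin n → Fin n → ℕ
  NM y u = sum (λ s → χ (nb y s) * χ (far s u) * sum (λ s′ → χ (nb y s′) * χ (far s′ u) * χ (far s s′)))

  farDeg : Fin n → Fin n → ℕ
  farDeg y s = sum (λ q → χ (nb y q) * χ (far q s))

  coh-farDeg : Coh farDeg
  coh-farDeg = coh-∘ coh-nb coh-far

  NA : Fin n → ℕ
  NA y = sum (λ s → χ (nb y s) * farDeg y s)

  NA-const : ∀ y y′ → NA y ≡ NA y′
  NA-const = coh-row {λ y s → χ (nb y s) * farDeg y s} (coh-op _*_ {λ y s → χ (nb y s)} {farDeg} coh-nb coh-farDeg)

  ν : Fin n → Fin n → ℕ
  ν y u = sum (λ s → χ (nb y s) * farDeg y s * χ (near s u))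

  coh-ν : Coh ν
  coh-ν = coh-∘ {λ y s → χ (nb y s) * farDeg y s} {λ s u → χ (near s u)} (coh-op _*_ {λ y s → χ (nb y s)} {farDeg} coh-nb coh-farDeg) coh-near

  -- Inclusion–exclusion over which members of a far pair of N(y) are near u.
  NM+2ν : ∀ y u → NM y u + (ν y u + ν y u) ≡ NA y + W y u
  NM+2ν y u = begin
    NM y u + (ν y u + ν y u) ≡⟨ cong₂ _+_ NM≡ (cong₂ _+_ ν≡₁ ν≡₂) ⟩
    S f₁ + (S f₂ + S f₃) ≡⟨ cong (S f₁ +_) (S-+ f₂ f₃) ⟨
    S f₁ + S (λ s s′ → f₂ s s′ + f₃ s s′) ≡⟨ S-+ f₁ (λ s s′ → f₂ s s′ + f₃ s s′) ⟨
    S (λ s s′ → f₁ s s′ + (f₂ s s′ + f₃ s s′)) ≡⟨ sum-cong-≗ (λ s → sum-cong-≗ (λ s′ → pointwise s s′)) ⟩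
    S (λ s s′ → f₄ s s′ + f₅ s s′) ≡⟨ S-+ f₄ f₅ ⟩
    S f₄ + S f₅ ≡⟨ cong₂ _+_ NA≡ W≡ ⟨
    NA y + W y u ∎
    where
    open ≡-Reasoning
    b : Fin n → ℕ
    b s = χ (nb y s)
    S : (Fin n → Fin n → ℕ) → ℕ
    S f = sum (λ s → sum (λ s′ → f s s′))
    S-+ : ∀ f g → S (λ s s′ → f s s′ + g s s′) ≡ S f + S g
    S-+ f g = trans (sum-cong-≗ (λ s → sum-+ (f s) (g s))) (sum-+ (λ s → sum (f s)) (λ s → sum (g s)))
    f₁ f₂ f₃ f₄ f₅ : Fin n → Fin n → ℕ
    f₁ s s′ = b s * b s′ * χ (far s s′) * (χ (far s u) * χ (far s′ u))
    f₂ s s′ = b s * b s′ * χ (far s s′) * χ (near s u)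
    f₃ s s′ = b s * b s′ * χ (far s s′) * χ (near s′ u)
    f₄ s s′ = b s * b s′ * χ (far s s′)
    f₅ s s′ = b s * b s′ * χ (far s s′) * (χ (near s u) * χ (near s′ u))
    pointwise : ∀ s s′ → f₁ s s′ + (f₂ s s′ + f₃ s s′) ≡ f₄ s s′ + f₅ s s′
    pointwise s s′ = trans (identity (b s * b s′ * χ (far s s′) ∷ χ (far s u) ∷ χ (far s′ u) ∷ χ (near s u) ∷ χ (near s′ u) ∷ []) (x₀ ⊗ (x₁ ⊗ x₂) ⊕ (x₀ ⊗ x₃ ⊕ x₀ ⊗ x₄)) (x₀ ⊗ (x₁ ⊗ x₂ ⊕ x₃ ⊕ x₄)) refl)
      (trans (cong (b s * b s′ * χ (far s s′) *_) (go (far s u) (far s′ u))) (trans (*-distribˡ-+ (b s * b s′ * χ (far s s′)) 1 _) (cong (_+ f₅ s s′) (*-identityʳ _))))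
      where
      go : ∀ p q → χ p * χ q + χ (not p) + χ (not q) ≡ 1 + χ (not p) * χ (not q)
      go true  true  = refl
      go true  false = refl
      go false true  = refl
      go false false = refl
    NM≡ : NM y u ≡ S f₁
    NM≡ = sum-cong-≗ (λ s → trans (sym (sum-*ˡ (b s * χ (far s u)) (λ s′ → b s′ * χ (far s′ u) * χ (far s s′))))
      (sum-cong-≗ (λ s′ → (identity (b s ∷ b s′ ∷ χ (far s s′) ∷ χ (far s u) ∷ χ (far s′ u) ∷ []) (x₀ ⊗ x₃ ⊗ (x₁ ⊗ x₄ ⊗ x₂)) (x₀ ⊗ x₁ ⊗ x₂ ⊗ (x₃ ⊗ x₄)) refl))))
    W≡ : W y u ≡ S f₅
    W≡ = sum-cong-≗ (λ s → trans (sym (sum-*ˡ (a y u s) (λ s′ → a y u s′ * χ (far s s′))))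
      (sum-cong-≗ (λ s′ → (identity (b s ∷ b s′ ∷ χ (far s s′) ∷ χ (near s u) ∷ χ (near s′ u) ∷ []) (x₀ ⊗ x₃ ⊗ (x₁ ⊗ x₄ ⊗ x₂)) (x₀ ⊗ x₁ ⊗ x₂ ⊗ (x₃ ⊗ x₄)) refl))))
    farDeg≡ : ∀ s → b s * farDeg y s ≡ sum (λ s′ → f₄ s s′)
    farDeg≡ s = trans (sym (sum-*ˡ (b s) (λ q → b q * χ (far q s)))) (sum-cong-≗ (λ s′ → trans (cong (λ t → b s * (b s′ * χ t)) (far-sym s′ s)) (sym (*-assoc (b s) (b s′) _))))
    NA≡ : NA y ≡ S f₄
    NA≡ = sum-cong-≗ farDeg≡
    ν≡₁ : ν y u ≡ S f₂
    ν≡₁ = sum-cong-≗ (λ s → trans (cong (_* χ (near s u)) (farDeg≡ s)) (sym (sum-*ʳ (χ (near s u)) (f₄ s))))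
    ν≡₂ : ν y u ≡ S f₃
    ν≡₂ = trans ν≡₁ (trans (sum-swap f₂) (sum-cong-≗ (λ s → sum-cong-≗ (λ s′ →
      cong₂ (λ i t → i * χ t * χ (near s′ u)) (*-comm (b s′) (b s)) (far-sym s′ s)))))

  -- `NA` and `ν` are coherent, so by `NM+2ν` the window of `W` carries over.
  NM-window : ∀ {y u y′ u′} → c y u ≡ c y′ u′ → NM y u ≤ NM y′ u′ + ρ * μ
  NM-window {y} {u} {y′} {u′} e = +-cancelʳ-≤ (ν y u + ν y u) (NM y u) (NM y′ u′ + ρ * μ) (begin
    NM y u + (ν y u + ν y u)             ≡⟨ NM+2ν y u ⟩
    NA y + W y u                         ≤⟨ +-mono-≤ (≤-reflexive (NA-const y y′)) (W-window e) ⟩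
    NA y′ + (W y′ u′ + ρ * μ)            ≡⟨ +-assoc (NA y′) _ _ ⟨
    NA y′ + W y′ u′ + ρ * μ              ≡⟨ cong (_+ ρ * μ) (NM+2ν y′ u′) ⟨
    NM y′ u′ + (ν y′ u′ + ν y′ u′) + ρ * μ ≡⟨ cong (λ k → NM y′ u′ + (k + k) + ρ * μ) (coh-ν e) ⟨
    NM y′ u′ + (ν y u + ν y u) + ρ * μ   ≡⟨ trans (+-assoc (NM y′ u′) _ _) (trans (cong (NM y′ u′ +_) (+-comm (ν y u + ν y u) _)) (sym (+-assoc (NM y′ u′) _ _))) ⟩
    NM y′ u′ + ρ * μ + (ν y u + ν y u)   ∎)
    where open ≤-Reasoning

-- Splitting through neighbourhoods

cube-root : ∀ n → ∃ λ k → k * k * k ≤ n × n < suc k * suc k * suc k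
cube-root zero = 0 , z≤n , s≤s z≤n
cube-root (suc n) with cube-root n
... | k , p , q = decide (suc n <? suc k * suc k * suc k)
  where
  decide : Dec (suc n < suc k * suc k * suc k) → ∃ λ k → k * k * k ≤ suc n × suc n < suc k * suc k * suc k
  decide (yes r) = k , m≤n⇒m≤1+n p , r
  decide (no ¬r) = suc k , ≮⇒≥ ¬r , (lin (n ∷ k ∷ []) 0 (κ 1 ⊕ (κ 1 ⊕ x₀) ≼ (κ 1 ⊕ (κ 1 ⊕ x₁)) ⊗ (κ 1 ⊕ (κ 1 ⊕ x₁)) ⊗ (κ 1 ⊕ (κ 1 ⊕ x₁))) ((κ 1 , κ 1 ⊕ x₀ ≼ (κ 1 ⊕ x₁) ⊗ (κ 1 ⊕ x₁) ⊗ (κ 1 ⊕ x₁)) ∷ []) refl (q , tt))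

square-cancel-≤ : ∀ a b → a * a ≤ b * b → a ≤ b
square-cancel-≤ a b p = ≮⇒≥ (λ b<a → <⇒≱ (*-mono-< b<a b<a) p)

cube-cancel-< : ∀ a b → a * a * a < b * b * b → a < b
cube-cancel-< a b p = ≰⇒> (λ b≤a → <⇒≱ p (*-mono-≤ (*-mono-≤ b≤a b≤a) b≤a))

hit-any : ∀ {n} (p : Fin n → Bool) S → hit p S ≡ true → ∃ λ s → p s ≡ true × (∀ p′ → p′ s ≡ true → hit p′ S ≡ true)
hit-any p (x ∷ S) e with ∨-true {p x} e
... | inj₁ px = x , px , λ p′ e′ → cong (_∨ hit p′ S) e′
... | inj₂ e′ with hit-any p S e′
...   | s , ps , k = s , ps , λ p′ e″ → or-right (p′ x) (k p′ e″)
  where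
  or-right : ∀ a {b} → b ≡ true → a ∨ b ≡ true
  or-right true  _ = refl
  or-right false e = e

module Splitting {n r : ℕ} (c : Coloring n r) (pcc : IsPCC c) (n≥2 : 2 ≤ n) (u₀ : Fin n) (d : Fin r)
                 (dominant : 2 * n < 3 * # (λ w → c u₀ w == d))
                 (h : ℕ) (h≥ : 120000 ≤ h) (L : ℕ) (L≥1 : 1 ≤ L) (n<2^ : n < 2 ^ suc L) (q : ℕ) (q≥1 : 1 ≤ q) (6q≤h : 6 * q ≤ h) where
  open Coherent c pcc
  open Dominant c pcc n≥2 u₀ d dominant
  open Windows c pcc n≥2 u₀ d dominant

  module _ (sparse : h * (ρ * ρ * ρ) ≤ N * N) (ρ≥1 : 1 ≤ ρ) (good : ∀ {y u} → nb y u ≡ true → ρ * ρ ≤ q * NM y u) where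
    open Sparse c pcc n≥2 u₀ d dominant
    open Params h h≥ sparse ρ≥1

    -- Each of the three terms of `bad≤` is at most ρ²/h: by μN ≤ ρ² each becomes at most ρ⁵ when
    -- multiplied by N², and N² ≥ hρ³.
    h*bad≤ : ∀ {y v} → far y v ≡ true → h * bad y v ≤ 3 * (ρ * ρ)
    h*bad≤ {y} {v} f = *-cancelʳ-≤ (h * bad y v) (3 * (ρ * ρ)) (ρ * ρ * ρ) ⦃ >-nonZero (*-mono-< (*-mono-< ρ≥1 ρ≥1) ρ≥1) ⦄
      (lin (h ∷ bad y v ∷ ρ ∷ N ∷ U f ∷ μ ∷ []) 0 (x₀ ⊗ x₁ ⊗ (x₂ ⊗ x₂ ⊗ x₂) ≼ κ 3 ⊗ (x₂ ⊗ x₂) ⊗ (x₂ ⊗ x₂ ⊗ x₂)) ((x₁ , x₀ ⊗ (x₂ ⊗ x₂ ⊗ x₂) ≼ x₃ ⊗ x₃) ∷ (x₃ ⊗ x₃ , x₁ ≼ x₄ ⊕ x₅ ⊗ (x₂ ⊗ x₅) ⊕ x₂ ⊗ (x₅ ⊗ x₅)) ∷ (x₃ , x₃ ⊗ x₄ ≼ x₂ ⊗ (x₂ ⊗ x₅) ⊗ x₂) ∷ (κ 3 ⊗ (x₂ ⊗ x₂ ⊗ x₂) ⊕ κ 2 ⊗ (x₂ ⊗ x₅ ⊗ x₃) , x₅ ⊗ x₃ ≼ x₂ ⊗ x₂) ∷ []) refl (sparse , bad≤ f , NU≤ f , μN≤ρρ , tt))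

    module Pair (u v : Fin n) where

      Y : Fin n → Bool
      Y y = nb u y ∧ far y v

      blocked : Fin n → Fin n → ℕ
      blocked s s′ = sum (λ z → χ (nb v z) * (χ (near s z) * χ (near s′ z)))

      γ : Fin n → Fin n → Fin n → Bool
      γ y s s′ = (nb y s ∧ far s u) ∧ ((nb y s′ ∧ far s′ u) ∧ (far s s′ ∧ not (pos (blocked s s′))))

      G : Fin n → ℕ
      G y = sum (λ s → sum (λ s′ → χ (γ y s s′)))

      -- A pair counted by `NM` that fails `γ` is blocked by some z in N(v), and with this z it is
      -- counted by `bad`.
      NM≤G+bad : ∀ y → NM y u ≤ G y + bad y v
      NM≤G+bad y = begin
        NM y u                                                ≡⟨ sum-cong-≗ (λ s → sym (sum-*ˡ (χ (nb y s) * χ (far s u)) (λ s′ → χ (nb y s′) * χ (far s′ u) * χ (far s s′)))) ⟩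
        sum (λ s → sum (λ s′ → T s s′))                       ≤⟨ sum-mono (λ s → sum-mono (λ s′ → pointwise s s′ (nb y s) (far s u) (nb y s′) (far s′ u) (far s s′) refl refl refl)) ⟩
        sum (λ s → sum (λ s′ → χ (γ y s s′) + Z s s′))        ≡⟨ sum-cong-≗ (λ s → sum-+ (λ s′ → χ (γ y s s′)) (Z s)) ⟩
        sum (λ s → sum (λ s′ → χ (γ y s s′)) + sum (Z s))     ≡⟨ sum-+ (λ s → sum (λ s′ → χ (γ y s s′))) (λ s → sum (Z s)) ⟩
        G y + sum (λ s → sum (Z s))                           ≡⟨ cong (G y +_) Z≡bad ⟩
        G y + bad y v                                         ∎
        where
        open ≤-Reasoning
        T Z : Fin n → Fin n → ℕ
        T s s′ = χ (nb y s) * χ (far s u) * (χ (nb y s′) * χ (far s′ u) * χ (far s s′))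
        Z s s′ = sum (λ z → χ (nb v z) * (a y z s * (a y z s′ * χ (far s s′))))
        Z≡bad : sum (λ s → sum (Z s)) ≡ bad y v
        Z≡bad = trans (sum-cong-≗ (λ s → sum-swap (λ s′ z → χ (nb v z) * (a y z s * (a y z s′ * χ (far s s′))))))
          (trans (sum-swap (λ s z → sum (λ s′ → χ (nb v z) * (a y z s * (a y z s′ * χ (far s s′))))))
          (sum-cong-≗ (λ z → trans (sum-cong-≗ (λ s → trans (sum-*ˡ (χ (nb v z)) (λ s′ → a y z s * (a y z s′ * χ (far s s′))))
              (cong (χ (nb v z) *_) (sum-*ˡ (a y z s) (λ s′ → a y z s′ * χ (far s s′))))))
            (sum-*ˡ (χ (nb v z)) (λ s → a y z s * sum (λ s′ → a y z s′ * χ (far s s′)))))))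
        pointwise : ∀ s s′ b₁ b₂ b₃ b₄ b₅ → nb y s ≡ b₁ → nb y s′ ≡ b₃ → far s s′ ≡ b₅ →
          χ b₁ * χ b₂ * (χ b₃ * χ b₄ * χ b₅) ≤ χ ((b₁ ∧ b₂) ∧ ((b₃ ∧ b₄) ∧ (b₅ ∧ not (pos (blocked s s′))))) + Z s s′
        pointwise s s′ false _ _ _ _ _ _ _ = z≤n
        pointwise s s′ true false _ _ _ _ _ _ = z≤n
        pointwise s s′ true true false _ _ _ _ _ = z≤n
        pointwise s s′ true true true false _ _ _ _ = z≤n
        pointwise s s′ true true true true false _ _ _ = z≤n
        pointwise s s′ true true true true true e₁ e₃ e₅ = go (blocked s s′) refl
          where
          go : ∀ k → blocked s s′ ≡ k → 1 ≤ χ (not (pos k)) + Z s s′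
          go zero    _ = s≤s z≤n
          go (suc k) p with sum>0⇒∃ (λ z → χ (nb v z) * (χ (near s z) * χ (near s′ z))) (subst (0 <_) (sym p) z<s)
          ... | z , z>0 = ≤-trans z>0 (≤-trans (≤-reflexive (cong (χ (nb v z) *_) (cong₂ _*_ (sym (trans (cong (λ t → χ t * χ (near s z)) e₁) (+-identityʳ _)))
                  (sym (trans (cong₂ (λ t t′ → χ t * χ (near s′ z) * χ t′) e₃ e₅) (trans (*-identityʳ _) (+-identityʳ _)))))))
               (term≤sum (λ z → χ (nb v z) * (a y z s * (a y z s′ * χ (far s s′)))) z))

      Y⇒ : ∀ {y} → Y y ≡ true → nb u y ≡ true × far y v ≡ true
      Y⇒ e = ∧-true e

      -- The origin of `6 * q ≤ h`: the loss 3ρ²/h is at most half of the guaranteed ρ²/q.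
      ρρ≤2qG : ∀ {y} → Y y ≡ true → ρ * ρ ≤ 2 * q * G y
      ρρ≤2qG {y} e = lin (ρ * ρ ∷ q ∷ G y ∷ NM y u ∷ bad y v ∷ h ∷ []) 2 (x₀ ≼ κ 2 ⊗ x₁ ⊗ x₂) ((κ 6 , x₀ ≼ x₁ ⊗ x₃) ∷ (κ 6 ⊗ x₁ , x₃ ≼ x₂ ⊕ x₄) ∷ (κ 1 , x₅ ⊗ x₄ ≼ κ 3 ⊗ x₀) ∷ (x₄ , κ 6 ⊗ x₁ ≼ x₅) ∷ []) refl (good (trans (nb-sym y u) (proj₁ (Y⇒ e))) , NM≤G+bad y , h*bad≤ (proj₂ (Y⇒ e)) , 6q≤h , tt)

      -- At least about a third of N(u) lies outside N(v), by `3λ≤2ρ+μ` or because u and v are far.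
      -- These vertices are far from v, except possibly v itself, hence the 1 in `diff≤`.
      ρ≤4#Y : u ≢ v → ρ ≤ 4 * # Y
      ρ≤4#Y u≢v = lin (ρ ∷ # Y ∷ N-diff u v ∷ μ ∷ h ∷ []) 119995 (x₀ ≼ κ 4 ⊗ x₁) ((κ 360000 , x₂ ≼ x₁ ⊕ κ 1) ∷ (κ 120000 , x₀ ≼ κ 3 ⊗ x₂ ⊕ x₃) ∷ (κ 1 , x₄ ⊗ x₃ ≼ x₀) ∷ (κ 3 ⊕ x₃ , κ 120000 ≼ x₄) ∷ (κ 3 , x₄ ≼ x₀) ∷ []) refl (diff≤ , large (far u v) refl , hμ≤ρ , h≥ , h≤ρ , tt)
        where
        large : ∀ b → far u v ≡ b → ρ ≤ 3 * N-diff u v + μ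
        large true  f = lin (ρ ∷ N-diff u v ∷ μ ∷ []) 0 (x₀ ≼ κ 3 ⊗ x₁ ⊕ x₂) ((κ 1 , x₀ ≼ x₁ ⊕ x₂) ∷ []) refl (≤-reflexive (sym (N-diff-far f)) , tt)
        large false f = lin (ρ ∷ N-diff u v ∷ μ ∷ cn u v ∷ []) 0 (x₀ ≼ κ 3 ⊗ x₁ ⊕ x₂) ((κ 3 , x₀ ≼ x₁ ⊕ x₃) ∷ (κ 1 , κ 3 ⊗ x₃ ≼ κ 2 ⊗ x₀ ⊕ x₂) ∷ []) refl (≤-reflexive (sym (N-diff-cn u v)) , 3λ≤2ρ+μ (≢∧¬far⇒nb u≢v f) , tt)
        diff≤ : N-diff u v ≤ # Y + 1
        diff≤ = ≤-trans (sum-mono (λ w → go w (nb u w) (nb v w) (far w v) (v == w) refl refl refl refl)) (≤-reflexive (trans (sum-+ (χ ∘ Y) (λ w → χ (v == w))) (cong (# Y +_)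
             (trans (sum-cong-≗ (λ x → sym (*-identityʳ (χ (v == x))))) (sum-δ (λ _ → 1) v)))))
          where
          go : ∀ w x y f e → nb u w ≡ x → nb v w ≡ y → far w v ≡ f → (v == w) ≡ e → χ (x ∧ not y) ≤ χ (x ∧ f) + χ e
          go w false y     f     e     _ _ _ _ = z≤n
          go w true  true  f     e     _ _ _ _ = z≤n
          go w true  false true  e     _ _ _ _ = s≤s z≤n
          go w true  false false true  _ _ _ _ = s≤s z≤n
          go w true  false false false p q f e = ⊥-elim (true≢false (≢∧¬far⇒nb (==⇒≢ e) (trans (far-sym v w) f)) q)

      -- Vertices y of N(u) are recognised in the second round by their colours to s and s′,
      -- which no vertex of N(v) shares.
      reach : Fin n → Fin n → ℕ
      reach s s′ = sum (λ y → χ (Y y ∧ γ y s s′))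

      -- The s′ that complete some s in S to a pair recognising a vertex of Y. The final set must
      -- contain such a pair, so S is enlarged until partners are frequent enough to be hit
      -- themselves.
      partners : List (Fin n) → Fin n → Bool
      partners S s′ = hit (λ s → pos (reach s s′)) S

      module _ (T : Fin n → Bool) where
        g t : Fin n → Fin n → ℕ
        g y s = sum (λ s′ → χ (not (T s′) ∧ γ y s s′))
        t y s = sum (λ s′ → χ (T s′ ∧ γ y s s′))

        -- Adding a heavy s to the chosen vertices creates at least ρ/32q new partners at once.
        heavy : Fin n → Fin n → Bool
        heavy y s = (Y y ∧ (nb y s ∧ far s u)) ∧ (ρ ≤ᵇ 32 * q * g y s)

        Q : Fin n → Bool
        Q s = pos (sum (λ y → χ (heavy y s)))

        H P : ℕ
        H = sum (λ y → sum (λ s → χ (heavy y s)))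
        P = sum (λ y → χ (Y y) * sum (g y))

        G-split : ∀ y → G y ≡ sum (g y) + sum (t y)
        G-split y = trans (sum-cong-≗ (λ s → trans (sum-cong-≗ (λ s′ → go (T s′) (γ y s s′))) (sum-+ (λ s′ → χ (not (T s′) ∧ γ y s s′)) (λ s′ → χ (T s′ ∧ γ y s s′)))))
                          (sum-+ (g y) (t y))
          where
          go : ∀ a b → χ b ≡ χ (not a ∧ b) + χ (a ∧ b)
          go true  b = refl
          go false b = sym (+-identityʳ _)

        -- When s′ is already a partner, being far from u it leaves μ choices for y, and then at
        -- most ρ for s.
        inside≤ : sum (λ y → χ (Y y) * sum (t y)) ≤ # T * (μ * ρ)
        inside≤ = begin
          sum (λ y → χ (Y y) * sum (t y)) ≡⟨ sum-cong-≗ (λ y → trans (cong (χ (Y y) *_) (sum-swap (λ s s′ → χ (T s′ ∧ γ y s s′)))) (sym (sum-*ˡ (χ (Y y)) (λ s′ → sum (λ s → χ (T s′ ∧ γ y s s′)))))) ⟩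
          sum (λ y → sum (λ s′ → χ (Y y) * sum (λ s → χ (T s′ ∧ γ y s s′)))) ≤⟨ sum-mono (λ y → sum-mono (λ s′ → per y s′)) ⟩
          sum (λ y → sum (λ s′ → χ (T s′) * χ (far s′ u) * (χ (nb u y) * χ (nb y s′)) * ρ)) ≡⟨ sum-swap (λ y s′ → χ (T s′) * χ (far s′ u) * (χ (nb u y) * χ (nb y s′)) * ρ) ⟩
          sum (λ s′ → sum (λ y → χ (T s′) * χ (far s′ u) * (χ (nb u y) * χ (nb y s′)) * ρ)) ≡⟨ sum-cong-≗ (λ s′ → trans (sum-*ʳ ρ (λ y → χ (T s′) * χ (far s′ u) * (χ (nb u y) * χ (nb y s′)))) (cong (_* ρ) (sum-*ˡ (χ (T s′) * χ (far s′ u)) (λ y → χ (nb u y) * χ (nb y s′))))) ⟩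
          sum (λ s′ → χ (T s′) * χ (far s′ u) * cn u s′ * ρ) ≤⟨ sum-mono (λ s′ → fixed s′ (far s′ u) refl) ⟩
          sum (λ s′ → χ (T s′) * (μ * ρ)) ≡⟨ sum-*ʳ (μ * ρ) (χ ∘ T) ⟩
          # T * (μ * ρ) ∎
          where
          open ≤-Reasoning
          fixed : ∀ s′ b → far s′ u ≡ b → χ (T s′) * χ b * cn u s′ * ρ ≤ χ (T s′) * (μ * ρ)
          fixed s′ true  f = ≤-reflexive (trans (cong (λ k → χ (T s′) * 1 * k * ρ) (cn-far (trans (far-sym u s′) f))) (identity (χ (T s′) ∷ μ ∷ ρ ∷ []) (x₀ ⊗ κ 1 ⊗ x₁ ⊗ x₂) (x₀ ⊗ (x₁ ⊗ x₂)) refl))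
          fixed s′ false f = lin (χ (T s′) ∷ μ ∷ ρ ∷ cn u s′ ∷ []) 0 (x₀ ⊗ κ 0 ⊗ x₃ ⊗ x₂ ≼ x₀ ⊗ (x₁ ⊗ x₂)) [] refl tt
          per : ∀ y s′ → χ (Y y) * sum (λ s → χ (T s′ ∧ γ y s s′)) ≤ χ (T s′) * χ (far s′ u) * (χ (nb u y) * χ (nb y s′)) * ρ
          per y s′ = begin
            χ (Y y) * sum (λ s → χ (T s′ ∧ γ y s s′))                     ≡⟨ sum-*ˡ (χ (Y y)) (λ s → χ (T s′ ∧ γ y s s′)) ⟨
            sum (λ s → χ (Y y) * χ (T s′ ∧ γ y s s′))                     ≤⟨ sum-mono (λ s → go (nb u y) (far y v) (T s′) (nb y s) (far s u) (nb y s′) (far s′ u) _) ⟩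
            sum (λ s → χ (T s′) * χ (far s′ u) * (χ (nb u y) * χ (nb y s′)) * χ (nb y s)) ≡⟨ sum-*ˡ (χ (T s′) * χ (far s′ u) * (χ (nb u y) * χ (nb y s′))) (χ ∘ nb y) ⟩
            χ (T s′) * χ (far s′ u) * (χ (nb u y) * χ (nb y s′)) * # (nb y) ≡⟨ cong (χ (T s′) * χ (far s′ u) * (χ (nb u y) * χ (nb y s′)) *_) (#nb y) ⟩
            χ (T s′) * χ (far s′ u) * (χ (nb u y) * χ (nb y s′)) * ρ ∎
            where
            go : ∀ p₁ p₂ x b₁ b₂ b₃ b₄ e → χ (p₁ ∧ p₂) * χ (x ∧ ((b₁ ∧ b₂) ∧ ((b₃ ∧ b₄) ∧ e))) ≤ χ x * χ b₄ * (χ p₁ * χ b₃) * χ b₁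
            go false p₂ x b₁ b₂ b₃ b₄ e = z≤n
            go true false x b₁ b₂ b₃ b₄ e = z≤n
            go true true false b₁ b₂ b₃ b₄ e = z≤n
            go true true true false b₂ b₃ b₄ e = z≤n
            go true true true true false b₃ b₄ e = z≤n
            go true true true true true false b₄ e = z≤n
            go true true true true true true false e = z≤n
            go true true true true true true true e = ≤-trans (≤-reflexive (+-identityʳ _)) (χ≤1 e)

        ρ³≤ : u ≢ v → ρ * (ρ * ρ) ≤ 8 * q * (P + # T * (μ * ρ))
        ρ³≤ u≢v = lin (ρ ∷ ρ * ρ ∷ # Y ∷ sum (λ y → χ (Y y) * (2 * q * G y)) ∷ q ∷ P ∷ sum (λ y → χ (Y y) * sum (t y)) ∷ # T * (μ * ρ) ∷ []) 0 (x₀ ⊗ x₁ ≼ κ 8 ⊗ x₄ ⊗ (x₅ ⊕ x₇)) ((x₁ , x₀ ≼ κ 4 ⊗ x₂) ∷ (κ 4 , x₂ ⊗ x₁ ≼ x₃) ∷ (κ 4 , x₃ ≼ κ 2 ⊗ x₄ ⊗ (x₅ ⊕ x₆)) ∷ (κ 8 ⊗ x₄ , x₆ ≼ x₇) ∷ []) refl (ρ≤4#Y u≢v , per , ≤-reflexive S≡ , inside≤ , tt)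
          where
          per : # Y * (ρ * ρ) ≤ sum (λ y → χ (Y y) * (2 * q * G y))
          per = ≤-trans (≤-reflexive (sym (sum-*ʳ (ρ * ρ) (χ ∘ Y)))) (pointwise-max Y (λ _ → ρ * ρ) (λ y → 2 * q * G y) (λ y → ρρ≤2qG))
          S≡ : sum (λ y → χ (Y y) * (2 * q * G y)) ≡ 2 * q * (P + sum (λ y → χ (Y y) * sum (t y)))
          S≡ = trans (sum-cong-≗ (λ y → trans (cong (λ k → χ (Y y) * (2 * q * k)) (G-split y))
                 (identity (χ (Y y) ∷ q ∷ sum (g y) ∷ sum (t y) ∷ []) (x₀ ⊗ (κ 2 ⊗ x₁ ⊗ (x₂ ⊕ x₃))) (κ 2 ⊗ x₁ ⊗ (x₀ ⊗ x₂ ⊕ x₀ ⊗ x₃)) refl)))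
               (trans (sum-*ˡ (2 * q) (λ y → χ (Y y) * sum (g y) + χ (Y y) * sum (t y))) (cong (2 * q *_) (sum-+ (λ y → χ (Y y) * sum (g y)) (λ y → χ (Y y) * sum (t y)))))

        -- A heavy s contributes at most ρ, any other at most ρ/32q, and there are at most ρ² pairs
        -- of y and s.
        32qP≤ : 32 * q * P ≤ 32 * q * ρ * H + ρ * (ρ * ρ)
        32qP≤ = begin
          32 * q * P ≡⟨ sum-*ˡ (32 * q) (λ y → χ (Y y) * sum (g y)) ⟨
          sum (λ y → 32 * q * (χ (Y y) * sum (g y))) ≡⟨ sum-cong-≗ (λ y → trans (cong (32 * q *_) (sym (sum-*ˡ (χ (Y y)) (g y)))) (sym (sum-*ˡ (32 * q) (λ s → χ (Y y) * g y s)))) ⟩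
          sum (λ y → sum (λ s → 32 * q * (χ (Y y) * g y s))) ≤⟨ sum-mono (λ y → sum-mono (λ s → per y s (Y y) (nb y s) (far s u) (ρ ≤ᵇ 32 * q * g y s) refl refl refl refl)) ⟩
          sum (λ y → sum (λ s → 32 * q * ρ * χ (heavy y s) + χ (Y y) * χ (nb y s) * ρ)) ≡⟨ sum-cong-≗ (λ y → trans (sum-+ (λ s → 32 * q * ρ * χ (heavy y s)) (λ s → χ (Y y) * χ (nb y s) * ρ))
              (cong₂ _+_ (sum-*ˡ (32 * q * ρ) (λ s → χ (heavy y s))) (trans (sum-*ʳ ρ (λ s → χ (Y y) * χ (nb y s))) (cong (_* ρ) (trans (sum-*ˡ (χ (Y y)) (χ ∘ nb y)) (cong (χ (Y y) *_) (#nb y))))))) ⟩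
          sum (λ y → 32 * q * ρ * sum (λ s → χ (heavy y s)) + χ (Y y) * ρ * ρ) ≡⟨ trans (sum-+ (λ y → 32 * q * ρ * sum (λ s → χ (heavy y s))) (λ y → χ (Y y) * ρ * ρ))
              (cong₂ _+_ (sum-*ˡ (32 * q * ρ) (λ y → sum (λ s → χ (heavy y s)))) (trans (sum-*ʳ ρ (λ y → χ (Y y) * ρ)) (cong (_* ρ) (sum-*ʳ ρ (χ ∘ Y))))) ⟩
          32 * q * ρ * H + # Y * ρ * ρ ≤⟨ +-monoʳ-≤ (32 * q * ρ * H) (≤-trans (*-monoˡ-≤ ρ (*-monoˡ-≤ ρ #Y≤ρ)) (≤-reflexive (*-assoc ρ ρ ρ))) ⟩
          32 * q * ρ * H + ρ * (ρ * ρ) ∎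
          where
          open ≤-Reasoning
          #Y≤ρ : # Y ≤ ρ
          #Y≤ρ = ≤-trans (#-mono {p = Y} {nb u} (λ y e → proj₁ (∧-true e))) (≤-reflexive (#nb u))
          g≤ρ : ∀ y s → g y s ≤ ρ
          g≤ρ y s = ≤-trans (sum-mono (λ s′ → go (T s′) (nb y s) (far s u) (nb y s′) (far s′ u) _)) (≤-reflexive (#nb y))
            where
            go : ∀ x b₁ b₂ b₃ b₄ e → χ (not x ∧ ((b₁ ∧ b₂) ∧ ((b₃ ∧ b₄) ∧ e))) ≤ χ b₃
            go true  b₁ b₂ b₃ b₄ e = z≤n
            go false false b₂ b₃ b₄ e = z≤n
            go false true false b₃ b₄ e = z≤n
            go false true true false b₄ e = z≤n
            go false true true true b₄ e = χ≤1 (b₄ ∧ e)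
          empty : ∀ y s → nb y s ∧ far s u ≡ false → g y s ≡ 0
          empty y s e = sum-0 {n} (λ s′ → trans (cong (λ b → χ (not (T s′) ∧ (b ∧ ((nb y s′ ∧ far s′ u) ∧ (far s s′ ∧ not (pos (blocked s s′))))))) e) (go (not (T s′))))
            where
            go : ∀ b → χ (b ∧ false) ≡ 0
            go true  = refl
            go false = refl
          per : ∀ y s x b f k → Y y ≡ x → nb y s ≡ b → far s u ≡ f → (ρ ≤ᵇ 32 * q * g y s) ≡ k →
                32 * q * (χ x * g y s) ≤ 32 * q * ρ * χ ((x ∧ (b ∧ f)) ∧ k) + χ x * χ b * ρ
          per y s false b f k _ _ _ _ = ≤-trans (≤-reflexive (*-zeroʳ (32 * q))) z≤n
          per y s true false f k _ p _ _ = ≤-trans (≤-reflexive (trans (cong (λ j → 32 * q * (1 * j)) (empty y s (cong (_∧ far s u) p))) (*-zeroʳ (32 * q)))) z≤n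
          per y s true true false k _ p p′ _ = ≤-trans (≤-reflexive (trans (cong (λ j → 32 * q * (1 * j)) (empty y s (cong₂ _∧_ p p′))) (*-zeroʳ (32 * q)))) z≤n
          per y s true true true true _ _ _ _ = lin (q ∷ g y s ∷ ρ ∷ []) 0 (κ 32 ⊗ x₀ ⊗ (κ 1 ⊗ x₁) ≼ κ 32 ⊗ x₀ ⊗ x₂ ⊗ κ 1 ⊕ κ 1 ⊗ κ 1 ⊗ x₂) ((κ 32 ⊗ x₀ , x₁ ≼ x₂) ∷ []) refl (g≤ρ y s , tt)
          per y s true true true false _ _ _ e = lin (q ∷ g y s ∷ ρ ∷ []) 0 (κ 32 ⊗ x₀ ⊗ (κ 1 ⊗ x₁) ≼ κ 32 ⊗ x₀ ⊗ x₂ ⊗ κ 0 ⊕ κ 1 ⊗ κ 1 ⊗ x₂) ((κ 1 , κ 32 ⊗ x₀ ⊗ x₁ ≼ x₂) ∷ []) refl (<⇒≤ (≰⇒> (λ le → subst (λ b → T′ b) e (≤⇒≤ᵇ le))) , tt)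
            where
            T′ : Bool → Set
            T′ = Data.Bool.T

        -- A heavy s is far from u and each of its y is a common neighbour of u and s.
        H≤ : H ≤ # Q * μ
        H≤ = ≤-trans (≤-reflexive (sum-swap (λ y s → χ (heavy y s)))) (≤-trans (sum-mono (λ s → per s (sum (λ y → χ (heavy y s))) refl)) (≤-reflexive (sum-*ʳ μ (χ ∘ Q))))
          where
          per : ∀ s k → sum (λ y → χ (heavy y s)) ≡ k → k ≤ χ (pos k) * μ
          per s zero    _ = z≤n
          per s (suc k) e with #>0⇒∃ (λ y → heavy y s) (subst (0 <_) (sym e) z<s)
          ... | y , hv = ≤-trans (≤-reflexive (sym e)) (≤-trans (sum-mono (λ y → go (nb u y) (far y v) (nb y s) _)) (≤-reflexive (trans (cn-far far-us) (sym (*-identityˡ μ)))))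
            where
            far-us : far u s ≡ true
            far-us = trans (far-sym u s) (proj₂ (∧-true {nb y s} (proj₂ (∧-true {Y y} (proj₁ (∧-true hv))))))
            go : ∀ p₁ p₂ b e {k} → χ (((p₁ ∧ p₂) ∧ (b ∧ e)) ∧ k) ≤ χ p₁ * χ b
            go false p₂ b e = z≤n
            go true false b e = z≤n
            go true true false e = z≤n
            go true true true e = χ≤1 _

        -- At least ρ³/8q triples y, s, s′ recognise. While there are at most N/16q partners, at
        -- most half of these triples end in a partner, and at most ρ³/32q of the others have an s
        -- that is not heavy. What remains spreads over the heavy s, each with at most μ vertices y.
        many-heavy : u ≢ v → 16 * q * # T ≤ N → n ≤ 64 * q * # Q
        many-heavy u≢v unsat = lin (n ∷ N ∷ q ∷ # Q ∷ []) 1 (x₀ ≼ κ 64 ⊗ x₂ ⊗ x₃) ((κ 3 , x₁ ≼ κ 32 ⊗ x₂ ⊗ x₃) ∷ (κ 1 , κ 1 ⊕ κ 2 ⊗ x₀ ≼ κ 3 ⊗ x₁) ∷ []) refl (N≤ , dominant , tt)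
          where
          ρρ≤ : ρ * ρ ≤ 32 * q * H
          ρρ≤ = *-cancelˡ-≤ ρ ⦃ >-nonZero ρ≥1 ⦄ (lin (ρ ∷ q ∷ H ∷ P ∷ # T ∷ μ ∷ N ∷ []) 0 (x₀ ⊗ (x₀ ⊗ x₀) ≼ x₀ ⊗ (κ 32 ⊗ x₁ ⊗ x₂)) ((κ 4 , x₀ ⊗ (x₀ ⊗ x₀) ≼ κ 8 ⊗ x₁ ⊗ (x₃ ⊕ x₄ ⊗ (x₅ ⊗ x₀))) ∷ (κ 1 , κ 32 ⊗ x₁ ⊗ x₃ ≼ κ 32 ⊗ x₁ ⊗ x₀ ⊗ x₂ ⊕ x₀ ⊗ (x₀ ⊗ x₀)) ∷ (κ 2 ⊗ (x₅ ⊗ x₀) , κ 16 ⊗ x₁ ⊗ x₄ ≼ x₆) ∷ (κ 2 ⊗ x₀ , x₅ ⊗ x₆ ≼ x₀ ⊗ x₀) ∷ []) refl (ρ³≤ u≢v , 32qP≤ , unsat , μN≤ρρ , tt))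
          N≤ : N ≤ 32 * q * # Q
          N≤ = *-cancelˡ-≤ μ ⦃ >-nonZero μ≥1 ⦄ (lin (ρ ∷ q ∷ H ∷ # Q ∷ μ ∷ N ∷ []) 0 (x₄ ⊗ x₅ ≼ x₄ ⊗ (κ 32 ⊗ x₁ ⊗ x₃)) ((κ 1 , x₄ ⊗ x₅ ≼ x₀ ⊗ x₀) ∷ (κ 1 , x₀ ⊗ x₀ ≼ κ 32 ⊗ x₁ ⊗ x₂) ∷ (κ 32 ⊗ x₁ , x₂ ≼ x₃ ⊗ x₄) ∷ []) refl (μN≤ρρ , ρρ≤ , H≤ , tt))

    open Pair

    unsaturated : List (Fin n) → Fin n → Fin n → Bool
    unsaturated S u v = 16 * q * # (partners u v S) ≤ᵇ N

    useful : List (Fin n) → Fin n → Fin n → Fin n → Bool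
    useful S u v s = not (unsaturated S u v) ∨ Q u v (partners u v S) s

    -- One hitting set serves all pairs u, v together, and each unsaturated pair gains ρ/32q
    -- partners. For a saturated pair every vertex counts as useful, which keeps all the sets to be
    -- hit large.
    round : ∀ S → ∃ λ R → length R ≤ 64 * q * (4 * L) ×
            (∀ u v → u ≢ v → 16 * q * # (partners u v S) ≤ N → ρ + 32 * q * # (partners u v S) ≤ 32 * q * # (partners u v (R ++ S)))
    round S = pack (pair-hitting-set n≥2 L L≥1 n<2^ (useful S) (64 * q) large)
      where
      large : ∀ u v → u ≢ v → n ≤ 64 * q * # (useful S u v)
      large u v u≢v = go (unsaturated S u v) refl
        where
        go : ∀ b → unsaturated S u v ≡ b → n ≤ 64 * q * # (λ s → not b ∨ Q u v (partners u v S) s)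
        go true  e = many-heavy u v (partners u v S) u≢v (≤ᵇ⇒≤ _ _ (subst Data.Bool.T (sym e) tt))
        go false _ = ≤-trans (≤-reflexive (sym (trans (sum-const n 1) (*-identityʳ n)))) (m≤n*m _ (64 * q) ⦃ >-nonZero (*-mono-< {0} {64} z<s q≥1) ⦄)
      pack : (∃ λ R → length R ≤ 64 * q * (4 * L) × (∀ u v → u ≢ v → hit (useful S u v) R ≡ true)) →
             ∃ λ R → length R ≤ 64 * q * (4 * L) ×
             (∀ u v → u ≢ v → 16 * q * # (partners u v S) ≤ N → ρ + 32 * q * # (partners u v S) ≤ 32 * q * # (partners u v (R ++ S)))
      pack (R , len , hits) = R , len , progress
       where
        progress : ∀ u v → u ≢ v → 16 * q * # (partners u v S) ≤ N → ρ + 32 * q * # (partners u v S) ≤ 32 * q * # (partners u v (R ++ S))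
        progress u v u≢v unsat = from (hit-any (useful S u v) R (hits u v u≢v))
          where
          T T⁺ : Fin n → Bool
          T  = partners u v S
          T⁺ = partners u v (R ++ S)
          Goal = ρ + 32 * q * # T ≤ 32 * q * # T⁺
          from : (∃ λ s → useful S u v s ≡ true × (∀ p′ → p′ s ≡ true → hit p′ R ≡ true)) → Goal
          from (s , us , member) = at (#>0⇒∃ (λ y → heavy u v T y s) (pos⇒ (drop (unsaturated S u v) (≤ᵇ-true unsat) us)))
            where
            ≤ᵇ-true : ∀ {a b} → a ≤ b → (a ≤ᵇ b) ≡ true
            ≤ᵇ-true {a} {b} p with a ≤ᵇ b | ≤⇒≤ᵇ p
            ... | true | _ = refl
            drop : ∀ b {x} → b ≡ true → not b ∨ x ≡ true → x ≡ true
            drop true _ e = e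
            at : (∃ λ y → heavy u v T y s ≡ true) → Goal
            at (y , hv) = lin (ρ ∷ q ∷ # T ∷ # T⁺ ∷ g u v T y s ∷ []) 0 (x₀ ⊕ κ 32 ⊗ x₁ ⊗ x₂ ≼ κ 32 ⊗ x₁ ⊗ x₃) ((κ 1 , x₀ ≼ κ 32 ⊗ x₁ ⊗ x₄) ∷ (κ 32 ⊗ x₁ , x₂ ⊕ x₄ ≼ x₃) ∷ []) refl (≤ᵇ⇒≤ _ _ (subst Data.Bool.T (sym heavy′) tt) , grow , tt)
              where
              Yy : Y u v y ≡ true
              Yy = proj₁ (∧-true (proj₁ (∧-true hv)))
              heavy′ : (ρ ≤ᵇ 32 * q * g u v T y s) ≡ true
              heavy′ = proj₂ (∧-true {Y u v y ∧ (nb y s ∧ far s u)} hv)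
              grow : # T + g u v T y s ≤ # T⁺
              grow = ≤-trans (≤-reflexive (sym (sum-+ (χ ∘ T) (λ s′ → χ (not (T s′) ∧ γ u v y s s′))))) (sum-mono (λ s′ → go s′ (T s′) (γ u v y s s′) refl refl))
                where
                go : ∀ s′ b e → T s′ ≡ b → γ u v y s s′ ≡ e → χ b + χ (not b ∧ e) ≤ χ (T⁺ s′)
                go s′ true  e     p _ = true⇒χ (hit-++ʳ (λ s → pos (reach u v s s′)) R S p)
                go s′ false false _ _ = z≤n
                go s′ false true  _ p = true⇒χ (hit-++ˡ (λ s → pos (reach u v s s′)) R S
                  (member (λ s → pos (reach u v s s′)) (⇒pos (∃⇒#>0 (λ y → Y u v y ∧ γ u v y s s′) y (∧-intro Yy p)))))

    partners-mono : ∀ u v R S → # (partners u v S) ≤ # (partners u v (R ++ S))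
    partners-mono u v R S = #-mono (λ s′ → hit-++ʳ (λ s → pos (reach u v s s′)) R S)

    rounds : ∀ j → ∃ λ S → length S ≤ j * (64 * q * (4 * L)) ×
             (∀ u v → u ≢ v → j * ρ ≤ 32 * q * # (partners u v S) ⊎ N < 16 * q * # (partners u v S))
    rounds zero = [] , z≤n , λ u v _ → inj₁ z≤n
    rounds (suc j) = step (rounds j)
     where
     step : (∃ λ S → length S ≤ j * (64 * q * (4 * L)) × (∀ u v → u ≢ v → j * ρ ≤ 32 * q * # (partners u v S) ⊎ N < 16 * q * # (partners u v S))) →
            ∃ λ S → length S ≤ suc j * (64 * q * (4 * L)) × (∀ u v → u ≢ v → suc j * ρ ≤ 32 * q * # (partners u v S) ⊎ N < 16 * q * # (partners u v S))
     step (S , len , inv) = extend (round S)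
      where
      extend : (∃ λ R → length R ≤ 64 * q * (4 * L) ×
            (∀ u v → u ≢ v → 16 * q * # (partners u v S) ≤ N → ρ + 32 * q * # (partners u v S) ≤ 32 * q * # (partners u v (R ++ S)))) →
            ∃ λ S → length S ≤ suc j * (64 * q * (4 * L)) × (∀ u v → u ≢ v → suc j * ρ ≤ 32 * q * # (partners u v S) ⊎ N < 16 * q * # (partners u v S))
      extend (R , lenR , more) = R ++ S , ≤-trans (≤-reflexive (length-++ R)) (+-mono-≤ lenR len) , λ u v u≢v → next u v u≢v (inv u v u≢v) (16 * q * # (partners u v S) ≤? N)
       where
       next : ∀ u v → u ≢ v → j * ρ ≤ 32 * q * # (partners u v S) ⊎ N < 16 * q * # (partners u v S) → Dec (16 * q * # (partners u v S) ≤ N) →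
              suc j * ρ ≤ 32 * q * # (partners u v (R ++ S)) ⊎ N < 16 * q * # (partners u v (R ++ S))
       next u v u≢v (inj₁ p) (yes unsat) = inj₁ (≤-trans (+-monoʳ-≤ ρ p) (more u v u≢v unsat))
       next u v u≢v (inj₂ p) (yes unsat) = ⊥-elim (<⇒≱ p unsat)
       next u v u≢v _ (no sat) = inj₂ (<-≤-trans (≰⇒> sat) (*-monoʳ-≤ (16 * q) (partners-mono u v R S)))

    good-splits : ∃ λ S → ∣ S ∣ * ∣ S ∣ * ∣ S ∣ ≤ (512 * q) * (512 * q) * (512 * q) * n * (L * L * L * L) × CompletelySplits c S
    good-splits = from (cube-root n)
      where
      from : (∃ λ k → k * k * k ≤ n × n < suc k * suc k * suc k) → ∃ λ S → ∣ S ∣ * ∣ S ∣ * ∣ S ∣ ≤ (512 * q) * (512 * q) * (512 * q) * n * (L * L * L * L) × CompletelySplits c S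
      from (k , k³≤n , n<) = choose (rounds k)
        where
        ρ≤n : ρ ≤ n
        ρ≤n = lin (ρ ∷ N ∷ n ∷ []) 0 (x₀ ≼ x₂) ((κ 1 , κ 1 ⊕ x₁ ⊕ x₀ ≼ x₂) ∷ []) refl (≤-reflexive 1+N+ρ≡n , tt)
        3≤k : 3 ≤ k
        3≤k = ≤-pred (cube-cancel-< 3 (suc k) (lin (k ∷ n ∷ ρ ∷ h ∷ []) 39999 (κ 1 ⊕ κ 3 ⊗ κ 3 ⊗ κ 3 ≼ (κ 1 ⊕ x₀) ⊗ (κ 1 ⊕ x₀) ⊗ (κ 1 ⊕ x₀)) ((κ 9 , κ 1 ⊕ x₁ ≼ (κ 1 ⊕ x₀) ⊗ (κ 1 ⊕ x₀) ⊗ (κ 1 ⊕ x₀)) ∷ (κ 9 , x₂ ≼ x₁) ∷ (κ 9 , x₃ ≼ x₂) ∷ (κ 9 , κ 120000 ≼ x₃) ∷ []) refl (n< , ρ≤n , h≤ρ , h≥ , tt)))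
        -- k² has order n^(2/3) and ρ ≥ √N at least order √n, so there is room. The inequality makes
        -- k gains of ρ/32q amount to n/64qk partners.
        n≤2k²ρ : n ≤ 2 * k * k * ρ
        n≤2k²ρ = square-cancel-≤ n (2 * k * k * ρ) (lin (n ∷ k ∷ ρ ∷ N ∷ []) 5 (x₀ ⊗ x₀ ≼ κ 2 ⊗ x₁ ⊗ x₁ ⊗ x₂ ⊗ (κ 2 ⊗ x₁ ⊗ x₁ ⊗ x₂)) ((κ 2 ⊗ (x₁ ⊗ x₀) , x₀ ≼ κ 3 ⊗ x₁ ⊗ x₁ ⊗ x₁) ∷ (κ 9 ⊗ (x₁ ⊗ x₁ ⊗ x₁ ⊗ x₁) , x₃ ≼ x₂ ⊗ x₂) ∷ (κ 3 ⊗ (x₁ ⊗ x₁ ⊗ x₁ ⊗ x₁) , κ 1 ⊕ κ 2 ⊗ x₀ ≼ κ 3 ⊗ x₃) ∷ (κ 2 ⊗ (x₀ ⊗ x₀) , κ 3 ≼ x₁) ∷ []) refl (n≤3k³ , N≤ρρ , dominant , 3≤k , tt))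
          where
          n≤3k³ : n ≤ 3 * k * k * k
          n≤3k³ = lin (n ∷ k ∷ []) 2 (x₀ ≼ κ 3 ⊗ x₁ ⊗ x₁ ⊗ x₁) ((κ 3 , κ 1 ⊕ x₀ ≼ (κ 1 ⊕ x₁) ⊗ (κ 1 ⊕ x₁) ⊗ (κ 1 ⊕ x₁)) ∷ (κ 4 ⊗ (x₁ ⊗ x₁) ⊕ κ 3 ⊗ x₁ , κ 3 ≼ x₁) ∷ []) refl (n< , 3≤k , tt)
        Goal = ∃ λ S → ∣ S ∣ * ∣ S ∣ * ∣ S ∣ ≤ (512 * q) * (512 * q) * (512 * q) * n * (L * L * L * L) × CompletelySplits c S
        choose : (∃ λ S → length S ≤ k * (64 * q * (4 * L)) ×
             (∀ u v → u ≢ v → k * ρ ≤ 32 * q * # (partners u v S) ⊎ N < 16 * q * # (partners u v S))) → Goal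
        -- The costs balance: k rounds of 256qL vertices, and 256qkL more to hit all the sets of
        -- partners, whose density is at least 1/64qk.
        choose (S₁ , len₁ , inv) = finish (pair-hitting-set n≥2 L L≥1 n<2^ (λ u v → partners u v S₁) (64 * q * k) (λ u v u≢v → large u v (inv u v u≢v)))
          where
          large : ∀ u v → k * ρ ≤ 32 * q * # (partners u v S₁) ⊎ N < 16 * q * # (partners u v S₁) → n ≤ 64 * q * k * # (partners u v S₁)
          large u v (inj₁ p) = lin (n ∷ k ∷ ρ ∷ q ∷ # (partners u v S₁) ∷ []) 0 (x₀ ≼ κ 64 ⊗ x₃ ⊗ x₁ ⊗ x₄) ((κ 1 , x₀ ≼ κ 2 ⊗ x₁ ⊗ x₁ ⊗ x₂) ∷ (κ 2 ⊗ x₁ , x₁ ⊗ x₂ ≼ κ 32 ⊗ x₃ ⊗ x₄) ∷ []) refl (n≤2k²ρ , p , tt)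
          large u v (inj₂ p) = lin (n ∷ k ∷ N ∷ q ∷ # (partners u v S₁) ∷ []) 1 (x₀ ≼ κ 64 ⊗ x₃ ⊗ x₁ ⊗ x₄) ((κ 1 , κ 1 ⊕ κ 2 ⊗ x₀ ≼ κ 3 ⊗ x₂) ∷ (κ 3 , κ 1 ⊕ x₂ ≼ κ 16 ⊗ x₃ ⊗ x₄) ∷ (κ 16 ⊗ (x₃ ⊗ x₄) , κ 3 ≼ x₁) ∷ []) refl (dominant , p , 3≤k , tt)
          finish : (∃ λ S₂ → length S₂ ≤ 64 * q * k * (4 * L) × (∀ u v → u ≢ v → hit (partners u v S₁) S₂ ≡ true)) → Goal
          finish (S₂ , len₂ , hits) = toSubset S , size , splits₂ c (toSubset S) separated
            where
            S : List (Fin n)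
            S = S₂ ++ S₁
            B : ℕ
            B = 512 * q * k * L
            small : ∣ toSubset S ∣ ≤ B
            small = ≤-trans (∣toSubset∣≤ S) (≤-trans (≤-reflexive (length-++ S₂)) (lin (length S₂ ∷ length S₁ ∷ q ∷ k ∷ L ∷ []) 0 (x₀ ⊕ x₁ ≼ κ 512 ⊗ x₂ ⊗ x₃ ⊗ x₄) ((κ 1 , x₀ ≼ κ 64 ⊗ x₂ ⊗ x₃ ⊗ (κ 4 ⊗ x₄)) ∷ (κ 1 , x₁ ≼ x₃ ⊗ (κ 64 ⊗ x₂ ⊗ (κ 4 ⊗ x₄))) ∷ []) refl (len₂ , len₁ , tt)))
            -- `k³≤n` accounts for the factor n, and L ≥ 1 raises L³ to L⁴.
            size : ∣ toSubset S ∣ * ∣ toSubset S ∣ * ∣ toSubset S ∣ ≤ (512 * q) * (512 * q) * (512 * q) * n * (L * L * L * L)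
            size = ≤-trans (*-mono-≤ (*-mono-≤ small small) small)
              (lin (q ∷ k ∷ L ∷ n ∷ []) 0 (κ 512 ⊗ x₀ ⊗ x₁ ⊗ x₂ ⊗ (κ 512 ⊗ x₀ ⊗ x₁ ⊗ x₂) ⊗ (κ 512 ⊗ x₀ ⊗ x₁ ⊗ x₂) ≼ κ 512 ⊗ x₀ ⊗ (κ 512 ⊗ x₀) ⊗ (κ 512 ⊗ x₀) ⊗ x₃ ⊗ (x₂ ⊗ x₂ ⊗ x₂ ⊗ x₂)) ((κ 134217728 ⊗ (x₀ ⊗ x₀ ⊗ x₀ ⊗ x₂ ⊗ x₂ ⊗ x₂) , x₁ ⊗ x₁ ⊗ x₁ ≼ x₃) ∷ (κ 134217728 ⊗ (x₀ ⊗ x₀ ⊗ x₀ ⊗ x₂ ⊗ x₂ ⊗ x₂ ⊗ x₃) , κ 1 ≼ x₂) ∷ []) refl (k³≤n , L≥1 , tt))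
            inS : ∀ s → hit (s ==_) S ≡ true → lookup (toSubset S) s ≡ true
            inS s e with hit⇒∃ (s ==_) S e
            ... | x , p , l = subst (λ z → lookup (toSubset S) z ≡ true) (sym (==⇒≡ p)) l
            separated : ∀ u v → u ≢ v → ∃ λ y → u ≢ y × c v y ≢ c u y × ∃ λ s → lookup (toSubset S) s ≡ true × ∃ λ s′ → lookup (toSubset S) s′ ≡ true ×
                          (∀ w → c v w ≡ c u y → c w s ≡ c y s → c w s′ ≡ c y s′ → ⊥)
            separated u v u≢v = first (hit-any (partners u v S₁) S₂ (hits u v u≢v))
             where
             Sep : Set
             Sep = ∃ λ y → u ≢ y × c v y ≢ c u y × ∃ λ s → lookup (toSubset S) s ≡ true × ∃ λ s′ → lookup (toSubset S) s′ ≡ true ×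
                          (∀ w → c v w ≡ c u y → c w s ≡ c y s → c w s′ ≡ c y s′ → ⊥)
             first : (∃ λ s′ → partners u v S₁ s′ ≡ true × (∀ p → p s′ ≡ true → hit p S₂ ≡ true)) → Sep
             first (s′ , ps′ , mem′) = second (hit-any (λ s → pos (reach u v s s′)) S₁ ps′)
              where
              second : (∃ λ s → pos (reach u v s s′) ≡ true × (∀ p → p s ≡ true → hit p S₁ ≡ true)) → Sep
              second (s , ps , mem) = third (#>0⇒∃ (λ y → Y u v y ∧ γ u v y s s′) (pos⇒ ps))
               where
               third : (∃ λ y → Y u v y ∧ γ u v y s s′ ≡ true) → Sep
               third (y , yγ) = y , nb⇒≢ uy , distinct , s , inS s (hit-++ʳ (s ==_) S₂ S₁ (mem (s ==_) (==-refl s))) , s′ , inS s′ (hit-++ˡ (s′ ==_) S₂ S₁ (mem′ (s′ ==_) (==-refl s′))) , none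
                where
                uy : nb u y ≡ true
                uy = proj₁ (∧-true (proj₁ (∧-true yγ)))
                yv : far y v ≡ true
                yv = proj₂ (∧-true {nb u y} (proj₁ (∧-true {Y u v y} yγ)))
                γ′ : γ u v y s s′ ≡ true
                γ′ = proj₂ (∧-true {Y u v y} yγ)
                distinct : c v y ≢ c u y
                distinct e = true≢false (trans (far-sym v y) yv) (nb⇒¬far (trans (nb-coh e) uy))
                ys : nb y s ≡ true
                ys = proj₁ (∧-true (proj₁ (∧-true γ′)))
                rest : (nb y s′ ∧ far s′ u) ∧ (far s s′ ∧ not (pos (blocked u v s s′))) ≡ true
                rest = proj₂ (∧-true {nb y s ∧ far s u} γ′)
                ys′ : nb y s′ ≡ true
                ys′ = proj₁ (∧-true (proj₁ (∧-true rest)))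
                unblocked : pos (blocked u v s s′) ≡ false
                unblocked = not-true (proj₂ (∧-true {far s s′} (proj₂ (∧-true {nb y s′ ∧ far s′ u} rest))))
                none : ∀ w → c v w ≡ c u y → c w s ≡ c y s → c w s′ ≡ c y s′ → ⊥
                none w e₁ e₂ e₃ = true≢false (⇒pos (≤-trans (≤-reflexive (sym (trans (cong₂ _*_ (cong χ (trans (nb-coh e₁) uy)) (both⇒χ*χ (near-w s (trans (nb-coh e₂) ys)) (near-w s′ (trans (nb-coh e₃) ys′)))) refl)))
                                                       (term≤sum (λ z → χ (nb v z) * (χ (near s z) * χ (near s′ z))) w))) unblocked
                  where
                  near-w : ∀ s → nb w s ≡ true → near s w ≡ true
                  near-w s e = trans (near-sym s w) (cong not (nb⇒¬far e))

-- Neighbourhoods made of two cliques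

weighted-∃≤ : ∀ {n} (p : Fin n → Bool) (f g : Fin n → ℕ) → 0 < # p → sum (λ x → χ (p x) * f x) ≤ sum (λ x → χ (p x) * g x) →
              ∃ λ x → p x ≡ true × f x ≤ g x
weighted-∃≤ p f g p>0 le = from (sum<⇒∃< (λ x → χ (p x) * f x) (λ x → χ (p x) * suc (g x)) lt)
  where
  lt : sum (λ x → χ (p x) * f x) < sum (λ x → χ (p x) * suc (g x))
  lt = ≤-trans (+-mono-≤ p>0 le) (≤-reflexive (trans (sym (sum-+ (χ ∘ p) (λ x → χ (p x) * g x))) (sum-cong-≗ (λ x → sym (*-suc (χ (p x)) (g x))))))
  go : ∀ b {k l} → χ b * k < χ b * suc l → b ≡ true × k ≤ l
  go true {k} {l} (s≤s q) = refl , subst₂ _≤_ (+-identityʳ k) (+-identityʳ l) q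
  from : (∃ λ x → χ (p x) * f x < χ (p x) * suc (g x)) → ∃ λ x → p x ≡ true × f x ≤ g x
  from (x , q) = x , go (p x) q

module TwoSided {n r : ℕ} (c : Coloring n r) (pcc : IsPCC c) (n≥2 : 2 ≤ n) (u₀ : Fin n) (d : Fin r)
                (dominant : 2 * n < 3 * # (λ w → c u₀ w == d)) (h : ℕ) (h≥ : 120000 ≤ h) where
  open Coherent c pcc
  open Dominant c pcc n≥2 u₀ d dominant
  open Windows c pcc n≥2 u₀ d dominant
  open Sparse c pcc n≥2 u₀ d dominant

  nf ne : (Fin n → Bool) → Fin n → ℕ
  nf P x = # (λ s → P s ∧ not (nb x s))
  ne P x = # (λ s → P s ∧ nb x s)

  nf+ne : ∀ P x → nf P x + ne P x ≡ # P
  nf+ne P x = trans (sym (sum-+ (λ s → χ (P s ∧ not (nb x s))) (λ s → χ (P s ∧ nb x s)))) (sum-cong-≗ (λ s → go (P s) (nb x s)))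
    where
    go : ∀ a b → χ (a ∧ not b) + χ (a ∧ b) ≡ χ a
    go true  true  = refl
    go true  false = refl
    go false b     = refl

  abstract
    -- Adjacent to all of P, or to none of it, up to ρ/50. Of this, ρ/100 covers the deviations that
    -- Markov's inequality allows in `NearClique`; the rest absorbs a term 1 or μ, as ρ ≥ hμ.
    Full Empty : (Fin n → Bool) → Fin n → Set
    Full P x  = 100 * nf P x ≤ 2 * ρ
    Empty P x = 100 * ne P x ≤ 2 * ρ

    full-≤ : ∀ P x → Full P x → 100 * nf P x ≤ 2 * ρ
    full-≤ P x p = p

    ≤-full : ∀ {P x} → 100 * nf P x ≤ 2 * ρ → Full P x
    ≤-full p = p

    empty-≤ : ∀ P x → Empty P x → 100 * ne P x ≤ 2 * ρ
    empty-≤ P x p = p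

    ≤-empty : ∀ {P x} → 100 * ne P x ≤ 2 * ρ → Empty P x
    ≤-empty p = p

    fullᵇ : (Fin n → Bool) → Fin n → Bool
    fullᵇ P x = 100 * nf P x ≤ᵇ 2 * ρ

    fullᵇ⇒ : ∀ {P x} → fullᵇ P x ≡ true → Full P x
    fullᵇ⇒ {P} {x} e = ≤ᵇ⇒≤ (100 * nf P x) (2 * ρ) (subst Data.Bool.T (sym e) tt)

    ⇒fullᵇ : ∀ {P x} → Full P x → fullᵇ P x ≡ true
    ⇒fullᵇ {P} {x} p = go (100 * nf P x ≤ᵇ 2 * ρ) refl
      where
      go : ∀ b → (100 * nf P x ≤ᵇ 2 * ρ) ≡ b → b ≡ true
      go true  _ = refl
      go false e = ⊥-elim (subst Data.Bool.T e (≤⇒≤ᵇ p))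

  record Side (P : Fin n → Bool) : Set where
    field
      large     : ρ ≤ 4 * # P
      dichotomy : ∀ x → Full P x ⊎ Empty P x
      mostly    : 100 * # (λ s → P s ∧ not (fullᵇ P s)) ≤ ρ

  record Sides (y : Fin n) : Set where
    field
      S    : Bool → Fin n → Bool
      part : ∀ s → χ (S true s) + χ (S false s) ≡ χ (nb y s)
      side : ∀ b → Side (S b)

  module _ (sparse : h * (ρ * ρ * ρ) ≤ N * N) (ρ≥1 : 1 ≤ ρ) where
    open Params h h≥ sparse ρ≥1

    module NearClique (P : Fin n → Bool) where
      na : Fin n → ℕ
      na s = sum (λ s′ → χ (P s′) * χ (far s s′))

      module _ (few : 10000 * sum (λ s → χ (P s) * na s) ≤ ρ * ρ) where

        atypical : Fin n → Bool
        atypical s = P s ∧ (ρ ≤ᵇ 100 * na s)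

        -- Markov's inequality; 10000 = 100² is shared between the number of atypical vertices and
        -- the number of their far partners, ρ/100 each.
        few-atypical : 100 * # atypical ≤ ρ
        few-atypical = *-cancelˡ-≤ ρ ⦃ >-nonZero ρ≥1 ⦄ (lin (ρ ∷ # atypical ∷ sum (λ s → χ (P s) * na s) ∷ []) 0 (x₀ ⊗ (κ 100 ⊗ x₁) ≼ x₀ ⊗ x₀) ((κ 100 , x₁ ⊗ x₀ ≼ κ 100 ⊗ x₂) ∷ (κ 1 , κ 10000 ⊗ x₂ ≼ x₀ ⊗ x₀) ∷ []) refl (bound , few , tt))
          where
          bound : # atypical * ρ ≤ 100 * sum (λ s → χ (P s) * na s)
          bound = ≤-trans (≤-reflexive (sym (sum-*ʳ ρ (χ ∘ atypical)))) (≤-trans (sum-mono (λ s → go s (P s) (ρ ≤ᵇ 100 * na s) refl)) (≤-reflexive (sum-*ˡ 100 (λ s → χ (P s) * na s))))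
            where
            go : ∀ s p t → (ρ ≤ᵇ 100 * na s) ≡ t → χ (p ∧ t) * ρ ≤ 100 * (χ p * na s)
            go s false t     _ = z≤n
            go s true  false _ = z≤n
            go s true  true  e = ≤-trans (≤-reflexive (+-identityʳ ρ)) (≤-trans (≤ᵇ⇒≤ ρ (100 * na s) (subst Data.Bool.T (sym e) tt)) (≤-reflexive (cong (100 *_) (sym (+-identityʳ (na s))))))

        typical-na : ∀ {s} → P s ≡ true → atypical s ≡ false → 100 * na s ≤ ρ
        typical-na {s} p e = go (ρ ≤ᵇ 100 * na s) refl (trans (cong (_∧ (ρ ≤ᵇ 100 * na s)) (sym p)) e)
          where
          go : ∀ b → (ρ ≤ᵇ 100 * na s) ≡ b → b ≡ false → 100 * na s ≤ ρ
          go false e _ = <⇒≤ (≰⇒> (λ le → subst Data.Bool.T e (≤⇒≤ᵇ le)))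

        nf≤1+na : ∀ x → nf P x ≤ 1 + na x
        nf≤1+na x = ≤-trans (sum-mono (λ s → go (P s) (x == s) (far x s))) (≤-reflexive (trans (sum-+ (λ s → χ (x == s)) (λ s → χ (P s) * χ (far x s))) (cong (_+ na x)
            (trans (sum-cong-≗ (λ s → sym (*-identityʳ (χ (x == s))))) (sum-δ (λ _ → 1) x)))))
          where
          go : ∀ p e f → χ (p ∧ not (not e ∧ not f)) ≤ χ e + χ p * χ f
          go false e     f     = z≤n
          go true  true  f     = s≤s z≤n
          go true  false true  = ≤-refl
          go true  false false = z≤n

        typical-full : ∀ {s} → P s ≡ true → atypical s ≡ false → Full P s
        typical-full {s} p e = ≤-full (lin (na s ∷ nf P s ∷ ρ ∷ h ∷ []) 1199 (κ 100 ⊗ x₁ ≼ κ 2 ⊗ x₂) ((κ 120000 , x₁ ≼ κ 1 ⊕ x₀) ∷ (κ 1200 , κ 100 ⊗ x₀ ≼ x₂) ∷ (κ 1 , x₃ ≼ x₂) ∷ (κ 1 , κ 120000 ≼ x₃) ∷ []) refl (nf≤1+na s , typical-na p e , h≤ρ , h≥ , tt))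

        mostly-full : 100 * # (λ s → P s ∧ not (fullᵇ P s)) ≤ ρ
        mostly-full = ≤-trans (*-monoʳ-≤ 100 (#-mono (λ s e → go s (atypical s) refl (∧-true {P s} e)))) few-atypical
          where
          go : ∀ s b → atypical s ≡ b → P s ≡ true × not (fullᵇ P s) ≡ true → b ≡ true
          go s true  _ _ = refl
          go s false e (p , q) = ⊥-elim (true≢false (⇒fullᵇ {P} {s} (typical-full p e)) (not-true q))

        -- If x is far from a typical p, its neighbours in P are common neighbours of x and p, at
        -- most μ, or far from p, at most ρ/100. Otherwise x is far only from atypical members of P.
        full-or-empty : ∀ x → Full P x ⊎ Empty P x
        full-or-empty x = go (any? (λ p → (P p ∧ not (atypical p)) ∧ far x p))
          where
          go : (∃ λ p → (P p ∧ not (atypical p)) ∧ far x p ≡ true) ⊎ (∀ p → (P p ∧ not (atypical p)) ∧ far x p ≡ false) → Full P x ⊎ Empty P x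
          go (inj₁ (p , e)) = inj₂ (≤-empty (lin (ne P x ∷ na p ∷ μ ∷ ρ ∷ h ∷ []) 1199 (κ 100 ⊗ x₀ ≼ κ 2 ⊗ x₃) ((κ 120000 , x₀ ≼ x₂ ⊕ x₁) ∷ (κ 1200 , κ 100 ⊗ x₁ ≼ x₃) ∷ (κ 1 , x₄ ⊗ x₂ ≼ x₃) ∷ (x₂ , κ 120000 ≼ x₄) ∷ []) refl (bound , typical-na Pp (not-true (proj₂ (∧-true {P p} (proj₁ (∧-true e))))) , hμ≤ρ , h≥ , tt)))
            where
            Pp : P p ≡ true
            Pp = proj₁ (∧-true (proj₁ (∧-true e)))
            xp : far x p ≡ true
            xp = proj₂ (∧-true {P p ∧ not (atypical p)} e)
            bound : ne P x ≤ μ + na p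
            bound = ≤-trans (sum-mono (λ s → each s (P s) (nb x s) (far p s) refl refl)) (≤-reflexive (trans (sum-+ (λ s → χ (nb x s) * χ (nb s p)) (λ s → χ (P s) * χ (far p s))) (cong (_+ na p) (cn-far xp))))
              where
              each : ∀ s a b f → nb x s ≡ b → far p s ≡ f → χ (a ∧ b) ≤ χ b * χ (nb s p) + χ a * χ f
              each s false b     f     _ _ = z≤n
              each s true  false f     _ _ = z≤n
              each s true  true  true  _ _ = ≤-trans (s≤s z≤n) (m≤n+m 1 (1 * χ (nb s p)))
              each s true  true  false q f = ≤-trans (≤-reflexive (sym (cong (λ b → 1 * χ b) (≢∧¬far⇒nb (λ { refl → true≢false xp (nb⇒¬far q) }) (trans (far-sym s p) f))))) (m≤m+n _ 0)
          go (inj₂ none) = inj₁ (≤-full (lin (nf P x ∷ # atypical ∷ ρ ∷ h ∷ []) 1199 (κ 100 ⊗ x₀ ≼ κ 2 ⊗ x₂) ((κ 120000 , x₀ ≼ κ 1 ⊕ x₁) ∷ (κ 1200 , κ 100 ⊗ x₁ ≼ x₂) ∷ (κ 1 , x₃ ≼ x₂) ∷ (κ 1 , κ 120000 ≼ x₃) ∷ []) refl (bound , few-atypical , h≤ρ , h≥ , tt)))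
            where
            bound : nf P x ≤ 1 + # atypical
            bound = ≤-trans (sum-mono (λ s → each (P s) (x == s) (far x s) (atypical s) (none s))) (≤-reflexive (trans (sum-+ (λ s → χ (x == s)) (χ ∘ atypical)) (cong (_+ # atypical)
                (trans (sum-cong-≗ (λ s → sym (*-identityʳ (χ (x == s))))) (sum-δ (λ _ → 1) x)))))
              where
              each : ∀ p e f t → (p ∧ not t) ∧ f ≡ false → χ (p ∧ not (not e ∧ not f)) ≤ χ e + χ t
              each false e     f     t     _ = z≤n
              each true  true  f     t     _ = s≤s z≤n
              each true  false true  true  _ = ≤-refl
              each true  false false t     _ = z≤n

    module Vertex {y u : Fin n} (yu : nb y u ≡ true) (fewW : 10000 * W y u ≤ ρ * ρ) (fewNM : 10000 * NM y u ≤ ρ * ρ) where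

      A M : Fin n → Bool
      A s = nb y s ∧ near s u
      M s = nb y s ∧ far s u

      partition : ∀ s → χ (A s) + χ (M s) ≡ χ (nb y s)
      partition s = go (nb y s) (far s u)
        where
        go : ∀ b f → χ (b ∧ not f) + χ (b ∧ f) ≡ χ b
        go true  true  = refl
        go true  false = refl
        go false f     = refl

      W≡ : W y u ≡ sum (λ s → χ (A s) * NearClique.na A s)
      W≡ = sum-cong-≗ (λ s → cong₂ _*_ (sym (χ-∧ (nb y s) _)) (sum-cong-≗ (λ s′ → cong (_* χ (far s s′)) (sym (χ-∧ (nb y s′) _)))))

      NM≡ : NM y u ≡ sum (λ s → χ (M s) * NearClique.na M s)
      NM≡ = sum-cong-≗ (λ s → cong₂ _*_ (sym (χ-∧ (nb y s) _)) (sum-cong-≗ (λ s′ → cong (_* χ (far s s′)) (sym (χ-∧ (nb y s′) _)))))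

      fewA : 10000 * sum (λ s → χ (A s) * NearClique.na A s) ≤ ρ * ρ
      fewA = subst (λ k → 10000 * k ≤ ρ * ρ) W≡ fewW

      fewM : 10000 * sum (λ s → χ (M s) * NearClique.na M s) ≤ ρ * ρ
      fewM = subst (λ k → 10000 * k ≤ ρ * ρ) NM≡ fewNM

      A+M : # A + # M ≡ ρ
      A+M = trans (sym (sum-+ (χ ∘ A) (χ ∘ M))) (trans (sum-cong-≗ partition) (#nb y))

      #A≤ : # A ≤ 1 + cn y u
      #A≤ = ≤-trans (sum-mono (λ s → go (nb y s) s (u == s) (far s u) refl refl)) (≤-reflexive (trans (sum-+ (λ s → χ (u == s)) (λ s → χ (nb y s) * χ (nb s u)))
               (cong (_+ cn y u) (trans (sum-cong-≗ (λ s → sym (*-identityʳ (χ (u == s))))) (sum-δ (λ _ → 1) u)))))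
        where
        go : ∀ b s e f → (u == s) ≡ e → far s u ≡ f → χ (b ∧ not f) ≤ χ e + χ b * χ (nb s u)
        go false s e     f     _ _ = z≤n
        go true  s e     true  _ _ = z≤n
        go true  s true  false _ _ = s≤s z≤n
        go true  s false false p q = ≤-reflexive (sym (cong (λ b → 1 * χ b) (≢∧¬far⇒nb (==⇒≢ {x = s} {u} (trans (==-sym s u) p)) q)))

      -- A consists of u and common neighbours of y and u, hardly more than two thirds of N(y).
      ρ≤4M : ρ ≤ 4 * # M
      ρ≤4M = lin (ρ ∷ # A ∷ # M ∷ cn y u ∷ μ ∷ h ∷ []) 119995 (x₀ ≼ κ 4 ⊗ x₂) ((κ 360000 , x₀ ≼ x₁ ⊕ x₂) ∷ (κ 360000 , x₁ ≼ κ 1 ⊕ x₃) ∷ (κ 120000 , κ 3 ⊗ x₃ ≼ κ 2 ⊗ x₀ ⊕ x₄) ∷ (κ 1 , x₅ ⊗ x₄ ≼ x₀) ∷ (x₄ ⊕ κ 3 , κ 120000 ≼ x₅) ∷ (κ 3 , x₅ ≼ x₀) ∷ []) refl (≤-reflexive (sym A+M) , #A≤ , 3λ≤2ρ+μ yu , hμ≤ρ , h≥ , h≤ρ , tt)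

      -- Were A smaller, M would hold three quarters of N(y), and a typical member x of M would
      -- share nearly all of M with y, against `3λ≤2ρ+μ`.
      ρ≤4A : ρ ≤ 4 * # A
      ρ≤4A = ≮⇒≥ absurd
        where
        absurd : 4 * # A < ρ → ⊥
        absurd lt = from (sum<⇒∃< (χ ∘ atyp) (χ ∘ M) more)
          where
          atyp : Fin n → Bool
          atyp = NearClique.atypical M fewM
          more : # atyp < # M
          more = lin (ρ ∷ # atyp ∷ # M ∷ h ∷ []) 119999 (κ 1 ⊕ x₁ ≼ x₂) ((κ 1200 , κ 100 ⊗ x₁ ≼ x₀) ∷ (κ 1201 , x₀ ≼ κ 4 ⊗ x₂) ∷ (κ 1 , κ 120000 ≼ x₃) ∷ (κ 1 , x₃ ≼ x₀) ∷ []) refl (NearClique.few-atypical M fewM , ρ≤4M , h≥ , h≤ρ , tt)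
          from : (∃ λ x → χ (atyp x) < χ (M x)) → ⊥
          from (x , lt′) = 1≰0 (lin (ρ ∷ # A ∷ # M ∷ cn y x ∷ μ ∷ h ∷ nf M x ∷ ne M x ∷ []) 2735969999 (κ 1 ≼ κ 0) ((κ 90000 , κ 1 ⊕ κ 4 ⊗ x₁ ≼ x₀) ∷ (κ 360000 , x₀ ≼ x₁ ⊕ x₂) ∷ (κ 120000 , κ 3 ⊗ x₃ ≼ κ 2 ⊗ x₀ ⊕ x₄) ∷ (κ 1 , x₅ ⊗ x₄ ≼ x₀) ∷ (x₄ ⊕ κ 22799 , κ 120000 ≼ x₅) ∷ (κ 22799 , x₅ ≼ x₀) ∷ (κ 3600 , κ 100 ⊗ x₆ ≼ κ 2 ⊗ x₀) ∷ (κ 360000 , x₂ ≼ x₆ ⊕ x₇) ∷ (κ 360000 , x₇ ≼ x₃) ∷ []) refl (lt , ≤-reflexive (sym A+M) , 3λ≤2ρ+μ yx , hμ≤ρ , h≥ , h≤ρ , full-≤ M x (NearClique.typical-full M fewM (proj₁ split) (proj₂ split)) , ≤-reflexive (sym (nf+ne M x)) , e≤l , tt))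
            where
            go : ∀ a b → χ a < χ b → b ≡ true × a ≡ false
            go false true _ = refl , refl
            go true true (s≤s ())
            split : M x ≡ true × atyp x ≡ false
            split = go (atyp x) (M x) lt′
            yx : nb y x ≡ true
            yx = proj₁ (∧-true (proj₁ split))
            e≤l : ne M x ≤ cn y x
            e≤l = sum-mono (λ s → ≤-trans (each (nb y s) (far s u) (nb x s)) (≤-reflexive (cong (λ b → χ (nb y s) * χ b) (nb-sym x s))))
              where
              each : ∀ b f k → χ ((b ∧ f) ∧ k) ≤ χ b * χ k
              each false f k = z≤n
              each true false k = z≤n
              each true true k = ≤-reflexive (sym (+-identityʳ (χ k)))

      sides : Sides y
      sides = record { S = pick ; part = partition ; side = λ { true → record { large = ρ≤4A ; dichotomy = NearClique.full-or-empty A fewA ; mostly = NearClique.mostly-full A fewA }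
                                                              ; false → record { large = ρ≤4M ; dichotomy = NearClique.full-or-empty M fewM ; mostly = NearClique.mostly-full M fewM } } }
        where
        pick : Bool → Fin n → Bool
        pick true  = A
        pick false = M

    -- At any y, averaging `W y u` over the u with the colour of ab gives a u with W at most
    -- ρ²μ/valency ≤ ρ²/h. For the same u, `NM-window` carries the smallness of `NM` from ab to yu,
    -- so both sides of N(y) have few far pairs.
    all-sides : ∀ {a b} → nb a b ≡ true → 20000 * NM a b < ρ * ρ → ∀ y → Sides y
    all-sides {a} {b} ab lt y = from (weighted-∃≤ (λ u → c y u == c a b) (λ u → valency a b * W y u) (λ _ → ρ * (ρ * μ)) positive average)
      where
      positive : 0 < # (λ u → c y u == c a b)
      positive = subst (0 <_) (sym (valency-const a b y)) (∃⇒#>0 (λ w → c a w == c a b) b (==-refl (c a b)))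
      average : sum (λ u → χ (c y u == c a b) * (valency a b * W y u)) ≤ sum (λ u → χ (c y u == c a b) * (ρ * (ρ * μ)))
      average = begin
        sum (λ u → χ (c y u == c a b) * (valency a b * W y u)) ≤⟨ sum-mono (λ u → go u (c y u == c a b) refl) ⟩
        sum (λ u → valency a b * (χ (nb y u) * W y u))         ≡⟨ sum-*ˡ (valency a b) (λ u → χ (nb y u) * W y u) ⟩
        valency a b * sum (λ u → χ (nb y u) * W y u)           ≤⟨ *-monoʳ-≤ (valency a b) (sum-W y) ⟩
        valency a b * (ρ * (ρ * μ))                            ≡⟨ cong (_* (ρ * (ρ * μ))) (valency-const a b y) ⟨
        # (λ u → c y u == c a b) * (ρ * (ρ * μ))               ≡⟨ sum-*ʳ (ρ * (ρ * μ)) (λ u → χ (c y u == c a b)) ⟨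
        sum (λ u → χ (c y u == c a b) * (ρ * (ρ * μ)))         ∎
        where
        open ≤-Reasoning
        go : ∀ u t → (c y u == c a b) ≡ t → χ t * (valency a b * W y u) ≤ valency a b * (χ (nb y u) * W y u)
        go u false _ = z≤n
        go u true  e = ≤-reflexive (trans (+-identityʳ _) (cong (valency a b *_) (sym (trans (cong (λ t → χ t * W y u) (same-nb ab (==⇒≡ {x = c y u} {c a b} e))) (+-identityʳ (W y u))))))
      from : (∃ λ u → (c y u == c a b) ≡ true × valency a b * W y u ≤ ρ * (ρ * μ)) → Sides y
      from (u , e , le) = Vertex.sides (same-nb ab same) fewW fewNM
        where
        same : c y u ≡ c a b
        same = ==⇒≡ {x = c y u} {c a b} e
        fewW : 10000 * W y u ≤ ρ * ρ
        fewW = *-cancelʳ-≤ (10000 * W y u) (ρ * ρ) μ ⦃ >-nonZero μ≥1 ⦄ (lin (W y u ∷ ρ ∷ μ ∷ valency a b ∷ h ∷ []) 11 (κ 10000 ⊗ x₀ ⊗ x₂ ≼ x₁ ⊗ x₁ ⊗ x₂) ((κ 1 , x₃ ⊗ x₀ ≼ x₁ ⊗ (x₁ ⊗ x₂)) ∷ (x₀ , x₄ ⊗ x₂ ≼ x₃) ∷ (x₂ ⊗ x₀ , κ 120000 ≼ x₄) ∷ []) refl (le , hμ≤valency ab , h≥ , tt))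
        fewNM : 10000 * NM y u ≤ ρ * ρ
        fewNM = lin (NM y u ∷ NM a b ∷ ρ ∷ μ ∷ h ∷ []) 11 (κ 10000 ⊗ x₀ ≼ x₂ ⊗ x₂) ((κ 120000 , x₀ ≼ x₁ ⊕ x₂ ⊗ x₃) ∷ (κ 6 , κ 1 ⊕ κ 20000 ⊗ x₁ ≼ x₂ ⊗ x₂) ∷ (x₂ , x₄ ⊗ x₃ ≼ x₂) ∷ (x₂ ⊗ x₃ , κ 120000 ≼ x₄) ∷ []) refl (NM-window same , lt , hμ≤ρ , h≥ , tt)

-- From almost cliques to exact cliques

agree : Bool → Bool → Bool
agree true  l = l
agree false l = not l

agree-refl : ∀ {b l} → l ≡ b → agree b l ≡ true
agree-refl {true}  refl = refl
agree-refl {false} refl = refl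

agree⇒ : ∀ {b l} → agree b l ≡ true → l ≡ b
agree⇒ {true}  e = e
agree⇒ {false} e = not-true e

module ExactCliques {n r : ℕ} (c : Coloring n r) (pcc : IsPCC c) (n≥2 : 2 ≤ n) (u₀ : Fin n) (d : Fin r)
                    (dominant : 2 * n < 3 * # (λ w → c u₀ w == d)) (h : ℕ) (h≥ : 120000 ≤ h) where
  open Coherent c pcc
  open Dominant c pcc n≥2 u₀ d dominant
  open Windows c pcc n≥2 u₀ d dominant
  open Sparse c pcc n≥2 u₀ d dominant
  open TwoSided c pcc n≥2 u₀ d dominant h h≥

  module _ (sparse : h * (ρ * ρ * ρ) ≤ N * N) (ρ≥1 : 1 ≤ ρ) (all : ∀ y → Sides y) where
    open Params h h≥ sparse ρ≥1

    S : Fin n → Bool → Fin n → Bool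
    S y = Sides.S (all y)

    part : ∀ y b s → χ (S y b s) + χ (S y (not b) s) ≡ χ (nb y s)
    part y true  s = Sides.part (all y) s
    part y false s = trans (+-comm (χ (S y false s)) _) (Sides.part (all y) s)

    large : ∀ y b → ρ ≤ 4 * # (S y b)
    large y b = Side.large (Sides.side (all y) b)

    dichotomy : ∀ y b x → Full (S y b) x ⊎ Empty (S y b) x
    dichotomy y b = Side.dichotomy (Sides.side (all y) b)

    S⇒nb : ∀ y b {s} → S y b s ≡ true → nb y s ≡ true
    S⇒nb y b {s} e = go (nb y s) refl (≤-trans (true⇒χ e) (≤-trans (m≤m+n _ _) (≤-reflexive (part y b s))))
      where
      go : ∀ t → nb y s ≡ t → 1 ≤ χ (nb y s) → nb y s ≡ true
      go true  p _ = p
      go false p q = 1≰0 (subst (λ t → 1 ≤ χ t) p q)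

    nb⇒S : ∀ {y s} → nb y s ≡ true → ∃ λ b → S y b s ≡ true
    nb⇒S {y} {s} e = go (S y true s) (S y false s) refl refl
      where
      go : ∀ a b → S y true s ≡ a → S y false s ≡ b → ∃ λ b → S y b s ≡ true
      go true  b     p _ = true , p
      go false true  _ q = false , q
      go false false p q = ⊥-elim (1≰0 (≤-trans (true⇒χ e) (≤-reflexive (trans (sym (part y true s)) (cong₂ (λ a b → χ a + χ b) p q)))))

    #S : ∀ y b → # (S y b) + # (S y (not b)) ≡ ρ
    #S y b = trans (sym (sum-+ (χ ∘ S y b) (χ ∘ S y (not b)))) (trans (sum-cong-≗ (part y b)) (#nb y))

    ne-sum : ∀ y b x → ne (S y b) x + ne (S y (not b)) x ≡ cn y x
    ne-sum y b x = trans (sym (sum-+ (λ s → χ (S y b s ∧ nb x s)) (λ s → χ (S y (not b) s ∧ nb x s)))) (sum-cong-≗ (λ s → trans (cong₂ _+_ (χ-∧ (S y b s) _) (χ-∧ (S y (not b) s) _))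
      (trans (sym (*-distribʳ-+ (χ (nb x s)) (χ (S y b s)) (χ (S y (not b) s)))) (cong₂ (λ k t → k * χ t) (part y b s) (nb-sym x s)))))

    cn-sym : ∀ x y → cn x y ≡ cn y x
    cn-sym x y = sum-cong-≗ (λ w → trans (*-comm (χ (nb x w)) _) (cong₂ (λ s t → χ s * χ t) (nb-sym w y) (nb-sym x w)))

    -- x would be adjacent to all but ρ/25 of N(y), well above the two thirds that neighbours may
    -- share.
    not-both : ∀ {y x} → nb y x ≡ true → ∀ b → Full (S y b) x → Full (S y (not b)) x → ⊥
    not-both {y} {x} yx b p q = 1≰0 (lin (ρ ∷ h ∷ μ ∷ cn y x ∷ nf (S y b) x ∷ nf (S y (not b)) x ∷ ne (S y b) x ∷ ne (S y (not b)) x ∷ # (S y b) ∷ # (S y (not b)) ∷ []) 105598 (κ 1 ≼ κ 0) ((κ 3600 , κ 100 ⊗ x₄ ≼ κ 2 ⊗ x₀) ∷ (κ 3600 , κ 100 ⊗ x₅ ≼ κ 2 ⊗ x₀) ∷ (κ 360000 , x₈ ≼ x₄ ⊕ x₆) ∷ (κ 360000 , x₉ ≼ x₅ ⊕ x₇) ∷ (κ 360000 , x₀ ≼ x₈ ⊕ x₉) ∷ (κ 360000 , x₆ ⊕ x₇ ≼ x₃) ∷ (κ 120000 , κ 3 ⊗ x₃ ≼ κ 2 ⊗ x₀ ⊕ x₂) ∷ (κ 1 , x₁ ⊗ x₂ ≼ x₀) ∷ (x₂ , κ 120000 ≼ x₁) ∷ (κ 105599 , κ 1 ≼ x₀) ∷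 []) refl (full-≤ (S y b) x p , full-≤ (S y (not b)) x q , ≤-reflexive (sym (nf+ne (S y b) x)) , ≤-reflexive (sym (nf+ne (S y (not b)) x)) , ≤-reflexive (sym (#S y b)) , ≤-reflexive (ne-sum y b x) , 3λ≤2ρ+μ yx , hμ≤ρ , h≥ , ρ≥1 , tt))

    full-not : ∀ {y x} → nb y x ≡ true → ∀ b → Full (S y b) x → Empty (S y (not b)) x
    full-not {y} {x} yx b p = from (dichotomy y (not b) x)
      where
      from : Full (S y (not b)) x ⊎ Empty (S y (not b)) x → Empty (S y (not b)) x
      from (inj₂ e) = e
      from (inj₁ q) = ⊥-elim (not-both yx b p q)

    abstract
      -- With more than ρ/25 common neighbours, x cannot be `Empty` for both sides of N(y). This
      -- condition is coherent and symmetric, whereas the sides are chosen separately at each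
      -- vertex.
      Thick : Fin n → Fin n → Set
      Thick y x = 4 * ρ < 100 * cn y x

      thick-< : ∀ y x → Thick y x → 4 * ρ < 100 * cn y x
      thick-< y x p = p

      <-thick : ∀ {y x} → 4 * ρ < 100 * cn y x → Thick y x
      <-thick p = p

      thick-sym : ∀ {y x} → Thick y x → Thick x y
      thick-sym {y} {x} p = subst (λ k → 4 * ρ < 100 * k) (cn-sym y x) p

      thick : Fin n → Fin n → Bool
      thick y x = 4 * ρ <ᵇ 100 * cn y x

      thick-coh : ∀ {u v u′ v′} → c u v ≡ c u′ v′ → thick u v ≡ thick u′ v′
      thick-coh {u} {v} {u′} {v′} e = cong (λ k → 4 * ρ <ᵇ 100 * k) (coh-cn {u} {v} {u′} {v′} e)

      thick-sym-≡ : ∀ y x → thick y x ≡ thick x y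
      thick-sym-≡ y x = cong (λ k → 4 * ρ <ᵇ 100 * k) (cn-sym y x)

      thick⇒ : ∀ {y x} → thick y x ≡ true → Thick y x
      thick⇒ {y} {x} e = <ᵇ⇒< (4 * ρ) (100 * cn y x) (subst Data.Bool.T (sym e) tt)

      ⇒thick : ∀ {y x} → Thick y x → thick y x ≡ true
      ⇒thick {y} {x} p = go (4 * ρ <ᵇ 100 * cn y x) refl
        where
        go : ∀ b → (4 * ρ <ᵇ 100 * cn y x) ≡ b → b ≡ true
        go true  _ = refl
        go false e = ⊥-elim (subst Data.Bool.T e (<⇒<ᵇ p))

    thick-full : ∀ {y x} → Thick y x → ∃ λ b → Full (S y b) x
    thick-full {y} {x} t = from (dichotomy y true x) (dichotomy y false x)
      where
      from : Full (S y true) x ⊎ Empty (S y true) x → Full (S y false) x ⊎ Empty (S y false) x → ∃ λ b → Full (S y b) x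
      from (inj₁ p) _        = true , p
      from (inj₂ _) (inj₁ q) = false , q
      from (inj₂ p) (inj₂ q) = 1≰0 (lin (ρ ∷ cn y x ∷ ne (S y true) x ∷ ne (S y false) x ∷ []) 0 (κ 1 ≼ κ 0) ((κ 1 , κ 1 ⊕ κ 4 ⊗ x₀ ≼ κ 100 ⊗ x₁) ∷ (κ 1 , κ 100 ⊗ x₂ ≼ κ 2 ⊗ x₀) ∷ (κ 1 , κ 100 ⊗ x₃ ≼ κ 2 ⊗ x₀) ∷ (κ 100 , x₁ ≼ x₂ ⊕ x₃) ∷ []) refl (thick-< y x t , empty-≤ (S y true) x p , empty-≤ (S y false) x q , ≤-reflexive (sym (ne-sum y true x)) , tt))

    shared : ∀ P x x′ → # P ≤ sum (λ s → χ (P s) * (χ (nb x s) * χ (nb s x′))) + nf P x + nf P x′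
    shared P x x′ = ≤-trans (sum-mono (λ s → ≤-trans (go (P s) (nb x s) (nb x′ s)) (≤-reflexive (cong (λ t → χ (P s) * (χ (nb x s) * χ t) + χ (P s ∧ not (nb x s)) + χ (P s ∧ not (nb x′ s))) (nb-sym x′ s)))))
      (≤-reflexive (trans (sum-+ (λ s → χ (P s) * (χ (nb x s) * χ (nb s x′)) + χ (P s ∧ not (nb x s))) (λ s → χ (P s ∧ not (nb x′ s))))
        (cong (_+ nf P x′) (sum-+ (λ s → χ (P s) * (χ (nb x s) * χ (nb s x′))) (λ s → χ (P s ∧ not (nb x s)))))))
      where
      go : ∀ a b e → χ a ≤ χ a * (χ b * χ e) + χ (a ∧ not b) + χ (a ∧ not e)
      go false b     e     = z≤n
      go true  true  true  = s≤s z≤n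
      go true  true  false = s≤s z≤n
      go true  false e     = s≤s z≤n

    shared-cn : ∀ P x x′ → # P ≤ cn x x′ + nf P x + nf P x′
    shared-cn P x x′ = ≤-trans (shared P x x′) (+-monoˡ-≤ (nf P x′) (+-monoˡ-≤ (nf P x) (sum-mono (λ s → ≤-trans (*-monoˡ-≤ (χ (nb x s) * χ (nb s x′)) (χ≤1 (P s))) (≤-reflexive (+-identityʳ _))))))

    -- Both vertices are adjacent to nearly all of a side with at least ρ/4 members, far more than
    -- μ.
    full-far : ∀ {y b x x′} → Full (S y b) x → Full (S y b) x′ → far x x′ ≡ true → ⊥
    full-far {y} {b} {x} {x′} p q f = 1≰0 (lin (ρ ∷ h ∷ μ ∷ nf (S y b) x ∷ nf (S y b) x′ ∷ # (S y b) ∷ []) 25198 (κ 1 ≼ κ 0) ((κ 1200 , κ 100 ⊗ x₃ ≼ κ 2 ⊗ x₀) ∷ (κ 1200 , κ 100 ⊗ x₄ ≼ κ 2 ⊗ x₀) ∷ (κ 30000 , x₀ ≼ κ 4 ⊗ x₅) ∷ (κ 120000 , x₅ ≼ x₂ ⊕ x₃ ⊕ x₄) ∷ (κ 1 , x₁ ⊗ x₂ ≼ x₀) ∷ (x₂ , κ 120000 ≼ x₁) ∷ (κ 25199 , κ 1 ≼ x₀) ∷ []) refl (full-≤ (S y b) x p , full-≤ (S y b) x′ q , large y b , subst (λ l → # (S y b) ≤ l + nf (S y b) x + nf (S y b) x′) (cn-far f) (shared-cn (S y b) x x′) , hμ≤ρ , h≥ , ρ≥1 , tt))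

    -- y and v are full for sides of N(x), and for opposite ones because they are far. These two
    -- sides make up N(x), and their sizes are about `cn y x` and `cn v x`, which in turn are about
    -- the sizes of `S y b` and `S v e`.
    covered : ∀ {y v x b e} → far y v ≡ true → nb y x ≡ true → nb v x ≡ true → Thick y x → Thick v x → Full (S y b) x → Full (S v e) x →
              100 * ρ ≤ 100 * # (S y b) + 100 * # (S v e) + 8 * ρ
    covered {y} {v} {x} {b} {e} yv yx vx ty tv p q =
      from (thick-full {x} {y} (thick-sym ty)) (thick-full {x} {v} (thick-sym tv))
      where
      both : ∀ t → Full (S x t) y → Full (S x (not t)) v → 100 * ρ ≤ 100 * # (S y b) + 100 * # (S v e) + 8 * ρ
      both t pt pt′ = lin (ρ ∷ # (S y b) ∷ # (S v e) ∷ # (S x t) ∷ # (S x (not t)) ∷ cn y x ∷ cn v x ∷ []) 0 (κ 100 ⊗ x₀ ≼ κ 100 ⊗ x₁ ⊕ κ 100 ⊗ x₂ ⊕ κ 8 ⊗ x₀) ((κ 1 , κ 100 ⊗ x₃ ≼ κ 100 ⊗ x₅ ⊕ κ 2 ⊗ x₀) ∷ (κ 1 , κ 100 ⊗ x₄ ≼ κ 100 ⊗ x₆ ⊕ κ 2 ⊗ x₀) ∷ (κ 100 , x₀ ≼ x₃ ⊕ x₄) ∷ (κ 1 , κ 100 ⊗ x₅ ≼ κ 100 ⊗ x₁ ⊕ κ 2 ⊗ x₀) ∷ (κ 1 , κ 100 ⊗ x₆ ≼ κ 100 ⊗ x₂ ⊕ κ 2 ⊗ x₀) ∷ []) refl (part-cn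 {t} {y} pt (cn-sym y x) , part-cn {not t} {v} pt′ (cn-sym v x) , ≤-reflexive (sym (#S x t)) , cn-part {y} {b} yx p , cn-part {v} {e} vx q , tt)
        where
        part-cn : ∀ {t y} → Full (S x t) y → cn y x ≡ cn x y → 100 * # (S x t) ≤ 100 * cn y x + 2 * ρ
        part-cn {t} {y} p e = lin (ρ ∷ # (S x t) ∷ nf (S x t) y ∷ ne (S x t) y ∷ ne (S x (not t)) y ∷ cn y x ∷ cn x y ∷ []) 0 (κ 100 ⊗ x₁ ≼ κ 100 ⊗ x₅ ⊕ κ 2 ⊗ x₀) ((κ 1 , κ 100 ⊗ x₂ ≼ κ 2 ⊗ x₀) ∷ (κ 100 , x₁ ≼ x₂ ⊕ x₃) ∷ (κ 100 , x₃ ⊕ x₄ ≼ x₆) ∷ (κ 100 , x₆ ≼ x₅) ∷ []) refl (full-≤ (S x t) y p , ≤-reflexive (sym (nf+ne (S x t) y)) , ≤-reflexive (ne-sum x t y) , ≤-reflexive (sym e) , tt)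
        cn-part : ∀ {y b} → nb y x ≡ true → Full (S y b) x → 100 * cn y x ≤ 100 * # (S y b) + 2 * ρ
        cn-part {y} {b} yx p = lin (ρ ∷ # (S y b) ∷ nf (S y b) x ∷ ne (S y b) x ∷ ne (S y (not b)) x ∷ cn y x ∷ []) 0 (κ 100 ⊗ x₅ ≼ κ 100 ⊗ x₁ ⊕ κ 2 ⊗ x₀) ((κ 1 , κ 100 ⊗ x₄ ≼ κ 2 ⊗ x₀) ∷ (κ 100 , x₂ ⊕ x₃ ≼ x₁) ∷ (κ 100 , x₅ ≼ x₃ ⊕ x₄) ∷ []) refl (empty-≤ (S y (not b)) x (full-not yx b p) , ≤-reflexive (nf+ne (S y b) x) , ≤-reflexive (sym (ne-sum y b x)) , tt)
      opposite : ∀ t t′ → Full (S x t) y → Full (S x t′) v → 100 * ρ ≤ 100 * # (S y b) + 100 * # (S v e) + 8 * ρ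
      opposite true  true  pt pt′ = ⊥-elim (full-far {x} {_} {y} {v} pt pt′ yv)
      opposite false false pt pt′ = ⊥-elim (full-far {x} {_} {y} {v} pt pt′ yv)
      opposite true  false pt pt′ = both true pt pt′
      opposite false true  pt pt′ = both false pt pt′
      from : (∃ λ t → Full (S x t) y) → (∃ λ t → Full (S x t) v) → 100 * ρ ≤ 100 * # (S y b) + 100 * # (S v e) + 8 * ρ
      from (t , pt) (t′ , pt′) = opposite t t′ pt pt′

    full-thick : ∀ {y b x} → Full (S y b) x → Thick y x
    full-thick {y} {b} {x} p = <-thick (lin (ρ ∷ # (S y b) ∷ nf (S y b) x ∷ ne (S y b) x ∷ ne (S y (not b)) x ∷ cn y x ∷ []) 22 (κ 1 ⊕ κ 4 ⊗ x₀ ≼ κ 100 ⊗ x₅) ((κ 5 , κ 100 ⊗ x₂ ≼ κ 2 ⊗ x₀) ∷ (κ 500 , x₁ ≼ x₂ ⊕ x₃) ∷ (κ 500 , x₃ ⊕ x₄ ≼ x₅) ∷ (κ 125 , x₀ ≼ κ 4 ⊗ x₁) ∷ (κ 23 , κ 1 ≼ x₀) ∷ []) refl (full-≤ (S y b) x p , ≤-reflexive (sym (nf+ne (S y b) x)) , ≤-reflexive (ne-sum y b x) , large y b , ρ≥1 , tt))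

    thin : Fin n → Fin n → Bool
    thin y x = nb y x ∧ not (thick y x)

    thin-coh : ∀ {u v u′ v′} → c u v ≡ c u′ v′ → thin u v ≡ thin u′ v′
    thin-coh e = cong₂ (λ a k → a ∧ not k) (nb-coh e) (thick-coh e)

    coh-thin : Coh (λ u v → χ (thin u v))
    coh-thin e = cong χ (thin-coh e)

    -- A thin neighbour is full for neither side, so it is one of the at most ρ/100 exceptions of
    -- its own side.
    few-thin : ∀ y → 100 * # (thin y) ≤ 2 * ρ
    few-thin y = lin (ρ ∷ # (thin y) ∷ # (λ s → S y true s ∧ not (fullᵇ (S y true) s)) ∷ # (λ s → S y false s ∧ not (fullᵇ (S y false) s)) ∷ []) 0 (κ 100 ⊗ x₁ ≼ κ 2 ⊗ x₀) ((κ 100 , x₁ ≼ x₂ ⊕ x₃) ∷ (κ 1 , κ 100 ⊗ x₂ ≼ x₀) ∷ (κ 1 , κ 100 ⊗ x₃ ≼ x₀) ∷ []) refl (bound , Side.mostly (Sides.side (all y) true) , Side.mostly (Sides.side (all y) false) , tt)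
      where
      bound : # (thin y) ≤ # (λ s → S y true s ∧ not (fullᵇ (S y true) s)) + # (λ s → S y false s ∧ not (fullᵇ (S y false) s))
      bound = ≤-trans (sum-mono (λ s → go s (thin y s) refl)) (≤-reflexive (sum-+ (λ s → χ (S y true s ∧ not (fullᵇ (S y true) s))) (λ s → χ (S y false s ∧ not (fullᵇ (S y false) s)))))
        where
        go : ∀ s t → thin y s ≡ t → χ t ≤ χ (S y true s ∧ not (fullᵇ (S y true) s)) + χ (S y false s ∧ not (fullᵇ (S y false) s))
        go s false _ = z≤n
        go s true  e = from (nb⇒S (proj₁ (∧-true e)))
          where
          not-full : ∀ b → not (fullᵇ (S y b) s) ≡ true
          not-full b = cong not (¬true⇒false (λ f → true≢false (⇒thick (full-thick {y} {b} (fullᵇ⇒ {S y b} {s} f))) (not-true (proj₂ (∧-true {nb y s} e)))))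
          from : (∃ λ b → S y b s ≡ true) → 1 ≤ χ (S y true s ∧ not (fullᵇ (S y true) s)) + χ (S y false s ∧ not (fullᵇ (S y false) s))
          from (true  , p) = ≤-trans (true⇒χ (∧-intro p (not-full true))) (m≤m+n _ _)
          from (false , p) = ≤-trans (true⇒χ (∧-intro p (not-full false))) (m≤n+m _ _)

    τ : ℕ
    τ = # (thin u₀)

    #thin : ∀ y → # (thin y) ≡ τ
    #thin y = coh-row coh-thin y u₀

    module _ {y v : Fin n} (yv : far y v ≡ true) where

      corner : Bool → Bool → Fin n → Bool
      corner b e x = ((nb y x ∧ nb v x) ∧ (thick y x ∧ thick v x)) ∧ (fullᵇ (S y b) x ∧ fullᵇ (S v e) x)

      -- Two such vertices would both be adjacent to nearly all of `S y b` and `S v e`, which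
      -- together have 92% of ρ by `covered` and overlap in at most μ vertices. That is too many
      -- common neighbours for far vertices and for neighbours alike.
      corner≤1 : ∀ b e → # (corner b e) ≤ 1
      corner≤1 b e = #≤1 (corner b e) unique
        where
        unique : ∀ x x′ → corner b e x ≡ true → corner b e x′ ≡ true → x ≡ x′
        unique x x′ p p′ = decide (x Fin.≟ x′) (far x x′) refl
          where
          nbs : ∀ {x} → corner b e x ≡ true → nb y x ∧ nb v x ≡ true
          nbs p = proj₁ (∧-true (proj₁ (∧-true p)))
          thicks : ∀ {x} → corner b e x ≡ true → thick y x ∧ thick v x ≡ true
          thicks {x} p = proj₂ (∧-true {nb y x ∧ nb v x} (proj₁ (∧-true p)))
          fulls : ∀ {x} → corner b e x ≡ true → fullᵇ (S y b) x ∧ fullᵇ (S v e) x ≡ true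
          fulls {x} p = proj₂ (∧-true {(nb y x ∧ nb v x) ∧ (thick y x ∧ thick v x)} p)
          full₁ : ∀ {x} → corner b e x ≡ true → Full (S y b) x
          full₁ {x} p = fullᵇ⇒ {S y b} {x} (proj₁ (∧-true (fulls p)))
          full₂ : ∀ {x} → corner b e x ≡ true → Full (S v e) x
          full₂ {x} p = fullᵇ⇒ {S v e} {x} (proj₂ (∧-true {fullᵇ (S y b) x} (fulls p)))
          sizes : 100 * ρ ≤ 100 * # (S y b) + 100 * # (S v e) + 8 * ρ
          sizes = covered yv (proj₁ (∧-true (nbs p))) (proj₂ (∧-true {nb y x} (nbs p))) (thick⇒ (proj₁ (∧-true (thicks p)))) (thick⇒ (proj₂ (∧-true {thick y x} (thicks p)))) (full₁ p) (full₂ p)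
          z : Fin n → ℕ
          z s = χ (nb x s) * χ (nb s x′)
          union : sum (λ s → χ (S y b s) * z s) + sum (λ s → χ (S v e s) * z s) ≤ cn x x′ + μ
          union = ≤-trans (≤-reflexive (sym (sum-+ (λ s → χ (S y b s) * z s) (λ s → χ (S v e s) * z s)))) (≤-trans (sum-mono (λ s → go s (S y b s) (S v e s) refl refl))
              (≤-reflexive (trans (sum-+ z (λ s → χ (nb y s) * χ (nb s v))) (cong (cn x x′ +_) (cn-far yv)))))
            where
            z≤1 : ∀ s → z s ≤ 1
            z≤1 s = *-mono-≤ (χ≤1 (nb x s)) (χ≤1 (nb s x′))
            go : ∀ s a b′ → S y b s ≡ a → S v e s ≡ b′ → χ a * z s + χ b′ * z s ≤ z s + χ (nb y s) * χ (nb s v)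
            go s false false _ _ = z≤n
            go s false true  _ _ = ≤-trans (≤-reflexive (+-identityʳ (z s))) (m≤m+n _ _)
            go s true  false _ _ = ≤-trans (≤-reflexive (trans (+-identityʳ _) (+-identityʳ (z s)))) (m≤m+n _ _)
            go s true  true  p q = ≤-trans (≤-reflexive (cong₂ _+_ (+-identityʳ (z s)) (+-identityʳ (z s)))) (+-monoʳ-≤ (z s) (≤-trans (z≤1 s) (≤-reflexive (sym (both⇒χ*χ (S⇒nb y b p) (trans (nb-sym s v) (S⇒nb v e q)))))))
          many : 84 * ρ ≤ 100 * cn x x′ + 100 * μ
          many = lin (ρ ∷ # (S y b) ∷ # (S v e) ∷ cn x x′ ∷ μ ∷ sum (λ s → χ (S y b s) * z s) ∷ sum (λ s → χ (S v e s) * z s) ∷ nf (S y b) x ∷ nf (S y b) x′ ∷ nf (S v e) x ∷ nf (S v e) x′ ∷ []) 0 (κ 84 ⊗ x₀ ≼ κ 100 ⊗ x₃ ⊕ κ 100 ⊗ x₄) ((κ 1 , κ 100 ⊗ x₀ ≼ κ 100 ⊗ x₁ ⊕ κ 100 ⊗ x₂ ⊕ κ 8 ⊗ x₀) ∷ (κ 100 , x₁ ≼ x₅ ⊕ x₇ ⊕ x₈) ∷ (κ 100 , x₂ ≼ x₆ ⊕ x₉ ⊕ x₁₀) ∷ (κ 100 , x₅ ⊕ x₆ ≼ x₃ ⊕ x₄) ∷ (κ 1 , κ 100 ⊗ x₇ ≼ κ 2 ⊗ x₀) ∷ (κ 1 , κ 100 ⊗ x₈ ≼ κ 2 ⊗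 x₀) ∷ (κ 1 , κ 100 ⊗ x₉ ≼ κ 2 ⊗ x₀) ∷ (κ 1 , κ 100 ⊗ x₁₀ ≼ κ 2 ⊗ x₀) ∷ []) refl (sizes , shared (S y b) x x′ , shared (S v e) x x′ , union , full-≤ (S y b) x (full₁ p) , full-≤ (S y b) x′ (full₁ p′) , full-≤ (S v e) x (full₂ p) , full-≤ (S v e) x′ (full₂ p′) , tt)
          decide : Dec (x ≡ x′) → ∀ f → far x x′ ≡ f → x ≡ x′
          decide (yes eq) _ _ = eq
          decide (no ne) true  f = 1≰0 (lin (ρ ∷ μ ∷ cn x x′ ∷ h ∷ []) 50398 (κ 1 ≼ κ 0) ((κ 600 , κ 84 ⊗ x₀ ≼ κ 100 ⊗ x₂ ⊕ κ 100 ⊗ x₁) ∷ (κ 60000 , x₂ ≼ x₁) ∷ (κ 1 , x₃ ⊗ x₁ ≼ x₀) ∷ (x₁ , κ 120000 ≼ x₃) ∷ (κ 50399 , κ 1 ≼ x₀) ∷ []) refl (many , ≤-reflexive (cn-far f) , hμ≤ρ , h≥ , ρ≥1 , tt))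
          decide (no ne) false f = 1≰0 (lin (ρ ∷ μ ∷ cn x x′ ∷ h ∷ []) 15598 (κ 1 ≼ κ 0) ((κ 900 , κ 84 ⊗ x₀ ≼ κ 100 ⊗ x₂ ⊕ κ 100 ⊗ x₁) ∷ (κ 30000 , κ 3 ⊗ x₂ ≼ κ 2 ⊗ x₀ ⊕ x₁) ∷ (κ 1 , x₃ ⊗ x₁ ≼ x₀) ∷ (x₁ , κ 120000 ≼ x₃) ∷ (κ 15599 , κ 1 ≼ x₀) ∷ []) refl (many , 3λ≤2ρ+μ (≢∧¬far⇒nb ne f) , hμ≤ρ , h≥ , ρ≥1 , tt))

      K₁ K₂ : ℕ
      K₁ = sum (λ w → χ (thin y w) * χ (nb w v))
      K₂ = sum (λ w → χ (nb y w) * χ (thin w v))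

      NK₁≤ : N * K₁ ≤ τ * ρ
      NK₁≤ = begin
        N * K₁ ≡⟨ far-const {λ y v → sum (λ w → χ (thin y w) * χ (nb w v))} (coh-∘ coh-thin coh-nb) y yv ⟨
        sum (λ v → χ (far y v) * sum (λ w → χ (thin y w) * χ (nb w v))) ≤⟨ sum-far-≤ y (λ v → sum (λ w → χ (thin y w) * χ (nb w v))) ⟩
        sum (λ v → sum (λ w → χ (thin y w) * χ (nb w v))) ≤⟨ sum-paths-≤ (χ ∘ thin y) (λ w v → χ (nb w v)) ρ (λ w → ≤-reflexive (#nb w)) ⟩
        # (thin y) * ρ ≡⟨ cong (_* ρ) (#thin y) ⟩
        τ * ρ ∎
        where open ≤-Reasoning

      NK₂≤ : N * K₂ ≤ ρ * τ
      NK₂≤ = begin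
        N * K₂ ≡⟨ far-const {λ y v → sum (λ w → χ (nb y w) * χ (thin w v))} (coh-∘ coh-nb coh-thin) y yv ⟨
        sum (λ v → χ (far y v) * sum (λ w → χ (nb y w) * χ (thin w v))) ≤⟨ sum-far-≤ y (λ v → sum (λ w → χ (nb y w) * χ (thin w v))) ⟩
        sum (λ v → sum (λ w → χ (nb y w) * χ (thin w v))) ≤⟨ sum-paths-≤ (χ ∘ nb y) (λ w v → χ (thin w v)) τ (λ w → ≤-reflexive (#thin w)) ⟩
        # (nb y) * τ ≡⟨ cong (_* τ) (#nb y) ⟩
        ρ * τ ∎
        where open ≤-Reasoning

      μ≤4+K : μ ≤ 4 + K₁ + K₂
      μ≤4+K = begin
        μ ≡⟨ cn-far yv ⟨
        cn y v ≤⟨ sum-mono per ⟩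
        sum (λ w → C true true w + C true false w + C false true w + C false false w + χ (thin y w) * χ (nb w v) + χ (nb y w) * χ (thin w v))
          ≡⟨ sum-+ (λ w → C true true w + C true false w + C false true w + C false false w + χ (thin y w) * χ (nb w v)) (λ w → χ (nb y w) * χ (thin w v)) ⟩
        sum (λ w → C true true w + C true false w + C false true w + C false false w + χ (thin y w) * χ (nb w v)) + K₂
          ≡⟨ cong (_+ K₂) (trans (sum-+ (λ w → C true true w + C true false w + C false true w + C false false w) (λ w → χ (thin y w) * χ (nb w v))) (cong (_+ K₁)
             (trans (sum-+ (λ w → C true true w + C true false w + C false true w) (C false false)) (cong (_+ sum (C false false))
               (trans (sum-+ (λ w → C true true w + C true false w) (C false true)) (cong (_+ sum (C false true)) (sum-+ (C true true) (C true false)))))))) ⟩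
        sum (C true true) + sum (C true false) + sum (C false true) + sum (C false false) + K₁ + K₂
          ≤⟨ +-monoˡ-≤ K₂ (+-monoˡ-≤ K₁ (+-mono-≤ (+-mono-≤ (+-mono-≤ (corner≤1 true true) (corner≤1 true false)) (corner≤1 false true)) (corner≤1 false false))) ⟩
        4 + K₁ + K₂ ∎
        where
        open ≤-Reasoning
        C : Bool → Bool → Fin n → ℕ
        C b e w = χ (corner b e w)
        pick : ∀ b e w → C b e w ≤ C true true w + C true false w + C false true w + C false false w
        pick true  true  w = lin (C true true w ∷ C true false w ∷ C false true w ∷ C false false w ∷ []) 0 (x₀ ≼ x₀ ⊕ x₁ ⊕ x₂ ⊕ x₃) [] refl tt
        pick true  false w = lin (C true true w ∷ C true false w ∷ C false true w ∷ C false false w ∷ []) 0 (x₁ ≼ x₀ ⊕ x₁ ⊕ x₂ ⊕ x₃) [] refl tt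
        pick false true  w = lin (C true true w ∷ C true false w ∷ C false true w ∷ C false false w ∷ []) 0 (x₂ ≼ x₀ ⊕ x₁ ⊕ x₂ ⊕ x₃) [] refl tt
        pick false false w = lin (C true true w ∷ C true false w ∷ C false true w ∷ C false false w ∷ []) 0 (x₃ ≼ x₀ ⊕ x₁ ⊕ x₂ ⊕ x₃) [] refl tt
        per : ∀ w → χ (nb y w) * χ (nb w v) ≤ C true true w + C true false w + C false true w + C false false w + χ (thin y w) * χ (nb w v) + χ (nb y w) * χ (thin w v)
        per w = go (nb y w) (nb w v) (thick y w) (thick w v) refl refl refl refl
          where
          go : ∀ p q s t → nb y w ≡ p → nb w v ≡ q → thick y w ≡ s → thick w v ≡ t →
               χ p * χ q ≤ C true true w + C true false w + C false true w + C false false w + χ (p ∧ not s) * χ q + χ p * χ (q ∧ not t)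
          go false q s t _ _ _ _ = z≤n
          go true false s t _ _ _ _ = z≤n
          go true true false t _ _ _ _ = ≤-trans (m≤n+m 1 (C true true w + C true false w + C false true w + C false false w)) (m≤m+n _ _)
          go true true true false _ _ _ _ = m≤n+m 1 _
          go true true true true p q s t = from (thick-full (thick⇒ s)) (thick-full (thick-sym (thick⇒ t)))
            where
            from : (∃ λ b → Full (S y b) w) → (∃ λ e → Full (S v e) w) →
                   1 ≤ C true true w + C true false w + C false true w + C false false w + χ (true ∧ not true) * χ true + χ true * χ (true ∧ not true)
            from (b , f) (e , f′) = ≤-trans (≤-trans (true⇒χ {corner b e w} (∧-intro (∧-intro (∧-intro p (trans (nb-sym v w) q)) (∧-intro s (trans (thick-sym-≡ v w) t))) (∧-intro (⇒fullᵇ {S y b} {w} f) (⇒fullᵇ {S v e} {w} f′))))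
                  (pick b e w)) (≤-reflexive (sym (trans (+-identityʳ _) (+-identityʳ _))))

      -- Count walks of two neighbour steps from y that end far from y: at least a quarter of each
      -- N(w) is far from y, and each far endpoint is reached μ times.
      ρρ≤4Nμ : ρ * ρ ≤ 4 * (N * μ)
      ρρ≤4Nμ = begin
        ρ * ρ ≡⟨ cong (_* ρ) (#nb y) ⟨
        # (nb y) * ρ ≡⟨ sum-*ʳ ρ (χ ∘ nb y) ⟨
        sum (λ w → χ (nb y w) * ρ) ≤⟨ pointwise-max (nb y) (λ _ → ρ) (λ w → 4 * sum (λ v → χ (nb w v) * χ (far y v))) (λ w → many) ⟩
        sum (λ w → χ (nb y w) * (4 * sum (λ v → χ (nb w v) * χ (far y v)))) ≡⟨ sum-cong-≗ (λ w → trans (sym (*-assoc (χ (nb y w)) 4 _)) (trans (cong (_* sum (λ v → χ (nb w v) * χ (far y v))) (*-comm (χ (nb y w)) 4)) (*-assoc 4 (χ (nb y w)) _))) ⟩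
        sum (λ w → 4 * (χ (nb y w) * sum (λ v → χ (nb w v) * χ (far y v)))) ≡⟨ sum-*ˡ 4 (λ w → χ (nb y w) * sum (λ v → χ (nb w v) * χ (far y v))) ⟩
        4 * sum (λ w → χ (nb y w) * sum (λ v → χ (nb w v) * χ (far y v))) ≡⟨ cong (4 *_) (sum-paths (χ ∘ nb y) (λ w v → χ (nb w v) * χ (far y v))) ⟨
        4 * sum (λ v → sum (λ w → χ (nb y w) * (χ (nb w v) * χ (far y v)))) ≡⟨ cong (4 *_) (sum-cong-≗ (λ v → trans (sum-cong-≗ (λ w → sym (*-assoc (χ (nb y w)) (χ (nb w v)) (χ (far y v))))) (trans (sum-*ʳ (χ (far y v)) (λ w → χ (nb y w) * χ (nb w v))) (*-comm (cn y v) (χ (far y v)))))) ⟩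
        4 * sum (λ v → χ (far y v) * cn y v) ≡⟨ cong (4 *_) (trans (far-const coh-cn y yv) (cong (N *_) (cn-far yv))) ⟩
        4 * (N * μ) ∎
        where
        open ≤-Reasoning
        many : ∀ {w} → nb y w ≡ true → ρ ≤ 4 * sum (λ v → χ (nb w v) * χ (far y v))
        many {w} yw = lin (ρ ∷ N-diff w y ∷ cn w y ∷ sum (λ v → χ (nb w v) * χ (far y v)) ∷ μ ∷ h ∷ []) 119995 (x₀ ≼ κ 4 ⊗ x₃) ((κ 360000 , x₁ ≼ x₃ ⊕ κ 1) ∷ (κ 360000 , x₀ ≼ x₁ ⊕ x₂) ∷ (κ 120000 , κ 3 ⊗ x₂ ≼ κ 2 ⊗ x₀ ⊕ x₄) ∷ (κ 1 , x₅ ⊗ x₄ ≼ x₀) ∷ (x₄ ⊕ κ 3 , κ 120000 ≼ x₅) ∷ (κ 3 , x₅ ≼ x₀) ∷ []) refl (bound , ≤-reflexive (sym (N-diff-cn w y)) , 3λ≤2ρ+μ (trans (nb-sym w y) yw) , hμ≤ρ , h≥ , h≤ρ , tt)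
          where
          bound : N-diff w y ≤ sum (λ v → χ (nb w v) * χ (far y v)) + 1
          bound = ≤-trans (sum-mono (λ v → each (nb w v) (y == v) (far y v))) (≤-reflexive (trans (sum-+ (λ v → χ (nb w v) * χ (far y v)) (λ v → χ (y == v))) (cong (sum (λ v → χ (nb w v) * χ (far y v)) +_)
               (trans (sum-cong-≗ (λ s → sym (*-identityʳ (χ (y == s))))) (sum-δ (λ _ → 1) y)))))
            where
            each : ∀ a e f → χ (a ∧ not (not e ∧ not f)) ≤ χ a * χ f + χ e
            each false e     f     = z≤n
            each true  true  f     = ≤-trans (χ≤1 _) (m≤n+m 1 (1 * χ f))
            each true  false true  = s≤s z≤n
            each true  false false = z≤n

    -- Each of the four corners holds at most one common neighbour. Those on a thin edge number at
    -- most 16μ/100 by averaging over far pairs, so 84μ ≤ 400.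
    μ≤4 : μ ≤ 4
    μ≤4 = from far-pair
      where
      from : (∃ λ v → far u₀ v ≡ true) → μ ≤ 4
      from (v , f) = ≮⇒≥ (λ lt → 1≰0 (lin (μ ∷ K₁ f ∷ K₂ f ∷ []) 19 (κ 1 ≼ κ 0) ((κ 100 , x₀ ≼ κ 4 ⊕ x₁ ⊕ x₂) ∷ (κ 1 , κ 100 ⊗ (x₁ ⊕ x₂) ≼ κ 16 ⊗ x₀) ∷ (κ 84 , κ 5 ≼ x₀) ∷ []) refl (μ≤4+K f , few , lt , tt)))
        where
        few : 100 * (K₁ f + K₂ f) ≤ 16 * μ
        few = *-cancelˡ-≤ N ⦃ >-nonZero N>0 ⦄ (lin (N ∷ K₁ f ∷ K₂ f ∷ μ ∷ ρ ∷ τ ∷ []) 0 (x₀ ⊗ (κ 100 ⊗ (x₁ ⊕ x₂)) ≼ x₀ ⊗ (κ 16 ⊗ x₃)) ((κ 100 , x₀ ⊗ x₁ ≼ x₅ ⊗ x₄) ∷ (κ 100 , x₀ ⊗ x₂ ≼ x₄ ⊗ x₅) ∷ (κ 2 ⊗ x₄ , κ 100 ⊗ x₅ ≼ κ 2 ⊗ x₄) ∷ (κ 4 , x₄ ⊗ x₄ ≼ κ 4 ⊗ (x₀ ⊗ x₃)) ∷ []) refl (NK₁≤ f , NK₂≤ f , few-thin u₀ , ρρ≤4Nμ f , tt))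

    ρρ≤16N : ρ * ρ ≤ 16 * N
    ρρ≤16N = from far-pair
      where
      from : (∃ λ v → far u₀ v ≡ true) → ρ * ρ ≤ 16 * N
      from (v , f) = lin (ρ ∷ N ∷ μ ∷ []) 0 (x₀ ⊗ x₀ ≼ κ 16 ⊗ x₁) ((κ 1 , x₀ ⊗ x₀ ≼ κ 4 ⊗ (x₁ ⊗ x₂)) ∷ (κ 4 ⊗ x₁ , x₂ ≼ κ 4) ∷ []) refl (ρρ≤4Nμ f , μ≤4 , tt)

    -- Thinness depends on the colour, and μ ≤ 4 forces every neighbour colour to have valency at
    -- least ρ/16, more than the ρ/50 thin vertices available.
    all-thick : ∀ {a b} → nb a b ≡ true → thick a b ≡ true
    all-thick {a} {b} ab = go (thick a b) refl
      where
      go : ∀ t → thick a b ≡ t → t ≡ true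
      go true  _ = refl
      go false e = 1≰0 (*-cancelˡ-≤ (ρ * ρ) ⦃ >-nonZero (*-mono-< ρ≥1 ρ≥1) ⦄
        (lin (ρ ∷ N ∷ τ ∷ valency a b ∷ []) 16 (x₀ ⊗ x₀ ⊗ κ 1 ≼ x₀ ⊗ x₀ ⊗ κ 0) ((κ 25 , x₀ ⊗ x₀ ≼ κ 16 ⊗ x₁) ∷ (κ 400 , x₁ ≼ x₀ ⊗ x₃) ∷ (κ 400 ⊗ x₀ , x₃ ≼ x₂) ∷ (κ 4 ⊗ x₀ , κ 100 ⊗ x₂ ≼ κ 2 ⊗ x₀) ∷ []) refl (ρρ≤16N , N≤ρ*valency ab , val≤τ , few-thin u₀ , tt)))
        where
        val≤τ : valency a b ≤ τ
        val≤τ = ≤-trans (#-mono {p = λ w → c a w == c a b} {thin a} (λ w p → trans (thin-coh (==⇒≡ {x = c a w} {c a b} p)) (∧-intro ab (cong not e)))) (≤-reflexive (#thin a))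

    label : Fin n → Fin n → Bool
    label y x = fullᵇ (S y true) x

    label-full : ∀ {y x} → nb y x ≡ true → Full (S y (label y x)) x
    label-full {y} {x} yx = go (label y x) refl (thick-full (thick⇒ (all-thick yx)))
      where
      go : ∀ t → label y x ≡ t → (∃ λ b → Full (S y b) x) → Full (S y t) x
      go true  e _ = fullᵇ⇒ {S y true} {x} e
      go false e (true  , f) = ⊥-elim (true≢false (⇒fullᵇ {S y true} {x} f) e)
      go false e (false , f) = f

    full-label : ∀ {y x} → nb y x ≡ true → ∀ b → Full (S y b) x → label y x ≡ b
    full-label {y} {x} yx true  f = ⇒fullᵇ {S y true} {x} f
    full-label {y} {x} yx false f = ¬true⇒false (λ e → not-both yx true (fullᵇ⇒ {S y true} {x} e) f)

    clique : Fin n → Bool → Fin n → Bool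
    clique y b x = nb y x ∧ agree b (label y x)

    clique⇒ : ∀ {y b x} → clique y b x ≡ true → nb y x ≡ true × label y x ≡ b
    clique⇒ {y} {b} {x} e = proj₁ (∧-true e) , agree⇒ (proj₂ (∧-true {nb y x} e))

    ⇒clique : ∀ {y b x} → nb y x ≡ true → label y x ≡ b → clique y b x ≡ true
    ⇒clique p q = ∧-intro p (agree-refl q)

    clique-nb : ∀ {y x x′} → nb y x ≡ true → nb y x′ ≡ true → label y x ≡ label y x′ → x ≢ x′ → nb x x′ ≡ true
    clique-nb {y} {x} {x′} p q e ne = ≢∧¬far⇒nb ne (¬true⇒false (λ f → full-far (label-full p) (subst (λ b → Full (S y b) x′) (sym e) (label-full q)) f))

    -- A side has at least ρ/4 members and loses at most ρ/100. Of this large number only 20 is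
    -- recorded, to pick distinct vertices from later.
    clique-size : ∀ y b → 20 ≤ # (clique y b)
    clique-size y b = lin (ρ ∷ h ∷ # (S y b) ∷ # (λ s → S y b s ∧ not (fullᵇ (S y b) s)) ∷ # (clique y b) ∷ []) 143999 (κ 20 ≼ x₄) ((κ 100 , x₂ ≼ x₃ ⊕ x₄) ∷ (κ 1 , κ 100 ⊗ x₃ ≼ x₀) ∷ (κ 25 , x₀ ≼ κ 4 ⊗ x₂) ∷ (κ 24 , x₁ ≼ x₀) ∷ (κ 24 , κ 120000 ≼ x₁) ∷ []) refl (bound , Side.mostly (Sides.side (all y) b) , large y b , h≤ρ , h≥ , tt)
      where
      bound : # (S y b) ≤ # (λ s → S y b s ∧ not (fullᵇ (S y b) s)) + # (clique y b)
      bound = ≤-trans (sum-mono (λ s → go s (S y b s) (fullᵇ (S y b) s) refl refl)) (≤-reflexive (sum-+ (λ s → χ (S y b s ∧ not (fullᵇ (S y b) s))) (χ ∘ clique y b)))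
        where
        go : ∀ s p f → S y b s ≡ p → fullᵇ (S y b) s ≡ f → χ p ≤ χ (p ∧ not f) + χ (clique y b s)
        go s false f     _ _ = z≤n
        go s true  false _ _ = s≤s z≤n
        go s true  true  p q = true⇒χ (⇒clique {y} {b} {s} (S⇒nb y b p) (full-label (S⇒nb y b p) b (fullᵇ⇒ {S y b} {s} q)))

    -- x is not adjacent to the whole opposite clique, or it would have ρ - 1 common neighbours with
    -- y. A member x′ of that clique not adjacent to x is far from x, and y and the counted z are
    -- among their μ ≤ 4 common neighbours.
    clique-cross : ∀ {y b x} → clique y b x ≡ true → # (λ z → clique y (not b) z ∧ nb x z) ≤ 3
    clique-cross {y} {b} {x} e = from (any? (λ z → clique y (not b) z ∧ not (nb x z)))
      where
      yx : nb y x ≡ true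
      yx = proj₁ (clique⇒ {y} {b} {x} e)
      lx : label y x ≡ b
      lx = proj₂ (clique⇒ {y} {b} {x} e)
      b≢not : ∀ {b} → b ≢ not b
      b≢not {true}  ()
      b≢not {false} ()
      bool : ∀ l b → l ≢ b → l ≡ not b
      bool true  true  ne = ⊥-elim (ne refl)
      bool true  false ne = refl
      bool false true  ne = refl
      bool false false ne = ⊥-elim (ne refl)
      from : (∃ λ z → clique y (not b) z ∧ not (nb x z) ≡ true) ⊎ (∀ z → clique y (not b) z ∧ not (nb x z) ≡ false) → # (λ z → clique y (not b) z ∧ nb x z) ≤ 3
      from (inj₁ (x′ , q)) = ≤-pred (≤-trans (≤-trans (s≤s ≤-refl) bound) μ≤4)
        where
        cx′ : nb y x′ ≡ true × label y x′ ≡ not b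
        cx′ = clique⇒ {y} {not b} {x′} (proj₁ (∧-true q))
        x≢x′ : x ≢ x′
        x≢x′ refl = b≢not (trans (sym lx) (proj₂ cx′))
        f : far x x′ ≡ true
        f = go (far x x′) refl
          where
          go : ∀ t → far x x′ ≡ t → t ≡ true
          go true  _ = refl
          go false p = ⊥-elim (true≢false (≢∧¬far⇒nb x≢x′ p) (not-true (proj₂ (∧-true {clique y (not b) x′} q))))
        bound : 1 + # (λ z → clique y (not b) z ∧ nb x z) ≤ μ
        bound = begin
          1 + # (λ z → clique y (not b) z ∧ nb x z) ≡⟨ cong (_+ # (λ z → clique y (not b) z ∧ nb x z)) (sym (trans (sum-cong-≗ (λ z → sym (*-identityʳ (χ (y == z))))) (sum-δ (λ _ → 1) y))) ⟩
          sum (λ z → χ (y == z)) + # (λ z → clique y (not b) z ∧ nb x z) ≡⟨ sum-+ (λ z → χ (y == z)) (λ z → χ (clique y (not b) z ∧ nb x z)) ⟨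
          sum (λ z → χ (y == z) + χ (clique y (not b) z ∧ nb x z)) ≤⟨ sum-mono (λ z → go z (y == z) (clique y (not b) z) (nb x z) refl refl refl) ⟩
          cn x x′ ≡⟨ cn-far f ⟩
          μ ∎
          where
          open ≤-Reasoning
          go : ∀ z p k t → (y == z) ≡ p → clique y (not b) z ≡ k → nb x z ≡ t → χ p + χ (k ∧ t) ≤ χ (nb x z) * χ (nb z x′)
          go z true  k t p k′ t′ with ==⇒≡ {x = y} {z} p
          ... | refl = ≤-trans (≤-reflexive (cong (λ i → 1 + χ i) (trans (cong (_∧ t) (trans (sym k′) (cong (_∧ agree (not b) (label y y)) (nb-irrefl y)))) refl))) (≤-reflexive (sym (both⇒χ*χ (trans (nb-sym x y) yx) (proj₁ cx′))))
          go z false false t _ _ _ = z≤n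
          go z false true false _ _ _ = z≤n
          go z false true true _ k t = ≤-reflexive (sym (both⇒χ*χ t (clique-nb (proj₁ cz) (proj₁ cx′) (trans (proj₂ cz) (sym (proj₂ cx′))) (λ { refl → true≢false f (nb⇒¬far t) }))))
            where
            cz : nb y z ≡ true × label y z ≡ not b
            cz = clique⇒ {y} {not b} {z} k
      from (inj₂ none) = 1≰0 (lin (ρ ∷ cn y x ∷ μ ∷ h ∷ []) 14399519999 (κ 1 ≼ κ 0) ((κ 360000 , x₀ ≼ x₁ ⊕ κ 1) ∷ (κ 120000 , κ 3 ⊗ x₁ ≼ κ 2 ⊗ x₀ ⊕ x₂) ∷ (κ 1 , x₃ ⊗ x₂ ≼ x₀) ∷ (x₂ ⊕ κ 119999 , κ 120000 ≼ x₃) ∷ (κ 119999 , x₃ ≼ x₀) ∷ []) refl (bound , 3λ≤2ρ+μ yx , hμ≤ρ , h≥ , h≤ρ , tt))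
        where
        bound : ρ ≤ cn y x + 1
        bound = ≤-trans (≤-reflexive (sym (#nb y))) (≤-trans (sum-mono (λ z → go z (nb y z) (x == z) refl refl)) (≤-reflexive (trans (sum-+ (λ z → χ (nb y z) * χ (nb z x)) (λ z → χ (x == z))) (cong (cn y x +_)
              (trans (sum-cong-≗ (λ z → sym (*-identityʳ (χ (x == z))))) (sum-δ (λ _ → 1) x))))))
          where
          go : ∀ z p t → nb y z ≡ p → (x == z) ≡ t → χ p ≤ χ p * χ (nb z x) + χ t
          go z false t     _ _ = z≤n
          go z true  true  _ _ = m≤n+m 1 (1 * χ (nb z x))
          go z true  false p t = ≤-trans (≤-reflexive (sym (cong (λ i → 1 * χ i) zx))) (m≤m+n _ 0)
            where
            decide : ∀ l → label y z ≡ l → nb x z ≡ true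
            decide l e′ with l Data.Bool.≟ b
            ... | yes refl = clique-nb yx p (trans lx (sym e′)) (==⇒≢ {x = x} {z} t)
            ... | no ne = ≡true (nb x z) refl
              where
              ≡true : ∀ i → nb x z ≡ i → i ≡ true
              ≡true true  _ = refl
              ≡true false i = ⊥-elim (true≢false (∧-intro (⇒clique {y} {not b} {z} p (trans e′ (bool l b ne))) (cong not i)) (none z))
            zx : nb z x ≡ true
            zx = trans (nb-sym z x) (decide (label y z) refl)

-- Finite quotients and enumerations

record Quotient {k : ℕ} (_~_ : Fin k → Fin k → Bool) : Set where
  field
    size  : ℕ
    class : Fin k → Fin size
    rep   : Fin size → Fin k
    class-rep : ∀ j → class (rep j) ≡ j
    sound     : ∀ x y → (x ~ y) ≡ true → class x ≡ class y
    complete  : ∀ x y → class x ≡ class y → (x ~ y) ≡ true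

quotient : ∀ {k} (_~_ : Fin k → Fin k → Bool) → (∀ x → (x ~ x) ≡ true) → (∀ x y → (x ~ y) ≡ true → (y ~ x) ≡ true) →
           (∀ x y z → (x ~ y) ≡ true → (y ~ z) ≡ true → (x ~ z) ≡ true) → Quotient _~_
quotient {zero} _~_ r s t = record { size = 0 ; class = λ () ; rep = λ () ; class-rep = λ () ; sound = λ () ; complete = λ () }
quotient {suc k} _~_ r s t = extend (any? (λ y → zero ~ suc y))
  where
  Q : Quotient (λ x y → suc x ~ suc y)
  Q = quotient (λ x y → suc x ~ suc y) (λ x → r (suc x)) (λ x y → s (suc x) (suc y)) (λ x y z → t (suc x) (suc y) (suc z))
  open Quotient Q
  extend : (∃ λ y → (zero ~ suc y) ≡ true) ⊎ (∀ y → (zero ~ suc y) ≡ false) → Quotient _~_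
  extend (inj₁ (y , e)) = record { size = size ; class = cl ; rep = λ j → suc (rep j) ; class-rep = class-rep ; sound = snd ; complete = cmp }
    where
    cl : Fin (suc k) → Fin size
    cl zero    = class y
    cl (suc x) = class x
    snd : ∀ a b → (a ~ b) ≡ true → cl a ≡ cl b
    snd zero zero _ = refl
    snd zero (suc b) p = sound y b (t (suc y) zero (suc b) (s zero (suc y) e) p)
    snd (suc a) zero p = sound a y (t (suc a) zero (suc y) p e)
    snd (suc a) (suc b) p = sound a b p
    cmp : ∀ a b → cl a ≡ cl b → (a ~ b) ≡ true
    cmp zero zero _ = r zero
    cmp zero (suc b) p = t zero (suc y) (suc b) e (complete y b p)
    cmp (suc a) zero p = t (suc a) (suc y) zero (complete a y p) (s zero (suc y) e)
    cmp (suc a) (suc b) p = complete a b p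
  extend (inj₂ none) = record { size = suc size ; class = cl ; rep = rp ; class-rep = cr ; sound = snd ; complete = cmp }
    where
    cl : Fin (suc k) → Fin (suc size)
    cl zero    = zero
    cl (suc x) = suc (class x)
    rp : Fin (suc size) → Fin (suc k)
    rp zero    = zero
    rp (suc j) = suc (rep j)
    cr : ∀ j → cl (rp j) ≡ j
    cr zero    = refl
    cr (suc j) = cong suc (class-rep j)
    snd : ∀ a b → (a ~ b) ≡ true → cl a ≡ cl b
    snd zero zero _ = refl
    snd zero (suc b) p = ⊥-elim (true≢false p (none b))
    snd (suc a) zero p = ⊥-elim (true≢false (s (suc a) zero p) (none a))
    snd (suc a) (suc b) p = cong suc (sound a b p)
    cmp : ∀ a b → cl a ≡ cl b → (a ~ b) ≡ true
    cmp zero zero _ = r zero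
    cmp (suc a) (suc b) p = complete a b (Fin.suc-injective p)

record Enumeration {m : ℕ} (p : Fin m → Bool) (size : ℕ) : Set where
  field
    elem   : Fin size → Fin m
    elem∈  : ∀ i → p (elem i) ≡ true
    index  : ∀ x → p x ≡ true → Fin size
    elem-index : ∀ x e → elem (index x e) ≡ x
    elem-injective : ∀ i j → elem i ≡ elem j → i ≡ j

enumerate : ∀ {m} (p : Fin m → Bool) → Enumeration p (# p)
enumerate {zero} p = record { elem = λ () ; elem∈ = λ () ; index = λ () ; elem-index = λ () ; elem-injective = λ () }
enumerate {suc m} p = extend (p zero) refl
  where
  open Enumeration (enumerate (p ∘ suc))
  extend : ∀ b → p zero ≡ b → Enumeration p (χ b + # (p ∘ suc))
  extend true e = record { elem = el ; elem∈ = el∈ ; index = ix ; elem-index = ei ; elem-injective = inj }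
    where
    el : Fin (suc (# (p ∘ suc))) → Fin (suc m)
    el zero    = zero
    el (suc i) = suc (elem i)
    el∈ : ∀ i → p (el i) ≡ true
    el∈ zero    = e
    el∈ (suc i) = elem∈ i
    ix : ∀ x → p x ≡ true → Fin (suc (# (p ∘ suc)))
    ix zero    _ = zero
    ix (suc x) q = suc (index x q)
    ei : ∀ x q → el (ix x q) ≡ x
    ei zero    q = refl
    ei (suc x) q = cong suc (elem-index x q)
    inj : ∀ i j → el i ≡ el j → i ≡ j
    inj zero    zero    _ = refl
    inj (suc i) (suc j) q = cong suc (elem-injective i j (Fin.suc-injective q))
  extend false e = record { elem = suc ∘ elem ; elem∈ = elem∈ ; index = ix ; elem-index = ei ; elem-injective = λ i j q → elem-injective i j (Fin.suc-injective q) }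
    where
    ix : ∀ x → p x ≡ true → Fin (# (p ∘ suc))
    ix zero    q = ⊥-elim (true≢false q e)
    ix (suc x) q = index x q
    ei : ∀ x q → suc (elem (ix x q)) ≡ x
    ei zero    q = ⊥-elim (true≢false q e)
    ei (suc x) q = cong suc (elem-index x q)

-- Line graphs

agree-refl′ : ∀ b → agree b b ≡ true
agree-refl′ b = agree-refl {b} refl

module LineGraph {n : ℕ} (nb far : Fin n → Fin n → Bool)
  (nb-sym : ∀ u v → nb u v ≡ nb v u) (nb-irrefl : ∀ u → nb u u ≡ false)
  (nb⇒¬far : ∀ {u v} → nb u v ≡ true → far u v ≡ false) (far-irrefl : ∀ u → far u u ≡ false)
  (≢∧¬far⇒nb : ∀ {u v} → u ≢ v → far u v ≡ false → nb u v ≡ true)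
  (label : Fin n → Fin n → Bool)
  (clique-nb : ∀ {y x x′} → nb y x ≡ true → nb y x′ ≡ true → label y x ≡ label y x′ → x ≢ x′ → nb x x′ ≡ true)
  (clique-size : ∀ y b → 20 ≤ # (λ x → nb y x ∧ agree b (label y x)))
  (clique-cross : ∀ {y b x} → nb y x ∧ agree b (label y x) ≡ true → # (λ z → (nb y z ∧ agree (not b) (label y z)) ∧ nb x z) ≤ 3)
  where

  clique : Fin n → Bool → Fin n → Bool
  clique y b x = nb y x ∧ agree b (label y x)

  nb⇒≢ : ∀ {u v} → nb u v ≡ true → u ≢ v
  nb⇒≢ {u} p refl = true≢false p (nb-irrefl u)

  nb-swap : ∀ {u v} → nb u v ≡ true → nb v u ≡ true
  nb-swap {u} {v} p = trans (nb-sym v u) p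

  ≢⇒≡not : ∀ a b → a ≢ b → a ≡ not b
  ≢⇒≡not true  true  ne = ⊥-elim (ne refl)
  ≢⇒≡not true  false ne = refl
  ≢⇒≡not false true  ne = refl
  ≢⇒≡not false false ne = ⊥-elim (ne refl)

  not-involutive : ∀ b → not (not b) ≡ b
  not-involutive true  = refl
  not-involutive false = refl

  single : (x : Fin n) → sum (λ z → χ (x == z)) ≡ 1
  single x = trans (sum-cong-≗ (λ z → sym (*-identityʳ (χ (x == z))))) (sum-δ (λ _ → 1) x)

  -- Two vertices in one clique of y lie, together with y, in one clique of each other:
  -- otherwise the clique, which consists of their common neighbours, would be small.
  collinear : ∀ {y x x′} → nb y x ≡ true → nb y x′ ≡ true → label y x ≡ label y x′ → x ≢ x′ → label x y ≡ label x x′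
  collinear {y} {x} {x′} p p′ same ne = decide (label x y Data.Bool.≟ label x x′)
    where
    xx′ : nb x x′ ≡ true
    xx′ = clique-nb p p′ same ne
    e : Bool
    e = label x y
    decide : Dec (label x y ≡ label x x′) → label x y ≡ label x x′
    decide (yes q) = q
    -- The clique, of size at least 20, would be covered by x, x′ and two crossing sets of at most 3
    -- vertices, 8 in all.
    decide (no q)  = 1≰0 (≤-trans (s≤s z≤n) (+-cancelˡ-≤ 8 12 0 (≤-trans (clique-size y (label y x)) (≤-trans bound small))))
      where
      other : label x x′ ≡ not e
      other = ≢⇒≡not (label x x′) e (λ r → q (sym r))
      P₁ P₂ : Fin n → Bool
      P₁ z = clique x (not e) z ∧ nb y z
      P₂ z = clique x (not (not e)) z ∧ nb x′ z
      small : # P₁ + # P₂ + 1 + 1 ≤ 8 + 0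
      small = +-monoˡ-≤ 1 (+-monoˡ-≤ 1 (+-mono-≤ (clique-cross {x} {e} {y} (∧-intro (nb-swap p) (agree-refl′ e))) (clique-cross {x} {not e} {x′} (∧-intro xx′ (agree-refl other)))))
      bound : # (clique y (label y x)) ≤ # P₁ + # P₂ + 1 + 1
      bound = ≤-trans (sum-mono (λ z → go z (clique y (label y x) z) (x == z) (x′ == z) (label x z) refl refl refl refl)) (≤-reflexive
          (trans (sum-+ (λ z → χ (P₁ z) + χ (P₂ z) + χ (x == z)) (λ z → χ (x′ == z))) (cong₂ _+_ (trans (sum-+ (λ z → χ (P₁ z) + χ (P₂ z)) (λ z → χ (x == z))) (cong₂ _+_ (sum-+ (χ ∘ P₁) (χ ∘ P₂)) (single x))) (single x′))))
        where
        go : ∀ z k i j l → clique y (label y x) z ≡ k → (x == z) ≡ i → (x′ == z) ≡ j → label x z ≡ l → χ k ≤ χ (P₁ z) + χ (P₂ z) + χ i + χ j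
        go z false i j l _ _ _ _ = z≤n
        go z true true j l _ _ _ _ = ≤-trans (m≤n+m 1 (χ (P₁ z) + χ (P₂ z))) (m≤m+n _ (χ j))
        go z true false true l _ _ _ _ = m≤n+m 1 (χ (P₁ z) + χ (P₂ z) + 0)
        go z true false false l k i j lz = ≤-trans (inside (l Data.Bool.≟ e)) (≤-trans (m≤m+n _ 0) (m≤m+n _ 0))
          where
          yz : nb y z ≡ true
          yz = proj₁ (∧-true k)
          lyz : label y z ≡ label y x
          lyz = agree⇒ {label y x} (proj₂ (∧-true {nb y z} k))
          xz : nb x z ≡ true
          xz = clique-nb p yz (sym lyz) (==⇒≢ {x = x} {z} i)
          x′z : nb x′ z ≡ true
          x′z = clique-nb p′ yz (trans (sym same) (sym lyz)) (==⇒≢ {x = x′} {z} j)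
          inside : Dec (l ≡ e) → 1 ≤ χ (P₁ z) + χ (P₂ z)
          inside (yes r) = ≤-trans (true⇒χ {P₂ z} (∧-intro (∧-intro xz (agree-refl (trans lz (trans r (sym (not-involutive e)))))) x′z)) (m≤n+m _ (χ (P₁ z)))
          inside (no r)  = ≤-trans (true⇒χ {P₁ z} (∧-intro (∧-intro xz (agree-refl (trans lz (≢⇒≡not l e r)))) yz)) (m≤m+n _ (χ (P₂ z)))

  -- A line is a vertex y with one of its two cliques.
  flagged : Fin n → Bool → Fin (n + n)
  flagged y true  = y ↑ˡ n
  flagged y false = n ↑ʳ y

  flag : Fin (n + n) → Fin n × Bool
  flag j = [ (λ y → y , true) , (λ y → y , false) ]′ (splitAt n j)

  flag-flagged : ∀ y b → flag (flagged y b) ≡ (y , b)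
  flag-flagged y true  = cong [ (λ y → y , true) , (λ y → y , false) ]′ (Fin.splitAt-↑ˡ n y n)
  flag-flagged y false = cong [ (λ y → y , true) , (λ y → y , false) ]′ (Fin.splitAt-↑ʳ n n y)

  SameLine : Fin n × Bool → Fin n × Bool → Set
  SameLine (y , b) (y′ , b′) = (y ≡ y′ × b ≡ b′) ⊎ (nb y y′ ≡ true × label y y′ ≡ b × label y′ y ≡ b′)

  sameLine : Fin n × Bool → Fin n × Bool → Bool
  sameLine (y , b) (y′ , b′) = ((y == y′) ∧ agree b b′) ∨ (nb y y′ ∧ (agree b (label y y′) ∧ agree b′ (label y′ y)))

  sameLine⇒ : ∀ l l′ → sameLine l l′ ≡ true → SameLine l l′
  sameLine⇒ (y , b) (y′ , b′) e with ∨-true {(y == y′) ∧ agree b b′} e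
  ... | inj₁ p = inj₁ (==⇒≡ {x = y} {y′} (proj₁ (∧-true p)) , sym (agree⇒ {b} (proj₂ (∧-true {y == y′} p))))
  ... | inj₂ p = inj₂ (proj₁ (∧-true p) , agree⇒ {b} (proj₁ (∧-true (proj₂ (∧-true {nb y y′} p)))) , agree⇒ {b′} (proj₂ (∧-true {agree b (label y y′)} (proj₂ (∧-true {nb y y′} p)))))

  ⇒sameLine : ∀ l l′ → SameLine l l′ → sameLine l l′ ≡ true
  ⇒sameLine (y , b) .(y , b) (inj₁ (refl , refl)) = ∨-introˡ {(y == y) ∧ agree b b} (∧-intro (==-refl y) (agree-refl′ b))
  ⇒sameLine (y , b) (y′ , b′) (inj₂ (p , q , r)) = ∨-introʳ {(y == y′) ∧ agree b b′} (∧-intro p (∧-intro (agree-refl q) (agree-refl r)))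

  -- The outer two vertices lie in one clique of the middle one, so they are equal or adjacent, and
  -- `collinear` matches their labels.
  SameLine-trans : ∀ l l′ l″ → SameLine l l′ → SameLine l′ l″ → SameLine l l″
  SameLine-trans _ _ _ (inj₁ (refl , refl)) q = q
  SameLine-trans _ _ _ (inj₂ p) (inj₁ (refl , refl)) = inj₂ p
  SameLine-trans (y , b) (y′ , b′) (y″ , b″) (inj₂ (p₁ , p₂ , p₃)) (inj₂ (q₁ , q₂ , q₃)) = decide (y Fin.≟ y″)
    where
    decide : Dec (y ≡ y″) → SameLine (y , b) (y″ , b″)
    decide (yes refl) = inj₁ (refl , trans (sym p₂) q₃)
    decide (no ne) = inj₂ (clique-nb (nb-swap p₁) q₁ (trans p₃ (sym q₂)) ne ,
      trans (sym (collinear (nb-swap p₁) q₁ (trans p₃ (sym q₂)) ne)) p₂ ,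
      trans (sym (collinear q₁ (nb-swap p₁) (trans q₂ (sym p₃)) (ne ∘ sym))) q₃)

  SameLine-sym : ∀ l l′ → SameLine l l′ → SameLine l′ l
  SameLine-sym _ _ (inj₁ (p , q)) = inj₁ (sym p , sym q)
  SameLine-sym _ _ (inj₂ (p , q , r)) = inj₂ (nb-swap p , r , q)

  lines : Quotient (λ i j → sameLine (flag i) (flag j))
  lines = quotient (λ i j → sameLine (flag i) (flag j)) (λ i → ⇒sameLine (flag i) (flag i) (inj₁ (refl , refl)))
    (λ i j p → ⇒sameLine (flag j) (flag i) (SameLine-sym _ _ (sameLine⇒ (flag i) (flag j) p)))
    (λ i j k p q → ⇒sameLine (flag i) (flag k) (SameLine-trans (flag i) (flag j) (flag k) (sameLine⇒ (flag i) (flag j) p) (sameLine⇒ (flag j) (flag k) q)))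

  abstract
    m : ℕ
    m = Quotient.size lines

    line : Fin n → Bool → Fin m
    line y b = Quotient.class lines (flagged y b)

    line-sound : ∀ y b y′ b′ → SameLine (y , b) (y′ , b′) → line y b ≡ line y′ b′
    line-sound y b y′ b′ s = Quotient.sound lines (flagged y b) (flagged y′ b′) (trans (cong₂ sameLine (flag-flagged y b) (flag-flagged y′ b′)) (⇒sameLine (y , b) (y′ , b′) s))

    line-complete : ∀ y b y′ b′ → line y b ≡ line y′ b′ → SameLine (y , b) (y′ , b′)
    line-complete y b y′ b′ e = sameLine⇒ (y , b) (y′ , b′) (trans (sym (cong₂ sameLine (flag-flagged y b) (flag-flagged y′ b′))) (Quotient.complete lines (flagged y b) (flagged y′ b′) e))

    line-surjective : ∀ j → ∃ λ y → ∃ λ b → line y b ≡ j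
    line-surjective j = go (splitAt n i) refl
      where
      i : Fin (n + n)
      i = Quotient.rep lines j
      go : ∀ s → splitAt n i ≡ s → ∃ λ y → ∃ λ b → line y b ≡ j
      go (inj₁ y) e = y , true  , trans (cong (Quotient.class lines) (trans (cong (Data.Fin.join n n) (sym e)) (Fin.join-splitAt n n i))) (Quotient.class-rep lines j)
      go (inj₂ y) e = y , false , trans (cong (Quotient.class lines) (trans (cong (Data.Fin.join n n) (sym e)) (Fin.join-splitAt n n i))) (Quotient.class-rep lines j)

  line-two : ∀ y b → line y b ≢ line y (not b)
  line-two y b e with line-complete y b y (not b) e
  ... | inj₁ (_ , q) = b≢not b q
    where
    b≢not : ∀ b → b ≢ not b
    b≢not true  ()
    b≢not false ()
  ... | inj₂ (p , _) = true≢false p (nb-irrefl y)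

  nb⇒line : ∀ {u v} → nb u v ≡ true → line u (label u v) ≡ line v (label v u)
  nb⇒line {u} {v} p = line-sound u (label u v) v (label v u) (inj₂ (p , refl , refl))

  line⇒nb : ∀ {u v b b′} → u ≢ v → line u b ≡ line v b′ → nb u v ≡ true × label u v ≡ b
  line⇒nb {u} {v} {b} {b′} ne e with line-complete u b v b′ e
  ... | inj₁ (p , _) = ⊥-elim (ne p)
  ... | inj₂ (p , q , _) = p , q

  -- x as an edge of the root graph: its ends i and j are the two lines through x.
  On : Fin n → Fin m → Fin m → Set
  On x i j = ∃ λ b → line x b ≡ i × line x (not b) ≡ j

  abstract
    on : Fin n → Fin m → Fin m → Bool
    on x i j = ((line x true == i) ∧ (line x false == j)) ∨ ((line x true == j) ∧ (line x false == i))

    on⇒ : ∀ {x i j} → on x i j ≡ true → On x i j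
    on⇒ {x} {i} {j} e = from (∨-true {(line x true == i) ∧ (line x false == j)} e)
      where
      from : (line x true == i) ∧ (line x false == j) ≡ true ⊎ (line x true == j) ∧ (line x false == i) ≡ true → On x i j
      from (inj₁ p) = true , ==⇒≡ {x = line x true} {i} (proj₁ (∧-true p)) , ==⇒≡ {x = line x false} {j} (proj₂ (∧-true {line x true == i} p))
      from (inj₂ p) = false , ==⇒≡ {x = line x false} {i} (proj₂ (∧-true {line x true == j} p)) , ==⇒≡ {x = line x true} {j} (proj₁ (∧-true p))

    ⇒on : ∀ {x i j} → On x i j → on x i j ≡ true
    ⇒on {x} (true  , refl , refl) = ∨-introˡ {(line x true == line x true) ∧ (line x false == line x false)} (∧-intro (==-refl (line x true)) (==-refl (line x false)))
    ⇒on {x} (false , refl , refl) = ∨-introʳ {(line x true == line x false) ∧ (line x false == line x true)} (∧-intro (==-refl (line x true)) (==-refl (line x false)))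

  On-sym : ∀ {x i j} → On x i j → On x j i
  On-sym {x} (b , p , q) = not b , q , trans (cong (line x) (not-involutive b)) p

  On-≢ : ∀ {x i j} → On x i j → i ≢ j
  On-≢ {x} (b , p , q) e = line-two x b (trans p (trans e (sym q)))

  On-cases : ∀ {x i j a b} → On x i j → On x a b → (i ≡ a × j ≡ b) ⊎ (i ≡ b × j ≡ a)
  On-cases {x} {i} {j} {a} {b} (s , p , q) (t , p′ , q′) = decide (s Data.Bool.≟ t)
    where
    decide : Dec (s ≡ t) → (i ≡ a × j ≡ b) ⊎ (i ≡ b × j ≡ a)
    decide (yes refl) = inj₁ (trans (sym p) p′ , trans (sym q) q′)
    decide (no ne) = inj₂ (trans (sym p) (trans (cong (line x) s≡) q′) , trans (sym q) (trans (cong (line x) (trans (cong not s≡) (not-involutive t))) p′))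
      where
      s≡ : s ≡ not t
      s≡ = ≢⇒≡not s t ne

  -- The root graph is simple: of two different vertices on both lines, each would lie in both
  -- cliques of the other.
  On-unique : ∀ {x x′ i j} → On x i j → On x′ i j → x ≡ x′
  On-unique {x} {x′} (b , p , q) (b′ , p′ , q′) = decide (x Fin.≟ x′)
    where
    decide : Dec (x ≡ x′) → x ≡ x′
    decide (yes e) = e
    decide (no ne) = ⊥-elim (line-two x b (cong (line x) (trans (sym (proj₂ (line⇒nb ne (trans p (sym p′))))) (proj₂ (line⇒nb ne (trans q (sym q′)))))))

  Adj : Fin m → Fin m → Set
  Adj i j = ∃ λ x → On x i j

  abstract
    adj : Fin m → Fin m → Bool
    adj i j = not (# (λ x → on x i j) ≡ᵇ 0)

    adj⇒ : ∀ {i j} → adj i j ≡ true → Adj i j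
    adj⇒ {i} {j} e = go (any? (λ x → on x i j))
      where
      go : (∃ λ x → on x i j ≡ true) ⊎ (∀ x → on x i j ≡ false) → Adj i j
      go (inj₁ (x , p)) = x , on⇒ p
      go (inj₂ none) = ⊥-elim (true≢false e (cong (λ k → not (k ≡ᵇ 0)) (sum-0 {n} (λ x → cong χ (none x)))))

    ⇒adj : ∀ {i j} → Adj i j → adj i j ≡ true
    ⇒adj {i} {j} (x , p) = go (# (λ x → on x i j)) (∃⇒#>0 (λ x → on x i j) x (⇒on p))
      where
      go : ∀ k → 0 < k → not (k ≡ᵇ 0) ≡ true
      go (suc k) _ = refl

    #on : ∀ i j → # (λ x → on x i j) ≡ χ (adj i j)
    #on i j = go (# (λ x → on x i j)) refl (#≤1 (λ x → on x i j) (λ x x′ p q → On-unique (on⇒ p) (on⇒ q)))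
      where
      go : ∀ k → # (λ x → on x i j) ≡ k → k ≤ 1 → k ≡ χ (not (k ≡ᵇ 0))
      go zero          _ _ = refl
      go (suc zero)    _ _ = refl
      go (suc (suc k)) _ (s≤s ())

  adj-sym : ∀ {i j} → adj i j ≡ true → adj j i ≡ true
  adj-sym e with adj⇒ e
  ... | x , p = ⇒adj (x , On-sym p)

  adj-≢ : ∀ {i j} → adj i j ≡ true → i ≢ j
  adj-≢ e = On-≢ (proj₂ (adj⇒ e))

  -- The common neighbours of the far vertices y = ab and v = cd are the vertices ac, ad, bc, bd.
  module _ {y v : Fin n} (yv : far y v ≡ true) where
    private
      pairs : Fin n → Bool → Bool → Bool
      pairs w b e = on w (line y b) (line v e)

      y≢v : y ≢ v
      y≢v refl = true≢false yv (far-irrefl y)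

    far-lines : ∀ b e → line y b ≢ line v e
    far-lines b e p = true≢false yv (nb⇒¬far (proj₁ (line⇒nb y≢v p)))

    common-nb : ∀ w → χ (nb y w) * χ (nb w v) ≡ χ (pairs w true true) + χ (pairs w true false) + χ (pairs w false true) + χ (pairs w false false)
    common-nb w = go (nb y w) (nb w v) refl refl
      where
      On⇒nb : ∀ {b e} → On w (line y b) (line v e) → nb y w ≡ true × label y w ≡ b × nb w v ≡ true × label v w ≡ e
      On⇒nb {b} {e} (t , p , q) = proj₁ ny , proj₂ ny , nb-swap (proj₁ nv) , proj₂ nv
        where
        ny = line⇒nb {y} {w} {b} {t} (λ { refl → far-lines (not t) e q }) (sym p)
        nv = line⇒nb {v} {w} {e} {not t} (λ { refl → far-lines b t (sym p) }) (sym q)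
      none : (∀ {b e} → On w (line y b) (line v e) → ⊥) → 0 ≡ χ (pairs w true true) + χ (pairs w true false) + χ (pairs w false true) + χ (pairs w false false)
      none h = sym (cong₂ _+_ (cong₂ _+_ (cong₂ _+_ (z true true) (z true false)) (z false true)) (z false false))
        where
        z : ∀ b e → χ (pairs w b e) ≡ 0
        z b e = cong χ (¬true⇒false (λ p → h {b} {e} (on⇒ p)))
      go : ∀ s t → nb y w ≡ s → nb w v ≡ t → χ s * χ t ≡ χ (pairs w true true) + χ (pairs w true false) + χ (pairs w false true) + χ (pairs w false false)
      go false t     p q = none (λ o → true≢false (proj₁ (On⇒nb o)) p)
      go true  false p q = none (λ o → true≢false (proj₁ (proj₂ (proj₂ (On⇒nb o)))) q)
      go true  true  p q = exactly (label y w) (label v w) refl refl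
        where
        line-w : line w (label w y) ≡ line y (label y w)
        line-w = sym (nb⇒line p)
        line-w′ : line w (label w v) ≡ line v (label v w)
        line-w′ = nb⇒line q
        it : On w (line y (label y w)) (line v (label v w))
        it = label w y , line-w , trans (cong (line w) (sym (≢⇒≡not (label w v) (label w y) (λ e → far-lines (label y w) (label v w) (trans (sym line-w) (trans (cong (line w) (sym e)) line-w′)))))) line-w′
        only : ∀ b e → pairs w b e ≡ agree b (label y w) ∧ agree e (label v w)
        only b e = agreeing (pairs w b e) (agree b (label y w) ∧ agree e (label v w)) refl refl
          where
          agreeing : ∀ i j → pairs w b e ≡ i → agree b (label y w) ∧ agree e (label v w) ≡ j → i ≡ j
          agreeing true  true  _ _ = refl
          agreeing false false _ _ = refl
          agreeing true  false i j = ⊥-elim (true≢false (∧-intro (agree-refl (proj₁ (proj₂ o))) (agree-refl (proj₂ (proj₂ (proj₂ o))))) j)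
            where o = On⇒nb (on⇒ i)
          agreeing false true  i j = ⊥-elim (true≢false (⇒on (subst₂ (λ b e → On w (line y b) (line v e)) (agree⇒ {b} (proj₁ (∧-true j))) (agree⇒ {e} (proj₂ (∧-true {agree b (label y w)} j))) it)) i)
        exactly : ∀ b e → label y w ≡ b → label v w ≡ e → 1 ≡ χ (pairs w true true) + χ (pairs w true false) + χ (pairs w false true) + χ (pairs w false false)
        exactly b e p q = trans (total b e) (sym (cong₂ _+_ (cong₂ _+_ (cong₂ _+_ (val true true) (val true false)) (val false true)) (val false false)))
          where
          val : ∀ b′ e′ → χ (pairs w b′ e′) ≡ χ (agree b′ b ∧ agree e′ e)
          val b′ e′ = cong χ (trans (only b′ e′) (cong₂ (λ s t → agree b′ s ∧ agree e′ t) p q))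
          total : ∀ b e → 1 ≡ χ (agree true b ∧ agree true e) + χ (agree true b ∧ agree false e) + χ (agree false b ∧ agree true e) + χ (agree false b ∧ agree false e)
          total true  true  = refl
          total true  false = refl
          total false true  = refl
          total false false = refl

    common-sum : (g : Fin n → ℕ) → sum (λ w → χ (nb y w) * χ (nb w v) * g w) ≡
      sum (λ w → χ (on w (line y true) (line v true)) * g w) + sum (λ w → χ (on w (line y true) (line v false)) * g w) +
      sum (λ w → χ (on w (line y false) (line v true)) * g w) + sum (λ w → χ (on w (line y false) (line v false)) * g w)
    common-sum g = trans (sum-cong-≗ (λ w → trans (cong (_* g w) (common-nb w)) (identity (χ (pairs w true true) ∷ χ (pairs w true false) ∷ χ (pairs w false true) ∷ χ (pairs w false false) ∷ g w ∷ []) ((x₀ ⊕ x₁ ⊕ x₂ ⊕ x₃) ⊗ x₄) (x₀ ⊗ x₄ ⊕ x₁ ⊗ x₄ ⊕ x₂ ⊗ x₄ ⊕ x₃ ⊗ x₄) refl)))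
      (trans (sum-+ (λ w → χ (pairs w true true) * g w + χ (pairs w true false) * g w + χ (pairs w false true) * g w) (λ w → χ (pairs w false false) * g w))
        (cong (_+ sum (λ w → χ (pairs w false false) * g w)) (trans (sum-+ (λ w → χ (pairs w true true) * g w + χ (pairs w true false) * g w) (λ w → χ (pairs w false true) * g w))
          (cong (_+ sum (λ w → χ (pairs w false true) * g w)) (sum-+ (λ w → χ (pairs w true true) * g w) (λ w → χ (pairs w true false) * g w))))))

  sum-on : ∀ {x i j} (g : Fin n → ℕ) → On x i j → sum (λ w → χ (on w i j) * g w) ≡ g x
  sum-on {x} {i} {j} g o = trans (sum-cong-≗ (λ w → cong (λ b → χ b * g w) (same w))) (sum-δ g x)
    where
    same : ∀ w → on w i j ≡ (x == w)
    same w = agreeing (on w i j) (x == w) refl refl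
      where
      agreeing : ∀ s t → on w i j ≡ s → (x == w) ≡ t → s ≡ t
      agreeing true  true  _ _ = refl
      agreeing false false _ _ = refl
      agreeing true  false p q = ⊥-elim (==⇒≢ {x = x} {w} q (On-unique o (on⇒ p)))
      agreeing false true  p q = ⊥-elim (true≢false (⇒on (subst (λ z → On z i j) (==⇒≡ {x = x} {w} q) o)) p)

  sum-not-on : ∀ {i j} (g : Fin n → ℕ) → adj i j ≡ false → sum (λ w → χ (on w i j) * g w) ≡ 0
  sum-not-on {i} {j} g e = sum-0 {n} (λ w → cong (λ b → χ b * g w) (¬true⇒false (λ p → true≢false (⇒adj (w , on⇒ p)) e)))

  -- If y and v were equal or neighbours they would share a line, against the four inequalities.
  far-On : ∀ {y v a b c d} → On y a b → On v c d → a ≢ c → a ≢ d → b ≢ c → b ≢ d → far y v ≡ true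
  far-On {y} {v} (s , refl , refl) (t , refl , refl) ac ad bc bd = go (far y v) refl
    where
    go : ∀ f → far y v ≡ f → f ≡ true
    go true  _ = refl
    go false e = decide (y Fin.≟ v)
      where
      contra : ∀ b b′ → line y b ≡ line v b′ → ⊥
      contra b b′ p with b Data.Bool.≟ s | b′ Data.Bool.≟ t
      ... | yes refl | yes refl = ac p
      ... | yes refl | no q = ad (trans p (cong (line v) (≢⇒≡not b′ t q)))
      ... | no q | yes refl = bc (trans (cong (line y) (sym (≢⇒≡not b s q))) p)
      ... | no q | no q′ = bd (trans (cong (line y) (sym (≢⇒≡not b s q))) (trans p (cong (line v) (≢⇒≡not b′ t q′))))
      decide : Dec (y ≡ v) → false ≡ true
      decide (yes refl) = ⊥-elim (contra true true refl)
      decide (no ne) = ⊥-elim (contra (label y v) (label v y) (nb⇒line (≢∧¬far⇒nb ne e)))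

  memberᵇ : Fin m → List (Fin m) → Bool
  memberᵇ x []      = false
  memberᵇ x (y ∷ F) = (x == y) ∨ memberᵇ x F

  -- A clique on line i has at least 20 vertices, and distinct ones lead to distinct lines by
  -- `On-unique`, so fewer than 20 lines cannot include all of these.
  fresh : ∀ i (F : List (Fin m)) → length F < 20 → ∃ λ j → adj i j ≡ true × memberᵇ j F ≡ false
  fresh i F lt with line-surjective i
  ... | y , b , refl = from (any? (λ z → clique y b z ∧ not (memberᵇ (other z) F)))
    where
    other : Fin n → Fin m
    other z = line z (not (label z y))
    on-z : ∀ {z} → clique y b z ≡ true → On z (line y b) (other z)
    on-z {z} e = label z y , trans (sym (nb⇒line (proj₁ (∧-true e)))) (cong (line y) (agree⇒ {b} (proj₂ (∧-true {nb y z} e)))) , refl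
    from : (∃ λ z → clique y b z ∧ not (memberᵇ (other z) F) ≡ true) ⊎ (∀ z → clique y b z ∧ not (memberᵇ (other z) F) ≡ false) →
           ∃ λ j → adj (line y b) j ≡ true × memberᵇ j F ≡ false
    from (inj₁ (z , e)) = other z , ⇒adj (z , on-z (proj₁ (∧-true e))) , not-true (proj₂ (∧-true {clique y b z} e))
    from (inj₂ none) = ⊥-elim (<⇒≱ lt (≤-trans (clique-size y b) (≤-trans (sum-mono (λ z → all-in z (clique y b z) (memberᵇ (other z) F) refl (none z))) (few F))))
      where
      all-in : ∀ z k t → memberᵇ (other z) F ≡ t → k ∧ not t ≡ false → χ k ≤ χ (k ∧ t)
      all-in z false t     _ _ = z≤n
      all-in z true  true  _ _ = s≤s z≤n
      few : ∀ F → # (λ z → clique y b z ∧ memberᵇ (other z) F) ≤ length F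
      few [] = ≤-reflexive (sum-0 {n} (λ z → go (clique y b z)))
        where
        go : ∀ k → χ (k ∧ false) ≡ 0
        go true  = refl
        go false = refl
      few (j ∷ F) = ≤-trans (sum-mono (λ z → go (clique y b z) (other z == j) (memberᵇ (other z) F))) (≤-trans (≤-reflexive (sum-+ (λ z → χ (clique y b z ∧ (other z == j))) (λ z → χ (clique y b z ∧ memberᵇ (other z) F))))
          (+-mono-≤ (#≤1 (λ z → clique y b z ∧ (other z == j)) (λ z z′ p q → On-unique (at p) (at q))) (few F)))
        where
        go : ∀ k s t → χ (k ∧ (s ∨ t)) ≤ χ (k ∧ s) + χ (k ∧ t)
        go false s     t = z≤n
        go true  true  t = s≤s z≤n
        go true  false t = ≤-refl
        at : ∀ {z} → clique y b z ∧ (other z == j) ≡ true → On z (line y b) j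
        at {z} p = subst (On z (line y b)) (==⇒≡ {x = other z} {j} (proj₂ (∧-true {clique y b z} p))) (on-z (proj₁ (∧-true p)))

  common-sum′ : ∀ {y v a b i j} (g : Fin n → ℕ) → far y v ≡ true → On y a b → On v i j → sum (λ w → χ (nb y w) * χ (nb w v) * g w) ≡
    sum (λ w → χ (on w a i) * g w) + sum (λ w → χ (on w a j) * g w) + sum (λ w → χ (on w b i) * g w) + sum (λ w → χ (on w b j) * g w)
  common-sum′ {y} {v} g f (s , refl , refl) (t , refl , refl) = reorder s t
    where
    Σon : Bool → Bool → ℕ
    Σon s t = sum (λ w → χ (on w (line y s) (line v t)) * g w)
    reorder : ∀ s t → sum (λ w → χ (nb y w) * χ (nb w v) * g w) ≡ Σon s t + Σon s (not t) + Σon (not s) t + Σon (not s) (not t)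
    reorder true  true  = common-sum f g
    reorder true  false = trans (common-sum f g) (identity (Σon true true ∷ Σon true false ∷ Σon false true ∷ Σon false false ∷ []) (x₀ ⊕ x₁ ⊕ x₂ ⊕ x₃) (x₁ ⊕ x₀ ⊕ x₃ ⊕ x₂) refl)
    reorder false true  = trans (common-sum f g) (identity (Σon true true ∷ Σon true false ∷ Σon false true ∷ Σon false false ∷ []) (x₀ ⊕ x₁ ⊕ x₂ ⊕ x₃) (x₂ ⊕ x₃ ⊕ x₀ ⊕ x₁) refl)
    reorder false false = trans (common-sum f g) (identity (Σon true true ∷ Σon true false ∷ Σon false true ∷ Σon false false ∷ []) (x₀ ⊕ x₁ ⊕ x₂ ⊕ x₃) (x₃ ⊕ x₂ ⊕ x₁ ⊕ x₀) refl)

  -- Disjoint root edges are far vertices, and their common neighbours are the root edges that join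
  -- them: `common-sum′` with weight 1.
  four-lines : ∀ {μ} → (∀ {y v} → far y v ≡ true → sum (λ w → χ (nb y w) * χ (nb w v)) ≡ μ) →
    ∀ {a b i j} → adj a b ≡ true → adj i j ≡ true → a ≢ i → a ≢ j → b ≢ i → b ≢ j → χ (adj a i) + χ (adj a j) + χ (adj b i) + χ (adj b j) ≡ μ
  four-lines {μ} cn {a} {b} {i} {j} e e′ ai aj bi bj = from (adj⇒ e) (adj⇒ e′)
    where
    times1 : ∀ p q → sum (λ w → χ (on w p q) * 1) ≡ χ (adj p q)
    times1 p q = trans (sum-cong-≗ (λ w → *-identityʳ (χ (on w p q)))) (#on p q)
    from : Adj a b → Adj i j → χ (adj a i) + χ (adj a j) + χ (adj b i) + χ (adj b j) ≡ μ
    from (y , o) (v , o′) = trans (sym (trans (trans (sym (sum-cong-≗ (λ w → *-identityʳ (χ (nb y w) * χ (nb w v))))) (common-sum′ (λ _ → 1) yv o o′))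
        (cong₂ _+_ (cong₂ _+_ (cong₂ _+_ (times1 a i) (times1 a j)) (times1 b i)) (times1 b j)))) (cn yv)
      where
      yv : far y v ≡ true
      yv = far-On o o′ ai aj bi bj

-- The root graph

NotIn : ∀ {m} → Fin m → List (Fin m) → Set
NotIn j []      = ⊤
NotIn j (x ∷ F) = j ≢ x × NotIn j F

Bool-cases : ∀ b → b ≡ true ⊎ b ≡ false
Bool-cases true  = inj₁ refl
Bool-cases false = inj₂ refl

χ≡0⇒ : ∀ {b} → χ b ≤ 0 → b ≡ false
χ≡0⇒ {false} _ = refl

χ≥1⇒ : ∀ {b} → 1 ≤ χ b → b ≡ true
χ≥1⇒ {true} _ = refl

module RootGraph {m : ℕ} (adj : Fin m → Fin m → Bool) (adj-sym : ∀ {i j} → adj i j ≡ true → adj j i ≡ true)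
  (adj-≢ : ∀ {i j} → adj i j ≡ true → i ≢ j) (μ : ℕ)
  (quad : ∀ {a b i j} → adj a b ≡ true → adj i j ≡ true → a ≢ i → a ≢ j → b ≢ i → b ≢ j → χ (adj a i) + χ (adj a j) + χ (adj b i) + χ (adj b j) ≡ μ)
  (fresh : ∀ i (F : List (Fin m)) → length F < 20 → ∃ λ j → adj i j ≡ true × NotIn j F) (o : Fin m) where

  private
    few : ∀ {k} → k ≤ 18 → suc k ≤ 20
    few p = s≤s (≤-trans p (n≤1+n 18))

  nonadj-sym : ∀ {i j} → adj i j ≡ false → adj j i ≡ false
  nonadj-sym {i} {j} e with Bool-cases (adj j i)
  ... | inj₁ p = ⊥-elim (true≢false (adj-sym p) e)
  ... | inj₂ p = p

  -- On a path b, a, x, w the edge ax is the only one between ab and xw, so no other pair is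
  -- adjacent (`induced`). Hence for neighbours x, x′ of o, every further neighbour w of x is joined
  -- to every further neighbour v of x′, as ww′ is the only candidate in `across`. Two choices of w
  -- and of v give a 4-cycle, which `induced` forbids.
  μ≢1 : μ ≢ 1
  μ≢1 μ1 = conclude
    where
    induced : ∀ {b a x w} → adj a b ≡ true → adj a x ≡ true → adj x w ≡ true → a ≢ w → b ≢ x → b ≢ w → adj b x ≡ false × adj b w ≡ false
    induced {b} {a} {x} {w} ab ax xw aw bx bw =
      χ≡0⇒ (lin (χ (adj a x) ∷ χ (adj a w) ∷ χ (adj b x) ∷ χ (adj b w) ∷ μ ∷ []) 0 (x₂ ≼ κ 0) ((κ 1 , x₀ ⊕ x₁ ⊕ x₂ ⊕ x₃ ≼ x₄) ∷ (κ 1 , x₄ ≼ κ 1) ∷ (κ 1 , κ 1 ≼ x₀) ∷ []) refl (≤-reflexive Q , ≤-reflexive μ1 , ≤-reflexive (sym (cong χ ax)) , tt)) ,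
      χ≡0⇒ (lin (χ (adj a x) ∷ χ (adj a w) ∷ χ (adj b x) ∷ χ (adj b w) ∷ μ ∷ []) 0 (x₃ ≼ κ 0) ((κ 1 , x₀ ⊕ x₁ ⊕ x₂ ⊕ x₃ ≼ x₄) ∷ (κ 1 , x₄ ≼ κ 1) ∷ (κ 1 , κ 1 ≼ x₀) ∷ []) refl (≤-reflexive Q , ≤-reflexive μ1 , ≤-reflexive (sym (cong χ ax)) , tt))
      where
      Q : χ (adj a x) + χ (adj a w) + χ (adj b x) + χ (adj b w) ≡ μ
      Q = quad ab xw (adj-≢ ax) aw bx bw
    across : ∀ {a x x′ w w′} → adj a x ≡ true → adj a x′ ≡ true → adj x w ≡ true → adj x′ w′ ≡ true →
             x ≢ x′ → a ≢ w → a ≢ w′ → x ≢ w′ → x′ ≢ w → w ≢ w′ → adj w w′ ≡ true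
    across {a} {x} {x′} {w} {w′} ax ax′ xw xw′ x≢x′ a≢w a≢w′ x≢w′ x′≢w w≢w′ =
      χ≥1⇒ (lin (χ (adj x x′) ∷ χ (adj x w′) ∷ χ (adj w x′) ∷ χ (adj w w′) ∷ μ ∷ []) 0 (κ 1 ≼ x₃) ((κ 1 , x₄ ≼ x₀ ⊕ x₁ ⊕ x₂ ⊕ x₃) ∷ (κ 1 , κ 1 ≼ x₄) ∷ (κ 1 , x₀ ≼ κ 0) ∷ (κ 1 , x₁ ≼ κ 0) ∷ (κ 1 , x₂ ≼ κ 0) ∷ []) refl (≤-reflexive (sym (quad xw xw′ x≢x′ x≢w′ (x′≢w ∘ sym) w≢w′)) , ≤-reflexive (sym μ1) , ≤-reflexive (cong χ (proj₁ I′)) , ≤-reflexive (cong χ (proj₂ I′)) , ≤-reflexive (cong χ (nonadj-sym (proj₂ I))) , tt))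
      where
      I : adj x′ x ≡ false × adj x′ w ≡ false
      I = induced ax′ ax xw a≢w (x≢x′ ∘ sym) x′≢w
      I′ : adj x x′ ≡ false × adj x w′ ≡ false
      I′ = induced ax ax′ xw′ a≢w′ x≢x′ x≢w′
    conclude : ⊥
    conclude with fresh o [] (s≤s z≤n)
    ... | x , ox , _ with fresh o (x ∷ []) (few (s≤s z≤n))
    ... | x′ , ox′ , x′≢x , _ with fresh x (o ∷ x′ ∷ []) (few (s≤s (s≤s z≤n)))
    ... | w₁ , xw₁ , w₁≢o , w₁≢x′ , _ with fresh x (o ∷ x′ ∷ w₁ ∷ []) (few (s≤s (s≤s (s≤s z≤n))))
    ... | w₂ , xw₂ , w₂≢o , w₂≢x′ , w₂≢w₁ , _ with fresh x′ (o ∷ x ∷ w₁ ∷ w₂ ∷ []) (few (s≤s (s≤s (s≤s (s≤s z≤n)))))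
    ... | v₁ , xv₁ , v₁≢o , v₁≢x , v₁≢w₁ , v₁≢w₂ , _ with fresh x′ (o ∷ x ∷ w₁ ∷ w₂ ∷ v₁ ∷ []) (few (s≤s (s≤s (s≤s (s≤s (s≤s z≤n))))))
    ... | v₂ , xv₂ , v₂≢o , v₂≢x , v₂≢w₁ , v₂≢w₂ , v₂≢v₁ , _ =
      true≢false (join xw₁ xv₂ w₁≢o v₂≢o v₂≢x w₁≢x′ v₂≢w₁)
        (proj₂ (induced (adj-sym (join xw₁ xv₁ w₁≢o v₁≢o v₁≢x w₁≢x′ v₁≢w₁)) (adj-sym (join xw₂ xv₁ w₂≢o v₁≢o v₁≢x w₂≢x′ v₁≢w₂)) (join xw₂ xv₂ w₂≢o v₂≢o v₂≢x w₂≢x′ v₂≢w₂)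
          (v₂≢v₁ ∘ sym) (w₂≢w₁ ∘ sym) (v₂≢w₁ ∘ sym)))
      where
      join : ∀ {w v} → adj x w ≡ true → adj x′ v ≡ true → w ≢ o → v ≢ o → v ≢ x → w ≢ x′ → v ≢ w → adj w v ≡ true
      join xw xv a b e f g = across ox ox′ xw xv (x′≢x ∘ sym) (a ∘ sym) (b ∘ sym) (e ∘ sym) (f ∘ sym) (g ∘ sym)

  -- In a triangle abx, a further neighbour w of x is adjacent to exactly one of a and b, so two
  -- triangles share an edge. A further neighbour z of the vertex that w misses then leaves, in
  -- `two-misses`, two disjoint edges joined by only two edges. A triangle exists, since two
  -- disjoint edges miss only one of their four joining pairs.
  μ≢3 : μ ≢ 3
  μ≢3 μ3 = start
    where
    one-of : ∀ {a b x w} → adj a b ≡ true → adj a x ≡ true → adj b x ≡ true → adj x w ≡ true → w ≢ a → w ≢ b → χ (adj a w) + χ (adj b w) ≡ 1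
    one-of {a} {b} {x} {w} ab ax bx xw w≢a w≢b = (≤-antisym (lin (χ (adj a x) ∷ χ (adj a w) ∷ χ (adj b x) ∷ χ (adj b w) ∷ μ ∷ []) 0 (x₁ ⊕ x₃ ≼ κ 1) ((κ 1 , x₀ ⊕ x₁ ⊕ x₂ ⊕ x₃ ≼ x₄) ∷ (κ 1 , x₄ ≼ κ 3) ∷ (κ 1 , κ 1 ≼ x₀) ∷ (κ 1 , κ 1 ≼ x₂) ∷ []) refl (≤-reflexive (quad ab xw (adj-≢ ax) (w≢a ∘ sym) (adj-≢ bx) (w≢b ∘ sym)) , ≤-reflexive μ3 , ≤-reflexive (sym (cong χ ax)) , ≤-reflexive (sym (cong χ bx)) , tt)) (lin (χ (adj a x) ∷ χ (adj a w) ∷ χ (adj b x) ∷ χ (adj b w) ∷ μ ∷ []) 0 (κ 1 ≼ x₁ ⊕ x₃) ((κ 1 , x₄ ≼ x₀ ⊕ x₁ ⊕ x₂ ⊕ x₃) ∷ (κ 1 , κ 3 ≼ x₄) ∷ (κ 1 , x₀ ≼ κ 1) ∷ (κ 1 , x₂ ≼ κ 1) ∷ []) refl (≤-reflexive (sym (quad ab xw (adj-≢ ax) (w≢a ∘ sym) (adj-≢ bx) (w≢b ∘ sym))) , ≤-reflexive (sym μ3) , ≤-reflexive (cong χ ax) , ≤-reflexive (cong χ bx) , tt)))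
    two-misses : ∀ {x p q w z} → adj x p ≡ true → adj x q ≡ true → adj p q ≡ true → adj x w ≡ true → adj p w ≡ true → adj q w ≡ false → w ≢ q →
                 adj q z ≡ true → adj p z ≡ true → adj x z ≡ false → z ≢ x → z ≢ w → ⊥
    two-misses {x} {p} {q} {w} {z} xp xq pq xw pw qw w≢q qz pz xz z≢x z≢w =
      1≰0 (lin (χ (adj x z) ∷ χ (adj x w) ∷ χ (adj q z) ∷ χ (adj q w) ∷ μ ∷ []) 0 (κ 1 ≼ κ 0) ((κ 1 , x₄ ≼ x₀ ⊕ x₁ ⊕ x₂ ⊕ x₃) ∷ (κ 1 , κ 3 ≼ x₄) ∷ (κ 1 , x₀ ≼ κ 0) ∷ (κ 1 , x₁ ≼ κ 1) ∷ (κ 1 , x₂ ≼ κ 1) ∷ (κ 1 , x₃ ≼ κ 0) ∷ []) refl (≤-reflexive (sym (quad xq (adj-sym wz) (z≢x ∘ sym) (adj-≢ xw) (adj-≢ qz) (w≢q ∘ sym))) , ≤-reflexive (sym μ3) , ≤-reflexive (cong χ xz) , ≤-reflexive (cong χ xw) , ≤-reflexive (cong χ qz) , ≤-reflexive (cong χ qw) , tt))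
      where
      wz : adj w z ≡ true
      wz = χ≥1⇒ (lin (χ (adj x z) ∷ χ (adj w z) ∷ []) 0 (κ 1 ≼ x₁) ((κ 1 , κ 1 ≼ x₀ ⊕ x₁) ∷ (κ 1 , x₀ ≼ κ 0) ∷ []) refl (≤-reflexive (sym (one-of xw xp (adj-sym pw) pz z≢x z≢w)) , ≤-reflexive (cong χ xz) , tt))
    miss : ∀ {x p q w} → adj x p ≡ true → adj x q ≡ true → adj p q ≡ true → adj x w ≡ true → adj p w ≡ true → adj q w ≡ false → w ≢ q → ⊥
    miss {x} {p} {q} {w} xp xq pq xw pw qw w≢q with fresh q (x ∷ p ∷ w ∷ []) (few (s≤s (s≤s (s≤s z≤n))))
    ... | z , qz , z≢x , z≢p , z≢w , _ with one-of xp xq pq qz z≢x z≢p | Bool-cases (adj x z)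
    ...   | e | inj₂ xz = two-misses xp xq pq xw pw qw w≢q qz (χ≥1⇒ (lin (χ (adj x z) ∷ χ (adj p z) ∷ []) 0 (κ 1 ≼ x₁) ((κ 1 , κ 1 ≼ x₀ ⊕ x₁) ∷ (κ 1 , x₀ ≼ κ 0) ∷ []) refl (≤-reflexive (sym e) , ≤-reflexive (cong χ xz) , tt))) xz z≢x z≢w
    ...   | e | inj₁ xz = two-misses (adj-sym xp) pq xq pw xw qw w≢q qz xz (χ≡0⇒ (lin (χ (adj x z) ∷ χ (adj p z) ∷ []) 0 (x₁ ≼ κ 0) ((κ 1 , x₀ ⊕ x₁ ≼ κ 1) ∷ (κ 1 , κ 1 ≼ x₀) ∷ []) refl (≤-reflexive e , ≤-reflexive (sym (cong χ xz)) , tt))) z≢p z≢w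
    triangle : ∀ {a b x} → adj a b ≡ true → adj a x ≡ true → adj b x ≡ true → ⊥
    triangle {a} {b} {x} ab ax bx with fresh x (a ∷ b ∷ []) (few (s≤s (s≤s z≤n)))
    ... | w , xw , w≢a , w≢b , _ with one-of ab ax bx xw w≢a w≢b | Bool-cases (adj a w)
    ...   | e | inj₁ aw = miss (adj-sym ax) (adj-sym bx) ab xw aw (χ≡0⇒ (lin (χ (adj a w) ∷ χ (adj b w) ∷ []) 0 (x₁ ≼ κ 0) ((κ 1 , x₀ ⊕ x₁ ≼ κ 1) ∷ (κ 1 , κ 1 ≼ x₀) ∷ []) refl (≤-reflexive e , ≤-reflexive (sym (cong χ aw)) , tt))) w≢b
    ...   | e | inj₂ aw = miss (adj-sym bx) (adj-sym ax) (adj-sym ab) xw (χ≥1⇒ (lin (χ (adj a w) ∷ χ (adj b w) ∷ []) 0 (κ 1 ≼ x₁) ((κ 1 , κ 1 ≼ x₀ ⊕ x₁) ∷ (κ 1 , x₀ ≼ κ 0) ∷ []) refl (≤-reflexive (sym e) , ≤-reflexive (cong χ aw) , tt))) aw w≢a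
    start : ⊥
    start with fresh o [] (s≤s z≤n)
    ... | b , ob , _ with fresh o (b ∷ []) (few (s≤s z≤n))
    ... | x , ox , x≢b , _ with Bool-cases (adj b x)
    ...   | inj₁ bx = triangle ob ox bx
    ...   | inj₂ bx with fresh x (o ∷ b ∷ []) (few (s≤s (s≤s z≤n)))
    ...     | w , xw , w≢o , w≢b , _ = triangle ox (χ≥1⇒ (lin (χ (adj o x) ∷ χ (adj o w) ∷ χ (adj b x) ∷ χ (adj b w) ∷ μ ∷ []) 0 (κ 1 ≼ x₁) ((κ 1 , x₄ ≼ x₀ ⊕ x₁ ⊕ x₂ ⊕ x₃) ∷ (κ 1 , κ 3 ≼ x₄) ∷ (κ 1 , x₀ ≼ κ 1) ∷ (κ 1 , x₂ ≼ κ 0) ∷ (κ 1 , x₃ ≼ κ 1) ∷ []) refl (≤-reflexive (sym (quad ob xw (adj-≢ ox) (w≢o ∘ sym) (x≢b ∘ sym) (w≢b ∘ sym))) , ≤-reflexive (sym μ3) , χ≤1 (adj o x) , ≤-reflexive (cong χ bx) , χ≤1 (adj b w) , tt))) xw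

  module Four (μ4 : μ ≡ 4) where
    complete : ∀ {a i} → a ≢ i → adj a i ≡ true
    complete {a} {i} a≢i with fresh a (i ∷ []) (few (s≤s z≤n))
    ... | b , ab , b≢i , _ with fresh i (a ∷ b ∷ []) (few (s≤s (s≤s z≤n)))
    ... | j , ij , j≢a , j≢b , _ = χ≥1⇒ (lin (χ (adj a i) ∷ χ (adj a j) ∷ χ (adj b i) ∷ χ (adj b j) ∷ μ ∷ []) 0 (κ 1 ≼ x₀) ((κ 1 , x₄ ≼ x₀ ⊕ x₁ ⊕ x₂ ⊕ x₃) ∷ (κ 1 , κ 4 ≼ x₄) ∷ (κ 1 , x₁ ≼ κ 1) ∷ (κ 1 , x₂ ≼ κ 1) ∷ (κ 1 , x₃ ≼ κ 1) ∷ []) refl (≤-reflexive (sym (quad ab ij a≢i (j≢a ∘ sym) b≢i (j≢b ∘ sym))) , ≤-reflexive (sym μ4) , χ≤1 (adj a j) , χ≤1 (adj b i) , χ≤1 (adj b j) , tt))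

  module Two (μ2 : μ ≡ 2) where
    -- In a triangle the edges from x to a and b already make two, so a further neighbour of a
    -- corner misses the other corners (`misses`), and further neighbours of different corners are
    -- adjacent (`pendant`). With w₁, w₂ at x, v at a and z at b, the edges w₁v and w₂z are then
    -- joined by three edges.
    no-triangle : ∀ {a b x} → adj a b ≡ true → adj a x ≡ true → adj b x ≡ true → ⊥
    no-triangle {a} {b} {x} ab ax bx = conclude
      where
      misses : ∀ {a b x w} → adj a b ≡ true → adj a x ≡ true → adj b x ≡ true → adj x w ≡ true → w ≢ a → w ≢ b → adj a w ≡ false × adj b w ≡ false
      misses {a} {b} {x} {w} ab ax bx xw w≢a w≢b =
        χ≡0⇒ (lin (χ (adj a x) ∷ χ (adj a w) ∷ χ (adj b x) ∷ χ (adj b w) ∷ μ ∷ []) 0 (x₁ ≼ κ 0) ((κ 1 , x₀ ⊕ x₁ ⊕ x₂ ⊕ x₃ ≼ x₄) ∷ (κ 1 , x₄ ≼ κ 2) ∷ (κ 1 , κ 1 ≼ x₀) ∷ (κ 1 , κ 1 ≼ x₂) ∷ []) refl (≤-reflexive Q , ≤-reflexive μ2 , ≤-reflexive (sym (cong χ ax)) , ≤-reflexive (sym (cong χ bx)) , tt)) ,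
        χ≡0⇒ (lin (χ (adj a x) ∷ χ (adj a w) ∷ χ (adj b x) ∷ χ (adj b w) ∷ μ ∷ []) 0 (x₃ ≼ κ 0) ((κ 1 , x₀ ⊕ x₁ ⊕ x₂ ⊕ x₃ ≼ x₄) ∷ (κ 1 , x₄ ≼ κ 2) ∷ (κ 1 , κ 1 ≼ x₀) ∷ (κ 1 , κ 1 ≼ x₂) ∷ []) refl (≤-reflexive Q , ≤-reflexive μ2 , ≤-reflexive (sym (cong χ ax)) , ≤-reflexive (sym (cong χ bx)) , tt))
        where
        Q : χ (adj a x) + χ (adj a w) + χ (adj b x) + χ (adj b w) ≡ μ
        Q = quad ab xw (adj-≢ ax) (w≢a ∘ sym) (adj-≢ bx) (w≢b ∘ sym)
      pendant : ∀ {x a b w v} → adj x a ≡ true → adj x b ≡ true → adj a b ≡ true → adj x w ≡ true → adj a v ≡ true → w ≢ a → w ≢ b → v ≢ x → v ≢ b → v ≢ w → adj w v ≡ true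
      pendant {x} {a} {b} {w} {v} xa xb ab xw av w≢a w≢b v≢x v≢b v≢w = χ≥1⇒ (lin (χ (adj x a) ∷ χ (adj x v) ∷ χ (adj w a) ∷ χ (adj w v) ∷ μ ∷ []) 0 (κ 1 ≼ x₃) ((κ 1 , x₄ ≼ x₀ ⊕ x₁ ⊕ x₂ ⊕ x₃) ∷ (κ 1 , κ 2 ≼ x₄) ∷ (κ 1 , x₀ ≼ κ 1) ∷ (κ 1 , x₁ ≼ κ 0) ∷ (κ 1 , x₂ ≼ κ 0) ∷ []) refl (≤-reflexive (sym (quad xw av (adj-≢ xa) (v≢x ∘ sym) w≢a (v≢w ∘ sym))) , ≤-reflexive (sym μ2) , ≤-reflexive (cong χ xa) , ≤-reflexive (cong χ (proj₁ (misses xb xa (adj-sym ab) av v≢x v≢b))) , ≤-reflexive (cong χ (nonadj-sym (proj₁ (misses ab (adj-sym xa) (adj-sym xb) xw w≢a w≢b)))) , tt))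
      conclude : ⊥
      conclude with fresh x (a ∷ b ∷ []) (few (s≤s (s≤s z≤n)))
      ... | w₁ , xw₁ , w₁≢a , w₁≢b , _ with fresh x (a ∷ b ∷ w₁ ∷ []) (few (s≤s (s≤s (s≤s z≤n))))
      ... | w₂ , xw₂ , w₂≢a , w₂≢b , w₂≢w₁ , _ with fresh a (b ∷ x ∷ w₁ ∷ w₂ ∷ []) (few (s≤s (s≤s (s≤s (s≤s z≤n)))))
      ... | v , av , v≢b , v≢x , v≢w₁ , v≢w₂ , _ with fresh b (a ∷ x ∷ w₁ ∷ w₂ ∷ v ∷ []) (few (s≤s (s≤s (s≤s (s≤s (s≤s z≤n))))))
      ... | z , bz , z≢a , z≢x , z≢w₁ , z≢w₂ , z≢v , _ =
        1≰0 (lin (χ (adj w₁ w₂) ∷ χ (adj w₁ z) ∷ χ (adj v w₂) ∷ χ (adj v z) ∷ μ ∷ []) 0 (κ 1 ≼ κ 0) ((κ 1 , x₀ ⊕ x₁ ⊕ x₂ ⊕ x₃ ≼ x₄) ∷ (κ 1 , x₄ ≼ κ 2) ∷ (κ 1 , κ 1 ≼ x₁) ∷ (κ 1 , κ 1 ≼ x₂) ∷ (κ 1 , κ 1 ≼ x₃) ∷ []) refl (≤-reflexive (quad (pendant (adj-sym ax) (adj-sym bx) ab xw₁ av w₁≢a w₁≢b v≢x v≢b v≢w₁) (pendant (adj-sym bx) (adj-sym ax) (adj-sym ab) xw₂ bz w₂≢b w₂≢a z≢x z≢a z≢w₂) (w₂≢w₁ ∘ sym) (z≢w₁ ∘ sym)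 v≢w₂ (z≢v ∘ sym)) , ≤-reflexive μ2 , ≤-reflexive (sym (cong χ (pendant (adj-sym bx) (adj-sym ax) (adj-sym ab) xw₁ bz w₁≢b w₁≢a z≢x z≢a z≢w₁))) , ≤-reflexive (sym (cong χ (adj-sym (pendant (adj-sym ax) (adj-sym bx) ab xw₂ av w₂≢a w₂≢b v≢x v≢b v≢w₂)))) , ≤-reflexive (sym (cong χ (pendant ab ax bx av bz v≢b v≢x z≢a z≢x z≢v))) , tt))

    close-path : ∀ {b a x w} → adj b a ≡ true → adj a x ≡ true → adj x w ≡ true → b ≢ x → b ≢ w → a ≢ w → adj b w ≡ true
    close-path {b} {a} {x} {w} ba ax xw b≢x b≢w a≢w = χ≥1⇒ (lin (χ (adj a x) ∷ χ (adj a w) ∷ χ (adj b x) ∷ χ (adj b w) ∷ μ ∷ []) 0 (κ 1 ≼ x₃) ((κ 1 , x₄ ≼ x₀ ⊕ x₁ ⊕ x₂ ⊕ x₃) ∷ (κ 1 , κ 2 ≼ x₄) ∷ (κ 1 , x₀ ≼ κ 1) ∷ (κ 1 , x₁ ≼ κ 0) ∷ (κ 1 , x₂ ≼ κ 0) ∷ []) refl (≤-reflexive (sym (quad (adj-sym ba) xw (adj-≢ ax) a≢w b≢x b≢w)) , ≤-reflexive (sym μ2) , χ≤1 (adj a x) , ≤-reflexive (cong χ (none (λ e → no-triangle ax e xw))) , ≤-reflexive (cong χ (none (λ e → no-triangle ba e ax))) , tt))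
      where
      none : ∀ {i j} → (adj i j ≡ true → ⊥) → adj i j ≡ false
      none {i} {j} h with Bool-cases (adj i j)
      ... | inj₁ p = ⊥-elim (h p)
      ... | inj₂ p = p

    o′ : Fin m
    o′ = proj₁ (fresh o [] (s≤s z≤n))

    oo′ : adj o o′ ≡ true
    oo′ = proj₁ (proj₂ (fresh o [] (s≤s z≤n)))

    -- The neighbours of `o` form one side; `o` itself belongs to the other.
    part : Fin m → Bool
    part = adj o

    -- If x differs from o and is adjacent to neither end of oo′, then for a further neighbour w of
    -- x both joining edges end at w, and w forms a triangle with oo′.
    otherwise : ∀ x → part x ≡ false → adj o′ x ≡ true
    otherwise x e = decide (x Fin.≟ o)
      where
      decide : Dec (x ≡ o) → adj o′ x ≡ true
      decide (yes refl) = adj-sym oo′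
      decide (no x≢o) = from (Bool-cases (adj o′ x))
        where
        from : adj o′ x ≡ true ⊎ adj o′ x ≡ false → adj o′ x ≡ true
        from (inj₁ p) = p
        from (inj₂ p) with fresh x (o ∷ o′ ∷ []) (few (s≤s (s≤s z≤n)))
        ... | w , xw , w≢o , w≢o′ , _ = ⊥-elim (no-triangle oo′ (χ≥1⇒ (lin (χ (adj o x) ∷ χ (adj o w) ∷ χ (adj o′ x) ∷ χ (adj o′ w) ∷ μ ∷ []) 0 (κ 1 ≼ x₁) ((κ 1 , x₄ ≼ x₀ ⊕ x₁ ⊕ x₂ ⊕ x₃) ∷ (κ 1 , κ 2 ≼ x₄) ∷ (κ 1 , x₀ ≼ κ 0) ∷ (κ 1 , x₂ ≼ κ 0) ∷ (κ 1 , x₃ ≼ κ 1) ∷ []) refl (≤-reflexive (sym Q) , ≤-reflexive (sym μ2) , ≤-reflexive (cong χ e) , ≤-reflexive (cong χ p) , χ≤1 (adj o′ w) , tt)))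
                (χ≥1⇒ (lin (χ (adj o x) ∷ χ (adj o w) ∷ χ (adj o′ x) ∷ χ (adj o′ w) ∷ μ ∷ []) 0 (κ 1 ≼ x₃) ((κ 1 , x₄ ≼ x₀ ⊕ x₁ ⊕ x₂ ⊕ x₃) ∷ (κ 1 , κ 2 ≼ x₄) ∷ (κ 1 , x₀ ≼ κ 0) ∷ (κ 1 , x₂ ≼ κ 0) ∷ (κ 1 , x₁ ≼ κ 1) ∷ []) refl (≤-reflexive (sym Q) , ≤-reflexive (sym μ2) , ≤-reflexive (cong χ e) , ≤-reflexive (cong χ p) , χ≤1 (adj o w) , tt))))
          where
          x≢o′ : x ≢ o′
          x≢o′ refl = true≢false oo′ e
          Q : χ (adj o x) + χ (adj o w) + χ (adj o′ x) + χ (adj o′ w) ≡ μ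
          Q = quad oo′ xw (x≢o ∘ sym) (w≢o ∘ sym) (x≢o′ ∘ sym) (w≢o′ ∘ sym)

    part-complete : ∀ {x z} → part x ≡ true → part z ≡ false → adj x z ≡ true
    part-complete {x} {z} p q = decide (x Fin.≟ o′) (z Fin.≟ o)
      where
      x≢z : x ≢ z
      x≢z refl = true≢false p q
      decide : Dec (x ≡ o′) → Dec (z ≡ o) → adj x z ≡ true
      decide (yes refl) _ = otherwise z q
      decide (no _) (yes refl) = adj-sym p
      decide (no ne) (no ne′) = close-path (adj-sym p) oo′ (otherwise z q) ne x≢z (ne′ ∘ sym)

    part-proper : ∀ {x z} → adj x z ≡ true → part x ≢ part z
    part-proper {x} {z} e q = go (part x) refl
      where
      go : ∀ b → part x ≡ b → ⊥
      go true  p = no-triangle p (trans (sym q) p) e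
      go false p = no-triangle (otherwise x p) (otherwise z (trans (sym q) p)) e

-- Triangular graphs

BoolFun : ℕ → Set
BoolFun zero    = Bool
BoolFun (suc k) = Bool → BoolFun k

-- Exhaustive evaluation, which lets the parity argument on ten triples be checked by `refl`.
tautology : ∀ k → BoolFun k → Bool
tautology zero    b = b
tautology (suc k) f = tautology k (f true) ∧ tautology k (f false)

apply : ∀ {k} → BoolFun k → Vec Bool k → Bool
apply b []       = b
apply f (b ∷ bs) = apply (f b) bs

tautology⇒ : ∀ {k} (f : BoolFun k) → tautology k f ≡ true → ∀ bs → apply f bs ≡ true
tautology⇒ {zero}  f e []           = e
tautology⇒ {suc k} f e (true ∷ bs)  = tautology⇒ (f true) (proj₁ (∧-true e)) bs
tautology⇒ {suc k} f e (false ∷ bs) = tautology⇒ (f false) (proj₂ (∧-true {tautology k (f true)} e)) bs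

-- Paths of a fixed colour i between the disjoint pairs ab and xz, in terms of the
-- orientations α, β, γ, δ of the triples abx, abz, axz, bxz.
oriented-paths : Bool → Bool → Bool → Bool → ℕ
oriented-paths α β γ δ = χ α * χ (not γ) + χ β * χ γ + χ (not α) * χ (not δ) + χ (not β) * χ δ

odd : Bool → Bool → Bool → Bool → Bool
odd α β γ δ = (α xor β) xor (γ xor δ)

-- The hypotheses belong to the three ways of splitting a quadruple into two disjoint pairs. A
-- single path for each of them forces an odd number of positive triples.
quadruple-odd : ∀ α β γ δ → oriented-paths α β γ δ ≡ 1 → oriented-paths (not α) γ β (not δ) ≡ 1 → oriented-paths (not β) (not γ) α δ ≡ 1 → odd α β γ δ ≡ true
quadruple-odd true  true  true  true  p () r
quadruple-odd true  true  true  false p q r = refl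
quadruple-odd true  true  false true  p q r = refl
quadruple-odd true  true  false false p q ()
quadruple-odd true  false true  true  p q r = refl
quadruple-odd true  false true  false () q r
quadruple-odd true  false false true  () q r
quadruple-odd true  false false false p q r = refl
quadruple-odd false true  true  true  p q r = refl
quadruple-odd false true  true  false () q r
quadruple-odd false true  false true  () q r
quadruple-odd false true  false false p q r = refl
quadruple-odd false false true  true  p q ()
quadruple-odd false false true  false p q r = refl
quadruple-odd false false false true  p q r = refl
quadruple-odd false false false false p () r

-- Each of the ten triples of a 5-set lies in two of its five quadruples.
five-odd : ∀ abx aby abz axy axz ayz bxy bxz byz xyz → odd abx aby axy bxy ≡ true → odd abx abz axz bxz ≡ true → odd aby abz ayz byz ≡ true →
           odd axy axz ayz xyz ≡ true → odd bxy bxz byz xyz ≡ true → ⊥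
five-odd p₁ p₂ p₃ p₄ p₅ p₆ p₇ p₈ p₉ p₀ q₁ q₂ q₃ q₄ q₅ = true≢false (∧-intro q₁ (∧-intro q₂ (∧-intro q₃ (∧-intro q₄ q₅))))
  (not-true (tautology⇒ {10} check refl (p₁ ∷ p₂ ∷ p₃ ∷ p₄ ∷ p₅ ∷ p₆ ∷ p₇ ∷ p₈ ∷ p₉ ∷ p₀ ∷ [])))
  where
  check : BoolFun 10
  check p₁ p₂ p₃ p₄ p₅ p₆ p₇ p₈ p₉ p₀ =
    not (odd p₁ p₂ p₄ p₇ ∧ (odd p₁ p₃ p₅ p₈ ∧ (odd p₂ p₃ p₆ p₉ ∧ (odd p₄ p₅ p₆ p₀ ∧ odd p₇ p₈ p₉ p₀))))

module Classify {n r : ℕ} (c : Coloring n r) (pcc : IsPCC c) (n≥2 : 2 ≤ n) (u₀ : Fin n) (d : Fin r)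
                (dominant : 2 * n < 3 * # (λ w → c u₀ w == d)) where
  open Coherent c pcc
  open Dominant c pcc n≥2 u₀ d dominant hiding (nb⇒≢)

  exceptional : ∀ b m (f : Fin n ↔ BaseV b m) → (∀ {u v} → nb u v ≡ true → BaseE b m (Inverse.to f u) (Inverse.to f v)) →
                (∀ {u v} → u ≢ v → BaseE b m (Inverse.to f u) (Inverse.to f v) → nb u v ≡ true) →
                (∀ {u v u′ v′} → nb u v ≡ true → nb u′ v′ ≡ true → c u v ≡ c u′ v′) → Exceptional c
  exceptional b m f nb⇒E E⇒nb one-colour = b , m , false , f , λ u v u′ v′ → mk⇔ (to u v u′ v′) (from u v u′ v′)
    where
    φ = Inverse.to f
    φ-injective : ∀ {u v} → φ u ≡ φ v → u ≡ v
    φ-injective {u} {v} e = trans (sym (Inverse.strictlyInverseʳ f u)) (trans (cong (Inverse.from f) e) (Inverse.strictlyInverseʳ f v))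
    to : ∀ u v u′ v′ → c u v ≡ c u′ v′ → SameX (BaseE b m) (φ u) (φ v) (φ u′) (φ v′)
    to u v u′ v′ e = decide (u Fin.≟ v) (Bool-cases (nb u v))
      where
      decide : Dec (u ≡ v) → nb u v ≡ true ⊎ nb u v ≡ false → SameX (BaseE b m) (φ u) (φ v) (φ u′) (φ v′)
      decide (yes refl) _ = inj₁ (refl , cong φ (c-diag (sym e)))
      decide (no ne) nbs = inj₂ (split nbs)
        where
        ne′ : u′ ≢ v′
        ne′ refl = ne (c-diag e)
        split : nb u v ≡ true ⊎ nb u v ≡ false → _
        split (inj₁ p) = inj₁ ((ne ∘ φ-injective , nb⇒E p) , (ne′ ∘ φ-injective , nb⇒E (trans (sym (nb-coh e)) p)))
        split (inj₂ p) = inj₂ ((ne ∘ φ-injective , λ E → true≢false (E⇒nb ne E) p) , (ne′ ∘ φ-injective , λ E → true≢false (E⇒nb ne′ E) (trans (sym (nb-coh e)) p)))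
    far-of : ∀ {u v} → φ u ≢ φ v → ¬ BaseE b m (φ u) (φ v) → c u v ≡ d
    far-of {u} {v} ne ¬E = from-far (Bool-cases (far u v))
      where
      from-far : far u v ≡ true ⊎ far u v ≡ false → c u v ≡ d
      from-far (inj₁ p) = ==⇒≡ {x = c u v} {d} p
      from-far (inj₂ p) = ⊥-elim (¬E (nb⇒E (≢∧¬far⇒nb (ne ∘ cong φ) p)))
    from : ∀ u v u′ v′ → SameX (BaseE b m) (φ u) (φ v) (φ u′) (φ v′) → c u v ≡ c u′ v′
    from u v u′ v′ (inj₁ (p , q)) with refl ← φ-injective p | refl ← φ-injective q = IsPCC.homogeneous pcc u u′
    from u v u′ v′ (inj₂ (inj₁ ((p , q) , (p′ , q′)))) = one-colour (E⇒nb (p ∘ cong φ) q) (E⇒nb (p′ ∘ cong φ) q′)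
    from u v u′ v′ (inj₂ (inj₂ ((p , q) , (p′ , q′)))) = trans (far-of p q) (sym (far-of p′ q′))

  module Geometry (label : Fin n → Fin n → Bool)
    (clique-nb : ∀ {y x x′} → nb y x ≡ true → nb y x′ ≡ true → label y x ≡ label y x′ → x ≢ x′ → nb x x′ ≡ true)
    (clique-size : ∀ y b → 20 ≤ # (λ x → nb y x ∧ agree b (label y x)))
    (clique-cross : ∀ {y b x} → nb y x ∧ agree b (label y x) ≡ true → # (λ z → (nb y z ∧ agree (not b) (label y z)) ∧ nb x z) ≤ 3)
    (μ≥1 : 1 ≤ μ) (μ≤4 : μ ≤ 4) where

    open LineGraph nb far nb-sym nb-irrefl (λ {u} {v} → nb⇒¬far {u} {v}) far-irrefl (λ {u} {v} → ≢∧¬far⇒nb {u} {v}) label (λ {y} {x} {x′} → clique-nb {y} {x} {x′}) clique-size (λ {y} {b} {x} → clique-cross {y} {b} {x})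

    not-member : ∀ {j : Fin m} F → memberᵇ j F ≡ false → NotIn j F
    not-member []      _ = tt
    not-member {j} (x ∷ F) e = ==⇒≢ {x = j} {x} (proj₁ split) , not-member F (proj₂ split)
      where
      or-false : ∀ a {b} → a ∨ b ≡ false → a ≡ false × b ≡ false
      or-false false e = refl , e
      split : (j == x) ≡ false × memberᵇ j F ≡ false
      split = or-false (j == x) e

    fresh′ : ∀ i (F : List (Fin m)) → length F < 20 → ∃ λ j → adj i j ≡ true × NotIn j F
    fresh′ i F lt with fresh i F lt
    ... | j , e , ne = j , e , not-member F ne

    quad : ∀ {a b i j} → adj a b ≡ true → adj i j ≡ true → a ≢ i → a ≢ j → b ≢ i → b ≢ j → χ (adj a i) + χ (adj a j) + χ (adj b i) + χ (adj b j) ≡ μ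
    quad = four-lines (λ {y} {v} → cn-far {y} {v})

    open RootGraph adj (λ {i} {j} → adj-sym {i} {j}) (λ {i} {j} → adj-≢ {i} {j}) μ (λ {a} {b} {i} {j} → quad {a} {b} {i} {j}) fresh′ (line u₀ true)

    abstract
      -- The vertex on the lines i and j; u₀ is a default for lines that are not adjacent.
      pt : Fin m → Fin m → Fin n
      pt i j = [ proj₁ , (λ _ → u₀) ]′ (any? (λ x → on x i j))

      pt-on : ∀ {i j} → adj i j ≡ true → On (pt i j) i j
      pt-on {i} {j} e = go (any? (λ x → on x i j))
        where
        go : (s : (∃ λ x → on x i j ≡ true) ⊎ (∀ x → on x i j ≡ false)) → On ([ proj₁ , (λ _ → u₀) ]′ s) i j
        go (inj₁ (x , p)) = on⇒ p
        go (inj₂ none) = ⊥-elim (true≢false (⇒on (proj₂ (adj⇒ e))) (none (proj₁ (adj⇒ e))))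

    pt-unique : ∀ {x i j} → On x i j → pt i j ≡ x
    pt-unique o = On-unique (pt-on (⇒adj (_ , o))) o

    On⇒nb : ∀ {u v a b b′} → b ≢ b′ → On u a b → On v a b′ → nb u v ≡ true
    On⇒nb {u} {v} {a} {b} {b′} ne o@(s , p , q) o′@(t , p′ , q′) = proj₁ (line⇒nb u≢v (trans p (sym p′)))
      where
      u≢v : u ≢ v
      u≢v refl = clash (On-cases o o′)
        where
        clash : (a ≡ a × b ≡ b′) ⊎ (a ≡ b′ × b ≡ a) → ⊥
        clash (inj₁ (_ , e)) = ne e
        clash (inj₂ (_ , e)) = On-≢ o (sym e)

    nb⇒On : ∀ {u v} → nb u v ≡ true → ∃ λ a → ∃ λ b → ∃ λ b′ → On u a b × On v a b′ × b ≢ b′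
    nb⇒On {u} {v} e = line u (label u v) , line u (not (label u v)) , line v (not (label v u)) , o , o′ , λ eq → nb⇒≢ e (On-unique o (subst (On v (line u (label u v))) (sym eq) o′))
      where
      o : On u (line u (label u v)) (line u (not (label u v)))
      o = label u v , refl , refl
      o′ : On v (line u (label u v)) (line v (not (label v u)))
      o′ = label v u , sym (nb⇒line e) , refl

    weighted-const : (φ ψ : Fin r → ℕ) → ∀ {y v y′ v′} → far y v ≡ true → far y′ v′ ≡ true →
      sum (λ w → χ (nb y w) * χ (nb w v) * (φ (c y w) * ψ (c w v))) ≡ sum (λ w → χ (nb y′ w) * χ (nb w v′) * (φ (c y′ w) * ψ (c w v′)))
    weighted-const φ ψ {y} {v} {y′} {v′} f f′ = trans (regroup y v) (trans (far-coh (coh-∘ {λ y w → χ (nb y w) * φ (c y w)} {λ w v → χ (nb w v) * ψ (c w v)}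
        (coh-op _*_ {λ y w → χ (nb y w)} {λ y w → φ (c y w)} coh-nb (coh-col φ)) (coh-op _*_ {λ y w → χ (nb y w)} {λ y w → ψ (c y w)} coh-nb (coh-col ψ))) f f′) (sym (regroup y′ v′)))
      where
      regroup : ∀ y v → sum (λ w → χ (nb y w) * χ (nb w v) * (φ (c y w) * ψ (c w v))) ≡ sum (λ w → χ (nb y w) * φ (c y w) * (χ (nb w v) * ψ (c w v)))
      regroup y v = sum-cong-≗ (λ w → (identity (χ (nb y w) ∷ χ (nb w v) ∷ φ (c y w) ∷ ψ (c w v) ∷ []) (x₀ ⊗ x₁ ⊗ (x₂ ⊗ x₃)) (x₀ ⊗ x₂ ⊗ (x₁ ⊗ x₃)) refl))

    abstract
      -- Walks through common neighbours of two far vertices whose first step has colour k. By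
      -- coherence this is one number for all far pairs, the source of the colour equations; the
      -- factor 1 is the weight of the second step.
      ω : Fin r → ℕ
      ω k = sum (λ w → χ (nb u₀ w) * χ (nb w (proj₁ far-pair)) * (χ (c u₀ w == k) * 1))

      paths-ω : ∀ k {y v} → far y v ≡ true → sum (λ w → χ (nb y w) * χ (nb w v) * (χ (c y w == k) * 1)) ≡ ω k
      paths-ω k f = weighted-const (λ j → χ (j == k)) (λ _ → 1) f (proj₂ far-pair)

    module Triangular (μ4 : μ ≡ 4) where
      open Four μ4

      pt-On : ∀ {i j} → i ≢ j → On (pt i j) i j
      pt-On ne = pt-on (complete ne)

      pt-sym : ∀ {i j} → i ≢ j → pt i j ≡ pt j i
      pt-sym ne = pt-unique (On-sym (pt-On (ne ∘ sym)))

      sum-pt : ∀ {i j} (g : Fin n → ℕ) → i ≢ j → sum (λ w → χ (on w i j) * g w) ≡ g (pt i j)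
      sum-pt g ne = sum-on g (pt-On ne)

      K : Fin m → Fin m → Fin m → Fin r
      K a b x = c (pt a b) (pt a x)

      K-flip : ∀ {a b x a′ b′ x′} → K a b x ≡ K a′ b′ x′ → K a x b ≡ K a′ x′ b′
      K-flip e = c-flip e

      colour : ∀ {a b x} → a ≢ b → c (pt b a) (pt b x) ≡ c (pt a b) (pt b x)
      colour {a} {b} {x} ne = cong (λ z → c z (pt b x)) (pt-sym (ne ∘ sym))

      -- The edges of colour k from ab to ax and bx: the share of the line x in the walks from ab to
      -- any xz.
      Φ : Fin r → Fin m → Fin m → Fin m → ℕ
      Φ k a b x = χ (K a b x == k) + χ (K b a x == k)

      Φ+Φ : ∀ k {a b x z} → a ≢ b → x ≢ z → a ≢ x → a ≢ z → b ≢ x → b ≢ z → Φ k a b x + Φ k a b z ≡ ω k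
      Φ+Φ k {a} {b} {x} {z} ab xz ax az bx bz = trans (sym (begin
        sum (λ w → χ (nb y w) * χ (nb w v) * g w) ≡⟨ common-sum′ g f (pt-On ab) (pt-On xz) ⟩
        sum (λ w → χ (on w a x) * g w) + sum (λ w → χ (on w a z) * g w) + sum (λ w → χ (on w b x) * g w) + sum (λ w → χ (on w b z) * g w)
          ≡⟨ cong₂ _+_ (cong₂ _+_ (cong₂ _+_ (sum-pt g ax) (sum-pt g az)) (sum-pt g bx)) (sum-pt g bz) ⟩
        g (pt a x) + g (pt a z) + g (pt b x) + g (pt b z)
          ≡⟨ (identity (χ (K a b x == k) ∷ χ (K a b z == k) ∷ χ (c y (pt b x) == k) ∷ χ (c y (pt b z) == k) ∷ []) (x₀ ⊗ κ 1 ⊕ x₁ ⊗ κ 1 ⊕ x₂ ⊗ κ 1 ⊕ x₃ ⊗ κ 1) (x₀ ⊕ x₂ ⊕ (x₁ ⊕ x₃)) refl) ⟩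
        χ (K a b x == k) + χ (c y (pt b x) == k) + (χ (K a b z == k) + χ (c y (pt b z) == k))
          ≡⟨ cong₂ (λ i j → χ (K a b x == k) + χ (i == k) + (χ (K a b z == k) + χ (j == k))) (sym (colour {a} {b} {x} ab)) (sym (colour {a} {b} {z} ab)) ⟩
        Φ k a b x + Φ k a b z ∎)) (paths-ω k f)
        where
        open ≡-Reasoning
        y v : Fin n
        y = pt a b
        v = pt x z
        f : far y v ≡ true
        f = far-On (pt-On ab) (pt-On xz) ax az bx bz
        g : Fin n → ℕ
        g w = χ (c y w == k) * 1

      -- Any two of three lines x, z, z′ outside ab have values of Φ with sum ω, so the three values
      -- are equal.
      2Φ : ∀ k {a b x} → a ≢ b → a ≢ x → b ≢ x → 2 * Φ k a b x ≡ ω k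
      2Φ k {a} {b} {x} ab ax bx = from (fresh′ a (b ∷ x ∷ []) (s≤s (s≤s (s≤s z≤n))))
       where
       from : (∃ λ z → adj a z ≡ true × NotIn z (b ∷ x ∷ [])) → 2 * Φ k a b x ≡ ω k
       from (z , az , z≢b , z≢x , _) = from′ (fresh′ a (b ∷ x ∷ z ∷ []) (s≤s (s≤s (s≤s (s≤s z≤n)))))
        where
        from′ : (∃ λ z′ → adj a z′ ≡ true × NotIn z′ (b ∷ x ∷ z ∷ [])) → 2 * Φ k a b x ≡ ω k
        from′ (z′ , az′ , z′≢b , z′≢x , z′≢z , _) = (≤-antisym (lin (Φ k a b x ∷ Φ k a b z ∷ Φ k a b z′ ∷ ω k ∷ []) 0 (κ 2 ⊗ x₀ ≼ x₃) ((κ 1 , x₀ ⊕ x₁ ≼ x₃) ∷ (κ 1 , x₀ ⊕ x₂ ≼ x₃) ∷ (κ 1 , x₃ ≼ x₁ ⊕ x₂) ∷ []) refl (≤-reflexive (Φ+Φ k ab (z≢x ∘ sym) ax (adj-≢ az) bx (z≢b ∘ sym)) , ≤-reflexive (Φ+Φ k ab (z′≢x ∘ sym) ax (adj-≢ az′) bx (z′≢b ∘ sym)) , ≤-reflexive (sym (Φ+Φ k ab (z′≢z ∘ sym) (adj-≢ az) (adj-≢ az′) (z≢b ∘ sym) (z′≢b ∘ sym))) , tt)) (lin (Φ k a b x ∷ Φ k a b z ∷ Φ k a b z′ ∷ ω k ∷ []) 0 (x₃ ≼ κ 2 ⊗ x₀) ((κ 1 , x₃ ≼ x₀ ⊕ x₁)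 ∷ (κ 1 , x₃ ≼ x₀ ⊕ x₂) ∷ (κ 1 , x₁ ⊕ x₂ ≼ x₃) ∷ []) refl (≤-reflexive (sym (Φ+Φ k ab (z≢x ∘ sym) ax (adj-≢ az) bx (z≢b ∘ sym))) , ≤-reflexive (sym (Φ+Φ k ab (z′≢x ∘ sym) ax (adj-≢ az′) bx (z′≢b ∘ sym))) , ≤-reflexive (Φ+Φ k ab (z′≢z ∘ sym) (adj-≢ az) (adj-≢ az′) (z≢b ∘ sym) (z′≢b ∘ sym)) , tt)))

      Φ-const : ∀ k {a b x a′ b′ x′} → a ≢ b → a ≢ x → b ≢ x → a′ ≢ b′ → a′ ≢ x′ → b′ ≢ x′ → Φ k a b x ≡ Φ k a′ b′ x′
      Φ-const k ab ax bx ab′ ax′ bx′ = *-cancelˡ-≡ _ _ 2 (trans (2Φ k ab ax bx) (sym (2Φ k ab′ ax′ bx′)))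

      -- If the two edges at ab in the triangle abx had different colours, the colours
      -- would orient the triples of lines.
      module Oriented {a₀ b₀ x₀ : Fin m} (ab₀ : a₀ ≢ b₀) (ax₀ : a₀ ≢ x₀) (bx₀ : b₀ ≢ x₀) (differ : K b₀ a₀ x₀ ≢ K a₀ b₀ x₀) where
        i j : Fin r
        i = K a₀ b₀ x₀
        j = K b₀ a₀ x₀

        o? : Fin m → Fin m → Fin m → Bool
        o? a b x = K a b x == i

        Φi≡1 : ∀ {a b x} → a ≢ b → a ≢ x → b ≢ x → Φ i a b x ≡ 1
        Φi≡1 ab ax bx = trans (Φ-const i ab ax bx ab₀ ax₀ bx₀) (cong₂ (λ s t → χ s + χ t) (==-refl i) (≢⇒== differ))

        Φj≡1 : ∀ {a b x} → a ≢ b → a ≢ x → b ≢ x → Φ j a b x ≡ 1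
        Φj≡1 ab ax bx = trans (Φ-const j ab ax bx ab₀ ax₀ bx₀) (cong₂ (λ s t → χ s + χ t) (≢⇒== (differ ∘ sym)) (==-refl j))

        sum1⇒ : ∀ {s t} → χ s + χ t ≡ 1 → t ≡ not s
        sum1⇒ {true}  {false} _ = refl
        sum1⇒ {false} {true}  _ = refl

        o-swap : ∀ {a b x} → a ≢ b → a ≢ x → b ≢ x → o? b a x ≡ not (o? a b x)
        o-swap ab ax bx = sum1⇒ (Φi≡1 ab ax bx)

        ¬i⇒j : ∀ {a b x} → a ≢ b → a ≢ x → b ≢ x → o? a b x ≡ false → K a b x ≡ j
        ¬i⇒j {a} {b} {x} ab ax bx e = ==⇒≡ {x = K a b x} {j} (flip (sum1⇒ {K a b x == j} {K b a x == j} (Φj≡1 ab ax bx)))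
          where
          ba : K b a x ≡ i
          ba = ==⇒≡ {x = K b a x} {i} (trans (o-swap ab ax bx) (cong not e))
          flip : (K b a x == j) ≡ not (K a b x == j) → (K a b x == j) ≡ true
          flip p = go (K a b x == j) (trans (sym p) (≢⇒== (λ q → differ (trans (sym q) ba))))
            where
            go : ∀ s → not s ≡ false → s ≡ true
            go true _ = refl

        -- With i its own converse, exchanging the last two arguments preserves `o?`, while
        -- exchanging the first two negates it; but transpositions of three letters are conjugate.
        symmetric : K a₀ x₀ b₀ ≡ i → ⊥
        symmetric e = true≢false (turn (==-refl i)) (trans (o-swap (ax₀ ∘ sym) (bx₀ ∘ sym) ab₀) (cong not (turn (trans (o-swap bx₀ (ab₀ ∘ sym) (ax₀ ∘ sym)) (cong not back)))))
          where
          turn : ∀ {a b x} → o? a b x ≡ true → o? a x b ≡ true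
          turn {a} {b} {x} p = trans (cong (_== i) (trans (K-flip (==⇒≡ {x = K a b x} {i} p)) e)) (==-refl i)
          back : o? b₀ x₀ a₀ ≡ false
          back = ¬true⇒false (λ p → true≢false (turn p) (trans (o-swap ab₀ ax₀ bx₀) (cong not (==-refl i))))

        module Alternating (ne : K a₀ x₀ b₀ ≢ i) where

          -- The converse of i is now j, so this exchange negates `o?` as well, and `o?` orients
          -- every triple.
          o-turn : ∀ {a b x} → a ≢ b → a ≢ x → b ≢ x → o? a x b ≡ not (o? a b x)
          o-turn {a} {b} {x} ab ax bx = go (o? a b x) refl
            where
            flipped : K a₀ x₀ b₀ ≡ j
            flipped = ¬i⇒j ax₀ ab₀ (bx₀ ∘ sym) (≢⇒== ne)
            go : ∀ t → o? a b x ≡ t → o? a x b ≡ not t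
            go true  p = ≢⇒== (λ q → ne (trans (K-flip (sym (==⇒≡ {x = K a b x} {i} p))) q))
            go false p = trans (cong (_== i) (K-flip (trans (¬i⇒j ab ax bx p) (sym flipped)))) (==-refl i)

          distinct₄ : Fin m → Fin m → Fin m → Fin m → Set
          distinct₄ a b x z = a ≢ b × x ≢ z × a ≢ x × a ≢ z × b ≢ x × b ≢ z

          paths : Fin m → Fin m → Fin m → Fin m → ℕ
          paths a b x z = oriented-paths (o? a b x) (o? a b z) (o? a x z) (o? b x z)

          S : Fin m → Fin m → Fin m → Fin m → ℕ
          S a b x z = sum (λ w → χ (nb (pt a b) w) * χ (nb w (pt x z)) * (χ (c (pt a b) w == i) * χ (c w (pt x z) == i)))

          S≡paths : ∀ {a b x z} → distinct₄ a b x z → S a b x z ≡ paths a b x z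
          S≡paths {a} {b} {x} {z} (ab , xz , ax , az , bx , bz) = begin
            S a b x z ≡⟨ common-sum′ g f (pt-On ab) (pt-On xz) ⟩
            sum (λ w → χ (on w a x) * g w) + sum (λ w → χ (on w a z) * g w) + sum (λ w → χ (on w b x) * g w) + sum (λ w → χ (on w b z) * g w)
              ≡⟨ cong₂ _+_ (cong₂ _+_ (cong₂ _+_ (sum-pt g ax) (sum-pt g az)) (sum-pt g bx)) (sum-pt g bz) ⟩
            g (pt a x) + g (pt a z) + g (pt b x) + g (pt b z)
              ≡⟨ cong₂ _+_ (cong₂ _+_ (cong₂ _+_ (value₂ refl (trans (corner ax) (o-swap ax az xz)))
                                                 (value₂ refl (trans (corner′ az) (trans (o-swap az ax (xz ∘ sym)) (trans (cong not (o-turn ax az xz)) (not-involutive _))))))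
                                       (value₂ (trans (near-b bx) (o-swap ab ax bx)) (trans (corner bx) (o-swap bx bz xz))))
                           (value₂ (trans (near-b bz) (o-swap ab az bz)) (trans (corner′ bz) (trans (o-swap bz bx (xz ∘ sym)) (trans (cong not (o-turn bx bz xz)) (not-involutive _))))) ⟩
            paths a b x z ∎
            where
            open ≡-Reasoning
            y v : Fin n
            y = pt a b
            v = pt x z
            f : far y v ≡ true
            f = far-On (pt-On ab) (pt-On xz) ax az bx bz
            g : Fin n → ℕ
            g w = χ (c y w == i) * χ (c w v == i)
            value₂ : ∀ {w s t} → (c y w == i) ≡ s → (c w v == i) ≡ t → g w ≡ χ s * χ t
            value₂ = cong₂ (λ s t → χ s * χ t)
            corner : ∀ {a} → a ≢ x → (c (pt a x) v == i) ≡ o? x a z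
            corner {a} ne = cong (λ p → c p v == i) (pt-sym ne)
            corner′ : ∀ {a} → a ≢ z → (c (pt a z) v == i) ≡ o? z a x
            corner′ {a} ne = cong₂ (λ p q → c p q == i) (pt-sym ne) (pt-sym xz)
            near-b : ∀ {x} → b ≢ x → (c y (pt b x) == i) ≡ o? b a x
            near-b {x} ne = cong (λ p → c p (pt b x) == i) (pt-sym ab)

          paths-const : ∀ {a b x z a′ b′ x′ z′} → distinct₄ a b x z → distinct₄ a′ b′ x′ z′ → paths a b x z ≡ paths a′ b′ x′ z′
          paths-const {a} {b} {x} {z} {a′} {b′} {x′} {z′} D@(ab , xz , ax , az , bx , bz) D′@(ab′ , xz′ , ax′ , az′ , bx′ , bz′) =
            trans (sym (S≡paths D)) (trans (weighted-const (λ k → χ (k == i)) (λ k → χ (k == i)) (far-On (pt-On ab) (pt-On xz) ax az bx bz) (far-On (pt-On ab′) (pt-On xz′) ax′ az′ bx′ bz′)) (S≡paths D′))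

          equal-pair : ∀ {a b x z} → o? a b x ≡ o? a b z → paths a b x z ≡ 1
          equal-pair {a} {b} {x} {z} e = trans (cong (λ t → oriented-paths (o? a b x) t (o? a x z) (o? b x z)) (sym e)) (one (o? a b x) (o? a x z) (o? b x z))
            where
            one : ∀ α γ δ → oriented-paths α α γ δ ≡ 1
            one true  true  δ = refl
            one true  false δ = refl
            one false γ true  = refl
            one false γ false = refl

          pigeonhole : ∀ (p q s : Bool) → p ≡ q ⊎ p ≡ s ⊎ q ≡ s
          pigeonhole true  true  s     = inj₁ refl
          pigeonhole true  false true  = inj₂ (inj₁ refl)
          pigeonhole true  false false = inj₂ (inj₂ refl)
          pigeonhole false false s     = inj₁ refl
          pigeonhole false true  false = inj₂ (inj₁ refl)
          pigeonhole false true  true  = inj₂ (inj₂ refl)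

          quad-odd : (∀ {a b x z} → distinct₄ a b x z → paths a b x z ≡ 1) → ∀ {a b x z} → distinct₄ a b x z →
                     odd (o? a b x) (o? a b z) (o? a x z) (o? b x z) ≡ true
          quad-odd one {a} {b} {x} {z} D@(ab , xz , ax , az , bx , bz) = quadruple-odd (o? a b x) (o? a b z) (o? a x z) (o? b x z) (one D)
            (trans (cong₂ (λ s t → oriented-paths s (o? a x z) (o? a b z) t) (sym (o-turn ab ax bx)) (sym (o-swap bx bz xz))) (one {a} {x} {b} {z} (ax , bz , ab , az , bx ∘ sym , xz)))
            (trans (cong₂ (λ s t → oriented-paths s t (o? a b x) (o? b x z)) (sym (o-turn ab az bz)) (sym (o-turn ax az xz)))
              (trans (cong (oriented-paths (o? a z b) (o? a z x) (o? a b x)) (sym (trans (o-swap bz bx (xz ∘ sym)) (trans (cong not (o-turn bx bz xz)) (not-involutive _)))))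
                (one {a} {z} {b} {x} (az , bx , ab , ax , bz ∘ sym , xz ∘ sym))))

          impossible : ⊥
          impossible = from (fresh′ a₀ (b₀ ∷ x₀ ∷ []) (s≤s (s≤s (s≤s z≤n))))
           where
           from : (∃ λ y → adj a₀ y ≡ true × NotIn y (b₀ ∷ x₀ ∷ [])) → ⊥
           from (y , ay , y≢b , y≢x , _) = from′ (fresh′ a₀ (b₀ ∷ x₀ ∷ y ∷ []) (s≤s (s≤s (s≤s (s≤s z≤n)))))
            where
            from′ : (∃ λ z → adj a₀ z ≡ true × NotIn z (b₀ ∷ x₀ ∷ y ∷ [])) → ⊥
            from′ (z , az , z≢b , z≢x , z≢y , _) = five-odd (o? a₀ b₀ x₀) (o? a₀ b₀ y) (o? a₀ b₀ z) (o? a₀ x₀ y) (o? a₀ x₀ z) (o? a₀ y z) (o? b₀ x₀ y) (o? b₀ x₀ z) (o? b₀ y z) (o? x₀ y z)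
                (odd′ D₁) (odd′ D₂) (odd′ D₃) (odd′ D₄) (odd′ D₅)
             where
             D₁ : distinct₄ a₀ b₀ x₀ y
             D₁ = ab₀ , y≢x ∘ sym , ax₀ , adj-≢ ay , bx₀ , y≢b ∘ sym
             D₂ : distinct₄ a₀ b₀ x₀ z
             D₂ = ab₀ , z≢x ∘ sym , ax₀ , adj-≢ az , bx₀ , z≢b ∘ sym
             D₃ : distinct₄ a₀ b₀ y z
             D₃ = ab₀ , z≢y ∘ sym , adj-≢ ay , adj-≢ az , y≢b ∘ sym , z≢b ∘ sym
             D₄ : distinct₄ a₀ x₀ y z
             D₄ = ax₀ , z≢y ∘ sym , adj-≢ ay , adj-≢ az , y≢x ∘ sym , z≢x ∘ sym
             D₅ : distinct₄ b₀ x₀ y z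
             D₅ = bx₀ , z≢y ∘ sym , y≢b ∘ sym , z≢b ∘ sym , y≢x ∘ sym , z≢x ∘ sym
             -- Two of the three values of `o?` at a₀b₀ agree; that quadruple has exactly one path
             -- by `equal-pair`, and `paths-const` carries the number to all disjoint pairs.
             one : ∀ {a b x z} → distinct₄ a b x z → paths a b x z ≡ 1
             one {p} {q} {s} {t} D = cases (pigeonhole (o? a₀ b₀ x₀) (o? a₀ b₀ y) (o? a₀ b₀ z))
               where
               cases : o? a₀ b₀ x₀ ≡ o? a₀ b₀ y ⊎ o? a₀ b₀ x₀ ≡ o? a₀ b₀ z ⊎ o? a₀ b₀ y ≡ o? a₀ b₀ z → paths p q s t ≡ 1
               cases (inj₁ e) = trans (paths-const D D₁) (equal-pair {a₀} {b₀} {x₀} {y} e)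
               cases (inj₂ (inj₁ e)) = trans (paths-const D D₂) (equal-pair {a₀} {b₀} {x₀} {z} e)
               cases (inj₂ (inj₂ e)) = trans (paths-const D D₃) (equal-pair {a₀} {b₀} {y} {z} e)
             odd′ : ∀ {a b x z} → distinct₄ a b x z → odd (o? a b x) (o? a b z) (o? a x z) (o? b x z) ≡ true
             odd′ = quad-odd one

      -- If both edges at ab in the triangle have the colour k, then Φ is 2 for k here, hence in
      -- every triangle, and every edge has colour k.
      K-const : ∀ {a b x a′ b′ x′} → a ≢ b → a ≢ x → b ≢ x → a′ ≢ b′ → a′ ≢ x′ → b′ ≢ x′ → K a b x ≡ K a′ b′ x′
      K-const {a} {b} {x} {a′} {b′} {x′} ab ax bx ab′ ax′ bx′ = decide (K b a x Fin.≟ K a b x)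
        where
        two⇒ : ∀ s t → χ s + χ t ≡ 2 → s ≡ true
        two⇒ true  true  _ = refl
        two⇒ true  false ()
        two⇒ false true  ()
        two⇒ false false ()
        decide : Dec (K b a x ≡ K a b x) → K a b x ≡ K a′ b′ x′
        decide (yes e) = sym (==⇒≡ {x = K a′ b′ x′} {K a b x} (two⇒ (K a′ b′ x′ == K a b x) _ (trans (Φ-const (K a b x) ab′ ax′ bx′ ab ax bx) (cong₂ (λ s t → χ s + χ t) (==-refl (K a b x)) (trans (cong (_== K a b x) e) (==-refl (K a b x)))))))
        decide (no ne) = ⊥-elim (alternate (K a x b Fin.≟ K a b x))
          where
          alternate : Dec (K a x b ≡ K a b x) → ⊥
          alternate (yes e) = Oriented.symmetric ab ax bx ne e
          alternate (no ne′) = Oriented.Alternating.impossible ab ax bx ne ne′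

      K-edge : ∀ {u v} → nb u v ≡ true → ∃ λ a → ∃ λ b → ∃ λ x → a ≢ b × a ≢ x × b ≢ x × c u v ≡ K a b x
      K-edge {u} {v} e = from (nb⇒On e)
        where
        from : (∃ λ a → ∃ λ b → ∃ λ x → On u a b × On v a x × b ≢ x) → ∃ λ a → ∃ λ b → ∃ λ x → a ≢ b × a ≢ x × b ≢ x × c u v ≡ K a b x
        from (a , b , x , o , o′ , bx) = a , b , x , On-≢ o , On-≢ o′ , bx , sym (cong₂ c (pt-unique o) (pt-unique o′))

      one-colour : ∀ {u v u′ v′} → nb u v ≡ true → nb u′ v′ ≡ true → c u v ≡ c u′ v′
      one-colour {u} {v} {u′} {v′} e e′ = from (K-edge e) (K-edge e′)
        where
        from : (∃ λ a → ∃ λ b → ∃ λ x → a ≢ b × a ≢ x × b ≢ x × c u v ≡ K a b x) → (∃ λ a → ∃ λ b → ∃ λ x → a ≢ b × a ≢ x × b ≢ x × c u′ v′ ≡ K a b x) → c u v ≡ c u′ v′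
        from (_ , _ , _ , ab , ax , bx , p) (_ , _ , _ , ab′ , ax′ , bx′ , p′) = trans p (trans (K-const ab ax bx ab′ ax′ bx′) (sym p′))

      ordered : ∀ y → ∃ λ i → ∃ λ j → i Data.Fin.< j × On y i j
      ordered y = from (Fin.<-cmp (line y true) (line y false))
        where
        from : Tri (line y true Data.Fin.< line y false) (line y true ≡ line y false) (line y false Data.Fin.< line y true) → ∃ λ i → ∃ λ j → i Data.Fin.< j × On y i j
        from (tri< lt _ _) = line y true , line y false , lt , true , refl , refl
        from (tri≈ _ e _)  = ⊥-elim (line-two y true e)
        from (tri> _ _ gt) = line y false , line y true , gt , false , refl , refl

      On-ordered : ∀ {y i j i′ j′} → i Data.Fin.< j → i′ Data.Fin.< j′ → On y i j → On y i′ j′ → i ≡ i′ × j ≡ j′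
      On-ordered {y} {i} {j} {i′} {j′} lt lt′ o o′ = from (On-cases o o′)
        where
        from : (i ≡ i′ × j ≡ j′) ⊎ (i ≡ j′ × j ≡ i′) → i ≡ i′ × j ≡ j′
        from (inj₁ e) = e
        from (inj₂ (e , e′)) = ⊥-elim (Fin.<-asym lt (subst₂ Data.Fin._<_ (sym e′) (sym e) lt′))

      toPair : Fin n → BaseV Tb m
      toPair y = (proj₁ (ordered y) , proj₁ (proj₂ (ordered y))) , proj₁ (proj₂ (proj₂ (ordered y)))

      toPair-On : ∀ y → On y (proj₁ (proj₁ (toPair y))) (proj₂ (proj₁ (toPair y)))
      toPair-On y = proj₂ (proj₂ (proj₂ (ordered y)))

      fromPair : BaseV Tb m → Fin n
      fromPair ((i , j) , _) = pt i j

      pairing : Fin n ↔ BaseV Tb m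
      pairing = mk↔ₛ′ toPair fromPair to-from from-to
        where
        from-to : ∀ y → fromPair (toPair y) ≡ y
        from-to y = pt-unique {y} {proj₁ (proj₁ (toPair y))} {proj₂ (proj₁ (toPair y))} (toPair-On y)
        to-from : ∀ p → toPair (fromPair p) ≡ p
        to-from ((i , j) , lt) = pair≡ (On-ordered {pt i j} (proj₂ (toPair (pt i j))) lt (toPair-On (pt i j)) (pt-On (Fin.<⇒≢ lt)))
          where
          pair≡ : ∀ {i′ j′ i j} {lt′ : i′ Data.Fin.< j′} {lt : i Data.Fin.< j} → i′ ≡ i × j′ ≡ j → _≡_ {A = BaseV Tb m} ((i′ , j′) , lt′) ((i , j) , lt)
          pair≡ {i′} {j′} {lt′ = lt′} {lt} (refl , refl) = cong (λ l → _,_ {B = λ (p : Fin m × Fin m) → proj₁ p Data.Fin.< proj₂ p} (i′ , j′) l) (≤-irrelevant lt′ lt)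

      triangular : Exceptional c
      triangular = exceptional Tb m pairing nb⇒E E⇒nb one-colour
        where
        Ev : Fin n → Fin n → Set
        Ev u v = BaseE Tb m (toPair u) (toPair v)
        shares : ∀ {u v i j i′ j′ a b b′} → On u i j → On v i′ j′ → On u a b → On v a b′ → ((i ≡ i′ ⊎ i ≡ j′) ⊎ (j ≡ i′ ⊎ j ≡ j′))
        shares {u} {v} {i} {j} {i′} {j′} {a} {b} {b′} o o′ p p′ = from (On-cases o p) (On-cases o′ p′)
          where
          from : (i ≡ a × j ≡ b) ⊎ (i ≡ b × j ≡ a) → (i′ ≡ a × j′ ≡ b′) ⊎ (i′ ≡ b′ × j′ ≡ a) → ((i ≡ i′ ⊎ i ≡ j′) ⊎ (j ≡ i′ ⊎ j ≡ j′))
          from (inj₁ (e , _)) (inj₁ (e′ , _)) = inj₁ (inj₁ (trans e (sym e′)))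
          from (inj₁ (e , _)) (inj₂ (_ , e′)) = inj₁ (inj₂ (trans e (sym e′)))
          from (inj₂ (_ , e)) (inj₁ (e′ , _)) = inj₂ (inj₁ (trans e (sym e′)))
          from (inj₂ (_ , e)) (inj₂ (_ , e′)) = inj₂ (inj₂ (trans e (sym e′)))
        nb⇒E : ∀ {u v} → nb u v ≡ true → Ev u v
        nb⇒E {u} {v} e = from (nb⇒On e)
          where
          from : (∃ λ a → ∃ λ b → ∃ λ b′ → On u a b × On v a b′ × b ≢ b′) → Ev u v
          from (a , b , b′ , o , o′ , _) = (λ eq → nb⇒≢ e (On-unique (toPair-On u) (subst (λ p → On v (proj₁ p) (proj₂ p)) (sym eq) (toPair-On v)))) , shares (toPair-On u) (toPair-On v) o o′
        meet : ∀ {u v a b b′} → u ≢ v → On u a b → On v a b′ → nb u v ≡ true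
        meet {u} {v} ne o o′ = On⇒nb (λ eq → ne (On-unique o (subst (On v _) (sym eq) o′))) o o′
        E⇒nb : ∀ {u v} → u ≢ v → Ev u v → nb u v ≡ true
        E⇒nb {u} {v} ne (_ , sh) = from sh
          where
          ou = toPair-On u
          ov = toPair-On v
          at : ∀ {i j i′} → On v i j → i′ ≡ i → On v i′ j
          at {j = j} o e = subst (λ z → On v z j) (sym e) o
          from : _ → nb u v ≡ true
          from (inj₁ (inj₁ e)) = meet ne ou (at ov e)
          from (inj₁ (inj₂ e)) = meet ne ou (at (On-sym ov) e)
          from (inj₂ (inj₁ e)) = meet ne (On-sym ou) (at ov e)
          from (inj₂ (inj₂ e)) = meet ne (On-sym ou) (at (On-sym ov) e)

-- Lattice graphs

module Bipartite {n r : ℕ} (c : Coloring n r) (pcc : IsPCC c) (n≥2 : 2 ≤ n) (u₀ : Fin n) (d : Fin r)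
                (dominant : 2 * n < 3 * # (λ w → c u₀ w == d)) where
  open Coherent c pcc
  open Dominant c pcc n≥2 u₀ d dominant hiding (nb⇒≢)
  open Classify c pcc n≥2 u₀ d dominant

  module Lattice (label : Fin n → Fin n → Bool)
    (clique-nb : ∀ {y x x′} → nb y x ≡ true → nb y x′ ≡ true → label y x ≡ label y x′ → x ≢ x′ → nb x x′ ≡ true)
    (clique-size : ∀ y b → 20 ≤ # (λ x → nb y x ∧ agree b (label y x)))
    (clique-cross : ∀ {y b x} → nb y x ∧ agree b (label y x) ≡ true → # (λ z → (nb y z ∧ agree (not b) (label y z)) ∧ nb x z) ≤ 3)
    (μ≥1 : 1 ≤ μ) (μ≤4 : μ ≤ 4) (μ2 : μ ≡ 2) where

    open LineGraph nb far nb-sym nb-irrefl (λ {u} {v} → nb⇒¬far {u} {v}) far-irrefl (λ {u} {v} → ≢∧¬far⇒nb {u} {v}) label (λ {y} {x} {x′} → clique-nb {y} {x} {x′}) clique-size (λ {y} {b} {x} → clique-cross {y} {b} {x})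
    open Geometry label (λ {y} {x} {x′} → clique-nb {y} {x} {x′}) clique-size (λ {y} {b} {x} → clique-cross {y} {b} {x}) μ≥1 μ≤4
    open RootGraph adj (λ {i} {j} → adj-sym {i} {j}) (λ {i} {j} → adj-≢ {i} {j}) μ (λ {a} {b} {i} {j} → quad {a} {b} {i} {j}) fresh′ (line u₀ true)
    open Two μ2

    A B : Fin m → Set
    A x = part x ≡ true
    B x = part x ≡ false

    A≢B : ∀ {a b} → A a → B b → a ≢ b
    A≢B p q refl = true≢false p q

    same-part : ∀ {x z} → part x ≡ part z → adj x z ≡ false
    same-part e = ¬true⇒false (λ p → part-proper p e)

    other-A : ∀ {b} → B b → ∀ F → length F < 20 → ∃ λ x → A x × NotIn x F
    other-A {b} Bb F lt = from (fresh′ b F lt)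
      where
      from : (∃ λ j → adj b j ≡ true × NotIn j F) → ∃ λ x → A x × NotIn x F
      from (x , e , ni) = x , go (part x) refl , ni
        where
        go : ∀ t → part x ≡ t → t ≡ true
        go true  _ = refl
        go false p = ⊥-elim (part-proper e (trans Bb (sym p)))

    other-B : ∀ {a} → A a → ∀ F → length F < 20 → ∃ λ x → B x × NotIn x F
    other-B {a} Aa F lt = from (fresh′ a F lt)
      where
      from : (∃ λ j → adj a j ≡ true × NotIn j F) → ∃ λ x → B x × NotIn x F
      from (x , e , ni) = x , go (part x) refl , ni
        where
        go : ∀ t → part x ≡ t → t ≡ false
        go false _ = refl
        go true  p = ⊥-elim (part-proper e (trans Aa (sym p)))

    pt-AB : ∀ {a b} → A a → B b → On (pt a b) a b
    pt-AB p q = pt-on (part-complete p q)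

    row col : Fin m → Fin m → Fin m → Fin r
    row a b z = c (pt a b) (pt a z)
    col a b x = c (pt a b) (pt x b)

    -- In the complete bipartite root graph the walks from ab to xz pass only through az and xb.
    row+col : ∀ k {a b x z} → A a → B b → A x → B z → a ≢ x → b ≢ z → χ (row a b z == k) + χ (col a b x == k) ≡ ω k
    row+col k {a} {b} {x} {z} Aa Bb Ax Bz ax bz = trans (sym (begin
      sum (λ w → χ (nb y w) * χ (nb w v) * g w) ≡⟨ common-sum′ g f (pt-AB Aa Bb) (pt-AB Ax Bz) ⟩
      sum (λ w → χ (on w a x) * g w) + sum (λ w → χ (on w a z) * g w) + sum (λ w → χ (on w b x) * g w) + sum (λ w → χ (on w b z) * g w)
        ≡⟨ cong₂ _+_ (cong₂ _+_ (cong₂ _+_ (sum-not-on g (same-part (trans Aa (sym Ax)))) (sum-on g (pt-AB Aa Bz))) (sum-on g (On-sym (pt-AB Ax Bb)))) (sum-not-on g (same-part (trans Bb (sym Bz)))) ⟩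
      0 + g (pt a z) + g (pt x b) + 0 ≡⟨ (identity (χ (row a b z == k) ∷ χ (col a b x == k) ∷ []) (κ 0 ⊕ x₀ ⊗ κ 1 ⊕ x₁ ⊗ κ 1 ⊕ κ 0) (x₀ ⊕ x₁) refl) ⟩
      χ (row a b z == k) + χ (col a b x == k) ∎)) (paths-ω k f)
      where
      open ≡-Reasoning
      y v : Fin n
      y = pt a b
      v = pt x z
      f : far y v ≡ true
      f = far-On (pt-AB Aa Bb) (pt-AB Ax Bz) ax (A≢B Aa Bz) (A≢B Ax Bb ∘ sym) bz
      g : Fin n → ℕ
      g w = χ (c y w == k) * 1

    -- Varying z in `row+col` leaves the column term unchanged.
    row-const : ∀ {a b z z′} → A a → B b → B z → B z′ → b ≢ z → b ≢ z′ → row a b z ≡ row a b z′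
    row-const {a} {b} {z} {z′} Aa Bb Bz Bz′ bz bz′ = from (other-A Bb (a ∷ []) (s≤s (s≤s z≤n)))
      where
      from : (∃ λ x → A x × NotIn x (a ∷ [])) → row a b z ≡ row a b z′
      from (x , Ax , x≢a , _) = sym (==⇒≡ {x = row a b z′} {row a b z} (trans (χ-injective (row a b z′ == row a b z) (row a b z == row a b z)
        (+-cancelʳ-≡ (χ (col a b x == row a b z)) _ _ (trans (row+col (row a b z) Aa Bb Ax Bz′ (x≢a ∘ sym) bz′) (sym (row+col (row a b z) Aa Bb Ax Bz (x≢a ∘ sym) bz))))) (==-refl (row a b z))))

    module Uniform {a₀ b₀ x₀ z₀ : Fin m} (Aa₀ : A a₀) (Bb₀ : B b₀) (Ax₀ : A x₀) (Bz₀ : B z₀) (ax₀ : a₀ ≢ x₀) (bz₀ : b₀ ≢ z₀) where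
      i : Fin r
      i = row a₀ b₀ z₀

      -- If a row and a column met in different colours, the edges of colour i would never
      -- leave the row of a₀, against primitivity.
      module Mixed (differ : col a₀ b₀ x₀ ≢ i) where
        ωi≡1 : ω i ≡ 1
        ωi≡1 = trans (sym (row+col i Aa₀ Bb₀ Ax₀ Bz₀ ax₀ bz₀)) (cong₂ (λ s t → χ s + χ t) (==-refl i) (≢⇒== differ))

        -- Within a row the colour of an edge depends only on its first vertex, by `row-const`, and
        -- after reversal only on its second. A third vertex of the row then makes it constant.
        self-paired : row a₀ z₀ b₀ ≡ i
        self-paired = from (other-B Aa₀ (b₀ ∷ z₀ ∷ []) (s≤s (s≤s (s≤s z≤n))))
          where
          from : (∃ λ z → B z × NotIn z (b₀ ∷ z₀ ∷ [])) → row a₀ z₀ b₀ ≡ i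
          from (z , Bz , z≢b , z≢z₀ , _) = trans (trans (row-const Aa₀ Bz₀ Bb₀ Bz (bz₀ ∘ sym) (z≢z₀ ∘ sym)) (c-flip (row-const Aa₀ Bz Bz₀ Bb₀ z≢z₀ z≢b)))
            (sym (row-const Aa₀ Bb₀ Bz₀ Bz bz₀ (z≢b ∘ sym)))

        row-i : ∀ {b} → B b → ∃ λ z → B z × b ≢ z × row a₀ b z ≡ i
        row-i {b} Bb = decide (b Fin.≟ b₀)
          where
          decide : Dec (b ≡ b₀) → ∃ λ z → B z × b ≢ z × row a₀ b z ≡ i
          decide (yes refl) = z₀ , Bz₀ , bz₀ , refl
          decide (no ne) = b₀ , Bb₀ , ne , trans (c-flip (row-const Aa₀ Bb₀ Bb Bz₀ (ne ∘ sym) bz₀)) self-paired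

        on-a₀ : Fin n → Bool
        on-a₀ w = (line w true == a₀) ∨ (line w false == a₀)

        on-a₀⇒ : ∀ {w} → on-a₀ w ≡ true → ∃ λ b → On w a₀ b
        on-a₀⇒ {w} e = from (∨-true {line w true == a₀} e)
          where
          from : (line w true == a₀) ≡ true ⊎ (line w false == a₀) ≡ true → ∃ λ b → On w a₀ b
          from (inj₁ p) = line w false , true  , ==⇒≡ {x = line w true} {a₀} p , refl
          from (inj₂ p) = line w true  , false , ==⇒≡ {x = line w false} {a₀} p , refl

        ⇒on-a₀ : ∀ {w b} → On w a₀ b → on-a₀ w ≡ true
        ⇒on-a₀ {w} (true  , p , _) = cong (_∨ (line w false == a₀)) (trans (cong (_== a₀) p) (==-refl a₀))
        ⇒on-a₀ {w} (false , p , _) = or-right (line w true == a₀) (trans (cong (_== a₀) p) (==-refl a₀))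
          where
          or-right : ∀ s {t} → t ≡ true → s ∨ t ≡ true
          or-right true  _ = refl
          or-right false e = e

        impossible : ⊥
        impossible = from (exit {i} (pt a₀ b₀ , pt a₀ z₀ , nb⇒≢ y₀z₀ , refl) on-a₀ {pt a₀ b₀} {pt x₀ b₀} (⇒on-a₀ (pt-AB Aa₀ Bb₀)) off)
          where
          y₀z₀ : nb (pt a₀ b₀) (pt a₀ z₀) ≡ true
          y₀z₀ = On⇒nb bz₀ (pt-AB Aa₀ Bb₀) (pt-AB Aa₀ Bz₀)
          B-of : ∀ {w b} → On w a₀ b → B b
          B-of {w} {b} o = go (part b) refl
            where
            go : ∀ t → part b ≡ t → t ≡ false
            go false _ = refl
            go true  p = ⊥-elim (part-proper (⇒adj (w , o)) (trans Aa₀ (sym p)))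
          off : on-a₀ (pt x₀ b₀) ≡ false
          off = ¬true⇒false (λ p → contra (on-a₀⇒ p))
            where
            contra : (∃ λ b → On (pt x₀ b₀) a₀ b) → ⊥
            contra (b , o) = clash (On-cases o (pt-AB Ax₀ Bb₀))
              where
              clash : (a₀ ≡ x₀ × b ≡ b₀) ⊎ (a₀ ≡ b₀ × b ≡ x₀) → ⊥
              clash (inj₁ (e , _)) = ax₀ e
              clash (inj₂ (e , _)) = A≢B Aa₀ Bb₀ e
          from : (∃ λ x → ∃ λ y → on-a₀ x ≡ true × on-a₀ y ≡ false × c x y ≡ i) → ⊥
          from (x , y , px , py , e) = at (on-a₀⇒ px)
            where
            xy : nb x y ≡ true
            xy = trans (nb-coh e) y₀z₀
            at : (∃ λ b → On x a₀ b) → ⊥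
            at (b , o) = share (nb⇒On xy)
              where
              Bb : B b
              Bb = B-of o
              share : (∃ λ p → ∃ λ q → ∃ λ q′ → On x p q × On y p q′ × q ≢ q′) → ⊥
              share (p , q , q′ , o₁ , o₂ , q≢q′) = which (p Fin.≟ a₀)
                where
                which : Dec (p ≡ a₀) → ⊥
                which (yes refl) = true≢false (⇒on-a₀ o₂) py
                which (no p≢a₀) = conclude (row-i Bb)
                  where
                  p≡b : p ≡ b
                  p≡b = go (On-cases o₁ o)
                    where
                    go : (p ≡ a₀ × q ≡ b) ⊎ (p ≡ b × q ≡ a₀) → p ≡ b
                    go (inj₁ (e , _)) = ⊥-elim (p≢a₀ e)
                    go (inj₂ (e , _)) = e
                  oy : On y q′ b
                  oy = subst (On y q′) p≡b (On-sym o₂)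
                  Aq′ : A q′
                  Aq′ = go (part q′) refl
                    where
                    go : ∀ t → part q′ ≡ t → t ≡ true
                    go true  _ = refl
                    go false k = ⊥-elim (part-proper (⇒adj (y , oy)) (trans k (sym Bb)))
                  a₀≢q′ : a₀ ≢ q′
                  a₀≢q′ refl = true≢false (⇒on-a₀ oy) py
                  col-i : col a₀ b q′ ≡ i
                  col-i = trans (cong₂ c (pt-unique o) (pt-unique oy)) e
                  conclude : (∃ λ z → B z × b ≢ z × row a₀ b z ≡ i) → ⊥
                  -- The edge that leaves the row of a₀ is a column edge of colour i at a₀b;
                  -- together with a row edge of colour i at the same vertex it makes `ω i` equal to
                  -- 2.
                  conclude (z , Bz , bz , ri) = two≢one (trans (sym (cong₂ (λ s t → χ s + χ t) (trans (cong (_== i) ri) (==-refl i)) (trans (cong (_== i) col-i) (==-refl i)))) (trans (row+col i Aa₀ Bb Aq′ Bz a₀≢q′ bz) ωi≡1))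
                    where
                    two≢one : 2 ≢ 1
                    two≢one ()

      col≡row : col a₀ b₀ x₀ ≡ i
      col≡row = decide (col a₀ b₀ x₀ Fin.≟ i)
        where
        decide : Dec (col a₀ b₀ x₀ ≡ i) → col a₀ b₀ x₀ ≡ i
        decide (yes e) = e
        decide (no ne) = ⊥-elim (Mixed.impossible ne)

      all-i : ∀ {a b x z} → A a → B b → A x → B z → a ≢ x → b ≢ z → row a b z ≡ i × col a b x ≡ i
      all-i {a} {b} {x} {z} Aa Bb Ax Bz ax bz = ==⇒≡ {x = row a b z} {i} (proj₁ both) , ==⇒≡ {x = col a b x} {i} (proj₂ both)
        where
        two⇒ : ∀ s t → χ s + χ t ≡ 2 → s ≡ true × t ≡ true
        two⇒ true  true  _ = refl , refl
        two⇒ true  false ()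
        two⇒ false true  ()
        two⇒ false false ()
        both : (row a b z == i) ≡ true × (col a b x == i) ≡ true
        both = two⇒ _ _ (trans (row+col i Aa Bb Ax Bz ax bz) (trans (sym (row+col i Aa₀ Bb₀ Ax₀ Bz₀ ax₀ bz₀)) (cong₂ (λ s t → χ s + χ t) (==-refl i) (trans (cong (_== i) col≡row) (==-refl i)))))

    coordinates : ∀ y → ∃ λ a → ∃ λ b → On y a b × A a × B b
    coordinates y = go (part (line y true)) (part (line y false)) refl refl
      where
      proper : part (line y true) ≢ part (line y false)
      proper = part-proper (⇒adj (y , true , refl , refl))
      go : ∀ s t → part (line y true) ≡ s → part (line y false) ≡ t → ∃ λ a → ∃ λ b → On y a b × A a × B b
      go true  false p q = line y true , line y false , (true , refl , refl) , p , q
      go false true  p q = line y false , line y true , (false , refl , refl) , q , p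
      go true  true  p q = ⊥-elim (proper (trans p (sym q)))
      go false false p q = ⊥-elim (proper (trans p (sym q)))

    base : ∃ λ a → ∃ λ b → ∃ λ x → ∃ λ z → A a × B b × A x × B z × a ≢ x × b ≢ z
    base = from (coordinates u₀)
      where
      from : (∃ λ a → ∃ λ b → On u₀ a b × A a × B b) → ∃ λ a → ∃ λ b → ∃ λ x → ∃ λ z → A a × B b × A x × B z × a ≢ x × b ≢ z
      from (a , b , _ , Aa , Bb) = from′ (other-A Bb (a ∷ []) (s≤s (s≤s z≤n))) (other-B Aa (b ∷ []) (s≤s (s≤s z≤n)))
        where
        from′ : (∃ λ x → A x × NotIn x (a ∷ [])) → (∃ λ z → B z × NotIn z (b ∷ [])) → ∃ λ a → ∃ λ b → ∃ λ x → ∃ λ z → A a × B b × A x × B z × a ≢ x × b ≢ z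
        from′ (x , Ax , x≢a , _) (z , Bz , z≢b , _) = a , b , x , z , Aa , Bb , Ax , Bz , x≢a ∘ sym , z≢b ∘ sym

    -- Stated for an abstract pair of sides because it is applied twice, to the rows and, as
    -- `Opposite`, to the columns.
    module Side (P Q : Fin m → Bool) (α β : Fin n → Fin m) (on-αβ : ∀ w → On w (α w) (β w)) (Pα : ∀ w → P (α w) ≡ true) (Qβ : ∀ w → Q (β w) ≡ true)
                (joined : ∀ {a b} → P a ≡ true → Q b ≡ true → adj a b ≡ true) (disjoint : ∀ {a} → P a ≡ true → Q a ≡ true → ⊥) where

      coords : ∀ {w a b} → On w a b → P a ≡ true → Q b ≡ true → α w ≡ a × β w ≡ b
      coords {w} {a} {b} o Pa Qb = from (On-cases (on-αβ w) o)
        where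
        from : (α w ≡ a × β w ≡ b) ⊎ (α w ≡ b × β w ≡ a) → α w ≡ a × β w ≡ b
        from (inj₁ e) = e
        from (inj₂ (_ , e)) = ⊥-elim (disjoint Pa (subst (λ z → Q z ≡ true) e (Qβ w)))

      unique : ∀ {u w} → α u ≡ α w → β u ≡ β w → u ≡ w
      unique {u} {w} p q = On-unique (subst₂ (On u) p q (on-αβ u)) (on-αβ w)

      α-or-β : ∀ {w p q} → On w p q → p ≡ α w ⊎ p ≡ β w
      α-or-β {w} {p} {q} o = from (On-cases o (on-αβ w))
        where
        from : (p ≡ α w × q ≡ β w) ⊎ (p ≡ β w × q ≡ α w) → p ≡ α w ⊎ p ≡ β w
        from (inj₁ (e , _)) = inj₁ e
        from (inj₂ (e , _)) = inj₂ e

      nb⇒shared : ∀ {u w} → nb u w ≡ true → (α u ≡ α w × β u ≢ β w) ⊎ (α u ≢ α w × β u ≡ β w)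
      nb⇒shared {u} {w} e = from (nb⇒On e)
        where
        from : (∃ λ p → ∃ λ q → ∃ λ q′ → On u p q × On w p q′ × q ≢ q′) → (α u ≡ α w × β u ≢ β w) ⊎ (α u ≢ α w × β u ≡ β w)
        from (p , q , q′ , o , o′ , _) = cases (α-or-β o) (α-or-β o′)
          where
          cases : p ≡ α u ⊎ p ≡ β u → p ≡ α w ⊎ p ≡ β w → (α u ≡ α w × β u ≢ β w) ⊎ (α u ≢ α w × β u ≡ β w)
          cases (inj₁ i) (inj₁ j) = inj₁ (trans (sym i) j , λ k → nb⇒≢ e (unique (trans (sym i) j) k))
          cases (inj₂ i) (inj₂ j) = inj₂ ((λ k → nb⇒≢ e (unique k (trans (sym i) j))) , trans (sym i) j)
          cases (inj₁ i) (inj₂ j) = ⊥-elim (disjoint (Pα u) (subst (λ z → Q z ≡ true) (trans (sym j) i) (Qβ w)))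
          cases (inj₂ i) (inj₁ j) = ⊥-elim (disjoint (Pα w) (subst (λ z → Q z ≡ true) (trans (sym i) j) (Qβ u)))

      shared-α⇒nb : ∀ {u w} → α u ≡ α w → β u ≢ β w → nb u w ≡ true
      shared-α⇒nb {u} {w} p ne = On⇒nb ne (on-αβ u) (subst (λ a → On w a (β w)) (sym p) (on-αβ w))

      shared-β⇒nb : ∀ {u w} → α u ≢ α w → β u ≡ β w → nb u w ≡ true
      shared-β⇒nb {u} {w} ne q = On⇒nb ne (On-sym (on-αβ u)) (subst (λ b → On w b (α w)) (sym q) (On-sym (on-αβ w)))

      -- A vertex on the line a is determined by its other line, which can be any member of Q.
      on-line : ∀ {a} → P a ≡ true → sum (λ w → χ (α w == a)) ≡ # Q
      on-line {a} Pa = trans (sum-cong-≗ expand) (trans (sum-swap (λ w j → χ (β w == j) * χ (α w == a))) (sum-cong-≗ (λ j → one j (Q j) refl)))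
        where
        expand : ∀ w → χ (α w == a) ≡ sum (λ j → χ (β w == j) * χ (α w == a))
        expand w = sym (sum-δ (λ _ → χ (α w == a)) (β w))
        one : ∀ j q → Q j ≡ q → sum (λ w → χ (β w == j) * χ (α w == a)) ≡ χ q
        one j false e = sum-0 {n} (λ w → cong (λ b → χ b * χ (α w == a)) (≢⇒== (λ k → true≢false (Qβ w) (trans (cong Q k) e))))
        one j true  e = trans (sum-cong-≗ at) (sum-δ (λ _ → 1) y)
          where
          y : Fin n
          y = pt a j
          yab : α y ≡ a × β y ≡ j
          yab = coords (pt-on (joined Pa e)) Pa e
          at : ∀ w → χ (β w == j) * χ (α w == a) ≡ χ (y == w) * 1
          at w = go (β w == j) (α w == a) refl refl
            where
            go : ∀ s t → (β w == j) ≡ s → (α w == a) ≡ t → χ s * χ t ≡ χ (y == w) * 1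
            go true true p q = cong (λ b → χ b * 1) (sym (trans (cong (y ==_) (sym y≡w)) (==-refl y)))
              where
              y≡w : y ≡ w
              y≡w = unique (trans (proj₁ yab) (sym (==⇒≡ {x = α w} {a} q))) (trans (proj₂ yab) (sym (==⇒≡ {x = β w} {j} p)))
            go true false p q = cong (λ b → χ b * 1) (sym (≢⇒== {x = y} {w} (λ k → ==⇒≢ {x = α w} {a} q (trans (cong α (sym k)) (proj₁ yab)))))
            go false t p q = cong (λ b → χ b * 1) (sym (≢⇒== {x = y} {w} (λ k → ==⇒≢ {x = β w} {j} p (trans (cong β (sym k)) (proj₂ yab)))))

      -- The common neighbours of two vertices on a line are the other vertices of that line.
      common+2 : ∀ {y v} → α y ≡ α v → β y ≢ β v → sum (λ w → χ (nb y w) * χ (nb w v)) + 1 + 1 ≡ # Q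
      common+2 {y} {v} yv ne = trans (sym (trans (sum-cong-≗ point) (trans (sum-+ (λ w → χ (nb y w) * χ (nb w v) + χ (y == w)) (λ w → χ (v == w)))
          (cong₂ _+_ (trans (sum-+ (λ w → χ (nb y w) * χ (nb w v)) (λ w → χ (y == w))) (cong (sum (λ w → χ (nb y w) * χ (nb w v)) +_) (single y))) (single v))))) (on-line (Pα y))
        where
        point : ∀ w → χ (α w == α y) ≡ χ (nb y w) * χ (nb w v) + χ (y == w) + χ (v == w)
        point w = go (α w Fin.≟ α y) (y Fin.≟ w) (v Fin.≟ w)
          where
          go : Dec (α w ≡ α y) → Dec (y ≡ w) → Dec (v ≡ w) → χ (α w == α y) ≡ χ (nb y w) * χ (nb w v) + χ (y == w) + χ (v == w)
          go (yes p) (yes refl) (yes refl) = ⊥-elim (ne refl)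
          go (yes p) (yes refl) (no k) = trans (cong χ (==-refl (α w))) (sym (cong₂ _+_ (cong₂ _+_ (cong (λ b → χ b * χ (nb w v)) (nb-irrefl w)) (cong χ (==-refl w))) (cong χ (≢⇒== k))))
          go (yes p) (no k) (yes refl) = trans (cong χ (trans (cong (α w ==_) (sym p)) (==-refl (α w)))) (sym (cong₂ _+_ (cong₂ _+_ (trans (cong (λ b → χ (nb y w) * χ b) (nb-irrefl w)) (*-zeroʳ (χ (nb y w)))) (cong χ (≢⇒== k))) (cong χ (==-refl w))))
          go (yes p) (no k) (no k′) = trans (cong χ (trans (cong (α w ==_) (sym p)) (==-refl (α w)))) (sym (cong₂ _+_ (cong₂ _+_ (cong₂ (λ s t → χ s * χ t) (shared-α⇒nb (sym p) (λ e → k (unique (sym p) e))) (shared-α⇒nb (trans p yv) (λ e → k′ (unique (sym (trans p yv)) (sym e))))) (cong χ (≢⇒== k))) (cong χ (≢⇒== k′))))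
          go (no p) _ _ = trans (cong χ (≢⇒== p)) (sym (cong₂ _+_ (cong₂ _+_ (none (nb y w) (nb w v) refl refl) (cong χ (≢⇒== (λ k → p (cong α (sym k)))))) (cong χ (≢⇒== (λ k → p (trans (cong α (sym k)) (sym yv)))))))
            where
            none : ∀ s t → nb y w ≡ s → nb w v ≡ t → χ s * χ t ≡ 0
            none false t     _ _ = refl
            none true  false _ _ = refl
            none true  true  e f = ⊥-elim (both (nb⇒shared e) (nb⇒shared f))
              where
              both : (α y ≡ α w × β y ≢ β w) ⊎ (α y ≢ α w × β y ≡ β w) → (α w ≡ α v × β w ≢ β v) ⊎ (α w ≢ α v × β w ≡ β v) → ⊥
              both (inj₁ (i , _)) _ = p (sym i)
              both (inj₂ _) (inj₁ (i , _)) = p (trans i (sym yv))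
              both (inj₂ (_ , i)) (inj₂ (_ , j)) = ne (trans i j)

    α β : Fin n → Fin m
    α y = proj₁ (coordinates y)
    β y = proj₁ (proj₂ (coordinates y))

    on-αβ : ∀ y → On y (α y) (β y)
    on-αβ y = proj₁ (proj₂ (proj₂ (coordinates y)))

    Aα : ∀ y → A (α y)
    Aα y = proj₁ (proj₂ (proj₂ (proj₂ (coordinates y))))

    Bβ : ∀ y → B (β y)
    Bβ y = proj₂ (proj₂ (proj₂ (proj₂ (coordinates y))))

    not-false : ∀ {b} → b ≡ false → not b ≡ true
    not-false = cong not

    open Side part (not ∘ part) α β on-αβ Aα (λ w → not-false (Bβ w)) (λ p q → part-complete p (not-true q)) (λ p q → true≢false p (not-true q))
    module Opposite = Side (not ∘ part) part β α (λ w → On-sym (on-αβ w)) (λ w → not-false (Bβ w)) Aα (λ p q → adj-sym (part-complete q (not-true p))) (λ p q → true≢false q (not-true p))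

    pt-αβ : ∀ y → pt (α y) (β y) ≡ y
    pt-αβ y = pt-unique (on-αβ y)

    monochromatic : ∃ λ i → ∀ {u v} → nb u v ≡ true → c u v ≡ i
    monochromatic = from base
      where
      from : (∃ λ a → ∃ λ b → ∃ λ x → ∃ λ z → A a × B b × A x × B z × a ≢ x × b ≢ z) → ∃ λ i → ∀ {u v} → nb u v ≡ true → c u v ≡ i
      from (a , b , x , z , Aa , Bb , Ax , Bz , ax , bz) = i , λ {u} {v} e → cases u v (nb⇒shared e)
        where
        open Uniform Aa Bb Ax Bz ax bz
        cases : ∀ u v → (α u ≡ α v × β u ≢ β v) ⊎ (α u ≢ α v × β u ≡ β v) → c u v ≡ i
        cases u v (inj₁ (p , q)) = trans (sym (cong₂ c (pt-αβ u) (trans (cong (λ t → pt t (β v)) p) (pt-αβ v)))) (fresh-A (other-A (Bβ u) (α u ∷ []) (s≤s (s≤s z≤n))))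
          where
          fresh-A : (∃ λ x → A x × NotIn x (α u ∷ [])) → row (α u) (β u) (β v) ≡ i
          fresh-A (x , Ax , ne , _) = proj₁ (all-i (Aα u) (Bβ u) Ax (Bβ v) (ne ∘ sym) q)
        cases u v (inj₂ (p , q)) = trans (sym (cong₂ c (pt-αβ u) (trans (cong (pt (α v)) q) (pt-αβ v)))) (fresh-B (other-B (Aα u) (β u ∷ []) (s≤s (s≤s z≤n))))
          where
          fresh-B : (∃ λ z → B z × NotIn z (β u ∷ [])) → col (α u) (β u) (α v) ≡ i
          fresh-B (z , Bz , ne , _) = proj₂ (all-i (Aα u) (Bβ u) (Aα v) Bz p (ne ∘ sym))

    one-colour : ∀ {u v u′ v′} → nb u v ≡ true → nb u′ v′ ≡ true → c u v ≡ c u′ v′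
    one-colour e e′ = trans (proj₂ monochromatic e) (sym (proj₂ monochromatic e′))

    -- A row edge and a column edge have the same colour, hence equally many common neighbours; by
    -- `common+2` that is two less than the length of a row and of a column.
    equal-sides : # (not ∘ part) ≡ # part
    equal-sides = from base
      where
      from : (∃ λ a → ∃ λ b → ∃ λ x → ∃ λ z → A a × B b × A x × B z × a ≢ x × b ≢ z) → # (not ∘ part) ≡ # part
      from (a , b , x , z , Aa , Bb , Ax , Bz , ax , bz) = trans (sym (common+2 {pt a b} {pt a z} αα ββ))
          (trans (cong (λ t → t + 1 + 1) (coh-cn (one-colour (shared-α⇒nb αα ββ) (shared-β⇒nb αα′ ββ′)))) (Opposite.common+2 {pt a b} {pt x b} ββ′ αα′))
        where
        ab = coords (pt-AB Aa Bb) Aa (not-false Bb)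
        az = coords (pt-AB Aa Bz) Aa (not-false Bz)
        xb = coords (pt-AB Ax Bb) Ax (not-false Bb)
        αα : α (pt a b) ≡ α (pt a z)
        αα = trans (proj₁ ab) (sym (proj₁ az))
        ββ : β (pt a b) ≢ β (pt a z)
        ββ e = bz (trans (sym (proj₂ ab)) (trans e (proj₂ az)))
        αα′ : α (pt a b) ≢ α (pt x b)
        αα′ e = ax (trans (sym (proj₁ ab)) (trans e (proj₁ xb)))
        ββ′ : β (pt a b) ≡ β (pt x b)
        ββ′ = trans (proj₂ ab) (sym (proj₂ xb))

    module _ {s : ℕ} (EA : Enumeration part s) (EB : Enumeration (not ∘ part) s) where
      module EA = Enumeration EA
      module EB = Enumeration EB

      grid : Fin n ↔ BaseV Lb s
      grid = mk↔ₛ′ (λ y → EA.index (α y) (Aα y) , EB.index (β y) (not-false (Bβ y))) (λ p → pt (EA.elem (proj₁ p)) (EB.elem (proj₂ p))) to-from from-to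
        where
        from-to : ∀ y → pt (EA.elem (EA.index (α y) (Aα y))) (EB.elem (EB.index (β y) (not-false (Bβ y)))) ≡ y
        from-to y = trans (cong₂ pt (EA.elem-index (α y) (Aα y)) (EB.elem-index (β y) (not-false (Bβ y)))) (pt-αβ y)
        to-from : ∀ p → _
        to-from (i , j) = cong₂ _,_ (EA.elem-injective _ i (trans (EA.elem-index _ _) (proj₁ ij))) (EB.elem-injective _ j (trans (EB.elem-index _ _) (proj₂ ij)))
          where
          ij : α (pt (EA.elem i) (EB.elem j)) ≡ EA.elem i × β (pt (EA.elem i) (EB.elem j)) ≡ EB.elem j
          ij = coords (pt-AB (EA.elem∈ i) (not-true (EB.elem∈ j))) (EA.elem∈ i) (EB.elem∈ j)

      α-index : ∀ {u v} → EA.index (α u) (Aα u) ≡ EA.index (α v) (Aα v) → α u ≡ α v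
      α-index {u} {v} e = trans (sym (EA.elem-index _ (Aα u))) (trans (cong EA.elem e) (EA.elem-index _ (Aα v)))

      β-index : ∀ {u v} → EB.index (β u) (not-false (Bβ u)) ≡ EB.index (β v) (not-false (Bβ v)) → β u ≡ β v
      β-index {u} {v} e = trans (sym (EB.elem-index _ (not-false (Bβ u)))) (trans (cong EB.elem e) (EB.elem-index _ (not-false (Bβ v))))

      index-α : ∀ {u v} → α u ≡ α v → EA.index (α u) (Aα u) ≡ EA.index (α v) (Aα v)
      index-α {u} {v} e = EA.elem-injective _ _ (trans (EA.elem-index _ (Aα u)) (trans e (sym (EA.elem-index _ (Aα v)))))

      index-β : ∀ {u v} → β u ≡ β v → EB.index (β u) (not-false (Bβ u)) ≡ EB.index (β v) (not-false (Bβ v))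
      index-β {u} {v} e = EB.elem-injective _ _ (trans (EB.elem-index _ (not-false (Bβ u))) (trans e (sym (EB.elem-index _ (not-false (Bβ v))))))

      grid-exceptional : Exceptional c
      grid-exceptional = exceptional Lb s grid (λ e → nb⇒E (nb⇒shared e)) (λ _ → E⇒nb) one-colour
        where
        nb⇒E : ∀ {u v} → (α u ≡ α v × β u ≢ β v) ⊎ (α u ≢ α v × β u ≡ β v) → BaseE Lb s (Inverse.to grid u) (Inverse.to grid v)
        nb⇒E (inj₁ (p , q)) = inj₁ (index-α p , λ e → q (β-index e))
        nb⇒E (inj₂ (p , q)) = inj₂ ((λ e → p (α-index e)) , index-β q)
        E⇒nb : ∀ {u v} → BaseE Lb s (Inverse.to grid u) (Inverse.to grid v) → nb u v ≡ true
        E⇒nb (inj₁ (p , q)) = shared-α⇒nb (α-index p) (λ e → q (index-β e))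
        E⇒nb (inj₂ (p , q)) = shared-β⇒nb (λ e → p (index-α e)) (β-index q)

    lattice : Exceptional c
    lattice = grid-exceptional (enumerate part) (subst (Enumeration (not ∘ part)) equal-sides (enumerate (not ∘ part)))

-- The bound

module Main {n r : ℕ} (c : Coloring n r) (pcc : IsPCC c) (¬exceptional : ¬ Exceptional c) (n≥2 : 2 ≤ n)
            (h : ℕ) (h≥ : 120000 ≤ h) (h≤ : h ≤ 120000) (q : ℕ) (q≥ : 20000 ≤ q) (6q≤h : 6 * q ≤ h)
            (L : ℕ) (L≥1 : 1 ≤ L) (n<2^ : n < 2 ^ suc L) where
  open Coherent c pcc
  open Differ c pcc

  Goal : Set
  Goal = ∃ λ S → ∣ S ∣ * ∣ S ∣ * ∣ S ∣ ≤ (512 * q) * (512 * q) * (512 * q) * n * (L * L * L * L) × CompletelySplits c S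

  -- As (k+1)³ > n, the hypothesis gives n³ < (1200(k+1)D)³, so the distinguishing vertices of each
  -- pair have density at least 1/1200(k+1), enough for a hitting set.
  well-separated : (∀ u v → u ≢ v → n * n ≤ (1200 * D u v) * (1200 * D u v) * (1200 * D u v)) → Goal
  well-separated big = from (cube-root n)
    where
    from : (∃ λ k → k * k * k ≤ n × n < suc k * suc k * suc k) → Goal
    from (k , k³≤n , n<) = finish (pair-hitting-set n≥2 L L≥1 n<2^ (λ u v w → not (c u w == c v w)) (1200 * suc k) large)
      where
      large : ∀ u v → u ≢ v → n ≤ 1200 * suc k * D u v
      large u v ne = <⇒≤ (cube-cancel-< n (1200 * suc k * D u v) (lin (n ∷ k ∷ D u v ∷ []) 3 (κ 1 ⊕ x₀ ⊗ x₀ ⊗ x₀ ≼ κ 1200 ⊗ (κ 1 ⊕ x₁) ⊗ x₂ ⊗ (κ 1200 ⊗ (κ 1 ⊕ x₁) ⊗ x₂) ⊗ (κ 1200 ⊗ (κ 1 ⊕ x₁) ⊗ x₂)) ((κ 4 ⊗ (x₀ ⊗ x₀) , κ 1 ⊕ x₀ ≼ (κ 1 ⊕ x₁) ⊗ (κ 1 ⊕ x₁) ⊗ (κ 1 ⊕ x₁)) ∷ (κ 4 ⊗ ((κ 1 ⊕ x₁) ⊗ (κ 1 ⊕ x₁) ⊗ (κ 1 ⊕ x₁)) , x₀ ⊗ x₀ ≼ κ 1200 ⊗ x₂ ⊗ (κ 1200 ⊗ x₂) ⊗ (κ 1200 ⊗ x₂)) ∷ (x₀ ⊕ κ 2 ,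 κ 2 ≼ x₀) ∷ []) refl (n< , big u v ne , n≥2 , tt)))
      k≥1 : 1 ≤ k
      k≥1 = ≤-pred (cube-cancel-< 1 (suc k) (lin (n ∷ k ∷ []) 1 (κ 1 ⊕ κ 1 ⊗ κ 1 ⊗ κ 1 ≼ (κ 1 ⊕ x₁) ⊗ (κ 1 ⊕ x₁) ⊗ (κ 1 ⊕ x₁)) ((κ 1 , κ 1 ⊕ x₀ ≼ (κ 1 ⊕ x₁) ⊗ (κ 1 ⊕ x₁) ⊗ (κ 1 ⊕ x₁)) ∷ (κ 1 , κ 2 ≼ x₀) ∷ []) refl (n< , n≥2 , tt)))
      finish : (∃ λ T → length T ≤ 1200 * suc k * (4 * L) × (∀ u v → u ≢ v → hit (λ w → not (c u w == c v w)) T ≡ true)) → Goal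
      finish (T , len , hits) = toSubset T , size , splits₁ c (toSubset T) separated
        where
        -- k + 1 ≤ 2k bounds the length by 9600kL, well below 512qkL as q ≥ 20000.
        small : ∣ toSubset T ∣ ≤ 512 * q * k * L
        small = ≤-trans (∣toSubset∣≤ T) (lin (length T ∷ k ∷ L ∷ q ∷ []) 24 (x₀ ≼ κ 512 ⊗ x₃ ⊗ x₁ ⊗ x₂) ((κ 25 , x₀ ≼ κ 1200 ⊗ (κ 1 ⊕ x₁) ⊗ (κ 4 ⊗ x₂)) ∷ (κ 120000 ⊗ x₂ , κ 1 ≼ x₁) ∷ (κ 12 ⊗ (x₁ ⊗ x₂) , κ 20000 ≼ x₃) ∷ []) refl (len , k≥1 , q≥ , tt))
        size : ∣ toSubset T ∣ * ∣ toSubset T ∣ * ∣ toSubset T ∣ ≤ (512 * q) * (512 * q) * (512 * q) * n * (L * L * L * L)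
        size = ≤-trans (*-mono-≤ (*-mono-≤ small small) small)
          (lin (q ∷ k ∷ L ∷ n ∷ []) 0 (κ 512 ⊗ x₀ ⊗ x₁ ⊗ x₂ ⊗ (κ 512 ⊗ x₀ ⊗ x₁ ⊗ x₂) ⊗ (κ 512 ⊗ x₀ ⊗ x₁ ⊗ x₂) ≼ κ 512 ⊗ x₀ ⊗ (κ 512 ⊗ x₀) ⊗ (κ 512 ⊗ x₀) ⊗ x₃ ⊗ (x₂ ⊗ x₂ ⊗ x₂ ⊗ x₂)) ((κ 134217728 ⊗ (x₀ ⊗ x₀ ⊗ x₀ ⊗ x₂ ⊗ x₂ ⊗ x₂) , x₁ ⊗ x₁ ⊗ x₁ ≼ x₃) ∷ (κ 134217728 ⊗ (x₀ ⊗ x₀ ⊗ x₀ ⊗ x₂ ⊗ x₂ ⊗ x₂ ⊗ x₃) , κ 1 ≼ x₂) ∷ []) refl (k³≤n , L≥1 , tt))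
        separated : ∀ u v → u ≢ v → ∃ λ s → lookup (toSubset T) s ≡ true × c u s ≢ c v s
        separated u v ne = at (hit⇒∃ (λ w → not (c u w == c v w)) T (hits u v ne))
          where
          at : (∃ λ s → not (c u s == c v s) ≡ true × lookup (toSubset T) s ≡ true) → ∃ λ s → lookup (toSubset T) s ≡ true × c u s ≢ c v s
          at (s , e , l) = s , l , ==⇒≢ {x = c u s} {c v s} (not-true e)

  module DominantColour (u₀ : Fin n) (d : Fin r) (dominant : 2 * n < 3 * # (λ w → c u₀ w == d)) where
    open Dominant c pcc n≥2 u₀ d dominant
    open Windows c pcc n≥2 u₀ d dominant
    module Cliques = ExactCliques c pcc n≥2 u₀ d dominant h h≥
    open TwoSided c pcc n≥2 u₀ d dominant h h≥
    module Split = Splitting c pcc n≥2 u₀ d dominant h h≥ L L≥1 n<2^ q (≤-trans (s≤s z≤n) q≥) 6q≤h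
    open Sparse c pcc n≥2 u₀ d dominant

    complete-graph : ρ ≡ 0 → Exceptional c
    complete-graph ρ≡0 = Kb , n , false , mk↔ₛ′ id id (λ _ → refl) (λ _ → refl) , λ u v u′ v′ → mk⇔ (to u v u′ v′) (from u v u′ v′)
      where
      c≡d : ∀ {u v} → u ≢ v → c u v ≡ d
      c≡d {u} {v} ne = decide (Bool-cases (far u v))
        where
        decide : far u v ≡ true ⊎ far u v ≡ false → c u v ≡ d
        decide (inj₁ p) = ==⇒≡ {x = c u v} {d} p
        decide (inj₂ p) = ⊥-elim (true≢false (≢∧¬far⇒nb ne p) (#≡0⇒ (nb u) (trans (#nb u) ρ≡0) v))
      to : ∀ u v u′ v′ → c u v ≡ c u′ v′ → SameX _≢_ u v u′ v′
      to u v u′ v′ e = decide (u Fin.≟ v)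
        where
        decide : Dec (u ≡ v) → SameX _≢_ u v u′ v′
        decide (yes refl) = inj₁ (refl , c-diag (sym e))
        decide (no ne) = inj₂ (inj₁ ((ne , ne) , (ne′ , ne′)))
          where
          ne′ : u′ ≢ v′
          ne′ refl = ne (c-diag e)
      from : ∀ u v u′ v′ → SameX _≢_ u v u′ v′ → c u v ≡ c u′ v′
      from u v u′ v′ (inj₁ (refl , refl)) = IsPCC.homogeneous pcc u u′
      from u v u′ v′ (inj₂ (inj₁ ((p , _) , (p′ , _)))) = trans (c≡d p) (sym (c≡d p′))
      from u v u′ v′ (inj₂ (inj₂ ((p , ¬p) , _))) = ⊥-elim (¬p p)

    line-graph : h * (ρ * ρ * ρ) ≤ N * N → 1 ≤ ρ → (∀ y → Sides y) → Exceptional c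
    line-graph sparse ρ≥1 all = cases μ refl
      where
      open Params h h≥ sparse ρ≥1 using (μ≥1)
      label = Cliques.label sparse ρ≥1 all
      clique-nb : ∀ {y x x′} → nb y x ≡ true → nb y x′ ≡ true → label y x ≡ label y x′ → x ≢ x′ → nb x x′ ≡ true
      clique-nb {y} {x} {x′} = Cliques.clique-nb sparse ρ≥1 all {y} {x} {x′}
      clique-size : ∀ y b → 20 ≤ # (λ x → nb y x ∧ agree b (label y x))
      clique-size = Cliques.clique-size sparse ρ≥1 all
      clique-cross : ∀ {y b x} → nb y x ∧ agree b (label y x) ≡ true → # (λ z → (nb y z ∧ agree (not b) (label y z)) ∧ nb x z) ≤ 3
      clique-cross {y} {b} {x} = Cliques.clique-cross sparse ρ≥1 all {y} {b} {x}
      μ≤4 : μ ≤ 4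
      μ≤4 = Cliques.μ≤4 sparse ρ≥1 all
      open LineGraph nb far nb-sym nb-irrefl (λ {u} {v} → nb⇒¬far {u} {v}) far-irrefl (λ {u} {v} → ≢∧¬far⇒nb {u} {v}) label (λ {y} {x} {x′} → clique-nb {y} {x} {x′}) clique-size (λ {y} {b} {x} → clique-cross {y} {b} {x})
        using (adj; adj-sym; adj-≢; line)
      open Classify c pcc n≥2 u₀ d dominant using (module Geometry)
      module G = Geometry label (λ {y} {x} {x′} → clique-nb {y} {x} {x′}) clique-size (λ {y} {b} {x} → clique-cross {y} {b} {x}) μ≥1 μ≤4
      open RootGraph adj (λ {i} {j} → adj-sym {i} {j}) (λ {i} {j} → adj-≢ {i} {j}) μ (λ {a} {b} {i} {j} → G.quad {a} {b} {i} {j}) G.fresh′ (line u₀ true) using (μ≢1; μ≢3)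
      open Bipartite c pcc n≥2 u₀ d dominant using (module Lattice)
      cases : ∀ k → μ ≡ k → Exceptional c
      cases 0 e = 1≰0 (subst (1 ≤_) e μ≥1)
      cases 1 e = ⊥-elim (μ≢1 e)
      cases 2 e = Lattice.lattice label (λ {y} {x} {x′} → clique-nb {y} {x} {x′}) clique-size (λ {y} {b} {x} → clique-cross {y} {b} {x}) μ≥1 μ≤4 e
      cases 3 e = ⊥-elim (μ≢3 e)
      cases 4 e = G.Triangular.triangular e
      cases (suc (suc (suc (suc (suc k))))) e = 1≰0 (+-cancelˡ-≤ 4 1 0 (≤-trans (s≤s (s≤s (s≤s (s≤s (s≤s z≤n))))) (subst (_≤ 4) e μ≤4)))

    sparse-case : h * (ρ * ρ * ρ) ≤ N * N → Goal
    sparse-case sparse = decide (1 ≤? ρ)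
      where
      decide : Dec (1 ≤ ρ) → Goal
      decide (no ρ<1) = ⊥-elim (¬exceptional (complete-graph (n≤0⇒n≡0 (≤-pred (≰⇒> ρ<1)))))
      decide (yes ρ≥1) = search (Fin.any? (λ a → Fin.any? (λ b → (nb a b Data.Bool.≟ true) ×-dec (20000 * NM a b <? ρ * ρ))))
        where
        search : Dec (∃ λ a → ∃ λ b → nb a b ≡ true × 20000 * NM a b < ρ * ρ) → Goal
        search (yes (a , b , ab , lt)) = ⊥-elim (¬exceptional (line-graph sparse ρ≥1 (all-sides sparse ρ≥1 {a} {b} ab lt)))
        search (no none) = Split.good-splits sparse ρ≥1 (λ {y} {u} yu → ≤-trans (≮⇒≥ (λ lt → none (y , u , yu , lt))) (*-monoˡ-≤ (NM y u) q≥))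

  close-pair : ∀ {u₁ v₁} → u₁ ≢ v₁ → (1200 * D u₁ v₁) * (1200 * D u₁ v₁) * (1200 * D u₁ v₁) < n * n → Goal
  close-pair {u₁} {v₁} ne close = search (Fin.any? (λ d → 2 * n <? 3 * # (λ w → c u₁ w == d)))
    where
    open LargeBound c pcc n≥2 u₁ v₁ ne
    search : Dec (∃ λ d → 2 * n < 3 * # (λ w → c u₁ w == d)) → Goal
    search (no none) = 1≰0 (lin (n ∷ D u₁ v₁ ∷ []) 0 (κ 1 ≼ κ 0) ((κ 1 , κ 1 ⊕ κ 1200 ⊗ x₁ ⊗ (κ 1200 ⊗ x₁) ⊗ (κ 1200 ⊗ x₁) ≼ x₀ ⊗ x₀) ∷ (κ 1 , x₀ ⊗ x₀ ≼ κ 35937 ⊗ x₁ ⊗ x₁ ⊗ x₁) ∷ []) refl (close , Flat.flat-large flat , tt))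
      where
      flat : ∀ u j → 3 * # (λ w → c u w == j) ≤ 2 * n
      flat u j = ≤-trans (≤-reflexive (cong (3 *_) (coh-row {λ u v → χ (c u v == j)} (coh-col (λ i → χ (i == j))) u u₁))) (≮⇒≥ (λ lt → none (j , lt)))
    search (yes (d , dominant)) = split (Peaked.peaked-large d dominant)
      where
      open Dominant c pcc n≥2 u₁ d dominant using (N; ρ)
      split : n * n ≤ 35937 * D u₁ v₁ * D u₁ v₁ * D u₁ v₁ ⊎ ρ ≤ 12 * D u₁ v₁ → Goal
      split (inj₁ p) = 1≰0 (lin (n ∷ D u₁ v₁ ∷ []) 0 (κ 1 ≼ κ 0) ((κ 1 , κ 1 ⊕ κ 1200 ⊗ x₁ ⊗ (κ 1200 ⊗ x₁) ⊗ (κ 1200 ⊗ x₁) ≼ x₀ ⊗ x₀) ∷ (κ 1 , x₀ ⊗ x₀ ≼ κ 35937 ⊗ x₁ ⊗ x₁ ⊗ x₁) ∷ []) refl (close , p , tt))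
      split (inj₂ p) = DominantColour.sparse-case u₁ d dominant sparse
        where
        cube : ρ * ρ * ρ ≤ (12 * D u₁ v₁) * (12 * D u₁ v₁) * (12 * D u₁ v₁)
        cube = *-mono-≤ (*-mono-≤ p p) p
        square : (2 * n) * (2 * n) ≤ (3 * N) * (3 * N)
        square = *-mono-≤ (<⇒≤ dominant) (<⇒≤ dominant)
        -- ρ ≤ 12D and (1200D)³ < n² give 10⁶ρ³ < n², while N² ≥ 4n²/9. This affords h = 120000,
        -- which is 6q for q = 20000.
        sparse : h * (ρ * ρ * ρ) ≤ N * N
        sparse = lin (h ∷ ρ ∷ N ∷ n ∷ D u₁ v₁ ∷ []) 99 (x₀ ⊗ (x₁ ⊗ x₁ ⊗ x₁) ≼ x₂ ⊗ x₂) ((κ 100 ⊗ (x₁ ⊗ x₁ ⊗ x₁) , x₀ ≼ κ 120000) ∷ (κ 12000000 , x₁ ⊗ x₁ ⊗ x₁ ≼ κ 12 ⊗ x₄ ⊗ (κ 12 ⊗ x₄) ⊗ (κ 12 ⊗ x₄)) ∷ (κ 3 , κ 2 ⊗ x₃ ⊗ (κ 2 ⊗ x₃) ≼ κ 3 ⊗ x₂ ⊗ (κ 3 ⊗ x₂)) ∷ (κ 12 , κ 1 ⊕ κ 1200 ⊗ x₄ ⊗ (κ 1200 ⊗ x₄) ⊗ (κ 1200 ⊗ x₄) ≼ x₃ ⊗ x₃) ∷ []) refl (h≤ , cube , square , close , tt)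

  splitting-set : Goal
  splitting-set = search (Fin.any? (λ u → Fin.any? (λ v → ¬? (u Fin.≟ v) ×-dec ((1200 * D u v) * (1200 * D u v) * (1200 * D u v) <? n * n))))
    where
    search : Dec (∃ λ u → ∃ λ v → u ≢ v × (1200 * D u v) * (1200 * D u v) * (1200 * D u v) < n * n) → Goal
    search (yes (u , v , ne , lt)) = close-pair ne lt
    search (no none) = well-separated (λ u v ne → ≮⇒≥ (λ lt → none (u , v , ne , lt)))

cube≡ : ∀ k → k * k * k ≡ k ^ 3
cube≡ k = trans (*-assoc k k k) (cong (λ t → k * (k * t)) (sym (*-identityʳ k)))

quartic≡ : ∀ k → k * k * k * k ≡ k ^ 4
quartic≡ k = trans (*-assoc (k * k) k k) (trans (*-assoc k k (k * k)) (cong (λ t → k * (k * t)) (cong (k *_) (sym (*-identityʳ k)))))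

-- Variables h and q in place of numerals, which the type checker would unfold.
bounded : ∀ h → 120000 ≤ h → h ≤ 120000 → ∀ q → 20000 ≤ q → 6 * q ≤ h →
  Σ ℕ λ C → 1 ≤ C × ((n : ℕ) → 2 ≤ n → (r : ℕ) → (c : Coloring n r) →
                 IsPCC c → ¬ Exceptional c →
                 Σ (Subset n) λ S → (∣ S ∣ ^ 3 ≤ C * n * ⌊log₂ n ⌋ ^ 4) × CompletelySplits c S)
bounded h h≥ h≤ q q≥ 6q≤h = C , *-mono-≤ (*-mono-≤ one one) one , λ n n≥2 r c pcc ¬exc →
    from n c (Main.splitting-set c pcc ¬exc n≥2 h h≥ h≤ q q≥ 6q≤h ⌊log₂ n ⌋ (log₂≥1 n≥2) (n<2^[1+log₂n] n))
  where
  C : ℕ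
  C = (512 * q) * (512 * q) * (512 * q)
  one : 1 ≤ 512 * q
  one = *-mono-≤ {1} {512} (s≤s z≤n) (≤-trans (s≤s z≤n) q≥)
  from : ∀ n {r} (c : Coloring n r) → (∃ λ S → ∣ S ∣ * ∣ S ∣ * ∣ S ∣ ≤ C * n * (⌊log₂ n ⌋ * ⌊log₂ n ⌋ * ⌊log₂ n ⌋ * ⌊log₂ n ⌋) × CompletelySplits c S) →
         Σ (Subset n) λ S → (∣ S ∣ ^ 3 ≤ C * n * ⌊log₂ n ⌋ ^ 4) × CompletelySplits c S
  from n c (S , size , splits) = S , subst₂ _≤_ (cube≡ ∣ S ∣) (cong (C * n *_) (quartic≡ ⌊log₂ n ⌋)) size , splits

theorem1p8 : Σ ℕ λ C → 1 ≤ C × ((n : ℕ) → 2 ≤ n → (r : ℕ) → (c : Coloring n r) →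
                 IsPCC c → ¬ Exceptional c →
                 Σ (Subset n) λ S → (∣ S ∣ ^ 3 ≤ C * n * ⌊log₂ n ⌋ ^ 4) × CompletelySplits c S)
theorem1p8 = bounded 120000 ≤-refl ≤-refl 20000 ≤-refl ≤-refl
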